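{- For each of the objectives (1), (2) and (3), the nonpreemptive Lazy Bureaucrat Problem with arbitrary (integer) arrival times and deadlines is strongly NP-complete (its decision version is NP-complete even when all numbers are bounded by a polynomial in the input size), and for every constant $\rho\ge1$, unless P = NP, there is no polynomial-time algorithm that approximates the optimum within factor $\rho$.
   Context: An instance of the Lazy Bureaucrat Problem (LBP) consists of jobs $1,\dots,n$; job $i$ has a processing time $t_i$, an arrival time $a_i$ and a deadline $d_i$, all nonnegative integers. Its critical time is $c_i=d_i-t_i$. A single processor (the bureaucrat) processes at most one job at a time. In the nonpreemptive setting, a schedule chooses a set of executed jobs and, for each executed job $i$, a start time $s_i$ with $a_i\le s_i\le c_i$; job $i$ is then processed without interruption during $[s_i,s_i+t_i)$, these intervals are pairwise disjoint, and each job is executed at most once. A job $i$ is executable at time $\tau$ if it has not been started before $\tau$ and $a_i\le\tau\le c_i$. A schedule is feasible if it satisfies the busy requirement: at every time $\tau$ at which the processor is not processing a job, no job is executable. The objectives, each to be minimized over feasible schedules, are: (1) the total time spent working, $\sum t_i$ over executed jobs; (2) the weighted sum of completed jobs, where job $i$ has weight $t_i$; (3) the makespan, i.e. the largest completion time $s_i+t_i$ of an executed job. The decision version asks, given an instance and a number $B$, whether some feasible schedule has objective value at most $B$. "No polynomial-time algorithm approximates the optimum within factor $\rho$" means there is no polynomial-time algorithm that on every instance outputs a feasible schedule whose objective value is at most $\rho$ times the optimal value. -}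

module Defs where

open import Data.Bool using (Bool; true; false)
open import Data.Fin using (Fin)
open import Data.Integer as ℤ using (ℤ; +_)
open import Data.List as List using (List; []; _∷_; _++_; [_]; length; concatMap)
open import Data.List.Relation.Unary.All using (All)
open import Data.Maybe using (Maybe; just; nothing)
open import Data.Nat using (ℕ; suc; _+_; _*_; _≤_; _<_; _⊔_)
open import Data.Nat.Binary using (ℕᵇ; zero; 2[1+_]; 1+[2_]; fromℕ)
open import Data.Product using (Σ; ∃; ∃-syntax; _×_; _,_)
open import Data.Rational as ℚ using (ℚ)
open import Data.Sum using (_⊎_)
open import Data.Vec as Vec using (Vec; []; _∷_; lookup; replicate; zipWith; toList)
open import Function.Bundles using (_⇔_)
open import Relation.Binary.PropositionalEquality using (_≡_)
open import Relation.Nullary using (¬_)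

-- Polynomials with coefficients in ℕ, constant coefficient first.

Poly : Set
Poly = List ℕ

eval : Poly → ℕ → ℕ
eval p n = List.foldr (λ c r → c + n * r) 0 p

-- Deterministic multi-tape Turing machines.  Tapes are infinite in both
-- directions: the two lists hold the cells to the left and to the right of the
-- head, nearest cell first, and every cell beyond them is blank.

data Symbol (aux : ℕ) : Set where
  blank : Symbol aux
  bit   : Bool → Symbol aux
  other : Fin aux → Symbol aux

data Move : Set where
  left stay right : Move

record Tape (aux : ℕ) : Set where
  constructor tape
  field
    before : List (Symbol aux)
    head   : Symbol aux
    after  : List (Symbol aux)

-- δ returns nothing exactly when the machine halts.

record TM : Set where
  field
    states    : ℕ
    workTapes : ℕ
    aux       : ℕ
    start     : Fin states
    δ         : Fin states → Vec (Symbol aux) (suc workTapes) →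
                Maybe (Fin states × Vec (Symbol aux × Move) (suc workTapes))

module _ {aux : ℕ} where

  move : Move → Tape aux → Tape aux
  move stay  t                    = t
  move left  (tape []       h rs) = tape [] blank (h ∷ rs)
  move left  (tape (l ∷ ls) h rs) = tape ls l (h ∷ rs)
  move right (tape ls h [])       = tape (h ∷ ls) blank []
  move right (tape ls h (r ∷ rs)) = tape (h ∷ ls) r rs

  act : Tape aux → Symbol aux × Move → Tape aux
  act (tape ls _ rs) (s , m) = move m (tape ls s rs)

  blankTape : Tape aux
  blankTape = tape [] blank []

  inputTape : List Bool → Tape aux
  inputTape []      = blankTape
  inputTape (b ∷ w) = tape [] (bit b) (List.map bit w)

  bitPrefix : List (Symbol aux) → List Bool
  bitPrefix (bit b ∷ ss) = b ∷ bitPrefix ss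
  bitPrefix _            = []

  -- The output starts under the head and extends to the first non-bit.
  outputOf : Tape aux → List Bool
  outputOf (tape _ h rs) = bitPrefix (h ∷ rs)

module _ (M : TM) where
  open TM M

  record Config : Set where
    constructor config
    field
      state : Fin states
      tapes : Vec (Tape aux) (suc workTapes)

  step : Config → Maybe Config
  step (config q ts) with δ q (Vec.map Tape.head ts)
  ... | nothing          = nothing
  ... | just (q′ , acts) = just (config q′ (zipWith act ts acts))

  initial : List Bool → Config
  initial w = config start (inputTape w ∷ replicate workTapes blankTape)

  -- The first tape serves both for input and for output.
  output : Config → List Bool
  output c = outputOf (Vec.head (Config.tapes c))

  data HaltsAfter : ℕ → Config → Config → Set where
    halted : ∀ {c} → step c ≡ nothing → HaltsAfter 0 c c
    next   : ∀ {n c c′ c″} → step c ≡ just c′ → HaltsAfter n c′ c″ →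
             HaltsAfter (suc n) c c″

PolyTime : (List Bool → List Bool) → Set
PolyTime f =
  ∃[ M ] ∃[ p ] ∀ w → ∃[ n ] ∃[ c ]
    n ≤ eval p (length w) × HaltsAfter M n (initial M w) c × output M c ≡ f w

Language : Set₁
Language = List Bool → Set

-- encodeList is self-delimiting: every item is announced by true, and false
-- closes the list.

encodeList : ∀ {A : Set} → (A → List Bool) → List A → List Bool
encodeList e []       = [ false ]
encodeList e (x ∷ xs) = true ∷ e x ++ encodeList e xs

encodePair : List Bool → List Bool → List Bool
encodePair u v = encodeList [_] u ++ v

InP : Language → Set
InP L = ∃[ f ] PolyTime f × (∀ w → L w ⇔ f w ≡ [ true ])

InNP : Language → Set
InNP L =
  ∃[ verify ] ∃[ p ] PolyTime verify ×
    (∀ w → L w ⇔ (∃[ u ] length u ≤ eval p (length w) ×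
                         verify (encodePair w u) ≡ [ true ]))

_≤ₚ_ : Language → Language → Set
L ≤ₚ L′ = ∃[ f ] PolyTime f × (∀ w → L w ⇔ L′ (f w))

NPHard : Language → Set₁
NPHard L = ∀ L′ → InNP L′ → L′ ≤ₚ L

NPComplete : Language → Set₁
NPComplete L = InNP L × NPHard L

P≡NP : Set₁
P≡NP = ∀ L → InP L ⇔ InNP L

record DecisionProblem : Set₁ where
  field
    Input   : Set
    encode  : Input → List Bool
    numbers : Input → List ℕ
    Yes     : Input → Set

language : DecisionProblem → Language
language Π w = ∃[ x ] w ≡ encode x × Yes x
  where open DecisionProblem Π

restrict : Poly → DecisionProblem → DecisionProblem
restrict p Π = record
  { Input   = Input
  ; encode  = encode
  ; numbers = numbers
  ; Yes     = λ x → All (_≤ eval p (length (encode x))) (numbers x) × Yes x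
  } where open DecisionProblem Π

StronglyNPComplete : DecisionProblem → Set₁
StronglyNPComplete Π =
  NPComplete (language Π) × ∃[ p ] NPComplete (language (restrict p Π))

record Job : Set where
  field
    processing : ℕ
    arrival    : ℕ
    deadline   : ℕ

open Job public

-- An integer: it is negative when the deadline is less than the processing time.
critical : Job → ℤ
critical j = + deadline j ℤ.- + processing j

Instance : ℕ → Set
Instance n = Vec Job n

-- The entry of job i is its start time if it is executed, and nothing if not.
-- Since all data are integers, time is discrete.
Schedule : ℕ → Set
Schedule n = Vec (Maybe ℕ) n

InWindow : Job → ℕ → Set
InWindow j τ = arrival j ≤ τ × + τ ℤ.≤ critical j

module _ {n : ℕ} (I : Instance n) (σ : Schedule n) where

  StartsAt : Fin n → ℕ → Set
  StartsAt i s = lookup σ i ≡ just s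

  ProcessedAt : Fin n → ℕ → Set
  ProcessedAt i τ =
    ∃[ s ] StartsAt i s × s ≤ τ × τ < s + processing (lookup I i)

  StartedBefore : Fin n → ℕ → Set
  StartedBefore i τ = ∃[ s ] StartsAt i s × s < τ

  Executable : Fin n → ℕ → Set
  Executable i τ = ¬ StartedBefore i τ × InWindow (lookup I i) τ

  record Feasible : Set where
    field
      inWindow : ∀ i s → StartsAt i s → InWindow (lookup I i) s
      disjoint : ∀ i j τ → ProcessedAt i τ → ProcessedAt j τ → i ≡ j
      busy     : ∀ τ → (∀ i → ¬ ProcessedAt i τ) → ∀ i → ¬ Executable i τ

data Objective : Set where
  workingTime weightedCompleted makespan : Objective

weight : Job → ℕ
weight = processing

-- f j s for each job j executed with start time s, and 0 for the other jobs.
perExecuted : ∀ {n} → (Job → ℕ → ℕ) → Instance n → Schedule n → Vec ℕ n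
perExecuted f = zipWith λ where
  j nothing  → 0
  j (just s) → f j s

-- Without preemption, the completed jobs are the executed ones.
value : ∀ {n} → Objective → Instance n → Schedule n → ℕ
value workingTime       I σ = Vec.sum (perExecuted (λ j _ → processing j) I σ)
value weightedCompleted I σ = Vec.sum (perExecuted (λ j _ → weight j) I σ)
value makespan          I σ =
  Vec.foldr′ _⊔_ 0 (perExecuted (λ j s → s + processing j) I σ)

-- Binary notation with digits 1 (false) and 2 (true), least significant first:
-- every number has exactly one numeral, of logarithmic length.

digits : ℕᵇ → List Bool
digits zero     = []
digits 2[1+ x ] = true ∷ digits x
digits 1+[2 x ] = false ∷ digits x

encodeℕ : ℕ → List Bool
encodeℕ n = encodeList [_] (digits (fromℕ n))

encodeJob : Job → List Bool
encodeJob j =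
  encodeℕ (processing j) ++ encodeℕ (arrival j) ++ encodeℕ (deadline j)

encodeInstance : ∀ {n} → Instance n → List Bool
encodeInstance I = encodeList encodeJob (toList I)

encodeStart : Maybe ℕ → List Bool
encodeStart nothing  = [ false ]
encodeStart (just s) = true ∷ encodeℕ s

encodeSchedule : ∀ {n} → Schedule n → List Bool
encodeSchedule σ = encodeList encodeStart (toList σ)

jobNumbers : Job → List ℕ
jobNumbers j = processing j ∷ arrival j ∷ deadline j ∷ []

LBP : Objective → DecisionProblem
LBP obj = record
  { Input   = Σ ℕ Instance × ℕ
  ; encode  = λ { ((n , I) , B) → encodeInstance I ++ encodeℕ B }
  ; numbers = λ { ((n , I) , B) → B ∷ concatMap jobNumbers (toList I) }
  ; Yes     = λ { ((n , I) , B) → ∃[ σ ] Feasible I σ × value obj I σ ≤ B }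
  }

-- Dedekind reals.

record ℝ : Set₁ where
  field
    Lower Upper    : ℚ → Set
    lowerInhabited : ∃ Lower
    upperInhabited : ∃ Upper
    lowerRounded   : ∀ q → Lower q ⇔ (∃[ r ] q ℚ.< r × Lower r)
    upperRounded   : ∀ q → Upper q ⇔ (∃[ r ] r ℚ.< q × Upper r)
    disjoint       : ∀ q → ¬ (Lower q × Upper q)
    located        : ∀ q r → q ℚ.< r → Lower q ⊎ Upper r

AtLeastOne : ℝ → Set
AtLeastOne ρ = ∀ q → ℝ.Upper ρ q → ℚ.1ℚ ℚ.≤ q

-- v ≤ ρ · o, expressed as v ≤ q · o for every rational q > ρ (note o ≥ 0).
WithinFactor : ℝ → ℕ → ℕ → Set
WithinFactor ρ v o = ∀ q → ℝ.Upper ρ q → (+ v) ℚ./ 1 ℚ.≤ q ℚ.* ((+ o) ℚ./ 1)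

IsOptimum : ∀ {n} → Objective → Instance n → ℕ → Set
IsOptimum obj I opt =
  (∃[ σ ] Feasible I σ × value obj I σ ≡ opt) ×
  (∀ σ → Feasible I σ → opt ≤ value obj I σ)

-- Nothing is asked about instances without an optimum, i.e. without a feasible
-- schedule; such instances exist, but only with jobs of processing time 0.
PolyTimeApproximable : Objective → ℝ → Set
PolyTimeApproximable obj ρ =
  ∃[ f ] PolyTime f ×
    (∀ {n} (I : Instance n) opt → IsOptimum obj I opt →
      ∃[ σ ] f (encodeInstance I) ≡ encodeSchedule σ ×
             Feasible I σ × WithinFactor ρ (value obj I σ) opt)

{-# OPTIONS --safe #-}
module Submission where

-- The run of an NP verifier is a formula made of implications, apart from the
-- clauses that guess the certificate.  It is satisfiable iff one can choose a
-- literal in every clause so that no two chosen literals contradict each other.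
-- With a label for every contradictory pair of literals, this is a walk through
-- an acyclic graph that uses every label at most once.  Nodes of the graph are
-- points in time, an edge is a job with a one-point window, and a label is a job
-- with a wide window, which can be executed only once.  A huge job, executable
-- at all times up to the end of the walk, is left out iff the bureaucrat never
-- idles, i.e. iff the schedule is such a walk.  Since the huge job can be made
-- longer than any constant multiple of all other jobs together, an approximate
-- schedule leaves it out iff some schedule does.
--
-- Polynomial-time computability is shown for functions on trees, which are kept
-- in prefix code on a stack and processed by structured programs on four stacks;
-- these programs compile to Turing machines.

-- The obstacle is that the window of a wide job admits starts at which the job does not belong.
-- Residues exclude these. Nodes sit at multiples of a modulus, edge jobs end at nodes, and every
-- wide job has length 1 modulo it. So, while the bureaucrat never idles, the residue of the current
-- time counts the wide jobs processed since the last node. Edge jobs start only at residue 0 or 1.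
-- After two wide jobs in a row the residue would have to wrap around before an edge job fits again;
-- but a wide job lasts at least half the distance between neighbouring nodes, and too few of them
-- fit before the end of the walk.
--
-- No clause of the formula says that a cell holds only one symbol. The true variables of a
-- satisfying assignment merely include those of a run, and the last clauses exclude the runs that
-- do not accept.
--
-- All numbers are polynomial in the number of jobs, even that of the huge job: its length is a
-- constant multiple of the cost of a walk, plus a term of the order of the horizon. With the
-- constant 1 the instances give strong NP-completeness, with larger constants inapproximability.

open import Data.Bool using (Bool; true; false; not; _∧_; _∨_; if_then_else_; T)
open import Data.Bool.ListAction using (all; any)
open import Data.Bool.Properties as Boolₚ using (∧-zeroʳ; ∧-assoc)
open import Data.Empty using (⊥; ⊥-elim)
open import Data.Fin as Fin using (Fin; zero; suc; _↑ˡ_; _↑ʳ_; splitAt)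
open import Data.Fin.Properties as Finₚ using (splitAt-↑ˡ; splitAt-↑ʳ; toℕ<n; any?)
open import Data.Integer as ℤ using ()
open import Data.Integer.Properties as ℤₚ using ()
open import Data.List as List using (List; []; _∷_; _++_; [_]; length; _ʳ++_; foldl; foldr; map; concatMap; reverse; concat; allFin)
open import Data.List.Membership.Propositional using (_∈_)
open import Data.List.Membership.Propositional.Properties using (∈-map⁺; ∈-map⁻; ∈-++⁺ˡ; ∈-++⁺ʳ; ∈-++⁻; ∈-allFin)
open import Data.List.Properties as Listₚ using (ʳ++-defn; ʳ++-ʳ++; length-reverse; ++-identityʳ; reverse-involutive; reverse-foldr; ++-assoc; length-++; map-++; length-map; map-∘; map-id; foldl-++; unfold-reverse; ∷-injective)
open import Data.List.Relation.Unary.All as All using (All; []; _∷_)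
open import Data.List.Relation.Unary.All.Properties as Allₚ using ()
open import Data.List.Relation.Unary.AllPairs using ([]; _∷_)
open import Data.List.Relation.Unary.Any as Any using (here; there; Any)
open import Data.List.Relation.Unary.Unique.Propositional using (Unique)
open import Data.List.Relation.Unary.Unique.Propositional.Properties as Uniqueₚ using ()
open import Data.Maybe using (Maybe; just; nothing; maybe′)
open import Data.Maybe.Properties using (just-injective)
open import Data.Nat using (ℕ; zero; suc; _+_; _*_; _∸_; _≤_; _<_; z≤n; s≤s; _⊔_; _≤?_; _<?_; >-nonZero)
open import Data.Nat.Binary as ℕᵇ using (ℕᵇ; zero; 2[1+_]; 1+[2_]; toℕ; fromℕ)
open import Data.Nat.Binary.Properties using (toℕ-injective; toℕ-homo-+; suc≗1+; fromℕ≡fromℕ'; toℕ-fromℕ; fromℕ-toℕ; fromℕ-injective)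
open import Data.Nat.Properties
open import Data.Nat.Tactic.RingSolver using (solve-∀)
open import Data.Product using (Σ; ∃-syntax; _×_; _,_; proj₁; proj₂)
open import Data.Product.Properties using (≡-dec)
open import Data.Rational as ℚ using (mkℚ; toℚᵘ)
open import Data.Rational.Properties using (toℚᵘ-mono-≤; toℚᵘ-homo-*; toℚᵘ-fromℚᵘ)
open import Data.Rational.Unnormalised as ℚᵘ using (mkℚᵘ)
open import Data.Rational.Unnormalised.Properties as ℚᵘₚ using ()
open import Data.Sum using (_⊎_; inj₁; inj₂)
open import Data.Unit using (⊤; tt)
open import Data.Vec as Vec using (Vec; []; _∷_; lookup; _[_]≔_; zipWith; toList)
open import Data.Vec.Properties using (lookup-map; lookup-zipWith; lookup-replicate; toList-map; toList∘fromList)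
open import Defs
open import Function using (_∘_; id)
open import Function.Bundles using (_⇔_; mk⇔; Equivalence)
open import Relation.Binary.Definitions using (tri<; tri≈; tri>)
open import Relation.Binary.PropositionalEquality hiding ([_])
open import Relation.Nullary using (¬_; Dec; yes; no; ⌊_⌋)
open import Relation.Nullary.Decidable using (decidable-stable)
open import Relation.Nullary.Reflects using (Reflects; ofʸ; ofⁿ; _×-reflects_; _⊎-reflects_; _→-reflects_; ¬-reflects)

-- Polynomial bounds

-- Bounds are kept as syntax, so that monotonicity and the conversion into a `Poly` are each proved
-- once for all bounds that occur. Composition is a constructor because the second of two
-- consecutive programs runs for a time that is a bound evaluated at another bound.
data PExp : Set where
  var  : PExp
  con  : ℕ → PExp
  _:+_ : PExp → PExp → PExp
  _:*_ : PExp → PExp → PExp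
  _:∘_ : PExp → PExp → PExp

infixl 6 _:+_
infixl 7 _:*_
infixr 8 _:∘_

⟦_⟧ : PExp → ℕ → ℕ
⟦ var ⟧ n    = n
⟦ con c ⟧ n  = c
⟦ p :+ q ⟧ n = ⟦ p ⟧ n + ⟦ q ⟧ n
⟦ p :* q ⟧ n = ⟦ p ⟧ n * ⟦ q ⟧ n
⟦ p :∘ q ⟧ n = ⟦ p ⟧ (⟦ q ⟧ n)

⟦⟧-mono : ∀ p {m n} → m ≤ n → ⟦ p ⟧ m ≤ ⟦ p ⟧ n
⟦⟧-mono var      h = h
⟦⟧-mono (con c)  h = ≤-refl
⟦⟧-mono (p :+ q) h = +-mono-≤ (⟦⟧-mono p h) (⟦⟧-mono q h)
⟦⟧-mono (p :* q) h = *-mono-≤ (⟦⟧-mono p h) (⟦⟧-mono q h)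
⟦⟧-mono (p :∘ q) h = ⟦⟧-mono p (⟦⟧-mono q h)

addᵖ : Poly → Poly → Poly
addᵖ []      q       = q
addᵖ (c ∷ p) []      = c ∷ p
addᵖ (c ∷ p) (d ∷ q) = c + d ∷ addᵖ p q

eval-addᵖ : ∀ p q n → eval (addᵖ p q) n ≡ eval p n + eval q n
eval-addᵖ []      q       n = refl
eval-addᵖ (c ∷ p) []      n = sym (+-identityʳ _)
eval-addᵖ (c ∷ p) (d ∷ q) n rewrite eval-addᵖ p q n = lem c d n (eval p n) (eval q n)
  where
  lem : ∀ c d n x y → c + d + n * (x + y) ≡ c + n * x + (d + n * y)
  lem = solve-∀

scaleᵖ : ℕ → Poly → Poly
scaleᵖ c = List.map (c *_)

eval-scaleᵖ : ∀ c p n → eval (scaleᵖ c p) n ≡ c * eval p n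
eval-scaleᵖ c []      n = sym (*-zeroʳ c)
eval-scaleᵖ c (d ∷ p) n rewrite eval-scaleᵖ c p n = lem c d n (eval p n)
  where
  lem : ∀ c d n x → c * d + n * (c * x) ≡ c * (d + n * x)
  lem = solve-∀

mulᵖ : Poly → Poly → Poly
mulᵖ []      q = []
mulᵖ (c ∷ p) q = addᵖ (scaleᵖ c q) (0 ∷ mulᵖ p q)

eval-mulᵖ : ∀ p q n → eval (mulᵖ p q) n ≡ eval p n * eval q n
eval-mulᵖ []      q n = refl
eval-mulᵖ (c ∷ p) q n
  rewrite eval-addᵖ (scaleᵖ c q) (0 ∷ mulᵖ p q) n | eval-scaleᵖ c q n | eval-mulᵖ p q n
  = lem c n (eval p n) (eval q n)
  where
  lem : ∀ c n x y → c * y + n * (x * y) ≡ (c + n * x) * y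
  lem = solve-∀

compᵖ : Poly → Poly → Poly
compᵖ []      q = []
compᵖ (c ∷ p) q = addᵖ [ c ] (mulᵖ q (compᵖ p q))

eval-compᵖ : ∀ p q n → eval (compᵖ p q) n ≡ eval p (eval q n)
eval-compᵖ []      q n = refl
eval-compᵖ (c ∷ p) q n
  rewrite eval-addᵖ [ c ] (mulᵖ q (compᵖ p q)) n | eval-mulᵖ q (compᵖ p q) n
        | eval-compᵖ p q n | *-zeroʳ n | +-identityʳ c = refl

toPoly : PExp → Poly
toPoly var      = 0 ∷ 1 ∷ []
toPoly (con c)  = [ c ]
toPoly (p :+ q) = addᵖ (toPoly p) (toPoly q)
toPoly (p :* q) = mulᵖ (toPoly p) (toPoly q)
toPoly (p :∘ q) = compᵖ (toPoly p) (toPoly q)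

eval-toPoly : ∀ p n → eval (toPoly p) n ≡ ⟦ p ⟧ n
eval-toPoly var n = lem n
  where
  lem : ∀ n → n * (1 + n * 0) ≡ n
  lem = solve-∀
eval-toPoly (con c) n = trans (cong (c +_) (*-zeroʳ n)) (+-identityʳ c)
eval-toPoly (p :+ q) n =
  trans (eval-addᵖ (toPoly p) (toPoly q) n) (cong₂ _+_ (eval-toPoly p n) (eval-toPoly q n))
eval-toPoly (p :* q) n =
  trans (eval-mulᵖ (toPoly p) (toPoly q) n) (cong₂ _*_ (eval-toPoly p n) (eval-toPoly q n))
eval-toPoly (p :∘ q) n =
  trans (eval-compᵖ (toPoly p) (toPoly q) n)
        (trans (cong (eval (toPoly p)) (eval-toPoly q n)) (eval-toPoly p _))

fromPoly : Poly → PExp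
fromPoly []      = con 0
fromPoly (c ∷ p) = con c :+ var :* fromPoly p

⟦fromPoly⟧ : ∀ p n → ⟦ fromPoly p ⟧ n ≡ eval p n
⟦fromPoly⟧ []      n = refl
⟦fromPoly⟧ (c ∷ p) n = cong (λ r → c + n * r) (⟦fromPoly⟧ p n)

-- Structured programs on four stacks of bits

data Prog : Set where
  skip   : Prog
  push   : Fin 4 → Bool → Prog
  pop    : Fin 4 → Prog
  _⨾_    : Prog → Prog → Prog
  branch : Fin 4 → (Maybe Bool → Bool) → Prog → Prog → Prog
  while  : Fin 4 → (Maybe Bool → Bool) → Prog → Prog

infixr 5 _⨾_

Store : Set
Store = Vec (List Bool) 4

top : List Bool → Maybe Bool
top []      = nothing
top (b ∷ _) = just b

-- The time index is an upper bound, because of slack.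
data Run : Prog → Store → ℕ → Store → Set where
  skipᵣ  : ∀ {s} → Run skip s 1 s
  pushᵣ  : ∀ {s i b} → Run (push i b) s 2 (s [ i ]≔ (b ∷ lookup s i))
  popᵣ   : ∀ {s i b xs} → lookup s i ≡ b ∷ xs → Run (pop i) s 1 (s [ i ]≔ xs)
  seqᵣ   : ∀ {p q s s′ s″ m n} → Run p s m s′ → Run q s′ n s″ → Run (p ⨾ q) s (m + n) s″
  thenᵣ  : ∀ {i f p q s s′ n} → f (top (lookup s i)) ≡ true → Run p s n s′ →
           Run (branch i f p q) s (suc n) s′
  elseᵣ  : ∀ {i f p q s s′ n} → f (top (lookup s i)) ≡ false → Run q s n s′ →
           Run (branch i f p q) s (suc n) s′
  stopᵣ  : ∀ {i f p s} → f (top (lookup s i)) ≡ false → Run (while i f p) s 1 s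
  loopᵣ  : ∀ {i f p s s′ s″ m n} → f (top (lookup s i)) ≡ true → Run p s m s′ →
           Run (while i f p) s′ n s″ → Run (while i f p) s (suc (m + n)) s″
  slack  : ∀ {p s s′ m n} → m ≤ n → Run p s m s′ → Run p s n s′

total : ∀ {n} → Vec (List Bool) n → ℕ
total []       = 0
total (x ∷ xs) = length x + total xs

total-push : ∀ {n} (s : Vec (List Bool) n) i b → total (s [ i ]≔ (b ∷ lookup s i)) ≡ suc (total s)
total-push (x ∷ s) zero    b = refl
total-push (x ∷ s) (suc i) b = trans (cong (length x +_) (total-push s i b)) (+-suc (length x) (total s))

total-pop : ∀ {n} (s : Vec (List Bool) n) i {b xs} → lookup s i ≡ b ∷ xs → total (s [ i ]≔ xs) ≤ total s
total-pop (_ ∷ s) zero    refl = m≤n+m _ 1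
total-pop (x ∷ s) (suc i) e    = +-monoʳ-≤ (length x) (total-pop s i e)

-- Only a push lengthens a stack, and it costs two units of time. Hence a time bound also bounds the
-- size of the result; `outSize`, and with it the composition of computable functions, rests on
-- this.
run-total : ∀ {p s n s′} → Run p s n s′ → total s′ ≤ total s + n
run-total skipᵣ = m≤m+n _ 1
run-total (pushᵣ {s} {i} {b}) rewrite total-push s i b | +-comm (total s) 2 = m≤n+m _ 1
run-total (popᵣ {s} {i} e) = ≤-trans (total-pop s i e) (m≤m+n _ 1)
run-total (seqᵣ {s = s} {m = m} {n} r r′) =
  ≤-trans (run-total r′) (≤-trans (+-monoˡ-≤ n (run-total r)) (≤-reflexive (+-assoc (total s) m n)))
run-total (thenᵣ {s = s} _ r) = ≤-trans (run-total r) (+-monoʳ-≤ (total s) (n≤1+n _))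
run-total (elseᵣ {s = s} _ r) = ≤-trans (run-total r) (+-monoʳ-≤ (total s) (n≤1+n _))
run-total (stopᵣ _) = m≤m+n _ 1
run-total (loopᵣ {s = s} {m = m} {n} _ r r′) =
  ≤-trans (run-total r′) (≤-trans (+-monoˡ-≤ n (run-total r))
    (≤-trans (≤-reflexive (+-assoc (total s) m n)) (+-monoʳ-≤ (total s) (n≤1+n _))))
run-total (slack {s = s} h r) = ≤-trans (run-total r) (+-monoʳ-≤ (total s) h)

-- Compilation to Turing machines: a stack is the output of its tape.

size : Prog → ℕ
size skip             = 1
size (push i b)       = 2
size (pop i)          = 1
size (p ⨾ q)          = size p + size q
size (branch i f p q) = suc (size p + size q)
size (while i f p)    = suc (size p)

entry : ∀ p → Fin (size p)
entry skip             = zero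
entry (push i b)       = zero
entry (pop i)          = zero
entry (p ⨾ q)          = entry p ↑ˡ size q
entry (branch i f p q) = zero
entry (while i f p)    = zero

Heads Acts : Set
Heads = Vec (Symbol 0) 4
Acts  = Vec (Symbol 0 × Move) 4

keep : Heads → Acts
keep = Vec.map (_, stay)

symbolTop : Symbol 0 → Maybe Bool
symbolTop blank   = nothing
symbolTop (bit b) = just b

-- The value `nothing` as next state means that a program is finished. The surrounding program
-- renames the states of its parts by `ι` and chooses by `x` where to continue after a part.
exitTo : ∀ {A B : Set} → (A → B) → B → Maybe A × Acts → B × Acts
exitTo ι x (just a  , u) = ι a , u
exitTo ι x (nothing , u) = x , u

nextOf : ∀ p → Fin (size p) → Heads → Maybe (Fin (size p)) × Acts
nextOf skip       _       h = nothing , keep h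
-- Two steps are needed: the first moves left without changing the cell under the head, the second
-- writes the bit over whatever an earlier pop has left there.
nextOf (push i b) zero    h = just (suc zero) , keep h [ i ]≔ (lookup h i , left)
nextOf (push i b) (suc _) h = nothing , keep h [ i ]≔ (bit b , stay)
nextOf (pop i)    _       h = nothing , keep h [ i ]≔ (lookup h i , right)
nextOf (p ⨾ q) st h with splitAt (size p) st
... | inj₁ a = exitTo (λ c → just (c ↑ˡ size q)) (just (size p ↑ʳ entry q)) (nextOf p a h)
... | inj₂ a = exitTo (λ c → just (size p ↑ʳ c)) nothing (nextOf q a h)
nextOf (branch i f p q) zero h =
  just (suc (if f (symbolTop (lookup h i)) then entry p ↑ˡ size q else size p ↑ʳ entry q)) , keep h
nextOf (branch i f p q) (suc st) h with splitAt (size p) st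
... | inj₁ a = exitTo (λ c → just (suc (c ↑ˡ size q))) nothing (nextOf p a h)
... | inj₂ a = exitTo (λ c → just (suc (size p ↑ʳ c))) nothing (nextOf q a h)
nextOf (while i f p) zero h =
  (if f (symbolTop (lookup h i)) then just (suc (entry p)) else nothing) , keep h
nextOf (while i f p) (suc st) h = exitTo (just ∘ suc) (just zero) (nextOf p st h)

machine : Prog → TM
machine p = record
  { states    = suc (size p)
  ; workTapes = 3
  ; aux       = 0
  ; start     = suc (entry p)
  ; δ         = λ { zero h → nothing ; (suc st) h → just (exitTo suc zero (nextOf p st h)) }
  }

Tapes : Set
Tapes = Vec (Tape 0) 4

heads : Tapes → Heads
heads = Vec.map Tape.head

contents : Tapes → Store
contents = Vec.map outputOf

top-outputOf : ∀ (t : Tape 0) → top (outputOf t) ≡ symbolTop (Tape.head t)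
top-outputOf (tape _ blank _)   = refl
top-outputOf (tape _ (bit _) _) = refl

top-contents : ∀ ts i → top (lookup (contents ts) i) ≡ symbolTop (lookup (heads ts) i)
top-contents ts i rewrite lookup-map i outputOf ts | lookup-map i Tape.head ts = top-outputOf (lookup ts i)

act-keep : ∀ {aux n} (ts : Vec (Tape aux) n) → zipWith act ts (Vec.map (_, stay) (Vec.map Tape.head ts)) ≡ ts
act-keep []       = refl
act-keep (t ∷ ts) = cong (t ∷_) (act-keep ts)

act-set : ∀ {n} (ts : Vec (Tape 0) n) i a →
  zipWith act ts (Vec.map (_, stay) (Vec.map Tape.head ts) [ i ]≔ a) ≡ ts [ i ]≔ act (lookup ts i) a
act-set (t ∷ ts) zero    a = cong (_ ∷_) (act-keep ts)
act-set (t ∷ ts) (suc i) a = cong (t ∷_) (act-set ts i a)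

outputOf-left : ∀ (t : Tape 0) b → outputOf (act (act t (Tape.head t , left)) (bit b , stay)) ≡ b ∷ outputOf t
outputOf-left (tape []      h rs) b = refl
outputOf-left (tape (_ ∷ _) h rs) b = refl

outputOf-right : ∀ (t : Tape 0) {b xs} → outputOf t ≡ b ∷ xs → outputOf (act t (Tape.head t , right)) ≡ xs
outputOf-right (tape ls (bit _) [])       refl = refl
outputOf-right (tape ls (bit _) (_ ∷ rs)) refl = refl

contents-push : ∀ {n} (ts : Vec (Tape 0) n) i b →
  let ts′ = ts [ i ]≔ act (lookup ts i) (lookup (Vec.map Tape.head ts) i , left) in
  Vec.map outputOf (ts′ [ i ]≔ act (lookup ts′ i) (bit b , stay)) ≡
  Vec.map outputOf ts [ i ]≔ (b ∷ lookup (Vec.map outputOf ts) i)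
contents-push (t ∷ ts) zero    b = cong (_∷ Vec.map outputOf ts) (outputOf-left t b)
contents-push (t ∷ ts) (suc i) b = cong (outputOf t ∷_) (contents-push ts i b)

contents-pop : ∀ {n} (ts : Vec (Tape 0) n) i {b xs} → lookup (Vec.map outputOf ts) i ≡ b ∷ xs →
  Vec.map outputOf (ts [ i ]≔ act (lookup ts i) (lookup (Vec.map Tape.head ts) i , right)) ≡
  Vec.map outputOf ts [ i ]≔ xs
contents-pop (t ∷ ts) zero    e = cong (_∷ Vec.map outputOf ts) (outputOf-right t e)
contents-pop (t ∷ ts) (suc i) e = cong (outputOf t ∷_) (contents-pop ts i e)

-- Correctness of the compilation

module Simulation (P : Prog) where

  M : TM
  M = machine P

  data Steps : ℕ → Config M → Config M → Set where
    done : ∀ {c} → Steps 0 c c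
    _then_ : ∀ {n c c′ c″} → step M c ≡ just c′ → Steps n c′ c″ → Steps (suc n) c c″

  steps-trans : ∀ {m n c c′ c″} → Steps m c c′ → Steps n c′ c″ → Steps (m + n) c c″
  steps-trans done         y = y
  steps-trans (e then x) y = e then (steps-trans x y)

  -- The program `p` occurs inside the machine with its states renamed by `ι`, and `x` is the state
  -- entered after it. The simulation is proved for all embeddings, because the parts of a program
  -- are themselves embedded programs.
  Embeds : ∀ p → (Fin (size p) → Fin (TM.states M)) → Fin (TM.states M) → Set
  Embeds p ι x = ∀ st h → TM.δ M (ι st) h ≡ just (exitTo ι x (nextOf p st h))

  stepTo : ∀ q ts {q′ acts} → TM.δ M q (heads ts) ≡ just (q′ , acts) →
           step M (config q ts) ≡ just (config q′ (zipWith act ts acts))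
  stepTo q ts e rewrite e = refl

  Reaches : Fin (TM.states M) → Tapes → Fin (TM.states M) → ℕ → Store → Set
  Reaches q ts x n s = ∃[ k ] ∃[ ts′ ] k ≤ n × Steps k (config q ts) (config x ts′) × contents ts′ ≡ s

  reaches-trans : ∀ {q ts x y m n s s′} → Reaches q ts x m s →
    (∀ ts′ → contents ts′ ≡ s → Reaches x ts′ y n s′) → Reaches q ts y (m + n) s′
  reaches-trans (k , ts′ , k≤ , xs , e) f with f ts′ e
  ... | k′ , ts″ , k′≤ , ys , e′ = k + k′ , ts″ , +-mono-≤ k≤ k′≤ , steps-trans xs ys , e′

  reaches-keep : ∀ {q q′ ts x n s} → TM.δ M q (heads ts) ≡ just (q′ , keep (heads ts)) →
    Reaches q′ ts x n s → Reaches q ts x (suc n) s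
  reaches-keep {q} {q′} {ts} e (k , ts′ , k≤ , xs , e′) =
    suc k , ts′ , s≤s k≤ ,
    (trans (stepTo q ts e) (cong (λ z → just (config q′ z)) (act-keep ts)) then xs) , e′

  reaches-refl : ∀ {ts x} → Reaches x ts x 0 (contents ts)
  reaches-refl {ts} = 0 , ts , z≤n , done , refl

  seqˡ : ∀ p q ι x → Embeds (p ⨾ q) ι x → Embeds p (ι ∘ (_↑ˡ size q)) (ι (size p ↑ʳ entry q))
  seqˡ p q ι x H st h = trans (H (st ↑ˡ size q) h) (cong just lem)
    where
    lem : exitTo ι x (nextOf (p ⨾ q) (st ↑ˡ size q) h) ≡ exitTo (ι ∘ (_↑ˡ size q)) (ι (size p ↑ʳ entry q)) (nextOf p st h)
    lem rewrite splitAt-↑ˡ (size p) st (size q) with nextOf p st h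
    ... | just _  , _ = refl
    ... | nothing , _ = refl

  seqʳ : ∀ p q ι x → Embeds (p ⨾ q) ι x → Embeds q (ι ∘ (size p ↑ʳ_)) x
  seqʳ p q ι x H st h = trans (H (size p ↑ʳ st) h) (cong just lem)
    where
    lem : exitTo ι x (nextOf (p ⨾ q) (size p ↑ʳ st) h) ≡ exitTo (ι ∘ (size p ↑ʳ_)) x (nextOf q st h)
    lem rewrite splitAt-↑ʳ (size p) (size q) st with nextOf q st h
    ... | just _  , _ = refl
    ... | nothing , _ = refl

  branchˡ : ∀ i f p q ι x → Embeds (branch i f p q) ι x → Embeds p (ι ∘ suc ∘ (_↑ˡ size q)) x
  branchˡ i f p q ι x H st h = trans (H (suc (st ↑ˡ size q)) h) (cong just lem)
    where
    lem : exitTo ι x (nextOf (branch i f p q) (suc (st ↑ˡ size q)) h) ≡ exitTo (ι ∘ suc ∘ (_↑ˡ size q)) x (nextOf p st h)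
    lem rewrite splitAt-↑ˡ (size p) st (size q) with nextOf p st h
    ... | just _  , _ = refl
    ... | nothing , _ = refl

  branchʳ : ∀ i f p q ι x → Embeds (branch i f p q) ι x → Embeds q (ι ∘ suc ∘ (size p ↑ʳ_)) x
  branchʳ i f p q ι x H st h = trans (H (suc (size p ↑ʳ st)) h) (cong just lem)
    where
    lem : exitTo ι x (nextOf (branch i f p q) (suc (size p ↑ʳ st)) h) ≡ exitTo (ι ∘ suc ∘ (size p ↑ʳ_)) x (nextOf q st h)
    lem rewrite splitAt-↑ʳ (size p) (size q) st with nextOf q st h
    ... | just _  , _ = refl
    ... | nothing , _ = refl

  whileᵉ : ∀ i f p ι x → Embeds (while i f p) ι x → Embeds p (ι ∘ suc) (ι zero)
  whileᵉ i f p ι x H st h = trans (H (suc st) h) (cong just lem)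
    where
    lem : exitTo ι x (nextOf (while i f p) (suc st) h) ≡ exitTo (ι ∘ suc) (ι zero) (nextOf p st h)
    lem with nextOf p st h
    ... | just _  , _ = refl
    ... | nothing , _ = refl

  simulate : ∀ {p s n s′} → Run p s n s′ → ∀ ι x → Embeds p ι x → ∀ ts → contents ts ≡ s →
             Reaches (ι (entry p)) ts x n s′
  simulate skipᵣ ι x H ts refl = reaches-keep (H zero (heads ts)) reaches-refl
  simulate (pushᵣ {i = i} {b}) ι x H ts refl =
    2 , _ , ≤-refl ,
    (trans (stepTo _ ts (H zero _)) (cong (λ z → just (config _ z)) (act-set ts i _)) then
      (trans (stepTo _ ts′ (H (suc zero) _)) (cong (λ z → just (config _ z)) (act-set ts′ i _)) then done)) ,
    contents-push ts i b
    where
    ts′ : Tapes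
    ts′ = ts [ i ]≔ act (lookup ts i) (lookup (heads ts) i , left)
  simulate (popᵣ {i = i} e) ι x H ts refl =
    1 , _ , ≤-refl ,
    (trans (stepTo _ ts (H zero _)) (cong (λ z → just (config _ z)) (act-set ts i _)) then done) ,
    contents-pop ts i e
  simulate (seqᵣ {p} {q} r r′) ι x H ts e =
    reaches-trans (simulate r _ _ (seqˡ p q ι x H) ts e)
      (λ ts′ e′ → simulate r′ _ _ (seqʳ p q ι x H) ts′ e′)
  simulate (thenᵣ {i} {f} {p} {q} c r) ι x H ts refl =
    reaches-keep (trans (H zero (heads ts)) (cong (λ b → just (ι (suc (if b then _ else _)) , _)) c′))
      (simulate r _ _ (branchˡ i f p q ι x H) ts refl)
    where
    c′ : f (symbolTop (lookup (heads ts) i)) ≡ true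
    c′ = trans (cong f (sym (top-contents ts i))) c
  simulate (elseᵣ {i} {f} {p} {q} c r) ι x H ts refl =
    reaches-keep (trans (H zero (heads ts)) (cong (λ b → just (ι (suc (if b then _ else _)) , _)) c′))
      (simulate r _ _ (branchʳ i f p q ι x H) ts refl)
    where
    c′ : f (symbolTop (lookup (heads ts) i)) ≡ false
    c′ = trans (cong f (sym (top-contents ts i))) c
  simulate (stopᵣ {i} {f} {p} c) ι x H ts refl =
    reaches-keep (trans (H zero (heads ts))
      (cong (λ b → just (exitTo ι x ((if b then just (suc (entry p)) else nothing) , _))) c′)) reaches-refl
    where
    c′ : f (symbolTop (lookup (heads ts) i)) ≡ false
    c′ = trans (cong f (sym (top-contents ts i))) c
  simulate (loopᵣ {i} {f} {p} c r r′) ι x H ts refl =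
    reaches-keep (trans (H zero (heads ts))
      (cong (λ b → just (exitTo ι x ((if b then just (suc (entry p)) else nothing) , _))) c′))
      (reaches-trans (simulate r _ _ (whileᵉ i f p ι x H) ts refl) (λ ts′ e′ → simulate r′ ι x H ts′ e′))
    where
    c′ : f (symbolTop (lookup (heads ts) i)) ≡ true
    c′ = trans (cong f (sym (top-contents ts i))) c
  simulate (slack h r) ι x H ts e with simulate r ι x H ts e
  ... | k , ts′ , k≤ , xs , e′ = k , ts′ , ≤-trans k≤ h , xs , e′

  halts : ∀ {n c ts} → Steps n c (config zero ts) → HaltsAfter M n c (config zero ts)
  halts done       = halted refl
  halts (e then x) = next e (halts x)

bitPrefix-map : ∀ (w : List Bool) → bitPrefix {0} (List.map bit w) ≡ w
bitPrefix-map []      = refl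
bitPrefix-map (b ∷ w) = cong (b ∷_) (bitPrefix-map w)

contents-initial : ∀ P w → contents (Config.tapes (initial (machine P) w)) ≡ w ∷ [] ∷ [] ∷ [] ∷ []
contents-initial P []      = refl
contents-initial P (b ∷ w) = cong (λ z → (b ∷ z) ∷ _) (bitPrefix-map w)

run⇒polyTime : ∀ (f : List Bool → List Bool) P (t : PExp) →
  (∀ w → ∃[ s ] Run P (w ∷ [] ∷ [] ∷ [] ∷ []) (⟦ t ⟧ (length w)) (f w ∷ s)) → PolyTime f
run⇒polyTime f P t run = machine P , toPoly t , go
  where
  open Simulation P
  go : ∀ w → ∃[ n ] ∃[ c ] n ≤ eval (toPoly t) (length w) × HaltsAfter M n (initial M w) c × output M c ≡ f w
  go w with simulate (proj₂ (run w)) suc zero (λ _ _ → refl) (Config.tapes (initial M w)) (contents-initial P w)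
  ... | k , t₀ ∷ ts , k≤ , xs , e =
    k , config zero (t₀ ∷ ts) , subst (k ≤_) (sym (eval-toPoly t (length w))) k≤ , halts xs , cong Vec.head e

-- Trees on stacks

data D : Set where
  leaf : D
  node : D → D → D

infixr 5 _▸_ _◂_

_▸_ : D → List Bool → List Bool
leaf     ▸ a = false ∷ a
node l r ▸ a = true ∷ (l ▸ (r ▸ a))

-- The bits of the prefix code are fed to `f` in the order in which they are read from the stack.
-- With `_∷_` they end up in reverse order, as on a stack to which a tree has been moved.
eff : (Bool → List Bool → List Bool) → D → List Bool → List Bool
eff f leaf       x = f false x
eff f (node l r) x = eff f r (eff f l (f true x))

_◂_ : D → List Bool → List Bool
_◂_ = eff _∷_

sizeᵈ : D → ℕ
sizeᵈ leaf       = 1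
sizeᵈ (node l r) = suc (sizeᵈ l + sizeᵈ r)

1≤sizeᵈ : ∀ d → 1 ≤ sizeᵈ d
1≤sizeᵈ leaf       = s≤s z≤n
1≤sizeᵈ (node _ _) = s≤s z≤n

length-▸ : ∀ d a → length (d ▸ a) ≡ sizeᵈ d + length a
length-▸ leaf       a = refl
length-▸ (node l r) a rewrite length-▸ l (r ▸ a) | length-▸ r a =
  cong suc (sym (+-assoc (sizeᵈ l) (sizeᵈ r) (length a)))

isTrue isJust : Maybe Bool → Bool
isTrue (just true) = true
isTrue _           = false
isJust (just _) = true
isJust nothing  = false

pattern #A = zero
pattern #B = suc zero
pattern #E = suc (suc zero)
pattern #C = suc (suc (suc zero))

module Transfer (emit : Bool → Prog) (fB fE : Bool → List Bool → List Bool)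
  (emits : ∀ t a b e c → Run (emit t) (a ∷ b ∷ e ∷ c ∷ []) 4 (a ∷ fB t b ∷ fE t e ∷ c ∷ [])) where

  -- Stack C counts the subtrees of the prefix code that are still to be read.
  transferLoop transfer : Prog
  transferLoop = while #C isJust
    (branch #A isTrue (pop #A ⨾ emit true ⨾ push #C true) (pop #A ⨾ emit false ⨾ pop #C))
  transfer = push #C true ⨾ transferLoop

  -- Stated with a continuation: a run of the loop from the point where `d` has been read is
  -- prolonged backwards over `d`. In this form the runs for two subtrees can be chained. A node
  -- costs 9: the loop test, the branch, a pop, 4 for the emission and 2 for the push.
  transferLoopᵣ : ∀ d {a b e c n s} →
    Run transferLoop (a ∷ eff fB d b ∷ eff fE d e ∷ c ∷ []) n s →
    Run transferLoop ((d ▸ a) ∷ b ∷ e ∷ (true ∷ c) ∷ []) (9 * sizeᵈ d + n) s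
  transferLoopᵣ leaf {n = n} r =
    slack (n≤1+n (8 + n)) (loopᵣ refl (elseᵣ refl (seqᵣ (popᵣ refl) (seqᵣ (emits _ _ _ _ _) (popᵣ refl)))) r)
  transferLoopᵣ (node x y) {n = n} r =
    slack (≤-reflexive (lem (sizeᵈ x) (sizeᵈ y) n))
      (loopᵣ refl (thenᵣ refl (seqᵣ (popᵣ refl) (seqᵣ (emits _ _ _ _ _) pushᵣ)))
        (transferLoopᵣ x (transferLoopᵣ y r)))
    where
    lem : ∀ x y n → 9 + (9 * x + (9 * y + n)) ≡ 9 * suc (x + y) + n
    lem = solve-∀

  transferᵣ : ∀ d {a b e} →
    Run transfer ((d ▸ a) ∷ b ∷ e ∷ [] ∷ []) (9 * sizeᵈ d + 3) (a ∷ eff fB d b ∷ eff fE d e ∷ [] ∷ [])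
  transferᵣ d = slack (≤-reflexive (lem (sizeᵈ d))) (seqᵣ pushᵣ (transferLoopᵣ d (stopᵣ refl)))
    where
    lem : ∀ x → 2 + (9 * x + 1) ≡ 9 * x + 3
    lem = solve-∀

moveBack : Fin 4 → Prog
moveBack i = while i isJust (branch i isTrue (pop i ⨾ push #A true) (pop i ⨾ push #A false))

-- Again with a continuation; the hypothesis is one round of the loop, for a single bit. The bits
-- return to stack A last one first, which restores the prefix code.
moveTree : ∀ {P s} (F : List Bool → List Bool → Store) →
  (∀ t {a x n} → Run P (F (t ∷ a) x) n s → Run P (F a (t ∷ x)) (5 + n) s) →
  ∀ d {a x n} → Run P (F (d ▸ a) x) n s → Run P (F a (d ◂ x)) (5 * sizeᵈ d + n) s
moveTree F h leaf r = h false r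
moveTree F h (node x y) {n = n} r =
  slack (≤-reflexive (lem (sizeᵈ x) (sizeᵈ y) n)) (moveTree F h y (moveTree F h x (h true r)))
  where
  lem : ∀ x y n → 5 * y + (5 * x + (5 + n)) ≡ 5 * suc (x + y) + n
  lem = solve-∀

moveBackBᵣ : ∀ d {a e c} → Run (moveBack #B) (a ∷ (d ◂ []) ∷ e ∷ c ∷ []) (5 * sizeᵈ d + 1) ((d ▸ a) ∷ [] ∷ e ∷ c ∷ [])
moveBackBᵣ d {e = e} {c} = moveTree (λ a x → a ∷ x ∷ e ∷ c ∷ [])
  (λ { true  r → loopᵣ refl (thenᵣ refl (seqᵣ (popᵣ refl) pushᵣ)) r
     ; false r → loopᵣ refl (elseᵣ refl (seqᵣ (popᵣ refl) pushᵣ)) r }) d (stopᵣ refl)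

moveBackEᵣ : ∀ d {a b c} → Run (moveBack #E) (a ∷ b ∷ (d ◂ []) ∷ c ∷ []) (5 * sizeᵈ d + 1) ((d ▸ a) ∷ b ∷ [] ∷ c ∷ [])
moveBackEᵣ d {b = b} {c} = moveTree (λ a x → a ∷ b ∷ x ∷ c ∷ [])
  (λ { true  r → loopᵣ refl (thenᵣ refl (seqᵣ (popᵣ refl) pushᵣ)) r
     ; false r → loopᵣ refl (elseᵣ refl (seqᵣ (popᵣ refl) pushᵣ)) r }) d (stopᵣ refl)

same : Bool → List Bool → List Bool
same _ x = x

eff-same : ∀ d x → eff same d x ≡ x
eff-same leaf       x = refl
eff-same (node l r) x = trans (eff-same r _) (eff-same l x)

module Drop  = Transfer (λ _ → skip) same same (λ _ _ _ _ _ → slack (s≤s z≤n) skipᵣ)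
module ToB   = Transfer (push #B) _∷_ same (λ _ _ _ _ _ → slack (s≤s (s≤s z≤n)) pushᵣ)
module ToE   = Transfer (push #E) same _∷_ (λ _ _ _ _ _ → slack (s≤s (s≤s z≤n)) pushᵣ)
module ToB×E = Transfer (λ t → push #B t ⨾ push #E t) _∷_ _∷_ (λ _ _ _ _ _ → seqᵣ pushᵣ pushᵣ)

drop dup swap : Prog
drop = Drop.transfer
dup  = ToB×E.transfer ⨾ moveBack #B ⨾ moveBack #E
-- The first tree waits on B and the second on E; since B is moved back first, the second tree ends
-- on top.
swap = ToB.transfer ⨾ ToE.transfer ⨾ moveBack #B ⨾ moveBack #E

st : List Bool → Store
st a = a ∷ [] ∷ [] ∷ [] ∷ []

slack-linear : ∀ a b x {n} → n ≡ a * x + b → 1 ≤ x → n ≤ (a + b) * x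
slack-linear a b x refl h = ≤-trans (+-monoʳ-≤ (a * x) (≤-trans (≤-reflexive (sym (*-identityʳ b))) (*-monoʳ-≤ b h)))
  (≤-reflexive (sym (*-distribʳ-+ x a b)))

resultᵣ : ∀ {p s n s′ s″} → s′ ≡ s″ → Run p s n s′ → Run p s n s″
resultᵣ refl r = r

dropᵣ : ∀ d {a} → Run drop (st (d ▸ a)) (24 * sizeᵈ d) (st a)
dropᵣ d {a} = slack (≤-trans (slack-linear 9 3 (sizeᵈ d) refl (1≤sizeᵈ d)) (*-monoˡ-≤ (sizeᵈ d) (m≤m+n 12 12)))
  (resultᵣ (cong₂ (λ b e → a ∷ b ∷ e ∷ [] ∷ []) (eff-same d []) (eff-same d [])) (Drop.transferᵣ d))

dupᵣ : ∀ d {a} → Run dup (st (d ▸ a)) (24 * sizeᵈ d) (st (d ▸ d ▸ a))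
dupᵣ d = slack (slack-linear 19 5 (sizeᵈ d) (lem (sizeᵈ d)) (1≤sizeᵈ d))
  (seqᵣ (ToB×E.transferᵣ d) (seqᵣ (moveBackBᵣ d) (moveBackEᵣ d)))
  where
  lem : ∀ x → 9 * x + 3 + (5 * x + 1 + (5 * x + 1)) ≡ 19 * x + 5
  lem = solve-∀

swapᵣ : ∀ x y {a} → Run swap (st (x ▸ y ▸ a)) (24 * (sizeᵈ x + sizeᵈ y)) (st (y ▸ x ▸ a))
swapᵣ x y {a} = slack (≤-trans (slack-linear 14 8 (sizeᵈ x + sizeᵈ y) (lem (sizeᵈ x) (sizeᵈ y)) (≤-trans (1≤sizeᵈ x) (m≤m+n _ _)))
    (*-monoˡ-≤ (sizeᵈ x + sizeᵈ y) (m≤m+n 22 2)))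
  (seqᵣ (resultᵣ (cong (λ e → (y ▸ a) ∷ (x ◂ []) ∷ e ∷ [] ∷ []) (eff-same x [])) (ToB.transferᵣ x))
    (seqᵣ (resultᵣ (cong (λ b → a ∷ b ∷ (y ◂ []) ∷ [] ∷ []) (eff-same y (x ◂ []))) (ToE.transferᵣ y))
      (seqᵣ (moveBackBᵣ x) (moveBackEᵣ y))))
  where
  lem : ∀ x y → 9 * x + 3 + (9 * y + 3 + (5 * x + 1 + (5 * y + 1))) ≡ 14 * (x + y) + 8
  lem = solve-∀

pushTree : D → Prog
pushTree leaf       = push #A false
pushTree (node l r) = pushTree r ⨾ pushTree l ⨾ push #A true

pushTreeᵣ : ∀ d {a} → Run (pushTree d) (st a) (2 * sizeᵈ d) (st (d ▸ a))
pushTreeᵣ leaf       = pushᵣ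
pushTreeᵣ (node x y) = slack (≤-reflexive (lem (sizeᵈ x) (sizeᵈ y))) (seqᵣ (pushTreeᵣ y) (seqᵣ (pushTreeᵣ x) pushᵣ))
  where
  lem : ∀ x y → 2 * y + (2 * x + 2) ≡ 2 * suc (x + y)
  lem = solve-∀

-- Encodings by trees and computable functions

record Enc (A : Set) : Set where
  field enc : A → D

open Enc {{...}} public

⟪_⟫ : ∀ {A : Set} {{_ : Enc A}} → A → ℕ
⟪ x ⟫ = sizeᵈ (enc x)

encList : ∀ {A : Set} {{_ : Enc A}} → List A → D
encList []       = leaf
encList (x ∷ xs) = node (enc x) (encList xs)

encNat : ℕ → D
encNat zero    = leaf
encNat (suc n) = node leaf (encNat n)

encBool : Bool → D
encBool false = leaf
encBool true  = node leaf leaf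

encBin : ℕᵇ → D
encBin zero     = leaf
encBin 2[1+ x ] = node (encBool true) (encBin x)
encBin 1+[2 x ] = node (encBool false) (encBin x)

instance
  Enc-D : Enc D
  Enc-D = record { enc = id }
  Enc-⊤ : Enc ⊤
  Enc-⊤ = record { enc = λ _ → leaf }
  Enc-Bool : Enc Bool
  Enc-Bool = record { enc = encBool }
  Enc-ℕ : Enc ℕ
  Enc-ℕ = record { enc = encNat }
  Enc-ℕᵇ : Enc ℕᵇ
  Enc-ℕᵇ = record { enc = encBin }
  Enc-List : ∀ {A : Set} {{_ : Enc A}} → Enc (List A)
  Enc-List = record { enc = encList }
  Enc-× : ∀ {A B : Set} {{_ : Enc A}} {{_ : Enc B}} → Enc (A × B)
  Enc-× = record { enc = λ p → node (enc (proj₁ p)) (enc (proj₂ p)) }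

1≤⟪_⟫ : ∀ {A : Set} {{_ : Enc A}} (x : A) → 1 ≤ ⟪ x ⟫
1≤⟪ x ⟫ = 1≤sizeᵈ (enc x)

-- The arbitrary `a` says that a program works on the topmost tree and preserves everything below
-- it; the other three stacks are empty before and after. This lets programs be run one after
-- another on parts of a larger structure.
record Comp {A B : Set} {{_ : Enc A}} {{_ : Enc B}} (f : A → B) : Set where
  field
    prog : Prog
    time : PExp
    run  : ∀ x {a} → Run prog (st (enc x ▸ a)) (⟦ time ⟧ ⟪ x ⟫) (st (enc (f x) ▸ a))

open Comp

module _ {A B : Set} {{encA : Enc A}} {{encB : Enc B}} where

  outSize : {f : A → B} → Comp f → PExp
  outSize c = var :+ time c

  outSize-bound : {f : A → B} (c : Comp f) → ∀ x → ⟪ f x ⟫ ≤ ⟦ outSize c ⟧ ⟪ x ⟫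
  outSize-bound {f} c x =
    subst₂ (λ m n → m ≤ n + ⟦ time c ⟧ ⟪ x ⟫) (lem (enc (f x))) (lem (enc x)) (run-total (run c x {[]}))
    where
    lem : ∀ d → total (st (d ▸ [])) ≡ sizeᵈ d
    lem d rewrite length-▸ d [] = trans (+-identityʳ _) (+-identityʳ _)

  -- A program sees only codes. Two functions whose values have the same codes therefore share a
  -- program, even if their types differ: constructors, wrappers and changes of representation cost
  -- nothing.
  recodeC : {C : Set} {{_ : Enc C}} {f : A → B} {g : A → C} → (∀ x → enc (g x) ≡ enc (f x)) → Comp f → Comp g
  recodeC {f = f} {g} e c = record
    { prog = prog c
    ; time = time c
    ; run  = λ x {a} → subst (λ d → Run (prog c) _ _ (st (d ▸ a))) (sym (e x)) (run c x) }

  extC : {f g : A → B} → (∀ x → g x ≡ f x) → Comp f → Comp g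
  extC e = recodeC (λ x → cong enc (e x))

  constC : (b : B) → Comp {A} (λ _ → b)
  constC b = record
    { prog = drop ⨾ pushTree (enc b)
    ; time = con 24 :* var :+ con (2 * ⟪ b ⟫)
    ; run  = λ x → seqᵣ (dropᵣ (enc x)) (pushTreeᵣ (enc b)) }

  fstC : Comp {A × B} proj₁
  fstC = record
    { prog = pop #A ⨾ swap ⨾ drop
    ; time = con 48 :* var :+ con 1
    ; run  = λ { (x , y) → let x′ = Enc.enc encA x ; y′ = Enc.enc encB y in slack (lem (sizeᵈ x′) (sizeᵈ y′))
        (seqᵣ (popᵣ refl) (seqᵣ (swapᵣ x′ y′) (dropᵣ y′))) } }
    where
    lem : ∀ x y → 1 + (24 * (x + y) + 24 * y) ≤ 48 * suc (x + y) + 1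
    lem x y = ≤-trans (m≤m+n _ (48 + 24 * x)) (≤-reflexive (lem′ x y))
      where
      lem′ : ∀ x y → 1 + (24 * (x + y) + 24 * y) + (48 + 24 * x) ≡ 48 * suc (x + y) + 1
      lem′ = solve-∀

  sndC : Comp {A × B} proj₂
  sndC = record
    { prog = pop #A ⨾ drop
    ; time = con 24 :* var
    ; run  = λ { (x , y) → slack (lem (sizeᵈ (Enc.enc encA x)) (sizeᵈ (Enc.enc encB y))) (seqᵣ (popᵣ refl) (dropᵣ (Enc.enc encA x))) } }
    where
    lem : ∀ x y → 1 + 24 * x ≤ 24 * suc (x + y)
    lem x y = ≤-trans (m≤m+n _ (23 + 24 * y)) (≤-reflexive (lem′ x y))
      where
      lem′ : ∀ x y → 1 + 24 * x + (23 + 24 * y) ≡ 24 * suc (x + y)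
      lem′ = solve-∀

idC : ∀ {A : Set} {{_ : Enc A}} → Comp {A} (λ x → x)
idC = record { prog = skip ; time = con 1 ; run = λ _ → skipᵣ }

coeC : ∀ {A B : Set} {{_ : Enc A}} {{_ : Enc B}} (g : A → B) → (∀ x → enc (g x) ≡ enc x) → Comp g
coeC g e = recodeC e idC

infixr 9 _∙_

_∙_ : ∀ {A B C : Set} {{_ : Enc A}} {{_ : Enc B}} {{_ : Enc C}} {g : B → C} {f : A → B} →
      Comp g → Comp f → Comp (λ x → g (f x))
_∙_ {f = f} cg cf = record
  { prog = prog cf ⨾ prog cg
  ; time = time cf :+ time cg :∘ outSize cf
  ; run  = λ x → slack (+-monoʳ-≤ _ (⟦⟧-mono (time cg) (outSize-bound cf x))) (seqᵣ (run cf x) (run cg (f x))) }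

module _ {A B C : Set} {{_ : Enc A}} {{_ : Enc B}} {{_ : Enc C}} where

  ffC : Comp {(A × B) × C} (λ p → proj₁ (proj₁ p))
  ffC = fstC ∙ fstC

  sfC : Comp {(A × B) × C} (λ p → proj₂ (proj₁ p))
  sfC = sndC ∙ fstC

  fsC : Comp {A × (B × C)} (λ p → proj₁ (proj₂ p))
  fsC = fstC ∙ sndC

  ssC : Comp {A × (B × C)} (λ p → proj₂ (proj₂ p))
  ssC = sndC ∙ sndC

infixr 4 _,C_

_,C_ : ∀ {A B C : Set} {{_ : Enc A}} {{_ : Enc B}} {{_ : Enc C}} {f : A → B} {g : A → C} →
       Comp f → Comp g → Comp (λ x → f x , g x)
_,C_ {f = f} {g} cf cg = record
  { prog = dup ⨾ prog cf ⨾ swap ⨾ prog cg ⨾ swap ⨾ push #A true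
  ; time = con 24 :* var :+ (time cf :+ (con 24 :* (outSize cf :+ var) :+
           (time cg :+ (con 24 :* (outSize cg :+ outSize cf) :+ con 2))))
  ; run  = λ x → slack
      (+-monoʳ-≤ (24 * ⟪ x ⟫) (+-monoʳ-≤ (⟦ time cf ⟧ ⟪ x ⟫) (+-mono-≤
        (*-monoʳ-≤ 24 (+-monoˡ-≤ ⟪ x ⟫ (outSize-bound cf x)))
        (+-monoʳ-≤ (⟦ time cg ⟧ ⟪ x ⟫) (+-monoˡ-≤ 2 (*-monoʳ-≤ 24 (+-mono-≤ (outSize-bound cg x) (outSize-bound cf x))))))))
      (seqᵣ (dupᵣ (enc x)) (seqᵣ (run cf x) (seqᵣ (swapᵣ (enc (f x)) (enc x))
        (seqᵣ (run cg x) (seqᵣ (swapᵣ (enc (g x)) (enc (f x))) pushᵣ))))) }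

listCase : ∀ {X C : Set} → List X → C → (X → List X → C) → C
listCase []       c f = c
listCase (x ∷ xs) c f = f x xs

module _ {A C : Set} {{_ : Enc A}} {{_ : Enc C}} where

  ifC : {b : A → Bool} {f g : A → C} → Comp b → Comp f → Comp g → Comp (λ x → if b x then f x else g x)
  ifC {b} {f} {g} cb cf cg = test ∙ (cb ,C idC)
    where
    test : Comp {Bool × A} (λ p → if proj₁ p then f (proj₂ p) else g (proj₂ p))
    test = record
      { prog = pop #A ⨾ branch #A isTrue (pop #A ⨾ pop #A ⨾ pop #A ⨾ prog cf) (pop #A ⨾ prog cg)
      ; time = con 5 :+ (time cf :+ time cg)
      ; run  = λ
        { (true  , x) → slack (+-monoʳ-≤ 5 (≤-trans (⟦⟧-mono (time cf) (m≤n+m _ 4)) (m≤m+n _ _)))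
            (seqᵣ (popᵣ refl) (thenᵣ refl (seqᵣ (popᵣ refl) (seqᵣ (popᵣ refl) (seqᵣ (popᵣ refl) (run cf x))))))
        ; (false , x) → slack (+-mono-≤ (m≤m+n 3 2) (≤-trans (⟦⟧-mono (time cg) (m≤n+m _ 2)) (m≤n+m _ _)))
            (seqᵣ (popᵣ refl) (elseᵣ refl (seqᵣ (popᵣ refl) (run cg x)))) } }

  caseListC : {X : Set} {{_ : Enc X}} {l : A → List X} {f : A → C} {g : X → List X → A → C} →
    Comp l → Comp f → Comp {(X × List X) × A} (λ p → g (proj₁ (proj₁ p)) (proj₂ (proj₁ p)) (proj₂ p)) →
    Comp (λ x → listCase (l x) (f x) (λ y ys → g y ys x))
  caseListC {X} {f = f} {g} cl cf cg = test ∙ (cl ,C idC)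
    where
    test : Comp {List X × A} (λ p → listCase (proj₁ p) (f (proj₂ p)) (λ y ys → g y ys (proj₂ p)))
    test = record
      { prog = pop #A ⨾ branch #A isTrue (push #A true ⨾ prog cg) (pop #A ⨾ prog cf)
      ; time = con 4 :+ (time cf :+ time cg)
      ; run  = λ
        { (y ∷ ys , x) → slack (+-monoʳ-≤ 4 (m≤n+m _ _))
            (seqᵣ (popᵣ refl) (thenᵣ refl (seqᵣ pushᵣ (run cg ((y , ys) , x)))))
        ; ([] , x) → slack (+-mono-≤ (m≤m+n 3 1) (≤-trans (⟦⟧-mono (time cf) (m≤n+m _ 2)) (m≤m+n _ _)))
            (seqᵣ (popᵣ refl) (elseᵣ refl (seqᵣ (popᵣ refl) (run cf x)))) } }

module _ {X : Set} {{_ : Enc X}} where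

  length≤size : ∀ (xs : List X) → length xs ≤ ⟪ xs ⟫
  length≤size []       = z≤n
  length≤size (x ∷ xs) = s≤s (≤-trans (length≤size xs) (m≤n+m _ _))

-- Folds over lists

module _ {Γ S X : Set} {{_ : Enc Γ}} {{_ : Enc S}} {{_ : Enc X}} where

  -- Polynomially many polynomial steps may still build up an exponentially large state, so a bound
  -- on the state is part of the data. Being asked for all lists, it holds in particular for the
  -- prefixes, whose folds are the intermediate states.
  module FoldC {h : Γ → S → X → S}
    (body : Comp {((X × List X) × S) × Γ} {(List X × S) × Γ}
      (λ p → (proj₂ (proj₁ (proj₁ p)) , h (proj₂ p) (proj₂ (proj₁ p)) (proj₁ (proj₁ (proj₁ p)))) , proj₂ p))
    (b : PExp) (bound : ∀ γ s xs → ⟪ foldl (h γ) s xs ⟫ ≤ ⟦ b ⟧ (⟪ xs ⟫ + ⟪ s ⟫ + ⟪ γ ⟫)) where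

    loop : Prog
    -- The stack holds list, state and parameter as three separate trees. The two pushed bits join
    -- them into one nested pair, and a nonempty list already has the code of the pair of its head
    -- and tail; the two pops take the result apart again.
    loop = while #A isTrue (push #A true ⨾ push #A true ⨾ prog body ⨾ pop #A ⨾ pop #A)

    iteration : PExp
    iteration = con 7 :+ time body :∘ (con 2 :+ (var :+ b))

    loopᵣ′ : ∀ n γ xs s {a} → ⟪ xs ⟫ + ⟪ γ ⟫ ≤ n →
      (∀ ys zs → xs ≡ ys ++ zs → ⟪ foldl (h γ) s ys ⟫ ≤ ⟦ b ⟧ n) →
      Run loop (st (enc xs ▸ enc s ▸ enc γ ▸ a)) (length xs * ⟦ iteration ⟧ n + 1)
               (st (false ∷ enc (foldl (h γ) s xs) ▸ enc γ ▸ a))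
    loopᵣ′ n γ []       s _ _ = stopᵣ refl
    loopᵣ′ n γ (x ∷ xs) s h₁ h₂ = slack lem
      (loopᵣ refl (seqᵣ pushᵣ (seqᵣ pushᵣ (seqᵣ (run body (((x , xs) , s) , γ)) (seqᵣ (popᵣ refl) (popᵣ refl)))))
        (loopᵣ′ n γ xs (h γ s x) (≤-trans (+-monoˡ-≤ ⟪ γ ⟫ (≤-trans (m≤n+m ⟪ xs ⟫ ⟪ x ⟫) (n≤1+n _))) h₁) (λ ys zs e → h₂ (x ∷ ys) zs (cong (x ∷_) e))))
      where
      arg : ⟪ (((x , xs) , s) , γ) ⟫ ≤ ⟦ con 2 :+ (var :+ b) ⟧ n
      arg = ≤-trans (≤-reflexive (lem′ ⟪ x ⟫ ⟪ xs ⟫ ⟪ s ⟫ ⟪ γ ⟫)) (+-monoʳ-≤ 2 (+-mono-≤ h₁ (h₂ [] (x ∷ xs) refl)))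
        where
        lem′ : ∀ x y s g → suc (suc (suc (x + y) + s) + g) ≡ 2 + (suc (x + y) + g + s)
        lem′ = solve-∀
      lem : suc (2 + (2 + (⟦ time body ⟧ ⟪ (((x , xs) , s) , γ) ⟫ + 2)) + (length xs * ⟦ iteration ⟧ n + 1))
            ≤ ⟦ iteration ⟧ n + length xs * ⟦ iteration ⟧ n + 1
      lem = ≤-trans (≤-reflexive (lem₁ (⟦ time body ⟧ ⟪ (((x , xs) , s) , γ) ⟫) (length xs * ⟦ iteration ⟧ n)))
        (+-monoˡ-≤ 1 (+-monoˡ-≤ _ (+-monoʳ-≤ 7 (⟦⟧-mono (time body) arg))))
        where
        lem₁ : ∀ t r → suc (2 + (2 + (t + 2)) + (r + 1)) ≡ 7 + t + r + 1
        lem₁ = solve-∀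

    foldC′ : Comp {(List X × S) × Γ} (λ p → foldl (h (proj₂ p)) (proj₂ (proj₁ p)) (proj₁ (proj₁ p)))
    foldC′ = record
      { prog = pop #A ⨾ pop #A ⨾ loop ⨾ pop #A ⨾ swap ⨾ drop
      ; time = con 4 :+ var :* iteration :+ con 24 :* (b :+ var) :+ con 24 :* var
      ; run  = λ { ((xs , s) , γ) → slack (lem xs s γ)
          (seqᵣ (popᵣ refl) (seqᵣ (popᵣ refl)
            (seqᵣ (loopᵣ′ ⟪ ((xs , s) , γ) ⟫ γ xs s (lem₁ ⟪ xs ⟫ ⟪ s ⟫ ⟪ γ ⟫) (lem₂ xs s γ))
              (seqᵣ (popᵣ refl) (seqᵣ (swapᵣ (enc (foldl (h γ) s xs)) (enc γ)) (dropᵣ (enc γ))))))) } }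
      where
      lem₁ : ∀ x s g → x + g ≤ suc (suc (x + s) + g)
      lem₁ x s g = ≤-trans (m≤m+n (x + g) (2 + s)) (≤-reflexive (eq x s g))
        where
        eq : ∀ x s g → x + g + (2 + s) ≡ suc (suc (x + s) + g)
        eq = solve-∀
      prefix : ∀ (ys zs : List X) → ⟪ ys ⟫ ≤ ⟪ ys ++ zs ⟫
      prefix []       zs = 1≤⟪ zs ⟫
      prefix (y ∷ ys) zs = s≤s (+-monoʳ-≤ ⟪ y ⟫ (prefix ys zs))
      lem₂ : ∀ xs s γ ys zs → xs ≡ ys ++ zs → ⟪ foldl (h γ) s ys ⟫ ≤ ⟦ b ⟧ ⟪ ((xs , s) , γ) ⟫
      lem₂ xs s γ ys zs refl = ≤-trans (bound γ s ys) (⟦⟧-mono b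
        (≤-trans (+-monoˡ-≤ ⟪ γ ⟫ (+-monoˡ-≤ ⟪ s ⟫ (prefix ys zs))) (≤-trans (n≤1+n _) (n≤1+n _))))
      lem : ∀ xs s γ → let n = ⟪ ((xs , s) , γ) ⟫ in
        1 + (1 + (length xs * ⟦ iteration ⟧ n + 1 +
          (1 + (24 * (⟪ foldl (h γ) s xs ⟫ + ⟪ γ ⟫) + 24 * ⟪ γ ⟫))))
        ≤ 4 + n * ⟦ iteration ⟧ n + 24 * (⟦ b ⟧ n + n) + 24 * n
      lem xs s γ = ≤-trans (≤-reflexive (eq (length xs * ⟦ iteration ⟧ n) (24 * (⟪ foldl (h γ) s xs ⟫ + ⟪ γ ⟫)) (24 * ⟪ γ ⟫)))
        (+-mono-≤ (+-mono-≤ (+-monoʳ-≤ 4 (*-monoˡ-≤ _ (≤-trans (length≤size xs) (≤-trans (m≤m+n ⟪ xs ⟫ (2 + ⟪ s ⟫ + ⟪ γ ⟫)) (≤-reflexive (eq₂ ⟪ xs ⟫ ⟪ s ⟫ ⟪ γ ⟫))))))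
          (*-monoʳ-≤ 24 (+-mono-≤ (lem₂ xs s γ xs [] (sym (++-identityʳ xs))) γ≤)))
          (*-monoʳ-≤ 24 γ≤))
        where
        n : ℕ
        n = ⟪ ((xs , s) , γ) ⟫
        γ≤ : ⟪ γ ⟫ ≤ n
        γ≤ = ≤-trans (m≤n+m ⟪ γ ⟫ _) (n≤1+n _)
        eq : ∀ a b c → 1 + (1 + (a + 1 + (1 + (b + c)))) ≡ 4 + a + b + c
        eq = solve-∀
        eq₂ : ∀ x s g → x + (2 + s + g) ≡ suc (suc (x + s) + g)
        eq₂ = solve-∀

  foldC : {h : Γ → S → X → S} {l : Γ → List X} {i : Γ → S} →
    Comp {(Γ × S) × X} (λ p → h (proj₁ (proj₁ p)) (proj₂ (proj₁ p)) (proj₂ p)) →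
    Comp l → Comp i →
    (b : PExp) → (∀ γ s xs → ⟪ foldl (h γ) s xs ⟫ ≤ ⟦ b ⟧ (⟪ xs ⟫ + ⟪ s ⟫ + ⟪ γ ⟫)) →
    Comp (λ γ → foldl (h γ) (i γ) (l γ))
  foldC ch cl ci b bound = FoldC.foldC′
    ((sndC ∙ ffC ,C ch ∙ ((sndC ,C sfC) ,C fstC ∙ ffC)) ,C sndC) b bound ∙ ((cl ,C ci) ,C idC)

  -- If the growth per item does not depend on the state, it adds up to at most the number of items
  -- times the growth for the largest one. Most folds below are of this kind.
  foldl-additive : (h : Γ → S → X → S) (g : PExp) →
    (∀ γ s x → ⟪ h γ s x ⟫ ≤ ⟪ s ⟫ + ⟦ g ⟧ (⟪ γ ⟫ + ⟪ x ⟫)) →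
    ∀ γ s xs → ⟪ foldl (h γ) s xs ⟫ ≤ ⟦ var :+ var :* g ⟧ (⟪ xs ⟫ + ⟪ s ⟫ + ⟪ γ ⟫)
  foldl-additive h g add γ s xs = ≤-trans (go s xs) (+-mono-≤ (≤-trans (m≤n+m ⟪ s ⟫ ⟪ xs ⟫) (m≤m+n _ ⟪ γ ⟫))
    (*-mono-≤ (≤-trans (length≤size xs) (≤-trans (m≤m+n ⟪ xs ⟫ ⟪ s ⟫) (m≤m+n _ ⟪ γ ⟫)))
      (⟦⟧-mono g (≤-trans (≤-reflexive (+-comm ⟪ γ ⟫ ⟪ xs ⟫)) (+-monoˡ-≤ ⟪ γ ⟫ (m≤m+n ⟪ xs ⟫ ⟪ s ⟫))))))
    where
    go : ∀ s xs → ⟪ foldl (h γ) s xs ⟫ ≤ ⟪ s ⟫ + length xs * ⟦ g ⟧ (⟪ γ ⟫ + ⟪ xs ⟫)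
    go s []       = m≤m+n _ _
    go s (x ∷ xs) = ≤-trans (go (h γ s x) xs) (≤-trans
      (+-mono-≤ (≤-trans (add γ s x) (+-monoʳ-≤ ⟪ s ⟫ (⟦⟧-mono g (+-monoʳ-≤ ⟪ γ ⟫ (≤-trans (m≤m+n ⟪ x ⟫ ⟪ xs ⟫) (n≤1+n _))))))
        (*-monoʳ-≤ (length xs) (⟦⟧-mono g (+-monoʳ-≤ ⟪ γ ⟫ (≤-trans (m≤n+m ⟪ xs ⟫ ⟪ x ⟫) (n≤1+n _))))))
      (≤-reflexive (+-assoc ⟪ s ⟫ _ _)))

  foldAddC : {h : Γ → S → X → S} {l : Γ → List X} {i : Γ → S} →
    Comp {(Γ × S) × X} (λ p → h (proj₁ (proj₁ p)) (proj₂ (proj₁ p)) (proj₂ p)) →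
    Comp l → Comp i →
    (g : PExp) → (∀ γ s x → ⟪ h γ s x ⟫ ≤ ⟪ s ⟫ + ⟦ g ⟧ (⟪ γ ⟫ + ⟪ x ⟫)) →
    Comp (λ γ → foldl (h γ) (i γ) (l γ))
  foldAddC {h} ch cl ci g add = foldC ch cl ci (var :+ var :* g) (foldl-additive h g add)

-- Input and output

-- The code of a list has to be built from its last item, hence the detour over B, which reverses
-- the input. Every bit becomes the mark of a list cell followed by the code of the bit: four
-- symbols for `true`, two for `false`.
readIn writeOut : Prog
readIn =
  while #A isJust (branch #A isTrue (pop #A ⨾ push #B true) (pop #A ⨾ push #B false)) ⨾
  push #A false ⨾
  while #B isJust (branch #B isTrue
    (pop #B ⨾ push #A false ⨾ push #A false ⨾ push #A true ⨾ push #A true)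
    (pop #B ⨾ push #A false ⨾ push #A true))
writeOut =
  while #A isTrue (pop #A ⨾ branch #A isTrue
    (pop #A ⨾ pop #A ⨾ pop #A ⨾ push #B true)
    (pop #A ⨾ push #B false)) ⨾
  pop #A ⨾ moveBack #B

ʳ++-ʳ++[] : ∀ (w : List Bool) → (w ʳ++ []) ʳ++ [] ≡ w
ʳ++-ʳ++[] w = trans (ʳ++-ʳ++ w) (++-identityʳ w)

length-ʳ++[] : ∀ (w : List Bool) → length (w ʳ++ []) ≡ length w
length-ʳ++[] w = trans (cong length (trans (ʳ++-defn w) (++-identityʳ (List.reverse w)))) (length-reverse w)

readInᵣ : ∀ w → Run readIn (st w) (16 * length w + 4) (st (enc w ▸ []))
readInᵣ w = slack (≤-reflexive (lem (length w)))
  (seqᵣ (collect w []) (seqᵣ pushᵣ (resultᵣ (cong (λ v → st (enc v ▸ [])) (ʳ++-ʳ++[] w))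
    (slack (≤-reflexive (cong (λ k → 11 * k + 1) (length-ʳ++[] w))) (build (w ʳ++ []) [])))))
  where
  lem : ∀ x → 5 * x + 1 + (2 + (11 * x + 1)) ≡ 16 * x + 4
  lem = solve-∀
  collect : ∀ w b → Run (while #A isJust (branch #A isTrue (pop #A ⨾ push #B true) (pop #A ⨾ push #B false)))
    (w ∷ b ∷ [] ∷ [] ∷ []) (5 * length w + 1) ([] ∷ (w ʳ++ b) ∷ [] ∷ [] ∷ [])
  collect []          b = stopᵣ refl
  collect (true ∷ w)  b = slack (≤-reflexive (lem₁ (length w))) (loopᵣ refl (thenᵣ refl (seqᵣ (popᵣ refl) pushᵣ)) (collect w (true ∷ b)))
    where
    lem₁ : ∀ x → 5 + (5 * x + 1) ≡ 5 * suc x + 1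
    lem₁ = solve-∀
  collect (false ∷ w) b = slack (≤-reflexive (lem₁ (length w))) (loopᵣ refl (elseᵣ refl (seqᵣ (popᵣ refl) pushᵣ)) (collect w (false ∷ b)))
    where
    lem₁ : ∀ x → 5 + (5 * x + 1) ≡ 5 * suc x + 1
    lem₁ = solve-∀
  build : ∀ b w → Run (while #B isJust (branch #B isTrue
    (pop #B ⨾ push #A false ⨾ push #A false ⨾ push #A true ⨾ push #A true)
    (pop #B ⨾ push #A false ⨾ push #A true))) ((enc w ▸ []) ∷ b ∷ [] ∷ [] ∷ []) (11 * length b + 1)
    (st (enc (b ʳ++ w) ▸ []))
  build []          w = stopᵣ refl
  build (true ∷ b)  w = slack (≤-reflexive (lem₁ (length b)))
    (loopᵣ refl (thenᵣ refl (seqᵣ (popᵣ refl) (seqᵣ pushᵣ (seqᵣ pushᵣ (seqᵣ pushᵣ pushᵣ))))) (build b (true ∷ w)))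
    where
    lem₁ : ∀ x → 11 + (11 * x + 1) ≡ 11 * suc x + 1
    lem₁ = solve-∀
  build (false ∷ b) w = slack (≤-trans (m≤m+n _ 4) (≤-reflexive (lem₁ (length b))))
    (loopᵣ refl (elseᵣ refl (seqᵣ (popᵣ refl) (seqᵣ pushᵣ pushᵣ))) (build b (false ∷ w)))
    where
    lem₁ : ∀ x → 7 + (11 * x + 1) + 4 ≡ 11 * suc x + 1
    lem₁ = solve-∀

writeOutᵣ : ∀ w → Run writeOut (st (enc w ▸ [])) (13 * length w + 3) (st w)
writeOutᵣ w = slack (≤-reflexive (lem (length w)))
  (seqᵣ (collect w []) (seqᵣ (popᵣ refl) (resultᵣ (cong st (ʳ++-ʳ++[] w))
    (slack (≤-reflexive (cong (λ k → 5 * k + 1) (length-ʳ++[] w))) (back (w ʳ++ []) [])))))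
  where
  lem : ∀ x → 8 * x + 1 + (1 + (5 * x + 1)) ≡ 13 * x + 3
  lem = solve-∀
  collect : ∀ w b → Run (while #A isTrue (pop #A ⨾ branch #A isTrue
      (pop #A ⨾ pop #A ⨾ pop #A ⨾ push #B true) (pop #A ⨾ push #B false)))
    ((enc w ▸ []) ∷ b ∷ [] ∷ [] ∷ []) (8 * length w + 1) ((false ∷ []) ∷ (w ʳ++ b) ∷ [] ∷ [] ∷ [])
  collect []          b = stopᵣ refl
  collect (true ∷ w)  b = slack (≤-reflexive (lem₁ (length w)))
    (loopᵣ refl (seqᵣ (popᵣ refl) (thenᵣ refl (seqᵣ (popᵣ refl) (seqᵣ (popᵣ refl) (seqᵣ (popᵣ refl) pushᵣ))))) (collect w (true ∷ b)))
    where
    lem₁ : ∀ x → 8 + (8 * x + 1) ≡ 8 * suc x + 1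
    lem₁ = solve-∀
  collect (false ∷ w) b = slack (≤-trans (m≤m+n _ 2) (≤-reflexive (lem₁ (length w))))
    (loopᵣ refl (seqᵣ (popᵣ refl) (elseᵣ refl (seqᵣ (popᵣ refl) pushᵣ))) (collect w (false ∷ b)))
    where
    lem₁ : ∀ x → 6 + (8 * x + 1) + 2 ≡ 8 * suc x + 1
    lem₁ = solve-∀
  back : ∀ b a → Run (moveBack #B) (a ∷ b ∷ [] ∷ [] ∷ []) (5 * length b + 1) (st (b ʳ++ a))
  back []          a = stopᵣ refl
  back (true ∷ b)  a = slack (≤-reflexive (lem₁ (length b))) (loopᵣ refl (thenᵣ refl (seqᵣ (popᵣ refl) pushᵣ)) (back b (true ∷ a)))
    where
    lem₁ : ∀ x → 5 + (5 * x + 1) ≡ 5 * suc x + 1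
    lem₁ = solve-∀
  back (false ∷ b) a = slack (≤-reflexive (lem₁ (length b))) (loopᵣ refl (elseᵣ refl (seqᵣ (popᵣ refl) pushᵣ)) (back b (false ∷ a)))
    where
    lem₁ : ∀ x → 5 + (5 * x + 1) ≡ 5 * suc x + 1
    lem₁ = solve-∀

size-bits : ∀ (w : List Bool) → ⟪ w ⟫ ≤ 4 * length w + 1
size-bits []      = s≤s z≤n
size-bits (b ∷ w) = ≤-trans (s≤s (+-mono-≤ (bits b) (size-bits w))) (≤-reflexive (lem (length w)))
  where
  bits : ∀ b → ⟪ b ⟫ ≤ 3
  bits true  = ≤-refl
  bits false = s≤s z≤n
  lem : ∀ x → suc (3 + (4 * x + 1)) ≡ 4 * suc x + 1
  lem = solve-∀

comp⇒polyTime : {f : List Bool → List Bool} → Comp f → PolyTime f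
comp⇒polyTime {f} c = run⇒polyTime f (readIn ⨾ prog c ⨾ writeOut)
  ((con 16 :* var :+ con 4) :+ (time c :∘ sz :+ (con 13 :* (outSize c :∘ sz) :+ con 3)))
  (λ w → _ , seqᵣ (readInᵣ w) (seqᵣ (slack (⟦⟧-mono (time c) (size-bits w)) (run c w))
    (slack (+-monoˡ-≤ 3 (*-monoʳ-≤ 13 (≤-trans (length≤size (f w)) (≤-trans (outSize-bound c w) (⟦⟧-mono (outSize c) (size-bits w))))))
      (writeOutᵣ (f w)))))
  where
  sz : PExp
  sz = con 4 :* var :+ con 1

-- Booleans

module _ {Γ : Set} {{_ : Enc Γ}} where

  andC : {a b : Γ → Bool} → Comp a → Comp b → Comp (λ γ → a γ ∧ b γ)
  andC {a} {b} ca cb = extC (λ γ → lem (a γ) (b γ)) (ifC ca cb (constC false))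
    where
    lem : ∀ a b → a ∧ b ≡ (if a then b else false)
    lem true  b = refl
    lem false b = refl

  orC : {a b : Γ → Bool} → Comp a → Comp b → Comp (λ γ → a γ ∨ b γ)
  orC {a} {b} ca cb = extC (λ γ → lem (a γ) (b γ)) (ifC ca (constC true) cb)
    where
    lem : ∀ a b → a ∨ b ≡ (if a then true else b)
    lem true  b = refl
    lem false b = refl

  notC : {a : Γ → Bool} → Comp a → Comp (λ γ → not (a γ))
  notC {a} ca = extC (λ γ → lem (a γ)) (ifC ca (constC false) (constC true))
    where
    lem : ∀ a → not a ≡ (if a then false else true)
    lem true  = refl
    lem false = refl

size-bool : ∀ (b : Bool) → ⟪ b ⟫ ≤ 3
size-bool true  = ≤-refl
size-bool false = s≤s z≤n

-- Lists

module _ {Γ X : Set} {{_ : Enc Γ}} {{_ : Enc X}} where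

  consC : {f : Γ → X} {g : Γ → List X} → Comp f → Comp g → Comp (λ γ → f γ ∷ g γ)
  consC cf cg = recodeC (λ _ → refl) (cf ,C cg)

  singleC : {f : Γ → X} → Comp f → Comp (λ γ → [ f γ ])
  singleC cf = consC cf (constC [])

module _ {Γ X : Set} {{_ : Enc Γ}} {{_ : Enc X}} where

  reverseC : {l : Γ → List X} → Comp l → Comp (λ γ → reverse (l γ))
  reverseC cl = foldAddC (consC sndC (sfC)) cl (constC []) (con 1 :+ var) (λ γ s x → lem ⟪ γ ⟫ ⟪ s ⟫ ⟪ x ⟫)
    where
    lem : ∀ g s x → suc (x + s) ≤ s + (1 + (g + x))
    lem g s x = ≤-trans (m≤m+n _ g) (≤-reflexive (eq g s x))
      where
      eq : ∀ g s x → suc (x + s) + g ≡ s + (1 + (g + x))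
      eq = solve-∀

module _ {Γ S X : Set} {{_ : Enc Γ}} {{_ : Enc S}} {{_ : Enc X}} where

  foldrC : {h : Γ → X → S → S} {l : Γ → List X} {i : Γ → S} →
    Comp {(Γ × S) × X} (λ p → h (proj₁ (proj₁ p)) (proj₂ p) (proj₂ (proj₁ p))) →
    Comp l → Comp i →
    (g : PExp) → (∀ γ s x → ⟪ h γ x s ⟫ ≤ ⟪ s ⟫ + ⟦ g ⟧ (⟪ γ ⟫ + ⟪ x ⟫)) →
    Comp (λ γ → foldr (h γ) (i γ) (l γ))
  foldrC {h} {l} {i} ch cl ci g add =
    extC (λ γ → trans (cong (foldr (h γ) (i γ)) (sym (reverse-involutive (l γ)))) (reverse-foldr (h γ) (i γ) (reverse (l γ))))
      (foldAddC ch (reverseC cl) ci g add)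

  foldrBoolC : {h : Γ → X → Bool → Bool} {l : Γ → List X} {i : Γ → Bool} →
    Comp {(Γ × Bool) × X} (λ p → h (proj₁ (proj₁ p)) (proj₂ p) (proj₂ (proj₁ p))) →
    Comp l → Comp i → Comp (λ γ → foldr (h γ) (i γ) (l γ))
  foldrBoolC {h} {l} {i} ch cl ci =
    extC (λ γ → trans (cong (foldr (h γ) (i γ)) (sym (reverse-involutive (l γ)))) (reverse-foldr (h γ) (i γ) (reverse (l γ))))
      (foldAddC ch (reverseC cl) ci (con 3) (λ γ s x → ≤-trans (size-bool (h γ x s)) (m≤n+m _ _)))

module _ {X : Set} {{_ : Enc X}} where

  size-++ : ∀ (xs ys : List X) → suc ⟪ xs ++ ys ⟫ ≡ ⟪ xs ⟫ + ⟪ ys ⟫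
  size-++ []       ys = refl
  size-++ (x ∷ xs) ys = cong suc (trans (sym (+-suc ⟪ x ⟫ _)) (trans (cong (⟪ x ⟫ +_) (size-++ xs ys)) (sym (+-assoc ⟪ x ⟫ _ _))))

  size-++≤ : ∀ (xs ys : List X) → ⟪ xs ++ ys ⟫ ≤ ⟪ ys ⟫ + ⟪ xs ⟫
  size-++≤ xs ys = ≤-trans (n≤1+n _) (≤-reflexive (trans (size-++ xs ys) (+-comm ⟪ xs ⟫ _)))

module _ {Γ X : Set} {{_ : Enc Γ}} {{_ : Enc X}} where

  appendC : {f g : Γ → List X} → Comp f → Comp g → Comp (λ γ → f γ ++ g γ)
  appendC {f} {g} cf cg = extC (λ γ → lem (f γ) (g γ))
    (foldrC {h = λ _ → _∷_} (consC sndC (sfC)) cf cg (con 1 :+ var) (λ γ s x → lem₁ ⟪ γ ⟫ ⟪ s ⟫ ⟪ x ⟫))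
    where
    lem : ∀ (xs ys : List X) → xs ++ ys ≡ foldr _∷_ ys xs
    lem []       ys = refl
    lem (x ∷ xs) ys = cong (x ∷_) (lem xs ys)
    lem₁ : ∀ g s x → suc (x + s) ≤ s + (1 + (g + x))
    lem₁ g s x = ≤-trans (m≤m+n _ g) (≤-reflexive (eq g s x))
      where
      eq : ∀ g s x → suc (x + s) + g ≡ s + (1 + (g + x))
      eq = solve-∀

module _ {Γ X Y : Set} {{_ : Enc Γ}} {{_ : Enc X}} {{_ : Enc Y}} where

  concatMapC : {f : Γ → X → List Y} {l : Γ → List X} →
    Comp {Γ × X} (λ p → f (proj₁ p) (proj₂ p)) → Comp l → Comp (λ γ → concatMap (f γ) (l γ))
  concatMapC {f} {l} cf cl = extC (λ γ → lem (f γ) (l γ))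
    (foldrC {h = λ γ x r → f γ x ++ r} (appendC (cf ∙ (ffC ,C sndC)) (sfC)) cl (constC [])
      (outSize cf :∘ (con 1 :+ var))
      (λ γ s x → ≤-trans (size-++≤ (f γ x) s) (+-monoʳ-≤ ⟪ s ⟫ (outSize-bound cf (γ , x)))))
    where
    lem : ∀ (f : X → List Y) xs → concatMap f xs ≡ foldr (λ x r → f x ++ r) [] xs
    lem f []       = refl
    lem f (x ∷ xs) = cong (f x ++_) (lem f xs)

module _ {Γ X Y : Set} {{_ : Enc Γ}} {{_ : Enc X}} {{_ : Enc Y}} where

  mapC : {f : Γ → X → Y} {l : Γ → List X} →
    Comp {Γ × X} (λ p → f (proj₁ p) (proj₂ p)) → Comp l → Comp (λ γ → map (f γ) (l γ))
  mapC {f} {l} cf cl = extC (λ γ → lem (f γ) (l γ)) (concatMapC (singleC cf) cl)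
    where
    lem : ∀ (f : X → Y) xs → map f xs ≡ concatMap (λ x → [ f x ]) xs
    lem f []       = refl
    lem f (x ∷ xs) = cong (f x ∷_) (lem f xs)

module _ {Γ X : Set} {{_ : Enc Γ}} {{_ : Enc X}} where

  allC : {p : Γ → X → Bool} {l : Γ → List X} →
    Comp {Γ × X} (λ q → p (proj₁ q) (proj₂ q)) → Comp l → Comp (λ γ → all (p γ) (l γ))
  allC {p} {l} cp cl = extC (λ γ → lem (p γ) (l γ))
    (foldrBoolC {S = Bool} {h = λ γ x r → p γ x ∧ r} (andC (cp ∙ (ffC ,C sndC)) (sfC)) cl (constC true))
    where
    lem : ∀ (p : X → Bool) xs → all p xs ≡ foldr (λ x r → p x ∧ r) true xs
    lem p []       = refl
    lem p (x ∷ xs) = cong (p x ∧_) (lem p xs)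

  anyC : {p : Γ → X → Bool} {l : Γ → List X} →
    Comp {Γ × X} (λ q → p (proj₁ q) (proj₂ q)) → Comp l → Comp (λ γ → any (p γ) (l γ))
  anyC {p} {l} cp cl = extC (λ γ → lem (p γ) (l γ))
    (foldrBoolC {S = Bool} {h = λ γ x r → p γ x ∨ r} (orC (cp ∙ (ffC ,C sndC)) (sfC)) cl (constC false))
    where
    lem : ∀ (p : X → Bool) xs → any p xs ≡ foldr (λ x r → p x ∨ r) false xs
    lem p []       = refl
    lem p (x ∷ xs) = cong (p x ∨_) (lem p xs)

  encodeListC : {e : X → List Bool} {l : Γ → List X} → Comp e → Comp l → Comp (λ γ → encodeList e (l γ))
  encodeListC {e} {l} ce cl = extC (λ γ → lem (l γ))
    (appendC (concatMapC {f = λ _ x → true ∷ e x} (consC (constC true) (ce ∙ sndC)) cl) (constC [ false ]))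
    where
    lem : ∀ xs → encodeList e xs ≡ concatMap (λ x → true ∷ e x) xs ++ [ false ]
    lem []       = refl
    lem (x ∷ xs) = cong (true ∷_) (trans (cong (e x ++_) (lem xs)) (sym (++-assoc (e x) _ _)))

-- Unary numbers

-- A unary number has the same code as a list of that many trivial items. Recursion over numbers
-- thereby becomes a fold.
units : ℕ → List ⊤
units zero    = []
units (suc n) = tt ∷ units n

module _ {Γ : Set} {{_ : Enc Γ}} where

  unitsC : {f : Γ → ℕ} → Comp f → Comp (λ γ → units (f γ))
  unitsC cf = coeC units lem ∙ cf
    where
    lem : ∀ n → enc (units n) ≡ enc n
    lem zero    = refl
    lem (suc n) = cong (node leaf) (lem n)

  sucC : {f : Γ → ℕ} → Comp f → Comp (λ γ → suc (f γ))
  sucC cf = recodeC (λ _ → refl) (constC tt ,C cf)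

module _ {Γ : Set} {{_ : Enc Γ}} where

  lengthC : {X : Set} {{_ : Enc X}} {l : Γ → List X} → Comp l → Comp (λ γ → length (l γ))
  lengthC {X} {l = l} cl = extC (λ γ → lem (l γ))
    (foldrC {h = λ _ _ → suc} (sucC (sfC)) cl (constC 0) (con 2) (λ γ s x → ≤-reflexive (+-comm 2 ⟪ s ⟫)))
    where
    lem : ∀ (xs : List X) → length xs ≡ foldr (λ _ → suc) 0 xs
    lem []       = refl
    lem (x ∷ xs) = cong suc (lem xs)

  plusC : {f g : Γ → ℕ} → Comp f → Comp g → Comp (λ γ → f γ + g γ)
  plusC {f} {g} cf cg = extC (λ γ → lem (f γ) (g γ))
    (foldrC {h = λ _ (_ : ⊤) → suc} (sucC (sfC)) (unitsC cf) cg (con 2) (λ γ s x → ≤-reflexive (+-comm 2 ⟪ s ⟫)))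
    where
    lem : ∀ m n → m + n ≡ foldr (λ _ → suc) n (units m)
    lem zero    n = refl
    lem (suc m) n = cong suc (lem m n)

size-+ : ∀ m n → ⟪ m + n ⟫ ≤ ⟪ n ⟫ + ⟪ m ⟫
size-+ zero    n = m≤m+n _ 1
size-+ (suc m) n = ≤-trans (+-monoʳ-≤ 2 (size-+ m n)) (≤-reflexive (lem ⟪ m ⟫ ⟪ n ⟫))
  where
  lem : ∀ m n → 2 + (n + m) ≡ n + suc (suc m)
  lem = solve-∀

natCase : ∀ {C : Set} → ℕ → C → (ℕ → C) → C
natCase zero    c f = c
natCase (suc n) c f = f n

module _ {Γ : Set} {{_ : Enc Γ}} where

  caseNatC : {C : Set} {{_ : Enc C}} {n : Γ → ℕ} {f : Γ → C} {g : ℕ → Γ → C} →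
    Comp n → Comp f → Comp {ℕ × Γ} (λ p → g (proj₁ p) (proj₂ p)) →
    Comp (λ x → natCase (n x) (f x) (λ m → g m x))
  caseNatC {n = n} {f} {g} cn cf cg = extC (λ γ → lem (n γ))
    (caseListC {g = λ _ us γ → g (length us) γ} (unitsC cn) cf (cg ∙ (lengthC (sfC) ,C sndC)))
    where
    length-units : ∀ m → length (units m) ≡ m
    length-units zero    = refl
    length-units (suc m) = cong suc (length-units m)
    lem : ∀ {γ} m → natCase m (f γ) (λ k → g k γ) ≡ listCase (units m) (f γ) (λ _ us → g (length us) γ)
    lem zero    = refl
    lem (suc m) = cong (λ k → g k _) (sym (length-units m))

module _ {Γ : Set} {{_ : Enc Γ}} where

  timesC : {f g : Γ → ℕ} → Comp f → Comp g → Comp (λ γ → f γ * g γ)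
  timesC {f} {g} cf cg = extC (λ γ → lem (f γ) (g γ))
    (foldrC {h = λ γ (_ : ⊤) s → g γ + s} (plusC (cg ∙ ffC) (sfC)) (unitsC cf) (constC 0) (outSize cg)
      (λ γ s x → ≤-trans (size-+ (g γ) s) (+-monoʳ-≤ ⟪ s ⟫ (≤-trans (outSize-bound cg γ) (⟦⟧-mono (outSize cg) (m≤m+n _ _))))))
    where
    lem : ∀ m n → m * n ≡ foldr (λ _ → n +_) 0 (units m)
    lem zero    n = refl
    lem (suc m) n = cong (n +_) (lem m n)

  monusC : {f g : Γ → ℕ} → Comp f → Comp g → Comp (λ γ → f γ ∸ g γ)
  monusC {f} {g} cf cg = extC (λ γ → lem (f γ) (g γ))
    (foldrC {h = λ γ (_ : ⊤) s → natCase s 0 id} (caseNatC {g = λ m _ → m} (sfC) (constC 0) fstC) (unitsC cg) cf (con 0)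
      (λ γ s x → ≤-trans (shrink s) (≤-reflexive (sym (+-identityʳ _)))))
    where
    shrink : ∀ s → ⟪ natCase s 0 id ⟫ ≤ ⟪ s ⟫
    shrink zero    = ≤-refl
    shrink (suc s) = ≤-trans (n≤1+n _) (n≤1+n _)
    pred-∸ : ∀ m n → m ∸ suc n ≡ natCase (m ∸ n) 0 id
    pred-∸ m n with m ∸ n in e
    ... | zero  = m≤n⇒m∸n≡0 (≤-trans (m∸n≡0⇒m≤n e) (n≤1+n n))
    ... | suc k = trans (sym (pred[m∸n]≡m∸[1+n] m n)) (cong Data.Nat.pred e)
    lem : ∀ m n → m ∸ n ≡ foldr (λ _ s → natCase s 0 id) m (units n)
    lem m zero    = refl
    lem m (suc n) = trans (pred-∸ m n) (cong (λ s → natCase s 0 id) (lem m n))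

  evalC : ∀ p {f : Γ → ℕ} → Comp f → Comp (λ γ → eval p (f γ))
  evalC []      cf = constC 0
  evalC (c ∷ p) cf = plusC (constC c) (timesC cf (evalC p cf))

-- Enumeration with a running counter

module _ {X Y : Set} where

  scan : (ℕ → X → List Y) → (X → ℕ) → ℕ → List X → List Y
  scan o d s []       = []
  scan o d s (x ∷ xs) = o s x ++ scan o d (d x + s) xs

module _ {Γ X Y : Set} {{_ : Enc Γ}} {{_ : Enc X}} {{_ : Enc Y}} where

  -- What is emitted depends on the counter, so the growth per item is not independent of the state
  -- and `foldAddC` does not apply; the counter has to be bounded first.
  module ScanC {o : Γ → ℕ → X → List Y} {d : Γ → X → ℕ}
    (co : Comp {(Γ × ℕ) × X} (λ p → o (proj₁ (proj₁ p)) (proj₂ (proj₁ p)) (proj₂ p)))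
    (cd : Comp {Γ × X} (λ p → d (proj₁ p) (proj₂ p))) where

    scanStep : Γ → ℕ × List Y → X → ℕ × List Y
    scanStep γ (s , acc) x = d γ x + s , acc ++ o γ s x

    scan-foldl : ∀ γ s acc xs → proj₂ (foldl (scanStep γ) (s , acc) xs) ≡ acc ++ scan (o γ) (d γ) s xs
    scan-foldl γ s acc []       = sym (++-identityʳ acc)
    scan-foldl γ s acc (x ∷ xs) = trans (scan-foldl γ (d γ x + s) (acc ++ o γ s x) xs) (++-assoc acc _ _)

    δ ω : PExp
    δ = var :+ var :* (outSize cd :∘ (con 1 :+ var))
    ω = outSize co :∘ (con 2 :+ (var :+ δ))

    -- Along the fold the counter stays below δ, so each emission stays below ω.
    scan-bound : ∀ n γ s acc xs → ⟪ γ ⟫ + ⟪ xs ⟫ ≤ n → ∀ r → ⟪ s ⟫ + length xs * ⟦ outSize cd :∘ (con 1 :+ var) ⟧ n ≤ r →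
      ⟪ foldl (scanStep γ) (s , acc) xs ⟫ ≤ suc (r + (⟪ acc ⟫ + length xs * ⟦ outSize co ⟧ (2 + (n + r))))
    scan-bound n γ s acc [] h r h₂ =
      s≤s (+-mono-≤ (≤-trans (m≤m+n ⟪ s ⟫ 0) h₂) (m≤m+n ⟪ acc ⟫ 0))
    scan-bound n γ s acc (x ∷ xs) h r h₂ =
      ≤-trans (scan-bound n γ (d γ x + s) (acc ++ o γ s x) xs
          (≤-trans (+-monoʳ-≤ ⟪ γ ⟫ (≤-trans (m≤n+m _ ⟪ x ⟫) (n≤1+n _))) h) r
          (≤-trans (+-monoˡ-≤ _ (≤-trans (size-+ (d γ x) s) (+-monoʳ-≤ ⟪ s ⟫
            (≤-trans (outSize-bound cd (γ , x)) (⟦⟧-mono (outSize cd) (s≤s γx≤))))))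
            (≤-trans (≤-reflexive (+-assoc ⟪ s ⟫ _ _)) h₂)))
        (s≤s (+-monoʳ-≤ r (≤-trans (+-monoˡ-≤ _ (≤-trans (size-++≤ acc (o γ s x)) (≤-reflexive (+-comm ⟪ o γ s x ⟫ ⟪ acc ⟫))))
          (≤-trans (≤-reflexive (+-assoc ⟪ acc ⟫ _ _)) (+-monoʳ-≤ ⟪ acc ⟫ (+-monoˡ-≤ _
            (≤-trans (outSize-bound co ((γ , s) , x)) (⟦⟧-mono (outSize co) arg))))))))
      where
      γx≤ : ⟪ γ ⟫ + ⟪ x ⟫ ≤ n
      γx≤ = ≤-trans (+-monoʳ-≤ ⟪ γ ⟫ (≤-trans (m≤m+n ⟪ x ⟫ _) (n≤1+n _))) h
      arg : suc (suc (⟪ γ ⟫ + ⟪ s ⟫) + ⟪ x ⟫) ≤ 2 + (n + r)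
      arg = ≤-trans (≤-reflexive (eq ⟪ γ ⟫ ⟪ s ⟫ ⟪ x ⟫)) (+-monoʳ-≤ 2 (+-mono-≤ γx≤ (≤-trans (m≤m+n _ _) h₂)))
        where
        eq : ∀ g s x → suc (suc (g + s) + x) ≡ 2 + (g + x + s)
        eq = solve-∀

    scanC′ : {l : Γ → List X} {i : Γ → ℕ} → Comp l → Comp i → Comp (λ γ → scan (o γ) (d γ) (i γ) (l γ))
    scanC′ {l} {i} cl ci = extC (λ γ → sym (scan-foldl γ (i γ) [] (l γ)))
      (sndC ∙ foldC {h = scanStep} (plusC (cd ∙ (ffC ,C sndC)) (fstC ∙ sfC) ,C
           appendC (sndC ∙ sfC) (co ∙ ((ffC ,C fstC ∙ sfC) ,C sndC)))
        cl (ci ,C constC []) (con 1 :+ (δ :+ (var :+ var :* ω))) bound)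
      where
      bound : ∀ γ s xs → ⟪ foldl (scanStep γ) s xs ⟫ ≤ ⟦ con 1 :+ (δ :+ (var :+ var :* ω)) ⟧ (⟪ xs ⟫ + ⟪ s ⟫ + ⟪ γ ⟫)
      bound γ (s , acc) xs = ≤-trans
        (scan-bound N γ s acc xs (≤-trans (≤-reflexive (+-comm ⟪ γ ⟫ _)) (+-monoˡ-≤ ⟪ γ ⟫ (m≤m+n ⟪ xs ⟫ _))) (⟦ δ ⟧ N)
          (+-mono-≤ (≤-trans (≤-trans (m≤m+n ⟪ s ⟫ ⟪ acc ⟫) (n≤1+n _)) sacc≤)
            (*-monoˡ-≤ _ len≤)))
        (s≤s (+-monoʳ-≤ (⟦ δ ⟧ N) (+-mono-≤ (≤-trans (≤-trans (m≤n+m ⟪ acc ⟫ ⟪ s ⟫) (n≤1+n _)) sacc≤) (*-monoˡ-≤ _ len≤))))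
        where
        N : ℕ
        N = ⟪ xs ⟫ + ⟪ (s , acc) ⟫ + ⟪ γ ⟫
        sacc≤ : ⟪ (s , acc) ⟫ ≤ N
        sacc≤ = ≤-trans (m≤n+m _ ⟪ xs ⟫) (m≤m+n _ ⟪ γ ⟫)
        len≤ : length xs ≤ N
        len≤ = ≤-trans (length≤size xs) (≤-trans (m≤m+n _ ⟪ (s , acc) ⟫) (m≤m+n _ ⟪ γ ⟫))

  scanC : {o : Γ → ℕ → X → List Y} {d : Γ → X → ℕ} {l : Γ → List X} {i : Γ → ℕ} →
    Comp {(Γ × ℕ) × X} (λ p → o (proj₁ (proj₁ p)) (proj₂ (proj₁ p)) (proj₂ p)) →
    Comp {Γ × X} (λ p → d (proj₁ p) (proj₂ p)) → Comp l → Comp i →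
    Comp (λ γ → scan (o γ) (d γ) (i γ) (l γ))
  scanC co cd = ScanC.scanC′ co cd

range : ℕ → ℕ → List ℕ
range s n = scan (λ i _ → [ i ]) (λ _ → 1) s (units n)

module _ {Γ : Set} {{_ : Enc Γ}} where

  rangeC : {f g : Γ → ℕ} → Comp f → Comp g → Comp (λ γ → range (f γ) (g γ))
  rangeC cf cg = scanC {o = λ _ i _ → [ i ]} {d = λ _ _ → 1} (singleC (sfC)) (constC 1) (unitsC cg) cf

-- Finite tables

lookupOr : ∀ {B : Set} → B → List B → ℕ → B
lookupOr d []       n       = d
lookupOr d (b ∷ bs) zero    = b
lookupOr d (b ∷ bs) (suc n) = lookupOr d bs n

module _ {B : Set} {{_ : Enc B}} where

  lookupOrC : ∀ d bs {Γ : Set} {{_ : Enc Γ}} {n : Γ → ℕ} → Comp n → Comp (λ γ → lookupOr {B} d bs (n γ))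
  lookupOrC d bs cn = go bs ∙ cn
    where
    lem : ∀ b bs n → lookupOr d (b ∷ bs) n ≡ natCase n b (lookupOr d bs)
    lem b bs zero    = refl
    lem b bs (suc n) = refl
    go : ∀ bs → Comp (lookupOr d bs)
    go []       = constC d
    go (b ∷ bs) = extC (lem b bs) (caseNatC {g = λ m _ → lookupOr d bs m} idC (constC b) (go bs ∙ fstC))

-- Equality of lists

module _ {X : Set} where

  eqList : (X → X → Bool) → List X → List X → Bool
  eqList eq []       []       = true
  eqList eq []       (y ∷ ys) = false
  eqList eq (x ∷ xs) []       = false
  eqList eq (x ∷ xs) (y ∷ ys) = eq x y ∧ eqList eq xs ys

  null : List X → Bool
  null xs = listCase xs true (λ _ _ → false)

  module _ {{_ : Enc X}} {Γ : Set} {{_ : Enc Γ}} where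

    eqListC : {eq : X → X → Bool} {f g : Γ → List X} → Comp {X × X} (λ p → eq (proj₁ p) (proj₂ p)) →
      Comp f → Comp g → Comp (λ γ → eqList eq (f γ) (g γ))
    eqListC {eq} {f} {g} ceq cf cg = extC (λ γ → sym (run-eq (f γ) true (g γ)))
      (andC fstC (caseListC {g = λ _ _ _ → false} sndC (constC true) (constC false)) ∙
        foldAddC {h = λ _ → eqStep}
          (caseListC {g = λ y ys p → proj₁ (proj₂ (proj₁ p)) ∧ eq (proj₂ p) y , ys}
            (sndC ∙ sfC) (constC (false , []))
            (andC (fsC ∙ fsC) (ceq ∙ (ssC ,C ffC)) ,C sfC))
          cf (constC true ,C cg) (con 5) (λ γ s x → grow s x))
      where
      -- The state is the agreement so far together with the unread rest of the second list. When
      -- that list ends first, the flag becomes `false`, and no later item can turn it back.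
      eqStep : Bool × List X → X → Bool × List X
      eqStep (b , ys) x = listCase ys (false , []) (λ y ys → b ∧ eq x y , ys)
      dead : ∀ xs ys → proj₁ (foldl eqStep (false , ys) xs) ≡ false
      dead []       ys       = refl
      dead (x ∷ xs) []       = dead xs []
      dead (x ∷ xs) (y ∷ ys) = dead xs ys
      run-eq : ∀ xs b ys → proj₁ (foldl eqStep (b , ys) xs) ∧ null (proj₂ (foldl eqStep (b , ys) xs)) ≡ b ∧ eqList eq xs ys
      run-eq []       b []       = refl
      run-eq []       b (y ∷ ys) = refl
      run-eq (x ∷ xs) b []       = trans (cong (_∧ null (proj₂ (foldl eqStep (false , []) xs))) (dead xs [])) (sym (∧-zeroʳ b))
      run-eq (x ∷ xs) b (y ∷ ys) = trans (run-eq xs (b ∧ eq x y) ys) (∧-assoc b _ _)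
      grow : ∀ s x → ⟪ eqStep s x ⟫ ≤ ⟪ s ⟫ + 5
      grow (b , [])     x = ≤-trans (m≤m+n 3 2) (m≤n+m 5 (suc (⟪ b ⟫ + 1)))
      grow (b , y ∷ ys) x = ≤-trans (s≤s (+-monoˡ-≤ ⟪ ys ⟫ (size-bool (b ∧ eq x y))))
        (≤-trans (m≤m+n _ (⟪ b ⟫ + (3 + ⟪ y ⟫))) (≤-reflexive (lem ⟪ b ⟫ ⟪ y ⟫ ⟪ ys ⟫)))
        where
        lem : ∀ b y z → suc (3 + z) + (b + (3 + y)) ≡ suc (b + suc (y + z)) + 5
        lem = solve-∀

eqList-sound : ∀ {X : Set} {eq : X → X → Bool} → (∀ x y → eq x y ≡ true → x ≡ y) →
  ∀ xs ys → eqList eq xs ys ≡ true → xs ≡ ys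
eqList-sound h []       []       e = refl
eqList-sound {eq = eq} h (x ∷ xs) (y ∷ ys) e with eq x y in e₁
... | true = cong₂ _∷_ (h x y e₁) (eqList-sound h xs ys e)

eqList-refl : ∀ {X : Set} {eq : X → X → Bool} → (∀ x → eq x x ≡ true) → ∀ xs → eqList eq xs xs ≡ true
eqList-refl h []       = refl
eqList-refl h (x ∷ xs) rewrite h x = eqList-refl h xs

eqBool : Bool → Bool → Bool
eqBool a b = if a then b else not b

eqBoolC : Comp {Bool × Bool} (λ p → eqBool (proj₁ p) (proj₂ p))
eqBoolC = ifC fstC sndC (notC sndC)

eqBool-sound : ∀ a b → eqBool a b ≡ true → a ≡ b
eqBool-sound true  true  e = refl
eqBool-sound false false e = refl

eqBool-refl : ∀ a → eqBool a a ≡ true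
eqBool-refl true  = refl
eqBool-refl false = refl

eqNat : ℕ → ℕ → Bool
eqNat m n = eqList (λ _ _ → true) (units m) (units n)

eqNatC : Comp {ℕ × ℕ} (λ p → eqNat (proj₁ p) (proj₂ p))
eqNatC = eqListC (constC true) (unitsC fstC) (unitsC sndC)

eqNat-sound : ∀ m n → eqNat m n ≡ true → m ≡ n
eqNat-sound m n e = units-injective m n (eqList-sound (λ _ _ _ → refl) (units m) (units n) e)
  where
  units-injective : ∀ m n → units m ≡ units n → m ≡ n
  units-injective zero    zero    e = refl
  units-injective (suc m) (suc n) e = cong suc (units-injective m n (cong (List.drop 1) e))

eqNat-refl : ∀ n → eqNat n n ≡ true
eqNat-refl n = eqList-refl (λ _ → refl) (units n)

-- Binary numbers

undigits : List Bool → ℕᵇ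
undigits []          = zero
undigits (true ∷ w)  = 2[1+ undigits w ]
undigits (false ∷ w) = 1+[2 undigits w ]

undigits-digits : ∀ x → undigits (digits x) ≡ x
undigits-digits zero     = refl
undigits-digits 2[1+ x ] = cong 2[1+_] (undigits-digits x)
undigits-digits 1+[2 x ] = cong 1+[2_] (undigits-digits x)

digits-undigits : ∀ w → digits (undigits w) ≡ w
digits-undigits []          = refl
digits-undigits (true ∷ w)  = cong (true ∷_) (digits-undigits w)
digits-undigits (false ∷ w) = cong (false ∷_) (digits-undigits w)

enc-digits : ∀ x → enc (digits x) ≡ enc x
enc-digits zero     = refl
enc-digits 2[1+ x ] = cong (node (enc true)) (enc-digits x)
enc-digits 1+[2 x ] = cong (node (enc false)) (enc-digits x)

digitsC : Comp digits
digitsC = coeC digits enc-digits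

undigitsC : Comp undigits
undigitsC = coeC undigits (λ w → trans (sym (enc-digits (undigits w))) (cong enc (digits-undigits w)))

val : List Bool → ℕ
val w = toℕ (undigits w)

lowest : List Bool → ℕ
lowest []          = 0
lowest (true ∷ _)  = 2
lowest (false ∷ _) = 1

rest : List Bool → List Bool
rest = List.drop 1

val-split : ∀ w → val w ≡ lowest w + 2 * val (rest w)
val-split []          = refl
val-split (true ∷ w)  = *-distribˡ-+ 2 1 (val w)
val-split (false ∷ w) = refl

-- With the digits 1 and 2, a column sum `s` from 1 to 6 leaves the digit 1 if it is odd and 2 if it
-- is even, and carries half of the rest, which may be 2. The sum 0 arises only when both numerals
-- and the carry are exhausted, and leaves no digit.
carry : ℕ → ℕ
carry = lookupOr 0 (0 ∷ 0 ∷ 0 ∷ 1 ∷ 1 ∷ 2 ∷ 2 ∷ [])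

emit : ℕ → List Bool
emit = lookupOr [] ([] ∷ [ false ] ∷ [ true ] ∷ [ false ] ∷ [ true ] ∷ [ false ] ∷ [ true ] ∷ [])

-- The first argument is fuel.
adder : List Bool → List Bool → List Bool → ℕ → List Bool
adder []      xs ys c = []
adder (_ ∷ f) xs ys c = emit s ++ adder f (rest xs) (rest ys) (carry s)
  where
  s : ℕ
  s = lowest xs + lowest ys + c

adder-zero : ∀ f → adder f [] [] 0 ≡ []
adder-zero []      = refl
adder-zero (_ ∷ f) = adder-zero f

emit-carry : ∀ s r → 1 ≤ s → s ≤ 6 → val (emit s ++ r) + 2 * carry s ≡ s + 2 * val r
emit-carry 1 r _ _ = +-identityʳ _
emit-carry 2 r _ _ = lem (val r)
  where
  lem : ∀ v → 2 * suc v + 2 * 0 ≡ 2 + 2 * v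
  lem = solve-∀
emit-carry 3 r _ _ = lem (val r)
  where
  lem : ∀ v → suc (2 * v) + 2 * 1 ≡ 3 + 2 * v
  lem = solve-∀
emit-carry 4 r _ _ = lem (val r)
  where
  lem : ∀ v → 2 * suc v + 2 * 1 ≡ 4 + 2 * v
  lem = solve-∀
emit-carry 5 r _ _ = lem (val r)
  where
  lem : ∀ v → suc (2 * v) + 2 * 2 ≡ 5 + 2 * v
  lem = solve-∀
emit-carry 6 r _ _ = lem (val r)
  where
  lem : ∀ v → 2 * suc v + 2 * 2 ≡ 6 + 2 * v
  lem = solve-∀
emit-carry (suc (suc (suc (suc (suc (suc (suc _))))))) r _ (s≤s (s≤s (s≤s (s≤s (s≤s (s≤s ()))))))

carry≤2 : ∀ s → carry s ≤ 2
carry≤2 0 = z≤n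
carry≤2 1 = z≤n
carry≤2 2 = z≤n
carry≤2 3 = s≤s z≤n
carry≤2 4 = s≤s z≤n
carry≤2 5 = ≤-refl
carry≤2 6 = ≤-refl
carry≤2 (suc (suc (suc (suc (suc (suc (suc _))))))) = z≤n

lowest≤2 : ∀ w → lowest w ≤ 2
lowest≤2 []          = z≤n
lowest≤2 (true ∷ _)  = ≤-refl
lowest≤2 (false ∷ _) = s≤s z≤n

length-rest : ∀ {A : Set} (w : List A) {k} → length w ≤ suc k → length (List.drop 1 w) ≤ k
length-rest []      h       = z≤n
length-rest (_ ∷ w) (s≤s h) = h

-- Once both numerals are used up, at most one digit is still due, because a carry of 1 or 2 is
-- itself a digit. This is why fuel one above the longer length suffices.
val-adder : ∀ k f xs ys c → length f ≡ suc k → length xs ≤ k → length ys ≤ k → c ≤ 2 →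
  val (adder f xs ys c) ≡ val xs + val ys + c
val-adder zero    (_ ∷ []) [] [] 0 h hx hy hc = refl
val-adder zero    (_ ∷ []) [] [] 1 h hx hy hc = refl
val-adder zero    (_ ∷ []) [] [] 2 h hx hy hc = refl
val-adder zero    (_ ∷ []) [] [] (suc (suc (suc _))) h hx hy (s≤s (s≤s ()))
val-adder (suc k) (b ∷ f) xs ys c h hx hy hc with lowest xs + lowest ys + c in e
... | zero = trans (trans (cong (λ z → val (adder f z (rest ys) 0)) (proj₁ empty)) (trans (cong (λ z → val (adder f [] z 0)) (proj₁ (proj₂ empty)))
       (cong val (adder-zero f)))) (sym total-zero)
  where
  rest-empty : ∀ w → lowest w ≡ 0 → rest w ≡ [] × w ≡ []
  rest-empty [] _ = refl , refl
  rest-empty (true ∷ _) ()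
  rest-empty (false ∷ _) ()
  x0 : lowest xs + lowest ys ≡ 0
  x0 = m+n≡0⇒m≡0 _ e
  empty : rest xs ≡ [] × rest ys ≡ [] × xs ≡ [] × ys ≡ []
  empty with rest-empty xs (m+n≡0⇒m≡0 _ x0) | rest-empty ys (m+n≡0⇒n≡0 (lowest xs) x0)
  ... | a , b | c , d = a , c , b , d
  total-zero : val xs + val ys + c ≡ 0
  total-zero rewrite proj₁ (proj₂ (proj₂ empty)) | proj₂ (proj₂ (proj₂ empty)) = m+n≡0⇒n≡0 (lowest xs + lowest ys) e
... | suc s = +-cancelʳ-≡ (2 * carry (suc s)) _ _ (trans (emit-carry (suc s) _ (s≤s z≤n) s≤6)
    (trans (cong (λ z → suc s + 2 * z) ih) (trans (cong (_+ 2 * (X + Y + carry (suc s))) (sym e))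
      (trans (lem (lowest xs) (lowest ys) c X Y (carry (suc s))) (cong (_+ 2 * carry (suc s))
        (cong₂ (λ x y → x + y + c) (sym (val-split xs)) (sym (val-split ys))))))))
  where
  X Y : ℕ
  X = val (rest xs)
  Y = val (rest ys)
  ih : val (adder f (rest xs) (rest ys) (carry (suc s))) ≡ X + Y + carry (suc s)
  ih = val-adder k f (rest xs) (rest ys) (carry (suc s)) (suc-injective h) (length-rest xs hx) (length-rest ys hy) (carry≤2 (suc s))
  s≤6 : suc s ≤ 6
  s≤6 = subst (_≤ 6) e (+-mono-≤ (+-mono-≤ (lowest≤2 xs) (lowest≤2 ys)) hc)
  lem : ∀ a b c x y d → a + b + c + 2 * (x + y + d) ≡ a + 2 * x + (b + 2 * y) + c + 2 * d
  lem = solve-∀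

addBits : List Bool → List Bool → List Bool
addBits xs ys = adder (true ∷ xs ++ ys) xs ys 0

val-addBits : ∀ xs ys → val (addBits xs ys) ≡ val xs + val ys
val-addBits xs ys = trans (val-adder (length xs + length ys) (true ∷ xs ++ ys) xs ys 0 (cong suc (length-++ xs)) (m≤m+n _ _) (m≤n+m _ (length xs)) z≤n)
  (+-identityʳ _)

module _ {Γ : Set} {{_ : Enc Γ}} where

  restC : {f : Γ → List Bool} → Comp f → Comp (λ γ → rest (f γ))
  restC {f} cf = extC (λ γ → lem (f γ)) (caseListC {g = λ _ ys _ → ys} cf (constC []) (sfC))
    where
    lem : ∀ w → rest w ≡ listCase w [] (λ _ ys → ys)
    lem []      = refl
    lem (_ ∷ _) = refl

  lowestC : {f : Γ → List Bool} → Comp f → Comp (λ γ → lowest (f γ))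
  lowestC {f} cf = extC (λ γ → lem (f γ)) (caseListC {g = λ y _ _ → if y then 2 else 1} cf (constC 0) (ifC (ffC) (constC 2) (constC 1)))
    where
    lem : ∀ w → lowest w ≡ listCase w 0 (λ y _ → if y then 2 else 1)
    lem []          = refl
    lem (true ∷ _)  = refl
    lem (false ∷ _) = refl

AdderState : Set
AdderState = (List Bool × List Bool) × (ℕ × List Bool)

adderSum : AdderState → ℕ
adderSum ((xs , ys) , (c , _)) = lowest xs + lowest ys + c

adderStep : AdderState → Bool → AdderState
adderStep ((xs , ys) , (c , out)) _ = (rest xs , rest ys) , (carry s , out ++ emit s)
  where
  s : ℕ
  s = lowest xs + lowest ys + c

adder-foldl : ∀ f xs ys c out →
  proj₂ (proj₂ (foldl adderStep ((xs , ys) , (c , out)) f)) ≡ out ++ adder f xs ys c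
adder-foldl []      xs ys c out = sym (++-identityʳ out)
adder-foldl (_ ∷ f) xs ys c out = trans (adder-foldl f (rest xs) (rest ys) (carry (lowest xs + lowest ys + c)) _)
  (++-assoc out _ _)

size-rest : ∀ w → ⟪ rest w ⟫ ≤ ⟪ w ⟫
size-rest []      = ≤-refl
size-rest (b ∷ w) = ≤-trans (m≤n+m _ ⟪ b ⟫) (n≤1+n _)

size-emit : ∀ s → ⟪ emit s ⟫ ≤ 5
size-emit 0 = m≤m+n 1 4
size-emit 1 = m≤m+n 3 2
size-emit 2 = ≤-refl
size-emit 3 = m≤m+n 3 2
size-emit 4 = ≤-refl
size-emit 5 = m≤m+n 3 2
size-emit 6 = ≤-refl
size-emit (suc (suc (suc (suc (suc (suc (suc _))))))) = m≤m+n 1 4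

size-nat : ∀ n → ⟪ n ⟫ ≡ 2 * n + 1
size-nat zero    = refl
size-nat (suc n) = trans (cong (2 +_) (size-nat n)) (lem n)
  where
  lem : ∀ n → 2 + (2 * n + 1) ≡ 2 * suc n + 1
  lem = solve-∀

adderSumC : Comp adderSum
adderSumC = plusC (plusC (lowestC ffC) (lowestC sfC)) fsC

adderStepC : Comp {AdderState × Bool} (λ p → adderStep (proj₁ p) (proj₂ p))
adderStepC = ((restC ffC ,C restC sfC) ,C
  (lookupOrC 0 (0 ∷ 0 ∷ 0 ∷ 1 ∷ 1 ∷ 2 ∷ 2 ∷ []) adderSumC ,C
    appendC ssC (lookupOrC [] ([] ∷ [ false ] ∷ [ true ] ∷ [ false ] ∷ [ true ] ∷ [ false ] ∷ [ true ] ∷ []) adderSumC))) ∙ fstC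

module _ {Γ : Set} {{_ : Enc Γ}} where

  addBitsC : {f g : Γ → List Bool} → Comp f → Comp g → Comp (λ γ → addBits (f γ) (g γ))
  addBitsC {f} {g} cf cg = extC (λ γ → sym (adder-foldl (true ∷ f γ ++ g γ) (f γ) (g γ) 0 []))
    (ssC ∙ foldAddC {h = λ _ → adderStep} (adderStepC ∙ (sfC ,C sndC))
      (consC (constC true) (appendC cf cg)) ((cf ,C cg) ,C (constC 0 ,C constC [])) (con 10) (λ _ → grow))
    where
    grow : ∀ s (x : Bool) → ⟪ adderStep s x ⟫ ≤ ⟪ s ⟫ + 10
    grow ((xs , ys) , (c , out)) x = ≤-trans
      (s≤s (+-mono-≤ (s≤s (+-mono-≤ (size-rest xs) (size-rest ys)))
        (s≤s (+-mono-≤ (≤-trans (≤-reflexive (size-nat (carry t))) (+-monoˡ-≤ 1 (*-monoʳ-≤ 2 (carry≤2 t))))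
          (≤-trans (size-++≤ out (emit t)) (+-monoˡ-≤ ⟪ out ⟫ (size-emit t)))))))
      (≤-trans (m≤m+n _ ⟪ c ⟫) (≤-reflexive (lem ⟪ xs ⟫ ⟪ ys ⟫ ⟪ c ⟫ ⟪ out ⟫)))
      where
      t : ℕ
      t = lowest xs + lowest ys + c
      lem : ∀ x y c o → suc (suc (x + y) + suc (5 + (5 + o))) + c ≡ suc (suc (x + y) + suc (c + o)) + 10
      lem = solve-∀

  addC : {f g : Γ → ℕᵇ} → Comp f → Comp g → Comp (λ γ → f γ ℕᵇ.+ g γ)
  addC {f} {g} cf cg = extC (λ γ → lem (f γ) (g γ)) (undigitsC ∙ addBitsC (digitsC ∙ cf) (digitsC ∙ cg))
    where
    lem : ∀ x y → x ℕᵇ.+ y ≡ undigits (addBits (digits x) (digits y))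
    lem x y = toℕ-injective (trans (toℕ-homo-+ x y) (sym (trans (val-addBits (digits x) (digits y))
      (cong₂ (λ a b → toℕ a + toℕ b) (undigits-digits x) (undigits-digits y)))))

module _ {Γ : Set} {{_ : Enc Γ}} where

  fromℕC : {f : Γ → ℕ} → Comp f → Comp (λ γ → fromℕ (f γ))
  fromℕC {f} cf = extC (λ γ → trans (fromℕ≡fromℕ' (f γ)) (lem (f γ)))
    (foldrC {h = λ _ (_ : ⊤) → ℕᵇ.suc} (extC (λ p → suc≗1+ (proj₂ (proj₁ p))) (addC (constC ℕᵇ.1ᵇ) (sfC)))
      (unitsC cf) (constC ℕᵇ.zero) (con 6) (λ γ s x → grow s))
    where
    lem : ∀ n → ℕᵇ.fromℕ' n ≡ foldr (λ _ → ℕᵇ.suc) ℕᵇ.zero (units n)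
    lem zero    = refl
    lem (suc n) = cong ℕᵇ.suc (lem n)
    grow : ∀ s → ⟪ ℕᵇ.suc s ⟫ ≤ ⟪ s ⟫ + 6
    grow ℕᵇ.zero  = m≤m+n 3 4
    grow 2[1+ x ] = ≤-trans (+-monoʳ-≤ 2 (grow x)) (≤-trans (m≤m+n _ 2) (≤-reflexive (eq ⟪ x ⟫)))
      where
      eq : ∀ x → 2 + (x + 6) + 2 ≡ suc (3 + x) + 6
      eq = solve-∀
    grow 1+[2 x ] = ≤-trans (m≤m+n _ 4) (≤-reflexive (eq ⟪ x ⟫))
      where
      eq : ∀ x → suc (3 + x) + 4 ≡ suc (1 + x) + 6
      eq = solve-∀

encodeBin : ℕᵇ → List Bool
encodeBin x = encodeList [_] (digits x)

encodeBinC : Comp encodeBin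
encodeBinC = encodeListC (singleC idC) digitsC

encodeℕC : Comp encodeℕ
encodeℕC = encodeBinC ∙ fromℕC idC

-- Comparison, least significant digit first: b is the borrow.

leBits : Bool → List Bool → List Bool → Bool
leBits b []       []       = not b
leBits b []       (y ∷ ys) = true
leBits b (x ∷ xs) []       = false
leBits b (x ∷ xs) (y ∷ ys) = leBits (if eqBool x y then b else x) xs ys

bit→ℕ : Bool → ℕ
bit→ℕ true  = 1
bit→ℕ false = 0

half-≤ : ∀ x y → 2 * x ≤ 2 * y + 1 → x ≤ y
half-≤ x y h = ≮⇒≥ λ y<x → <⇒≱ (≤-trans (s≤s (≤-reflexive (+-comm (2 * y) 1))) (≤-trans (≤-reflexive (lem y)) (*-monoʳ-≤ 2 y<x))) h
  where
  lem : ∀ y → 2 + 2 * y ≡ 2 * suc y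
  lem = solve-∀

half-bit : ∀ x y b → 2 * x + bit→ℕ b ≤ 2 * y → x + bit→ℕ b ≤ y
half-bit x y false h = subst (_≤ y) (sym (+-identityʳ x)) (*-cancelˡ-≤ 2 (subst (_≤ 2 * y) (+-identityʳ (2 * x)) h))
half-bit x y true  h = subst (_≤ y) (+-comm 1 x) (half-≤ (suc x) y (subst (_≤ 2 * y + 1) (lem x) (+-monoˡ-≤ 1 h)))
  where
  lem : ∀ x → 2 * x + 1 + 1 ≡ 2 * suc x
  lem = solve-∀

double-bit : ∀ x y b → x + bit→ℕ b ≤ y → 2 * x + bit→ℕ b ≤ 2 * y
double-bit x y b h = ≤-trans (m≤m+n _ (bit→ℕ b)) (≤-trans (≤-reflexive (lem x (bit→ℕ b))) (*-monoʳ-≤ 2 h))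
  where
  lem : ∀ x b → 2 * x + b + b ≡ 2 * (x + b)
  lem = solve-∀

-- Differing digits settle the comparison of all positions read so far. Since `b` is at most 1,
-- after halving the digit 2 against 1 leaves a borrow of 1, and 1 against 2 leaves none, whatever
-- `b` was.
leBits-sound : ∀ b xs ys → leBits b xs ys ≡ true → val xs + bit→ℕ b ≤ val ys
leBits-sound false []       []           e = z≤n
leBits-sound true  []       (true ∷ ys)  e = s≤s z≤n
leBits-sound true  []       (false ∷ ys) e = s≤s z≤n
leBits-sound false []       (y ∷ ys)     e = z≤n
leBits-sound b (true ∷ xs)  (true ∷ ys)  e = ≤-trans (≤-reflexive (lem (val xs) (bit→ℕ b)))
    (≤-trans (+-monoʳ-≤ 2 (double-bit _ _ b (leBits-sound b xs ys e))) (≤-reflexive (sym (*-distribˡ-+ 2 1 (val ys)))))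
  where
  lem : ∀ x b → 2 * suc x + b ≡ 2 + (2 * x + b)
  lem = solve-∀
leBits-sound b (false ∷ xs) (false ∷ ys) e = s≤s (double-bit _ _ b (leBits-sound b xs ys e))
leBits-sound b (true ∷ xs)  (false ∷ ys) e = ≤-trans (+-monoʳ-≤ _ (bit≤1 b)) (≤-trans (≤-reflexive (lem (val xs)))
    (s≤s (*-monoʳ-≤ 2 (leBits-sound true xs ys e))))
  where
  bit≤1 : ∀ b → bit→ℕ b ≤ 1
  bit≤1 true  = ≤-refl
  bit≤1 false = z≤n
  lem : ∀ x → 2 * suc x + 1 ≡ suc (2 * (x + 1))
  lem = solve-∀
leBits-sound b (false ∷ xs) (true ∷ ys)  e = ≤-trans (s≤s (+-monoʳ-≤ (2 * val xs) (bit≤1 b))) (≤-trans (≤-reflexive (lem (val xs)))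
    (*-monoʳ-≤ 2 (s≤s (subst (_≤ val ys) (+-identityʳ (val xs)) (leBits-sound false xs ys e)))))
  where
  bit≤1 : ∀ b → bit→ℕ b ≤ 1
  bit≤1 true  = ≤-refl
  bit≤1 false = z≤n
  lem : ∀ x → suc (2 * x + 1) ≡ 2 * suc x
  lem = solve-∀

leBits-complete : ∀ b xs ys → val xs + bit→ℕ b ≤ val ys → leBits b xs ys ≡ true
leBits-complete false []           []           h = refl
leBits-complete true  []           []           ()
leBits-complete b     []           (y ∷ ys)     h = refl
leBits-complete b     (true ∷ xs)  []           ()
leBits-complete b     (false ∷ xs) []           ()
leBits-complete b     (true ∷ xs)  (true ∷ ys)  h =
  leBits-complete b xs ys (half-bit _ _ b (+-cancelˡ-≤ 2 _ _ (subst₂ _≤_ (lem (val xs) (bit→ℕ b)) (*-distribˡ-+ 2 1 (val ys)) h)))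
  where
  lem : ∀ x b → 2 * suc x + b ≡ 2 + (2 * x + b)
  lem = solve-∀
leBits-complete b     (false ∷ xs) (false ∷ ys) (s≤s h) = leBits-complete b xs ys (half-bit _ _ b h)
leBits-complete b     (true ∷ xs)  (false ∷ ys) h =
  leBits-complete true xs ys (subst (_≤ val ys) (+-comm 1 (val xs)) (half-≤ (suc (val xs)) (val ys)
    (≤-trans (≤-trans (m≤m+n _ (bit→ℕ b)) h) (≤-reflexive (+-comm 1 _)))))
leBits-complete b     (false ∷ xs) (true ∷ ys)  h =
  leBits-complete false xs ys (subst (_≤ val ys) (sym (+-identityʳ _)) (half-≤ (val xs) (val ys)
    (≤-trans (m≤m+n _ (bit→ℕ b)) (s≤s⁻¹ (≤-trans h (≤-reflexive (lem (val ys))))))))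
  where
  open import Data.Nat using (s≤s⁻¹)
  lem : ∀ y → 2 * suc y ≡ suc (2 * y + 1)
  lem = solve-∀

infix 4 _≤ᵇⁿ_

_≤ᵇⁿ_ : ℕᵇ → ℕᵇ → Bool
x ≤ᵇⁿ y = leBits false (digits x) (digits y)

≤ᵇⁿ-sound : ∀ x y → (x ≤ᵇⁿ y) ≡ true → toℕ x ≤ toℕ y
≤ᵇⁿ-sound x y e = subst₂ _≤_ (trans (+-identityʳ _) (cong toℕ (undigits-digits x))) (cong toℕ (undigits-digits y))
  (leBits-sound false (digits x) (digits y) e)

≤ᵇⁿ-complete : ∀ x y → toℕ x ≤ toℕ y → (x ≤ᵇⁿ y) ≡ true
≤ᵇⁿ-complete x y h = leBits-complete false (digits x) (digits y)
  (subst₂ _≤_ (sym (trans (+-identityʳ _) (cong toℕ (undigits-digits x)))) (cong toℕ (sym (undigits-digits y))) h)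

LeState : Set
LeState = List Bool × (Bool × Bool)

leStep : LeState → Bool → LeState
leStep (ys , (b , dead)) x = listCase ys ([] , (b , true)) (λ y ys → ys , ((if eqBool x y then b else x) , dead))

leEnd : LeState → Bool
leEnd (ys , (b , dead)) = if dead then false else listCase ys (not b) (λ _ _ → true)

leStep-leBits : ∀ xs ys b → leEnd (foldl leStep (ys , (b , false)) xs) ≡ leBits b xs ys
leStep-leBits []       []       b = refl
leStep-leBits []       (y ∷ ys) b = refl
leStep-leBits (x ∷ xs) []       b = dead xs
  where
  dead : ∀ xs → leEnd (foldl leStep ([] , (b , true)) xs) ≡ false
  dead []       = refl
  dead (x ∷ xs) = dead xs
leStep-leBits (x ∷ xs) (y ∷ ys) b = leStep-leBits xs ys _

leStepC : Comp {LeState × Bool} (λ p → leStep (proj₁ p) (proj₂ p))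
leStepC = caseListC {g = λ y ys p → ys , ((if eqBool (proj₂ p) y then proj₁ (proj₂ (proj₁ p)) else proj₂ p) , proj₂ (proj₂ (proj₁ p)))}
  ffC (constC [] ,C (fstC ∙ sfC ,C constC true))
  (sfC ,C (ifC (eqBoolC ∙ (ssC ,C ffC)) (fsC ∙ fsC) ssC ,C ssC ∙ fsC))

leEndC : Comp leEnd
leEndC = ifC ssC (constC false) (caseListC {g = λ _ _ _ → true} fstC (notC fsC) (constC true))

module _ {Γ : Set} {{_ : Enc Γ}} where

  leC : {f g : Γ → ℕᵇ} → Comp f → Comp g → Comp (λ γ → f γ ≤ᵇⁿ g γ)
  leC {f} {g} cf cg = extC (λ γ → sym (leStep-leBits (digits (f γ)) (digits (g γ)) false))
    (leEndC ∙ foldAddC {h = λ _ → leStep} (leStepC ∙ (sfC ,C sndC))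
      (digitsC ∙ cf) (digitsC ∙ cg ,C constC (false , false)) (con 8) (λ _ → grow))
    where
    grow : ∀ s (x : Bool) → ⟪ leStep s x ⟫ ≤ ⟪ s ⟫ + 8
    grow ([] , (b , dead)) x = ≤-trans (m≤m+n _ (5 + ⟪ dead ⟫)) (≤-reflexive (lem ⟪ b ⟫ ⟪ dead ⟫))
      where
      lem : ∀ b d → suc (1 + suc (b + 3)) + (5 + d) ≡ suc (1 + suc (b + d)) + 8
      lem = solve-∀
    grow (y ∷ ys , (b , dead)) x = ≤-trans
      (s≤s (+-monoʳ-≤ ⟪ ys ⟫ (s≤s (+-monoˡ-≤ ⟪ dead ⟫ (size-bool (if eqBool x y then b else x))))))
      (≤-trans (m≤m+n _ (⟪ y ⟫ + ⟪ b ⟫ + 6)) (≤-reflexive (lem ⟪ y ⟫ ⟪ ys ⟫ ⟪ b ⟫ ⟪ dead ⟫)))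
      where
      lem : ∀ y z b d → suc (z + suc (3 + d)) + (y + b + 6) ≡ suc (suc (y + z) + suc (b + d)) + 8
      lem = solve-∀

-- Functions on finite types, and Turing machines as computable functions

symbolIndex : ∀ {aux} → Symbol aux → ℕ
symbolIndex blank       = 0
symbolIndex (bit false) = 1
symbolIndex (bit true)  = 2
symbolIndex (other i)   = 3 + Fin.toℕ i

encVec : ∀ {A : Set} {{_ : Enc A}} {n} → Vec A n → D
encVec []       = leaf
encVec (x ∷ xs) = node (enc x) (encVec xs)

instance
  Enc-Fin : ∀ {n} → Enc (Fin n)
  Enc-Fin = record { enc = λ i → enc (Fin.toℕ i) }
  Enc-Symbol : ∀ {aux} → Enc (Symbol aux)
  Enc-Symbol = record { enc = λ s → enc (symbolIndex s) }
  Enc-Vec : ∀ {A : Set} {{_ : Enc A}} {n} → Enc (Vec A n)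
  Enc-Vec = record { enc = encVec }
  Enc-Tape : ∀ {aux} → Enc (Tape aux)
  Enc-Tape = record { enc = λ t → enc (Tape.before t , (Tape.head t , Tape.after t)) }
  Enc-Config : ∀ {M} → Enc (Config M)
  Enc-Config = record { enc = λ c → enc (Config.state c , Config.tapes c) }

module _ {Γ B : Set} {{_ : Enc Γ}} {{_ : Enc B}} where

  -- A finite argument is resolved by a decision tree that strips its unary code one layer at a
  -- time. In this way the transition table of a fixed machine is built into a program.
  finCase : ∀ n {h : Fin n × Γ → B} → (∀ j → Comp (λ γ → h (j , γ))) → Comp h
  finCase zero    cs = record { prog = skip ; time = con 0 ; run = λ { (() , _) } }
  finCase (suc n) {h} cs = record
    { prog = pop #A ⨾ branch #A isTrue (pop #A ⨾ pop #A ⨾ push #A true ⨾ prog later) (pop #A ⨾ prog (cs zero))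
    ; time = con 6 :+ (time later :+ time (cs zero))
    ; run  = λ
      { (zero  , γ) → slack (+-mono-≤ (m≤m+n 3 3) (≤-trans (⟦⟧-mono (time (cs zero)) (m≤n+m _ 2)) (m≤n+m _ _)))
          (seqᵣ (popᵣ refl) (elseᵣ refl (seqᵣ (popᵣ refl) (run (cs zero) γ))))
      ; (suc j , γ) → slack (+-monoʳ-≤ 6 (≤-trans (⟦⟧-mono (time later) (s≤s (+-monoˡ-≤ ⟪ γ ⟫ (m≤n+m _ 2)))) (m≤m+n _ _)))
          (seqᵣ (popᵣ refl) (thenᵣ refl (seqᵣ (popᵣ refl) (seqᵣ (popᵣ refl) (seqᵣ pushᵣ (run later (j , γ))))))) } }
    where
    later : Comp {Fin n × Γ} (λ p → h (suc (proj₁ p) , proj₂ p))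
    later = finCase n (λ j → cs (suc j))

symbol→Fin : ∀ {aux} → Symbol aux → Fin (3 + aux)
symbol→Fin blank       = zero
symbol→Fin (bit false) = suc zero
symbol→Fin (bit true)  = suc (suc zero)
symbol→Fin (other i)   = suc (suc (suc i))

fin→Symbol : ∀ {aux} → Fin (3 + aux) → Symbol aux
fin→Symbol zero                = blank
fin→Symbol (suc zero)          = bit false
fin→Symbol (suc (suc zero))    = bit true
fin→Symbol (suc (suc (suc i))) = other i

symbol-fin : ∀ {aux} (s : Symbol aux) → fin→Symbol (symbol→Fin s) ≡ s
symbol-fin blank       = refl
symbol-fin (bit false) = refl
symbol-fin (bit true)  = refl
symbol-fin (other i)   = refl

symbolIndex-toℕ : ∀ {aux} (s : Symbol aux) → Fin.toℕ (symbol→Fin s) ≡ symbolIndex s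
symbolIndex-toℕ blank       = refl
symbolIndex-toℕ (bit false) = refl
symbolIndex-toℕ (bit true)  = refl
symbolIndex-toℕ (other i)   = refl

module _ {aux : ℕ} {Γ B : Set} {{_ : Enc Γ}} {{_ : Enc B}} where

  symbolCase : {h : Symbol aux × Γ → B} → (∀ s → Comp (λ γ → h (s , γ))) → Comp h
  symbolCase {h} cs = extC (λ { (s , γ) → cong (λ z → h (z , γ)) (sym (symbol-fin s)) })
    (finCase (3 + aux) {λ p → h (fin→Symbol (proj₁ p) , proj₂ p)} (λ j → cs (fin→Symbol j)) ∙
      (coeC symbol→Fin (λ s → cong enc (symbolIndex-toℕ s)) ∙ fstC ,C sndC))

module _ {A : Set} {{_ : Enc A}} where

  unconsC : ∀ {n} → Comp {Vec A (suc n)} (λ v → Vec.head v , Vec.tail v)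
  unconsC = coeC _ (λ { (x ∷ v) → refl })

module _ {aux : ℕ} where

  vecCase : ∀ n {Γ B : Set} {{_ : Enc Γ}} {{_ : Enc B}} {h : Vec (Symbol aux) n × Γ → B} →
    (∀ v → Comp (λ γ → h (v , γ))) → Comp h
  vecCase zero    {h = h} cs = extC (λ { ([] , γ) → refl }) (cs [] ∙ sndC)
  vecCase (suc n) {h = h} cs = extC (λ { (x ∷ v , γ) → refl })
    (symbolCase {h = λ p → h (proj₁ p ∷ proj₁ (proj₂ p) , proj₂ (proj₂ p))}
       (λ s → vecCase n {h = λ p → h (s ∷ proj₁ p , proj₂ p)} (λ v → cs (s ∷ v))) ∙
      (fstC ∙ unconsC ∙ fstC ,C (sndC ∙ unconsC ∙ fstC ,C sndC)))

module _ {aux : ℕ} where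

  private
    beforeC : Comp {Tape aux} Tape.before
    beforeC = fstC ∙ coeC (λ t → Tape.before t , (Tape.head t , Tape.after t)) (λ _ → refl)
    headC : Comp {Tape aux} Tape.head
    headC = fsC ∙ coeC (λ t → Tape.before t , (Tape.head t , Tape.after t)) (λ _ → refl)
    afterC : Comp {Tape aux} Tape.after
    afterC = ssC ∙ coeC (λ t → Tape.before t , (Tape.head t , Tape.after t)) (λ _ → refl)

  tapeC : {Γ : Set} {{_ : Enc Γ}} {l r : Γ → List (Symbol aux)} {h : Γ → Symbol aux} →
    Comp l → Comp h → Comp r → Comp (λ γ → tape (l γ) (h γ) (r γ))
  tapeC cl ch cr = recodeC (λ _ → refl) (cl ,C (ch ,C cr))

  actC : ∀ a → Comp {Tape aux} (λ t → act t a)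
  actC (s , stay)  = extC (λ { (tape _ _ _) → refl }) (tapeC beforeC (constC s) afterC)
  actC (s , left)  = extC lem
    (caseListC {g = λ l ls t → tape ls l (s ∷ Tape.after t)} beforeC (tapeC (constC []) (constC blank) (consC (constC s) afterC))
      (tapeC (sfC) (ffC) (consC (constC s) (afterC ∙ sndC))))
    where
    lem : ∀ t → act t (s , left) ≡ listCase (Tape.before t) (tape [] blank (s ∷ Tape.after t)) (λ l ls → tape ls l (s ∷ Tape.after t))
    lem (tape []      _ _) = refl
    lem (tape (_ ∷ _) _ _) = refl
  actC (s , right) = extC lem
    (caseListC {g = λ r rs t → tape (s ∷ Tape.before t) r rs} afterC (tapeC (consC (constC s) beforeC) (constC blank) (constC []))
      (tapeC (consC (constC s) (beforeC ∙ sndC)) (ffC) (sfC)))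
    where
    lem : ∀ t → act t (s , right) ≡ listCase (Tape.after t) (tape (s ∷ Tape.before t) blank []) (λ r rs → tape (s ∷ Tape.before t) r rs)
    lem (tape _ _ [])      = refl
    lem (tape _ _ (_ ∷ _)) = refl

  actsC : ∀ {n} (as : Vec (Symbol aux × Move) n) → Comp (λ ts → Vec.zipWith act ts as)
  actsC []       = extC (λ { [] → refl }) (constC [])
  actsC (a ∷ as) = extC (λ { (t ∷ ts) → refl }) (recodeC {g = λ ts → act (Vec.head ts) a ∷ Vec.zipWith act (Vec.tail ts) as} (λ _ → refl)
    (actC a ∙ fstC ∙ unconsC ,C actsC as ∙ sndC ∙ unconsC))

  headsC : ∀ n → Comp {Vec (Tape aux) n} (Vec.map Tape.head)
  headsC zero    = extC (λ { [] → refl }) (constC [])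
  headsC (suc n) = extC (λ { (t ∷ ts) → refl }) (recodeC {g = λ ts → Tape.head (Vec.head ts) ∷ Vec.map Tape.head (Vec.tail ts)} (λ _ → refl)
    (headC ∙ fstC ∙ unconsC ,C headsC n ∙ sndC ∙ unconsC))

  size-symbol : ∀ (s : Symbol aux) → ⟪ s ⟫ ≤ 2 * (3 + aux) + 1
  size-symbol s = ≤-trans (≤-reflexive (size-nat (symbolIndex s))) (+-monoˡ-≤ 1 (*-monoʳ-≤ 2
    (subst (_≤ 3 + aux) (symbolIndex-toℕ s) (<⇒≤ (toℕ<n (symbol→Fin s))))))

  size-act : ∀ t (a : Symbol aux × Move) → ⟪ act t a ⟫ ≤ ⟪ t ⟫ + (4 + ⟪ proj₁ a ⟫)
  size-act (tape ls h rs) (s , stay) = ≤-trans (m≤m+n _ (⟪ h ⟫ + 4)) (≤-reflexive (lem ⟪ ls ⟫ ⟪ h ⟫ ⟪ rs ⟫ ⟪ s ⟫))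
    where
    lem : ∀ l h r s → suc (l + suc (s + r)) + (h + 4) ≡ suc (l + suc (h + r)) + (4 + s)
    lem = solve-∀
  size-act (tape [] h rs) (s , left) = ≤-trans (m≤m+n _ (⟪ h ⟫ + 2)) (≤-reflexive (lem ⟪ h ⟫ ⟪ rs ⟫ ⟪ s ⟫))
    where
    lem : ∀ h r s → suc (1 + suc (1 + suc (s + r))) + (h + 2) ≡ suc (1 + suc (h + r)) + (4 + s)
    lem = solve-∀
  size-act (tape (l ∷ ls) h rs) (s , left) = ≤-trans (m≤m+n _ (⟪ h ⟫ + 4)) (≤-reflexive (lem ⟪ l ⟫ ⟪ ls ⟫ ⟪ h ⟫ ⟪ rs ⟫ ⟪ s ⟫))
    where
    lem : ∀ l m h r s → suc (m + suc (l + suc (s + r))) + (h + 4) ≡ suc (suc (l + m) + suc (h + r)) + (4 + s)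
    lem = solve-∀
  size-act (tape ls h []) (s , right) = ≤-trans (m≤m+n _ (⟪ h ⟫ + 2)) (≤-reflexive (lem ⟪ ls ⟫ ⟪ h ⟫ ⟪ s ⟫))
    where
    lem : ∀ l h s → suc (suc (s + l) + suc (1 + 1)) + (h + 2) ≡ suc (l + suc (h + 1)) + (4 + s)
    lem = solve-∀
  size-act (tape ls h (r ∷ rs)) (s , right) = ≤-trans (m≤m+n _ (⟪ h ⟫ + 4)) (≤-reflexive (lem ⟪ ls ⟫ ⟪ h ⟫ ⟪ r ⟫ ⟪ rs ⟫ ⟪ s ⟫))
    where
    lem : ∀ l h r q s → suc (suc (s + l) + suc (r + q)) + (h + 4) ≡ suc (l + suc (h + suc (r + q))) + (4 + s)
    lem = solve-∀

  size-acts : ∀ {n} ts (as : Vec (Symbol aux × Move) n) →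
    ⟪ Vec.zipWith act ts as ⟫ ≤ ⟪ ts ⟫ + n * (4 + (2 * (3 + aux) + 1))
  size-acts []       []       = ≤-refl
  size-acts {suc n} (t ∷ ts) (a ∷ as) = ≤-trans
    (s≤s (+-mono-≤ (≤-trans (size-act t a) (+-monoʳ-≤ ⟪ t ⟫ (+-monoʳ-≤ 4 (size-symbol (proj₁ a))))) (size-acts ts as)))
    (≤-reflexive (lem ⟪ t ⟫ ⟪ ts ⟫ (4 + (2 * (3 + aux) + 1)) (n * (4 + (2 * (3 + aux) + 1)))))
    where
    lem : ∀ t u k m → suc (t + k + (u + m)) ≡ suc (t + u) + (k + m)
    lem = solve-∀

  bitC : Comp {Bool} (bit {aux})
  bitC = extC (λ { true → refl ; false → refl }) (ifC idC (constC (bit true)) (constC (bit false)))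

  inputTapeC : Comp (inputTape {aux})
  inputTapeC = extC (λ { [] → refl ; (_ ∷ _) → refl })
    (caseListC {g = λ b w _ → tape [] (bit b) (List.map bit w)} idC (constC blankTape)
      (tapeC (constC []) (bitC ∙ ffC) (mapC (bitC ∙ sndC) (sfC))))

  bitPrefixStep : Symbol aux → List Bool → List Bool
  bitPrefixStep (bit b) r = b ∷ r
  bitPrefixStep _       r = []

  bitPrefixC : Comp (bitPrefix {aux})
  bitPrefixC = extC lem (foldrC {h = λ _ → bitPrefixStep}
      (symbolCase {h = λ p → bitPrefixStep (proj₁ p) (proj₂ p)} cases ∙ (sndC ,C sfC)) idC (constC []) (con 4) (λ _ → grow))
    where
    lem : ∀ ss → bitPrefix ss ≡ foldr bitPrefixStep [] ss
    lem []            = refl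
    lem (blank ∷ ss)  = refl
    lem (bit b ∷ ss)  = cong (b ∷_) (lem ss)
    lem (other _ ∷ _) = refl
    cases : ∀ s → Comp (bitPrefixStep s)
    cases blank     = constC []
    cases (bit b)   = consC (constC b) idC
    cases (other _) = constC []
    grow : ∀ s x → ⟪ bitPrefixStep x s ⟫ ≤ ⟪ s ⟫ + 4
    grow s blank     = ≤-trans (m≤m+n 1 3) (m≤n+m 4 _)
    grow s (bit b)   = ≤-trans (s≤s (+-monoˡ-≤ ⟪ s ⟫ (size-bool b))) (≤-reflexive (+-comm 4 ⟪ s ⟫))
    grow s (other _) = ≤-trans (m≤m+n 1 3) (m≤n+m 4 _)

  outputOfC : Comp (outputOf {aux})
  outputOfC = extC (λ { (tape _ _ _) → refl }) (bitPrefixC ∙ consC headC afterC)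

-- Clocked simulation of a Turing machine by a computable function

module Interpreter (M : TM) where
  open TM M

  proceed : Fin states → Vec (Tape aux) (suc workTapes) →
    Maybe (Fin states × Vec (Symbol aux × Move) (suc workTapes)) → Config M
  proceed q ts nothing          = config q ts
  proceed q ts (just (q′ , as)) = config q′ (Vec.zipWith act ts as)

  -- Halted configurations are fixed points.
  stepᵗ : Config M → Config M
  stepᵗ (config q ts) = proceed q ts (δ q (Vec.map Tape.head ts))

  stepᵗ-just : ∀ c {c′} → step M c ≡ just c′ → stepᵗ c ≡ c′
  stepᵗ-just (config q ts) e with δ q (Vec.map Tape.head ts)
  stepᵗ-just (config q ts) refl | just _ = refl

  stepᵗ-nothing : ∀ c → step M c ≡ nothing → stepᵗ c ≡ c
  stepᵗ-nothing (config q ts) e with δ q (Vec.map Tape.head ts)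
  ... | nothing = refl

  runᵗ : ℕ → Config M → Config M
  runᵗ zero    c = c
  runᵗ (suc n) c = runᵗ n (stepᵗ c)

  runᵗ-halted : ∀ n c → stepᵗ c ≡ c → runᵗ n c ≡ c
  runᵗ-halted zero    c e = refl
  runᵗ-halted (suc n) c e = trans (cong (runᵗ n) e) (runᵗ-halted n c e)

  runᵗ-halts : ∀ {n c c′} → HaltsAfter M n c c′ → ∀ N → n ≤ N → runᵗ N c ≡ c′
  runᵗ-halts (halted {c} e) N       h       = runᵗ-halted N c (stepᵗ-nothing c e)
  runᵗ-halts (next {c = c} e r) (suc N) (s≤s h) = trans (cong (runᵗ N) (stepᵗ-just c e)) (runᵗ-halts r N h)

  runᵗ-foldl : ∀ n c → runᵗ n c ≡ foldl (λ c (_ : ⊤) → stepᵗ c) c (units n)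
  runᵗ-foldl zero    c = refl
  runᵗ-foldl (suc n) c = runᵗ-foldl n (stepᵗ c)

  private
    stateC : Comp {Config M} Config.state
    stateC = fstC ∙ coeC (λ c → Config.state c , Config.tapes c) (λ _ → refl)
    tapesC : Comp {Config M} Config.tapes
    tapesC = sndC ∙ coeC (λ c → Config.state c , Config.tapes c) (λ _ → refl)

  configC : {Γ : Set} {{_ : Enc Γ}} {q : Γ → Fin states} {ts : Γ → Vec (Tape aux) (suc workTapes)} →
    Comp q → Comp ts → Comp {B = Config M} (λ γ → config (q γ) (ts γ))
  configC cq cts = recodeC (λ _ → refl) (cq ,C cts)

  stepᵗC : Comp stepᵗ
  stepᵗC = finCase states {h = λ p → proceed (proj₁ p) (proj₂ (proj₂ p)) (δ (proj₁ p) (proj₁ (proj₂ p)))}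
      (λ q → vecCase (suc workTapes) {h = λ p → proceed q (proj₂ p) (δ q (proj₁ p))} (λ v → proceedC q (δ q v))) ∙
    (stateC ,C (headsC (suc workTapes) ∙ tapesC ,C tapesC))
    where
    proceedC : ∀ q r → Comp (λ ts → proceed q ts r)
    proceedC q nothing          = configC (constC q) idC
    proceedC q (just (q′ , as)) = configC (constC q′) (actsC as)

  stepGrowth : ℕ
  stepGrowth = suc workTapes * (4 + (2 * (3 + aux) + 1)) + (2 * states + 1)

  -- The growth is a constant of the machine: each tape gains at most one cell, and codes of symbols
  -- and states are bounded. This makes iterated steps an additive fold.
  size-stepᵗ : ∀ c → ⟪ stepᵗ c ⟫ ≤ ⟪ c ⟫ + stepGrowth
  size-stepᵗ (config q ts) with δ q (Vec.map Tape.head ts)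
  ... | nothing        = m≤m+n _ _
  ... | just (q′ , as) = ≤-trans (s≤s (+-mono-≤ (≤-trans (≤-reflexive (size-nat (Fin.toℕ q′)))
           (+-monoˡ-≤ 1 (*-monoʳ-≤ 2 (<⇒≤ (toℕ<n q′))))) (size-acts ts as)))
        (≤-trans (m≤n+m _ ⟪ q ⟫) (≤-reflexive (lem ⟪ q ⟫ ⟪ ts ⟫ (2 * states + 1) (suc workTapes * (4 + (2 * (3 + aux) + 1))))))
    where
    lem : ∀ q t s k → q + suc (s + (t + k)) ≡ suc (q + t) + (k + s)
    lem = solve-∀

  runᵗC : {Γ : Set} {{_ : Enc Γ}} {n : Γ → ℕ} {c : Γ → Config M} → Comp n → Comp c → Comp (λ γ → runᵗ (n γ) (c γ))
  runᵗC {n = n} {c} cn cc = extC (λ γ → runᵗ-foldl (n γ) (c γ))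
    (foldAddC {h = λ _ c (_ : ⊤) → stepᵗ c} (stepᵗC ∙ sfC) (unitsC cn) cc (con stepGrowth) (λ _ c _ → size-stepᵗ c))

  initialC : Comp (initial M)
  initialC = configC (constC start) (recodeC (λ _ → refl) (inputTapeC ,C constC (Vec.replicate workTapes blankTape)))

  outputC : Comp (output M)
  outputC = extC (λ { (config _ (_ ∷ _)) → refl }) (outputOfC ∙ fstC ∙ unconsC ∙ tapesC)

-- The converse of `comp⇒polyTime`. It is needed where an algorithm is given only as a Turing
-- machine, such as a decision procedure or a hypothetical approximation algorithm, and must be
-- composed with other functions.
polyTime⇒comp : {f : List Bool → List Bool} → PolyTime f → Comp f
polyTime⇒comp {f} (M , p , h) = extC lem (outputC ∙ runᵗC (evalC p (lengthC idC)) initialC)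
  where
  open Interpreter M
  lem : ∀ w → f w ≡ output M (runᵗ (eval p (length w)) (initial M w))
  lem w with h w
  ... | n , c , n≤ , r , e = trans (sym e) (cong (output M) (sym (runᵗ-halts r _ n≤)))

-- Windows and values

-- Together with `window⁻` this replaces the integer critical time by an inequality between natural
-- numbers, the form in which windows are handled below.
window⁺ : ∀ j τ → arrival j ≤ τ → τ + processing j ≤ deadline j → InWindow j τ
window⁺ j τ h h′ = h , ℤₚ.≤-trans (ℤ.+≤+ (subst (_≤ deadline j ∸ processing j) (m+n∸n≡m τ (processing j)) (∸-monoˡ-≤ (processing j) h′)))
  (ℤₚ.≤-reflexive (sym (trans (ℤₚ.m-n≡m⊖n (deadline j) (processing j)) (ℤₚ.⊖-≥ (≤-trans (m≤n+m _ τ) h′)))))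

window⁻ : ∀ j τ → InWindow j τ → arrival j ≤ τ × τ + processing j ≤ deadline j
window⁻ j τ (h , h′) = h , ℤₚ.drop‿+≤+ (subst (ℤ.+_ (τ + processing j) ℤ.≤_) eq (ℤₚ.+-monoˡ-≤ (ℤ.+_ (processing j)) h′))
  where
  eq : critical j ℤ.+ ℤ.+_ (processing j) ≡ ℤ.+_ (deadline j)
  eq = trans (ℤₚ.+-assoc (ℤ.+_ (deadline j)) (ℤ.- (ℤ.+_ (processing j))) (ℤ.+_ (processing j)))
    (trans (cong (λ z → ℤ.+_ (deadline j) ℤ.+ z) (ℤₚ.+-inverseˡ (ℤ.+_ (processing j)))) (ℤₚ.+-identityʳ (ℤ.+_ (deadline j))))

sum-bound : ∀ {n} (v : Vec ℕ n) d → (∀ i → lookup v i ≤ d) → Vec.sum v ≤ n * d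
sum-bound []      d h = z≤n
sum-bound (x ∷ v) d h = +-mono-≤ (h zero) (sum-bound v d (h ∘ suc))

max-bound : ∀ {n} (v : Vec ℕ n) d → (∀ i → lookup v i ≤ d) → Vec.foldr′ _⊔_ 0 v ≤ d
max-bound []      d h = z≤n
max-bound (x ∷ v) d h = ⊔-lub (h zero) (max-bound v d (h ∘ suc))

lookup≤sum : ∀ {n} (v : Vec ℕ n) i → lookup v i ≤ Vec.sum v
lookup≤sum (x ∷ v) zero    = m≤m+n _ _
lookup≤sum (x ∷ v) (suc i) = ≤-trans (lookup≤sum v i) (m≤n+m _ _)

lookup≤max : ∀ {n} (v : Vec ℕ n) i → lookup v i ≤ Vec.foldr′ _⊔_ 0 v
lookup≤max (x ∷ v) zero    = m≤m⊔n _ _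
lookup≤max (x ∷ v) (suc i) = ≤-trans (lookup≤max v i) (m≤n⊔m x _)

lookup-perExecuted : ∀ f {n} (I : Instance n) (σ : Schedule n) i →
  lookup (perExecuted f I σ) i ≡ maybe′ (f (lookup I i)) 0 (lookup σ i)
lookup-perExecuted f (j ∷ I) (nothing ∷ σ) zero    = refl
lookup-perExecuted f (j ∷ I) (just s ∷ σ)  zero    = refl
lookup-perExecuted f (j ∷ I) (_ ∷ σ)       (suc i) = lookup-perExecuted f I σ i

module _ {n : ℕ} (I : Instance n) (σ : Schedule n) where

  perExecuted≤ : ∀ f d → (∀ i s → lookup σ i ≡ just s → f (lookup I i) s ≤ d) → ∀ i → lookup (perExecuted f I σ) i ≤ d
  perExecuted≤ f d h i rewrite lookup-perExecuted f I σ i with lookup σ i in e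
  ... | nothing = z≤n
  ... | just s  = h i s e

  perExecuted≡ : ∀ f i s → lookup σ i ≡ just s → f (lookup I i) s ≡ lookup (perExecuted f I σ) i
  perExecuted≡ f i s e = sym (trans (lookup-perExecuted f I σ i) (cong (maybe′ (f (lookup I i)) 0) e))

  -- The reduction sees the objectives only through this upper bound and the lower bound
  -- `executed≤value`, which hold for all three. That is why one construction serves all of them;
  -- the factor `n` is there for the sums.
  value≤ : ∀ obj d → 1 ≤ n → (∀ i s → lookup σ i ≡ just s → s + processing (lookup I i) ≤ d) → value obj I σ ≤ n * d
  value≤ workingTime       d _ h =
    sum-bound (perExecuted (λ j _ → processing j) I σ) d (perExecuted≤ (λ j _ → processing j) d (λ i s e → ≤-trans (m≤n+m _ s) (h i s e)))
  value≤ weightedCompleted d _ h =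
    sum-bound (perExecuted (λ j _ → weight j) I σ) d (perExecuted≤ (λ j _ → weight j) d (λ i s e → ≤-trans (m≤n+m _ s) (h i s e)))
  value≤ makespan          d p h =
    ≤-trans (max-bound (perExecuted (λ j s → s + processing j) I σ) d (perExecuted≤ (λ j s → s + processing j) d h))
      (≤-trans (≤-reflexive (sym (*-identityˡ d))) (*-monoˡ-≤ d p))

  executed≤value : ∀ obj i s → lookup σ i ≡ just s → processing (lookup I i) ≤ value obj I σ
  executed≤value workingTime       i s e =
    ≤-trans (≤-reflexive (perExecuted≡ (λ j _ → processing j) i s e)) (lookup≤sum (perExecuted (λ j _ → processing j) I σ) i)
  executed≤value weightedCompleted i s e =
    ≤-trans (≤-reflexive (perExecuted≡ (λ j _ → weight j) i s e)) (lookup≤sum (perExecuted (λ j _ → weight j) I σ) i)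
  executed≤value makespan          i s e =
    ≤-trans (m≤n+m _ s) (≤-trans (≤-reflexive (perExecuted≡ (λ j s → s + processing j) i s e)) (lookup≤max (perExecuted (λ j s → s + processing j) I σ) i))

-- Walks with labels used at most once

-- (source , (label , target)); label 0 means that the edge is unlabelled.
Edge : Set
Edge = ℕ × (ℕ × ℕ)

src lab dst : Edge → ℕ
src e = proj₁ e
lab e = proj₁ (proj₂ e)
dst e = proj₂ (proj₂ e)

data Walk (E : List Edge) (v : ℕ) : ℕ → List Edge → Set where
  stop : Walk E v v []
  _∷_  : ∀ {e es} → e ∈ E → Walk E v (dst e) es → Walk E v (src e) (e ∷ es)

labels : List Edge → List ℕ
labels []                       = []
labels ((_ , (zero  , _)) ∷ es) = labels es
labels ((_ , (suc ℓ , _)) ∷ es) = ℓ ∷ labels es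

quotient-≮ : ∀ r x y {j k} → j < r → r * x + j ≡ r * y + k → ¬ x < y
quotient-≮ r x y {j} {k} j<r e x<y = <⇒≱ (<-≤-trans (+-monoʳ-< (r * x) j<r)
  (≤-trans (≤-reflexive (trans (+-comm _ r) (sym (*-suc r x)))) (*-monoʳ-≤ r x<y))) (≤-trans (m≤m+n _ k) (≤-reflexive (sym e)))

remainder-unique : ∀ r x y {j k} → j < r → k < r → r * x + j ≡ r * y + k → x ≡ y × j ≡ k
remainder-unique r x y {j} {k} j<r k<r e with <-cmp x y
... | tri≈ _ refl _ = refl , +-cancelˡ-≡ (r * x) j k e
... | tri< x<y _ _  = ⊥-elim (quotient-≮ r x y j<r e x<y)
... | tri> _ _ y<x  = ⊥-elim (quotient-≮ r y x k<r (sym e) y<x)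

data Tag : Set where
  big  : Tag
  wide : ℕ → Tag
  edge : Edge → Tag

_≟ᵗ_ : (s t : Tag) → Dec (s ≡ t)
big    ≟ᵗ big    = yes refl
big    ≟ᵗ wide _ = no λ ()
big    ≟ᵗ edge _ = no λ ()
wide _ ≟ᵗ big    = no λ ()
wide k ≟ᵗ wide l with k ≟ l
... | yes refl = yes refl
... | no k≢l   = no λ { refl → k≢l refl }
wide _ ≟ᵗ edge _ = no λ ()
edge _ ≟ᵗ big    = no λ ()
edge _ ≟ᵗ wide _ = no λ ()
edge d ≟ᵗ edge e with ≡-dec _≟_ (≡-dec _≟_ _≟_) d e
... | yes refl = yes refl
... | no d≢e   = no λ { refl → d≢e refl }

module Scale (V L : ℕ) where

  opaque
    -- Fewer than `2 * V` jobs of length at least `halfUnit` end before time `V * unit`, so a count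
    -- of wide jobs stays below `modulus`. The factor `suc L` leaves room below `halfUnit` for a
    -- separate multiple of `modulus` for each of the `L` labels.
    modulus halfUnit unit : ℕ
    modulus  = 2 * V + 2
    halfUnit = modulus * suc L
    unit     = 2 * halfUnit

    modulus-def : modulus ≡ 2 * V + 2
    modulus-def = refl

    halfUnit-def : halfUnit ≡ modulus * suc L
    halfUnit-def = refl

    unit-def : unit ≡ 2 * halfUnit
    unit-def = refl

  horizon : ℕ
  horizon = V * unit

  -- The three summands have separate tasks: `halfUnit` keeps the number of wide jobs small, the 1
  -- is what the residue counts, and the multiple of `modulus` tells the labels apart.
  wideLength : ℕ → ℕ
  wideLength ℓ = halfUnit + suc (modulus * ℓ)

  offset : ℕ → ℕ
  offset zero    = 0
  offset (suc ℓ) = wideLength ℓ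

  halfUnit≤wideLength : ∀ ℓ → halfUnit ≤ wideLength ℓ
  halfUnit≤wideLength ℓ = m≤m+n halfUnit _

  opaque
    unfolding modulus

    2≤modulus : 2 ≤ modulus
    2≤modulus = m≤n+m 2 (2 * V)

    wideLength<unit : ∀ {ℓ} → ℓ < L → wideLength ℓ < unit
    wideLength<unit {ℓ} h = ≤-trans (≤-reflexive (lem halfUnit (modulus * ℓ))) (+-monoʳ-≤ halfUnit
      (≤-trans (+-monoˡ-≤ (modulus * ℓ) 2≤modulus) (≤-trans (≤-reflexive (sym (*-suc modulus ℓ)))
        (≤-trans (*-monoʳ-≤ modulus (≤-trans h (n≤1+n L))) (m≤m+n halfUnit 0)))))
      where
      lem : ∀ h r → suc (h + suc r) ≡ h + (2 + r)
      lem = solve-∀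

    0<unit : 0 < unit
    0<unit = ≤-trans (s≤s z≤n) (*-monoʳ-≤ 2 (≤-trans (≤-trans (s≤s z≤n) 2≤modulus) (m≤m*n modulus (suc L))))

    node-mod : ∀ u → u * unit ≡ modulus * (2 * suc L * u)
    node-mod u = lem modulus (suc L) u
      where
      lem : ∀ m l u → u * (2 * (m * l)) ≡ m * (2 * l * u)
      lem = solve-∀

    node+wide-mod : ∀ u ℓ → u * unit + wideLength ℓ ≡ modulus * (2 * suc L * u + suc L + ℓ) + 1
    node+wide-mod u ℓ = lem modulus (suc L) u ℓ
      where
      lem : ∀ m l u k → u * (2 * (m * l)) + (m * l + suc (m * k)) ≡ m * (2 * l * u + l + k) + 1
      lem = solve-∀

    +wide-mod : ∀ x k ℓ → modulus * x + k + wideLength ℓ ≡ modulus * (x + suc L + ℓ) + suc k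
    +wide-mod x k ℓ = lem modulus (suc L) x k ℓ
      where
      lem : ∀ m l x k n → m * x + k + (m * l + suc (m * n)) ≡ m * (x + l + n) + suc k
      lem = solve-∀

    few-wide : ∀ {k p} → k * halfUnit ≤ p → p < horizon → k < modulus
    few-wide {k} kH h = <-≤-trans (*-cancelʳ-< halfUnit k (2 * V) (≤-<-trans kH (<-≤-trans h (≤-reflexive (lem V halfUnit))))) (m≤m+n (2 * V) 2)
      where
      lem : ∀ v h → v * (2 * h) ≡ 2 * v * h
      lem = solve-∀

  node-injective : ∀ {u v} → u * unit ≡ v * unit → u ≡ v
  node-injective {u} {v} e = *-cancelʳ-≡ u v unit {{>-nonZero 0<unit}} e

  node+wide-injective : ∀ {u v k ℓ} → k < L → ℓ < L → u * unit + wideLength k ≡ v * unit + wideLength ℓ → u ≡ v × k ≡ ℓ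
  node+wide-injective {u} {v} {k} {ℓ} hk hℓ e with remainder-unique unit u v (wideLength<unit hk) (wideLength<unit hℓ)
    (trans (cong (_+ wideLength k) (*-comm unit u)) (trans e (cong (_+ wideLength ℓ) (*-comm v unit))))
  ... | u≡v , w≡ = u≡v , *-cancelˡ-≡ k ℓ modulus {{>-nonZero (≤-trans (s≤s z≤n) 2≤modulus)}} (suc-injective (+-cancelˡ-≡ halfUnit _ _ w≡))

-- Node u sits at time u * unit.  A wide job may start at any node, but from the
-- middle of an edge only the edge job for that node and that label continues.
module Gadget (V L huge : ℕ) where

  open Scale V L

  -- A labelled edge is traversed by the wide job of its label, started at the source, and then by
  -- the edge job, which fills the remaining time up to the target. Without a label the edge job
  -- fills the whole edge.
  startOf : Edge → ℕ
  startOf e = src e * unit + offset (lab e)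

  jobOf : Tag → Job
  -- The critical time is `horizon ∸ 1`, the last moment before the walk is over.
  jobOf big      = record { processing = huge ; arrival = 0 ; deadline = (horizon ∸ 1) + huge }
  -- The critical time is that of node `V ∸ 1`, the last one that an edge can leave.
  jobOf (wide ℓ) = record { processing = wideLength ℓ ; arrival = 0 ; deadline = (V ∸ 1) * unit + wideLength ℓ }
  jobOf (edge e) = record { processing = dst e * unit ∸ startOf e ; arrival = startOf e ; deadline = dst e * unit }

  module _ {E : List Edge} (E-ok : ∀ {e} → e ∈ E → src e < dst e × dst e ≤ V × lab e ≤ L) (1≤V : 1 ≤ V) (horizon<huge : horizon < huge)
    {n : ℕ} (tags : Vec Tag n) (bigIx : Fin n) (bigIx-big : lookup tags bigIx ≡ big)
    (tags-ok : ∀ i → lookup tags i ≡ big ⊎ (∃[ ℓ ] ℓ < L × lookup tags i ≡ wide ℓ) ⊎ (∃[ e ] e ∈ E × lookup tags i ≡ edge e))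
    (tags-injective : ∀ i j → lookup tags i ≡ lookup tags j → i ≡ j)
    (wide∈tags : ∀ {ℓ} → ℓ < L → ∃[ i ] lookup tags i ≡ wide ℓ)
    (edge∈tags : ∀ {e} → e ∈ E → ∃[ i ] lookup tags i ≡ edge e)
    where

    I : Instance n
    I = Vec.map jobOf tags

    job-tag : ∀ i {t} → lookup tags i ≡ t → lookup I i ≡ jobOf t
    job-tag i e = trans (lookup-map i jobOf tags) (cong jobOf e)

    1≤horizon : 1 ≤ horizon
    1≤horizon = *-mono-≤ 1≤V 0<unit

    last+unit : (V ∸ 1) * unit + unit ≡ horizon
    last+unit = trans (+-comm _ unit) (cong (_* unit) (m+[n∸m]≡n 1≤V))

    last<horizon : (V ∸ 1) * unit < horizon
    last<horizon = subst (suc ((V ∸ 1) * unit) ≤_) last+unit (≤-trans (≤-reflexive (+-comm 1 _)) (+-monoʳ-≤ _ 0<unit))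

    node≤last : ∀ {u} → u < V → u * unit ≤ (V ∸ 1) * unit
    node≤last {u} (s≤s h) = *-monoˡ-≤ unit h

    start<end : ∀ {e} → e ∈ E → startOf e < dst e * unit
    start<end {u , (l , v)} h = ≤-trans (+-monoʳ-< (u * unit) (off l (proj₂ (proj₂ (E-ok h)))))
      (≤-trans (≤-reflexive (+-comm (u * unit) unit)) (*-monoˡ-≤ unit (proj₁ (E-ok h))))
      where
      off : ∀ l → l ≤ L → offset l < unit
      off zero    _ = 0<unit
      off (suc l) h = wideLength<unit h

    start+processing : ∀ {e} → e ∈ E → startOf e + processing (jobOf (edge e)) ≡ dst e * unit
    start+processing h = m+[n∸m]≡n (<⇒≤ (start<end h))

    -- From the horizon on no job can be executable, so being busy up to it is all that the busy
    -- requirement asks for.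
    critical<horizon : ∀ i τ → InWindow (lookup I i) τ → τ < horizon
    critical<horizon i τ w with tags-ok i
    ... | inj₁ e rewrite job-tag i e = ≤-trans (s≤s (+-cancelʳ-≤ huge _ _ (proj₂ (window⁻ _ τ w)))) (≤-reflexive (m+[n∸m]≡n 1≤horizon))
    ... | inj₂ (inj₁ (ℓ , _ , e)) rewrite job-tag i e = ≤-<-trans (+-cancelʳ-≤ (wideLength ℓ) _ _ (proj₂ (window⁻ _ τ w))) last<horizon
    ... | inj₂ (inj₂ (e , e∈ , eq)) rewrite job-tag i eq =
      <-≤-trans (+-cancelʳ-< (processing (jobOf (edge e))) _ _ (≤-<-trans (proj₂ (window⁻ _ τ w))
        (≤-<-trans (≤-reflexive (sym (+-identityʳ _))) (+-monoʳ-< (dst e * unit) (m<n⇒0<n∸m (start<end e∈))))))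
        (*-monoˡ-≤ unit (proj₁ (proj₂ (E-ok e∈))))

    -- From a schedule without the huge job to a walk

    module Extract (σ : Schedule n) (F : Feasible I σ) (lazy : lookup σ bigIx ≡ nothing) where
      open Feasible F

      len : Fin n → ℕ
      len i = processing (lookup I i)

      Boundary : ℕ → Set
      Boundary p = ∀ i s → lookup σ i ≡ just s → s < p → s + len i ≤ p

      processed? : ∀ τ i → Dec (ProcessedAt I σ i τ)
      processed? τ i with lookup σ i in e
      ... | nothing = no λ { (_ , () , _) }
      ... | just s with s ≤? τ | τ <? s + len i
      ...   | yes a | yes b = yes (s , refl , a , b)
      ...   | no a  | _     = no λ { (_ , refl , h , _) → a h }
      ...   | _     | no b  = no λ { (_ , refl , _ , h) → b h }

      -- The huge job is never started and hence executable at every time before the horizon; an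
      -- idle moment would violate the busy requirement.
      covered : ∀ τ → τ < horizon → ∃[ i ] ProcessedAt I σ i τ
      covered τ h with any? (processed? τ)
      ... | yes p = p
      ... | no ¬p = ⊥-elim (busy τ (λ i q → ¬p (i , q)) bigIx
        ( (λ { (s , e , _) → case-nothing (trans (sym lazy) e) })
        , subst (λ j → InWindow j τ) (sym (job-tag bigIx bigIx-big)) (window⁺ _ τ z≤n (+-monoˡ-≤ huge (∸-monoˡ-≤ 1 h)))))
        where
        case-nothing : ∀ {s : ℕ} → nothing ≡ just s → ⊥
        case-nothing ()

      starting : ∀ p → p < horizon → Boundary p → ∃[ i ] lookup σ i ≡ just p
      starting p h b with covered p h
      ... | i , s , e , s≤p , p< with m≤n⇒m<n∨m≡n s≤p
      ...   | inj₁ s<p  = ⊥-elim (<⇒≱ p< (b i s e s<p))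
      ...   | inj₂ refl = i , e

      -- A job started earlier and still running at the end of job `i` would share the last time
      -- unit of `i`, the moment `p + len i ∸ 1`.
      boundary-next : ∀ i p → lookup σ i ≡ just p → 0 < len i → Boundary (p + len i)
      boundary-next i p e 0<len j s e′ s< with s + len j ≤? p + len i
      ... | yes h = h
      ... | no ¬h = ⊥-elim (¬h (lem (disjoint i j τ (p , e , p≤τ , τ<₁) (s , e′ , s≤τ , τ<₂))))
        where
        τ : ℕ
        τ = p + len i ∸ 1
        sucτ : suc τ ≡ p + len i
        sucτ = m+[n∸m]≡n (≤-trans 0<len (m≤n+m _ p))
        s≤τ : s ≤ τ
        s≤τ = ∸-monoˡ-≤ 1 s<
        p≤τ : p ≤ τ
        p≤τ = ∸-monoˡ-≤ 1 (≤-trans (≤-reflexive (+-comm 1 p)) (+-monoʳ-≤ p 0<len))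
        τ<₁ : τ < p + len i
        τ<₁ = ≤-reflexive sucτ
        τ<₂ : τ < s + len j
        τ<₂ = ≤-trans (≤-reflexive sucτ) (<⇒≤ (≰⇒> ¬h))
        lem : i ≡ j → s + len j ≤ p + len i
        lem refl = ≤-reflexive (cong (_+ len i) (just-injective (trans (sym e′) e)))

      data Started (p : ℕ) : Set where
        wideₛ : ∀ {ℓ} → ℓ < L → p ≤ (V ∸ 1) * unit → (∃[ i ] lookup tags i ≡ wide ℓ × lookup σ i ≡ just p) →
                Boundary (p + wideLength ℓ) → Started p
        edgeₛ : ∀ {e} → e ∈ E → startOf e ≡ p → Boundary (dst e * unit) → Started p

      started : ∀ p → p < horizon → Boundary p → Started p
      started p h b with starting p h b
      ... | i , e with tags-ok i
      ...   | inj₁ t = ⊥-elim (absurd (tags-injective i bigIx (trans t (sym bigIx-big))))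
        where
        absurd : i ≡ bigIx → ⊥
        absurd refl with trans (sym lazy) e
        ... | ()
      ...   | inj₂ (inj₁ (ℓ , ℓ<L , t)) = wideₛ ℓ<L
              (+-cancelʳ-≤ (wideLength ℓ) _ _ (proj₂ (window⁻ (jobOf (wide ℓ)) p (subst (λ j → InWindow j p) (job-tag i t) (inWindow i p e)))))
              (i , t , e)
              (subst (λ l → Boundary (p + l)) (cong processing (job-tag i t))
                (boundary-next i p e (subst (λ j → 0 < processing j) (sym (job-tag i t)) (≤-trans (s≤s z≤n) (m≤n+m _ halfUnit)))))
      ...   | inj₂ (inj₂ (d , d∈ , t)) = edgeₛ d∈ start≡
              (subst Boundary (trans (cong₂ (λ q j → q + processing j) (sym start≡) (job-tag i t)) (start+processing d∈))
                (boundary-next i p e (subst (λ j → 0 < processing j) (sym (job-tag i t)) (m<n⇒0<n∸m (start<end d∈)))))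
        where
        w : startOf d ≤ p × p + processing (jobOf (edge d)) ≤ dst d * unit
        w = window⁻ (jobOf (edge d)) p (subst (λ j → InWindow j p) (job-tag i t) (inWindow i p e))
        start≡ : startOf d ≡ p
        start≡ = ≤-antisym (proj₁ w) (+-cancelʳ-≤ (processing (jobOf (edge d))) _ _
          (≤-trans (proj₂ w) (≤-reflexive (sym (start+processing d∈)))))

      1<modulus : 1 < modulus
      1<modulus = 2≤modulus

      -- After two wide jobs in a row no edge job fits any more.
      lost : ∀ fuel p x k → p ≡ modulus * x + k → 2 ≤ k → k * halfUnit ≤ p → Boundary p → p < horizon → horizon ≤ p + fuel → ⊥
      lost zero p x k e 2≤k kH b h f = <⇒≱ h (≤-trans f (≤-reflexive (+-identityʳ p)))
      lost (suc fuel) p x k e 2≤k kH b h f with started p h b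
      -- A wide job starts no later than the last node and so ends before the horizon. Time
      -- advances, yet always another job has to follow, until the fuel is used up.
      ... | wideₛ {ℓ} ℓ<L p≤ _ b′ = lost fuel (p + wideLength ℓ) (x + suc L + ℓ) (suc k)
              (trans (cong (_+ wideLength ℓ) e) (+wide-mod x k ℓ)) (≤-trans 2≤k (n≤1+n k))
              (≤-trans (≤-reflexive (+-comm halfUnit _)) (+-mono-≤ kH (halfUnit≤wideLength ℓ))) b′
              (≤-<-trans (+-monoˡ-≤ (wideLength ℓ) p≤) (<-≤-trans (+-monoʳ-< ((V ∸ 1) * unit) (wideLength<unit ℓ<L)) (≤-reflexive last+unit)))
              (≤-trans f (≤-trans (≤-reflexive (+-suc p fuel)) (+-monoˡ-≤ fuel (≤-trans (≤-reflexive (+-comm 1 p)) (+-monoʳ-≤ p (≤-trans (s≤s z≤n) (m≤n+m _ halfUnit)))))))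
      -- An edge job starts at residue 0 or 1, whereas the residue of `p` is `k`, which has not
      -- wrapped around.
      ... | edgeₛ {u , (l , v)} _ s≡ _ = <⇒≱ 2≤k (contra l s≡)
        where
        k<modulus : k < modulus
        k<modulus = few-wide {k} kH h
        contra : ∀ l → u * unit + offset l ≡ p → k ≤ 1
        contra zero    s = ≤-trans (≤-reflexive (sym (proj₂ (remainder-unique modulus (2 * suc L * u) x (≤-trans (s≤s z≤n) 1<modulus) k<modulus
          (trans (cong (_+ 0) (sym (node-mod u))) (trans s e)))))) z≤n
        contra (suc l) s = ≤-reflexive (sym (proj₂ (remainder-unique modulus (2 * suc L * u + suc L + l) x 1<modulus k<modulus
          (trans (sym (node+wide-mod u l)) (trans s e)))))

      WideStarts : ℕ → ℕ → Set
      WideStarts ℓ s = ∃[ i ] lookup tags i ≡ wide ℓ × lookup σ i ≡ just s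

      wideStarts-unique : ∀ {ℓ s t} → WideStarts ℓ s → WideStarts ℓ t → s ≡ t
      wideStarts-unique (i , ti , ei) (j , tj , ej) with tags-injective i j (trans ti (sym tj))
      ... | refl = just-injective (trans (sym ei) ej)

      -- The last component records that the wide jobs of the remaining walk start at `u` or later.
      -- It is what turns the single start of a job into the uniqueness of its label.
      follow : ∀ fuel u → u ≤ V → V ≤ u + fuel → Boundary (u * unit) →
        ∃[ es ] Walk E V u es × Unique (labels es) × All (λ ℓ → ∃[ s ] u * unit ≤ s × WideStarts ℓ s) (labels es)
      follow fuel u u≤V f b with m≤n⇒m<n∨m≡n u≤V
      ... | inj₂ refl = [] , stop , [] , []
      follow zero u u≤V f b | inj₁ u<V = ⊥-elim (<⇒≱ u<V (≤-trans f (≤-reflexive (+-identityʳ u))))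
      follow (suc fuel) u u≤V f b | inj₁ u<V with started (u * unit) (*-monoˡ-< unit {{>-nonZero 0<unit}} u<V) b
      -- At a node the residue is 0, but the job of a labelled edge starts at residue 1.
      ... | edgeₛ {w , (suc l , v)} _ s≡ _ = ⊥-elim (0≢1+n (proj₂ (remainder-unique modulus (2 * suc L * u) (2 * suc L * w + suc L + l) (≤-trans (s≤s z≤n) 1<modulus) 1<modulus
              (trans (+-identityʳ _) (trans (sym (node-mod u)) (trans (sym s≡) (node+wide-mod w l)))))))
      ... | edgeₛ {w , (zero , v)} e∈ s≡ b′ with node-injective {w} {u} (trans (sym (+-identityʳ _)) s≡) | E-ok e∈
      ...   | refl | w<v , v≤V , _ with follow fuel v v≤V (≤-trans f (≤-trans (≤-reflexive (+-suc w fuel)) (+-monoˡ-≤ fuel w<v))) b′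
      ...     | es , walk , uniq , all = (w , (0 , v)) ∷ es , e∈ ∷ walk , uniq ,
                All.map (λ { (s , h , ws) → s , ≤-trans (*-monoˡ-≤ unit (<⇒≤ w<v)) h , ws }) all
      follow (suc fuel) u u≤V f b | inj₁ u<V | wideₛ {k} k<L p≤ ws b₁ with started (u * unit + wideLength k)
              (≤-<-trans (+-monoˡ-≤ (wideLength k) p≤) (<-≤-trans (+-monoʳ-< ((V ∸ 1) * unit) (wideLength<unit k<L)) (≤-reflexive last+unit))) b₁
      ... | wideₛ {ℓ} ℓ<L p₁≤ _ b₂ = ⊥-elim (lost horizon _ (2 * suc L * u + suc L + k + suc L + ℓ) 2
              (trans (cong (_+ wideLength ℓ) (node+wide-mod u k)) (+wide-mod (2 * suc L * u + suc L + k) 1 ℓ)) ≤-refl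
              (≤-trans (≤-reflexive (cong (halfUnit +_) (+-identityʳ halfUnit)))
                (+-mono-≤ (≤-trans (halfUnit≤wideLength k) (m≤n+m _ (u * unit))) (halfUnit≤wideLength ℓ))) b₂
              (≤-<-trans (+-monoˡ-≤ (wideLength ℓ) p₁≤) (<-≤-trans (+-monoʳ-< ((V ∸ 1) * unit) (wideLength<unit ℓ<L)) (≤-reflexive last+unit)))
              (m≤n+m horizon _))
      ... | edgeₛ {w , (zero , v)} _ s≡ _ = ⊥-elim (0≢1+n (proj₂ (remainder-unique modulus (2 * suc L * w) (2 * suc L * u + suc L + k) (≤-trans (s≤s z≤n) 1<modulus) 1<modulus
              (trans (cong (_+ 0) (sym (node-mod w))) (trans s≡ (node+wide-mod u k))))))
      -- The starting time determines source and label, because wide jobs with different labels have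
      -- different lengths, all below `unit`.
      ... | edgeₛ {w , (suc l , v)} e∈ s≡ b′ with E-ok e∈
      ...   | w<v , v≤V , l≤L with node+wide-injective {w} {u} l≤L k<L s≡
      ...     | refl , refl with follow fuel v v≤V (≤-trans f (≤-trans (≤-reflexive (+-suc w fuel)) (+-monoˡ-≤ fuel w<v))) b′
      ...       | es , walk , uniq , all = (w , (suc l , v)) ∷ es , e∈ ∷ walk ,
                  -- A repetition of this label would make its wide job start both at the present
                  -- node and at a later one.
                  All.map (λ { (s , h , ws′) refl → <⇒≢ (<-≤-trans (*-monoˡ-< unit {{>-nonZero 0<unit}} w<v) h) (wideStarts-unique ws ws′) }) all ∷ uniq ,
                  (w * unit , ≤-refl , ws) ∷ All.map (λ { (s , h , ws′) → s , ≤-trans (*-monoˡ-≤ unit (<⇒≤ w<v)) h , ws′ }) all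

      extract : ∃[ es ] Walk E V 0 es × Unique (labels es)
      extract with follow V 0 z≤n ≤-refl (λ _ _ _ ())
      ... | es , walk , uniq , _ = es , walk , uniq

    -- From a walk to a schedule without the huge job

    path : List Edge → List (Tag × ℕ)
    path []                         = []
    path (e@(u , (zero  , _)) ∷ es) = (edge e , startOf e) ∷ path es
    path (e@(u , (suc ℓ , _)) ∷ es) = (wide ℓ , u * unit) ∷ (edge e , startOf e) ∷ path es

    lengthᵗ : Tag → ℕ
    lengthᵗ t = processing (jobOf t)

    data Tiling : ℕ → List (Tag × ℕ) → ℕ → Set where
      []   : ∀ {a} → Tiling a [] a
      tile : ∀ {t s ps b} → Tiling (s + lengthᵗ t) ps b → Tiling s ((t , s) ∷ ps) b

    from≡ : ∀ {a a′ ps b} → a ≡ a′ → Tiling a ps b → Tiling a′ ps b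
    from≡ refl T = T

    tiling : ∀ {u es} → Walk E V u es → Tiling (u * unit) (path es) horizon
    tiling stop = []
    tiling (_∷_ {u , (zero , v)} e∈ walk) =
      from≡ (+-identityʳ (u * unit)) (tile (from≡ (sym (start+processing e∈)) (tiling walk)))
    tiling (_∷_ {u , (suc ℓ , v)} e∈ walk) = tile (tile (from≡ (sym (start+processing e∈)) (tiling walk)))

    tiling-≥ : ∀ {a ps b t s} → Tiling a ps b → (t , s) ∈ ps → a ≤ s
    tiling-≥ (tile _) (here refl) = ≤-refl
    tiling-≥ (tile T) (there h)   = ≤-trans (m≤m+n _ _) (tiling-≥ T h)

    tiling-cover : ∀ {a ps b τ} → Tiling a ps b → a ≤ τ → τ < b → ∃[ t ] ∃[ s ] (t , s) ∈ ps × s ≤ τ × τ < s + lengthᵗ t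
    tiling-cover []       a≤τ τ<b = ⊥-elim (<⇒≱ τ<b a≤τ)
    tiling-cover {τ = τ} (tile {t} {s} T) a≤τ τ<b with τ <? s + lengthᵗ t
    ... | yes h = t , s , here refl , a≤τ , h
    ... | no ¬h with tiling-cover T (≮⇒≥ ¬h) τ<b
    ...   | t′ , s′ , p , q = t′ , s′ , there p , q

    tiling-disjoint : ∀ {a ps b τ t s t′ s′} → Tiling a ps b → (t , s) ∈ ps → (t′ , s′) ∈ ps →
      s ≤ τ → τ < s + lengthᵗ t → s′ ≤ τ → τ < s′ + lengthᵗ t′ → t ≡ t′
    tiling-disjoint (tile T) (here refl) (here refl) _ _ _ _ = refl
    tiling-disjoint (tile T) (here refl) (there q)   _ τ< s′≤ _ = ⊥-elim (<⇒≱ τ< (≤-trans (tiling-≥ T q) s′≤))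
    tiling-disjoint (tile T) (there p)   (here refl) s≤ _ _ τ< = ⊥-elim (<⇒≱ τ< (≤-trans (tiling-≥ T p) s≤))
    tiling-disjoint (tile T) (there p)   (there q)   a b c d = tiling-disjoint T p q a b c d

    path-edge : ∀ {e s} es → (edge e , s) ∈ path es → s ≡ startOf e
    path-edge ((_ , (zero , _)) ∷ es)  (here refl)         = refl
    path-edge ((_ , (zero , _)) ∷ es)  (there h)           = path-edge es h
    path-edge ((_ , (suc _ , _)) ∷ es) (there (here refl)) = refl
    path-edge ((_ , (suc _ , _)) ∷ es) (there (there h))   = path-edge es h

    path-wide : ∀ {ℓ s} es → (wide ℓ , s) ∈ path es → ℓ ∈ labels es
    path-wide ((_ , (zero , _)) ∷ es)  (there h)         = path-wide es h
    path-wide ((_ , (suc _ , _)) ∷ es) (here refl)       = here refl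
    path-wide ((_ , (suc _ , _)) ∷ es) (there (there h)) = there (path-wide es h)

    path-wide-unique : ∀ {ℓ s s′} es → Unique (labels es) → (wide ℓ , s) ∈ path es → (wide ℓ , s′) ∈ path es → s ≡ s′
    path-wide-unique ((_ , (zero , _)) ∷ es)  u       (there p) (there q) = path-wide-unique es u p q
    path-wide-unique ((_ , (suc _ , _)) ∷ es) (x ∷ u) (here refl) (here refl) = refl
    path-wide-unique ((_ , (suc _ , _)) ∷ es) (x ∷ u) (here refl) (there (there q)) = ⊥-elim (All.lookup x (path-wide es q) refl)
    path-wide-unique ((_ , (suc _ , _)) ∷ es) (x ∷ u) (there (there p)) (here refl) = ⊥-elim (All.lookup x (path-wide es p) refl)
    path-wide-unique ((_ , (suc _ , _)) ∷ es) (x ∷ u) (there (there p)) (there (there q)) = path-wide-unique es u p q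

    path-ok : ∀ {u es t s} → Walk E V u es → (t , s) ∈ path es →
      (∃[ i ] lookup tags i ≡ t) × arrival (jobOf t) ≤ s × s + lengthᵗ t ≤ deadline (jobOf t) × deadline (jobOf t) ≤ horizon
    path-ok (_∷_ {u , (zero , v)} e∈ walk) (here refl) =
      edge∈tags e∈ , ≤-refl , ≤-reflexive (start+processing e∈) , *-monoˡ-≤ unit (proj₁ (proj₂ (E-ok e∈)))
    path-ok (_∷_ {u , (zero , v)} e∈ walk) (there h) = path-ok walk h
    path-ok (_∷_ {u , (suc ℓ , v)} e∈ walk) (here refl) with E-ok e∈
    ... | u<v , v≤V , ℓ<L = wide∈tags ℓ<L , z≤n , +-monoˡ-≤ (wideLength ℓ) (node≤last (≤-trans u<v v≤V)) ,
      ≤-trans (+-monoʳ-≤ ((V ∸ 1) * unit) (<⇒≤ (wideLength<unit ℓ<L))) (≤-reflexive last+unit)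
    path-ok (_∷_ {u , (suc ℓ , v)} e∈ walk) (there (here refl)) =
      edge∈tags e∈ , ≤-refl , ≤-reflexive (start+processing e∈) , *-monoˡ-≤ unit (proj₁ (proj₂ (E-ok e∈)))
    path-ok (_∷_ {u , (suc ℓ , v)} e∈ walk) (there (there h)) = path-ok walk h

    startIn : List (Tag × ℕ) → Tag → Maybe ℕ
    startIn []             t = nothing
    startIn ((t′ , s) ∷ ps) t with t ≟ᵗ t′
    ... | yes _ = just s
    ... | no _  = startIn ps t

    startIn-sound : ∀ ps {t s} → startIn ps t ≡ just s → (t , s) ∈ ps
    startIn-sound ((t′ , s) ∷ ps) {t} e with t ≟ᵗ t′
    startIn-sound ((t′ , s) ∷ ps) {t} refl | yes refl = here refl
    ... | no _ = there (startIn-sound ps e)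

    startIn-defined : ∀ ps {t s} → (t , s) ∈ ps → ∃[ s′ ] startIn ps t ≡ just s′
    startIn-defined ((t′ , s) ∷ ps) {t} h with t ≟ᵗ t′
    startIn-defined ((t′ , s) ∷ ps) {t} h           | yes _ = s , refl
    startIn-defined ((t′ , s) ∷ ps) {t} (here refl) | no ≢  = ⊥-elim (≢ refl)
    startIn-defined ((t′ , s) ∷ ps) {t} (there h)   | no _  = startIn-defined ps h

    module Build {es : List Edge} (walk : Walk E V 0 es) (uniq : Unique (labels es)) where

      σ : Schedule n
      σ = Vec.map (startIn (path es)) tags

      σ-path : ∀ i {s} → lookup σ i ≡ just s → (lookup tags i , s) ∈ path es
      σ-path i e = startIn-sound (path es) (trans (sym (lookup-map i (startIn (path es)) tags)) e)

      -- The schedule assigns to a tag the first start found in the path, so a tag must not occur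
      -- with two starts. For wide jobs this is the hypothesis that labels are used once; for edge
      -- jobs the edge fixes the start.
      functional : ∀ t {s s′} → (t , s) ∈ path es → (t , s′) ∈ path es → s ≡ s′
      functional big      p q = ⊥-elim (no-big es p)
        where
        no-big : ∀ es {s} → ¬ (big , s) ∈ path es
        no-big ((_ , (zero , _)) ∷ es)  (there h)         = no-big es h
        no-big ((_ , (suc _ , _)) ∷ es) (there (there h)) = no-big es h
      functional (wide ℓ) p q = path-wide-unique es uniq p q
      functional (edge e) p q = trans (path-edge es p) (sym (path-edge es q))

      path-σ : ∀ i {t s} → lookup tags i ≡ t → (t , s) ∈ path es → lookup σ i ≡ just s
      path-σ i {t} refl p with startIn-defined (path es) p
      ... | s′ , e = trans (lookup-map i (startIn (path es)) tags) (trans e (cong just (functional t (startIn-sound (path es) e) p)))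

      feasible : Feasible I σ
      feasible = record
        { inWindow = λ i s e → subst (λ j → InWindow j s) (sym (job-tag i refl))
            (let _ , a , b , _ = path-ok walk (σ-path i e) in window⁺ _ s a b)
        ; disjoint = λ { i j τ (s , e , s≤ , τ<) (s′ , e′ , s′≤ , τ<′) → tags-injective i j
            (tiling-disjoint (tiling walk) (σ-path i e) (σ-path j e′) s≤ (subst (λ k → τ < s + processing k) (job-tag i refl) τ<)
              s′≤ (subst (λ k → τ < s′ + processing k) (job-tag j refl) τ<′)) }
        ; busy = λ τ idle i → λ { (_ , w) → noIdle τ idle (critical<horizon i τ w) } }
        where
        noIdle : ∀ τ → (∀ i → ¬ ProcessedAt I σ i τ) → ¬ τ < horizon
        noIdle τ idle h with tiling-cover (tiling walk) z≤n h
        ... | t , s , p , s≤ , τ< with proj₁ (path-ok walk p)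
        ...   | i , e = idle i (s , path-σ i e p , s≤ , subst (λ k → τ < s + processing k) (sym (job-tag i e)) τ<)

      cheap : ∀ obj → value obj I σ ≤ n * horizon
      cheap obj = value≤ I σ obj horizon (fin-positive bigIx) (λ i s e →
        let _ , _ , b , c = path-ok walk (σ-path i e) in
        subst (λ j → s + processing j ≤ horizon) (sym (job-tag i refl)) (≤-trans b c))
        where
        fin-positive : ∀ {n} → Fin n → 1 ≤ n
        fin-positive zero    = s≤s z≤n
        fin-positive (suc _) = s≤s z≤n

    onlyBig : Tag → Maybe ℕ
    onlyBig big = just 0
    onlyBig _   = nothing

    -- The huge job alone keeps the bureaucrat busy past the horizon. So there is always a feasible
    -- schedule, even for an unsatisfiable formula, and a guarantee about instances that have an
    -- optimum can be applied.
    feasible-onlyBig : Feasible I (Vec.map onlyBig tags)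
    feasible-onlyBig = record
      { inWindow = λ i s e → window i s (isBig i e)
      ; disjoint = λ { i j τ (_ , e , _) (_ , e′ , _) →
          tags-injective i j (trans (proj₁ (isBig i e)) (sym (proj₁ (isBig j e′)))) }
      ; busy = λ τ idle i → λ { (_ , w) → idle bigIx (0 , bigStart , z≤n ,
          <-trans (critical<horizon i τ w) (subst (λ j → horizon < processing j) (sym (job-tag bigIx bigIx-big)) horizon<huge)) } }
      where
      isBig : ∀ i {s} → lookup (Vec.map onlyBig tags) i ≡ just s → lookup tags i ≡ big × s ≡ 0
      isBig i e rewrite lookup-map i onlyBig tags with lookup tags i
      isBig i refl | big = refl , refl
      window : ∀ i s → lookup tags i ≡ big × s ≡ 0 → InWindow (lookup I i) s
      window i s (e , refl) = subst (λ j → InWindow j 0) (sym (job-tag i e)) (window⁺ _ 0 z≤n (m≤n+m huge _))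
      bigStart : lookup (Vec.map onlyBig tags) bigIx ≡ just 0
      bigStart = trans (lookup-map bigIx onlyBig tags) (cong onlyBig bigIx-big)

    lazy⇐cheap : ∀ obj σ → value obj I σ < huge → lookup σ bigIx ≡ nothing
    lazy⇐cheap obj σ h with lookup σ bigIx in e
    ... | nothing = refl
    ... | just s  = ⊥-elim (<⇒≱ h (subst (λ j → processing j ≤ value obj I σ) (job-tag bigIx bigIx-big) (executed≤value I σ obj bigIx s e)))

-- From choosing one option per group, with all labels distinct, to walks

data Choice {A : Set} : List (List A) → List A → Set where
  []  : Choice [] []
  _∷_ : ∀ {g gs x xs} → x ∈ g → Choice gs xs → Choice (g ∷ gs) (x ∷ xs)

chain : ℕ → List ℕ → List Edge
chain = scan (λ u ℓ → [ (u , (suc ℓ , suc u)) ]) (λ _ → 1)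

-- The nodes from `r` to `r + length ls` belong to this option alone. A walk that enters at `r` can
-- only pass through all the labels of the option and leave for `e`.
block : ℕ → ℕ → ℕ → List ℕ → List Edge
block s e r ls = (s , (0 , r)) ∷ (r + length ls , (0 , e)) ∷ chain r ls

options : ℕ → ℕ → ℕ → List (List ℕ) → List Edge
options s e = scan (block s e) (λ ls → suc (length ls))

-- The number of nodes inside a group: an option with `k` labels takes `suc k` nodes, the prepended
-- 0 standing for the extra one.
regions : List (List ℕ) → ℕ
regions g = length (concatMap (0 ∷_) g)

-- Groups are connected in series and the options of a group in parallel; the exit of a group is the
-- entry of the next. A walk through the graph thus chooses one option in every group.
graphFrom : ℕ → List (List (List ℕ)) → List Edge
graphFrom = scan (λ s g → options s (suc (regions g + s)) (suc s) g) (λ g → suc (regions g))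

nodes : List (List (List ℕ)) → ℕ
nodes gs = length (concatMap (λ g → 0 ∷ concatMap (0 ∷_) g) gs)

nodes-∷ : ∀ g gs s → nodes gs + suc (regions g + s) ≡ nodes (g ∷ gs) + s
nodes-∷ g gs s = trans (+-suc (nodes gs) _) (cong suc (trans (sym (+-assoc (nodes gs) (regions g) s))
  (cong (_+ s) (trans (+-comm (nodes gs) (regions g)) (sym (length-++ (concatMap (0 ∷_) g)))))))

regions-∷ : ∀ ls g r → regions g + (suc (length ls) + r) ≡ regions (ls ∷ g) + r
regions-∷ ls g r = trans (sym (+-assoc (regions g) (suc (length ls)) r))
  (cong (_+ r) (trans (+-comm (regions g) (suc (length ls))) (cong suc (sym (length-++ ls)))))

chain-at : ∀ u ls {e} → e ∈ chain u ls → u ≤ src e × src e < u + length ls × dst e ≡ suc (src e) × (∃[ ℓ ] ℓ ∈ ls × lab e ≡ suc ℓ)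
chain-at u (ℓ ∷ ls) (here refl) = ≤-refl , m<m+n u (s≤s z≤n) , refl , ℓ , here refl , refl
chain-at u (ℓ ∷ ls) (there h) with chain-at (suc u) ls h
... | a , b , c , k , k∈ , d = ≤-trans (n≤1+n u) a , ≤-trans b (≤-reflexive (sym (+-suc u _))) , c , k , there k∈ , d

data InBlock (s e r : ℕ) (ls : List ℕ) : Edge → Set where
  enters : InBlock s e r ls (s , (0 , r))
  inside : ∀ {d} → d ∈ (r + length ls , (0 , e)) ∷ chain r ls → r ≤ src d → src d ≤ r + length ls → InBlock s e r ls d

inBlock : ∀ {s e} r ls {d} → d ∈ block s e r ls → InBlock s e r ls d
inBlock r ls (here refl)         = enters
inBlock r ls (there (here refl)) = inside (here refl) (m≤m+n r _) ≤-refl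
inBlock r ls (there (there h)) with chain-at r ls h
... | a , b , _ = inside (there h) a (<⇒≤ b)

data InOptions (s e r : ℕ) : Edge → Set where
  enters : ∀ {r′} → r ≤ r′ → r′ < e → InOptions s e r (s , (0 , r′))
  inside : ∀ {d} → r ≤ src d → src d < e → InOptions s e r d

inOptions : ∀ {s e} r os → regions os + r ≡ e → ∀ {d} → d ∈ options s e r os → InOptions s e r d
inOptions {s} {e} r (ls ∷ os) eq h with ∈-++⁻ (block s e r ls) h
... | inj₂ h′ with inOptions (suc (length ls) + r) os (trans (regions-∷ ls os r) eq) h′
...   | enters a b = enters (≤-trans (m≤n+m r _) a) b
...   | inside a b = inside (≤-trans (m≤n+m r _) a) b
inOptions {s} {e} r (ls ∷ os) eq h | inj₁ h′ with inBlock r ls h′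
... | enters     = enters ≤-refl (≤-trans (s≤s (m≤n+m r (length ls + regions os)))
                    (≤-reflexive (trans (cong (λ z → suc (z + r)) (sym (length-++ ls))) eq)))
... | inside _ a b = inside a (≤-trans (s≤s b) (≤-trans (≤-trans (≤-reflexive (cong suc (+-comm r (length ls)))) (m≤n+m _ (regions os)))
                    (≤-reflexive (trans (regions-∷ ls os r) eq))))

inGraph : ∀ s gs {d} → d ∈ graphFrom s gs → s ≤ src d × src d < nodes gs + s
inGraph s (g ∷ gs) h with ∈-++⁻ (options s (suc (regions g + s)) (suc s) g) h
... | inj₂ h′ with inGraph (suc (regions g) + s) gs h′
...   | a , b = ≤-trans (m≤n+m s _) a , ≤-trans b (≤-reflexive (nodes-∷ g gs s))
inGraph s (g ∷ gs) h | inj₁ h′ with inOptions (suc s) g (+-suc (regions g) s) h′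
... | enters _ _ = ≤-refl , m<n+m s (s≤s z≤n)
... | inside a b = <⇒≤ a , ≤-trans b (≤-trans (m≤n+m _ (nodes gs)) (≤-reflexive (nodes-∷ g gs s)))

unique-chain : ∀ u ls → Unique (chain u ls)
unique-chain u []       = []
unique-chain u (ℓ ∷ ls) = All.tabulate (λ h e → <⇒≢ (proj₁ (chain-at (suc u) ls h)) (cong src e)) ∷ unique-chain (suc u) ls

unique-block : ∀ {s e} r ls → s < r → Unique (block s e r ls)
unique-block {s} r ls s<r =
  ((λ e → <⇒≢ (≤-trans s<r (m≤m+n r _)) (cong src e)) ∷
    All.tabulate (λ h e → <⇒≢ (≤-trans s<r (proj₁ (chain-at r ls h))) (cong src e))) ∷
  All.tabulate (λ h e → case-label (chain-at r ls h) e) ∷ unique-chain r ls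
  where
  case-label : ∀ {d x y} → r ≤ src d × src d < r + length ls × dst d ≡ suc (src d) × (∃[ ℓ ] ℓ ∈ ls × lab d ≡ suc ℓ) → ¬ (x , (0 , y)) ≡ d
  case-label (_ , _ , _ , _ , _ , e) refl with e
  ... | ()

unique-options : ∀ {s e} r os → s < r → regions os + r ≡ e → Unique (options s e r os)
unique-options r []        s<r eq = []
unique-options {s} {e} r (ls ∷ os) s<r eq = Uniqueₚ.++⁺ (unique-block r ls s<r) (unique-options r′ os (≤-trans s<r (m≤n+m r _)) eq′)
  (λ { (h , h′) → apart (inBlock r ls h) (inOptions r′ os eq′ h′) })
  where
  r′ : ℕ
  r′ = suc (length ls) + r
  eq′ : regions os + r′ ≡ e
  eq′ = trans (regions-∷ ls os r) eq
  r<r′ : r < r′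
  r<r′ = m<n+m r (s≤s z≤n)
  apart : ∀ {d} → InBlock s e r ls d → InOptions s e r′ d → ⊥
  apart enters         (enters a _) = <⇒≱ r<r′ a
  apart enters         (inside a _) = <⇒≱ (<-trans s<r r<r′) a
  apart (inside _ a _) (enters _ _) = <⇒≱ s<r a
  apart (inside _ _ a) (inside b _) = <⇒≱ b (≤-trans a (≤-reflexive (+-comm r _)))

unique-graph : ∀ s gs → Unique (graphFrom s gs)
unique-graph s []       = []
unique-graph s (g ∷ gs) = Uniqueₚ.++⁺ (unique-options (suc s) g ≤-refl (+-suc (regions g) s)) (unique-graph (suc (regions g) + s) gs)
  (λ { (h , h′) → apart (inOptions (suc s) g (+-suc (regions g) s) h) (proj₁ (inGraph (suc (regions g) + s) gs h′)) })
  where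
  apart : ∀ {d} → InOptions s (suc (regions g + s)) (suc s) d → ¬ suc (regions g) + s ≤ src d
  apart (enters _ _) h = <⇒≱ (m<n+m s (s≤s z≤n)) h
  apart (inside _ a) h = <⇒≱ a h

graph-ok : ∀ L s gs → All (All (All (_< L))) gs → ∀ {d} → d ∈ graphFrom s gs → src d < dst d × dst d ≤ nodes gs + s × lab d ≤ L
graph-ok L s (g ∷ gs) (ok ∷ oks) h with ∈-++⁻ (options s (suc (regions g + s)) (suc s) g) h
... | inj₂ h′ with graph-ok L (suc (regions g) + s) gs oks h′
...   | a , b , c = a , ≤-trans b (≤-reflexive (nodes-∷ g gs s)) , c
graph-ok L s (g ∷ gs) (ok ∷ oks) h | inj₁ h′ with options-ok (suc s) g ok (+-suc (regions g) s) ≤-refl h′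
  where
  options-ok : ∀ {s e} r os → All (All (_< L)) os → regions os + r ≡ e → s < r → ∀ {d} → d ∈ options s e r os → src d < dst d × dst d ≤ e × lab d ≤ L
  options-ok {s} {e} r (ls ∷ os) (o ∷ ok) eq s<r h with ∈-++⁻ (block s e r ls) h
  ... | inj₂ h′ = options-ok (suc (length ls) + r) os ok (trans (regions-∷ ls os r) eq) (≤-trans s<r (m≤n+m r _)) h′
  ... | inj₁ (here refl) = s<r , <⇒≤ (≤-trans (s≤s (m≤n+m r (length ls + regions os))) (≤-reflexive (trans (cong (λ z → suc (z + r)) (sym (length-++ ls))) eq))) , z≤n
  ... | inj₁ (there h₂) = go h₂
    where
    r+ls<e : r + length ls < e
    r+ls<e = ≤-trans (≤-trans (≤-reflexive (cong suc (+-comm r (length ls)))) (m≤n+m _ (regions os))) (≤-reflexive (trans (regions-∷ ls os r) eq))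
    go : ∀ {d} → d ∈ (r + length ls , (0 , e)) ∷ chain r ls → src d < dst d × dst d ≤ e × lab d ≤ L
    go (here refl) = r+ls<e , ≤-refl , z≤n
    go (there h₃) with chain-at r ls h₃
    ... | a , b , c , ℓ , ℓ∈ , l = ≤-reflexive (sym c) , ≤-trans (≤-reflexive c) (≤-trans b (<⇒≤ r+ls<e)) , ≤-trans (≤-reflexive l) (All.lookup o ℓ∈)
... | a , b , c = a , ≤-trans b (≤-trans (m≤n+m _ (nodes gs)) (≤-reflexive (nodes-∷ g gs s))) , c

module _ {E : List Edge} {v : ℕ} where

  -- The edge set `E` remains that of the whole graph during the recursion. The hypothesis `only`
  -- narrows down which of its edges start at the nodes under consideration; `followChoice` works
  -- the same way.
  followChain : ∀ {e} r ls es → (∀ {d} → d ∈ E → r ≤ src d → src d ≤ r + length ls → d ∈ (r + length ls , (0 , e)) ∷ chain r ls) →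
    r + length ls < v → Walk E v r es → ∃[ es′ ] Walk E v e es′ × labels es ≡ ls ++ labels es′
  followChain r ls [] only lt stop = ⊥-elim (<⇒≱ lt (m≤m+n r _))
  followChain r [] ((_ , (l , t)) ∷ es) only lt (d∈ ∷ walk) with only d∈ ≤-refl (m≤m+n r 0)
  ... | here eq with cong lab eq | cong dst eq
  ...   | refl | refl = es , walk , refl
  followChain {e} r (ℓ ∷ ls) (_ ∷ es) only lt (d∈ ∷ walk) with only d∈ ≤-refl (m≤m+n r _)
  ... | here eq = ⊥-elim (m≢1+m+n r (trans (cong src eq) (+-suc r (length ls))))
  ... | there (there h) = ⊥-elim (<⇒≱ (proj₁ (chain-at (suc r) ls h)) ≤-refl)
  ... | there (here refl) with followChain (suc r) ls es only′ (subst (_< v) (+-suc r _) lt) walk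
    where
    only′ : ∀ {d} → d ∈ E → suc r ≤ src d → src d ≤ suc r + length ls → d ∈ (suc r + length ls , (0 , e)) ∷ chain (suc r) ls
    only′ d∈ a b with only d∈ (<⇒≤ a) (≤-trans b (≤-reflexive (sym (+-suc r _))))
    ... | here refl         = here (cong (_, (0 , e)) (+-suc r _))
    ... | there (here refl) = ⊥-elim (<⇒≱ a ≤-refl)
    ... | there (there h)   = there h
  ...   | es′ , walk′ , eq = es′ , walk′ , cong (ℓ ∷_) eq

  followChoice : ∀ gs s es → (∀ {d} → d ∈ E → s ≤ src d → d ∈ graphFrom s gs) → v ≡ nodes gs + s → Walk E v s es →
    ∃[ os ] Choice gs os × labels es ≡ concat os
  followChoice []       s []       only eq walk = [] , [] , refl
  followChoice []       s (_ ∷ es) only eq (d∈ ∷ walk) with only d∈ ≤-refl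
  ... | ()
  followChoice (g ∷ gs) s []       only eq stop = ⊥-elim (<⇒≢ (m<n+m s (s≤s z≤n)) eq)
  followChoice (g ∷ gs) s (_ ∷ es) only eq (d∈ ∷ walk) with ∈-++⁻ (options s (suc (regions g + s)) (suc s) g) (only d∈ ≤-refl)
  ... | inj₂ h = ⊥-elim (<⇒≱ (m<n+m s (s≤s z≤n)) (proj₁ (inGraph (suc (regions g) + s) gs h)))
  ... | inj₁ h with find (suc s) g ≤-refl (+-suc (regions g) s) h refl
    where
    -- The edge that leaves the entry of the group determines the option. The last component says
    -- which edges start inside its region, as `followChain` requires.
    find : ∀ {s e} r os → s < r → regions os + r ≡ e → ∀ {d} → d ∈ options s e r os → src d ≡ s →
      ∃[ ls ] ls ∈ os × lab d ≡ 0 × r ≤ dst d × dst d + length ls < e ×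
        (∀ {d′} → d′ ∈ options s e r os → dst d ≤ src d′ → src d′ ≤ dst d + length ls → d′ ∈ (dst d + length ls , (0 , e)) ∷ chain (dst d) ls)
    find {s} {e} r (ls ∷ os) s<r eq h src≡ with ∈-++⁻ (block s e r ls) h
    ... | inj₁ h′ with inBlock r ls h′
    ...   | inside _ a _ = ⊥-elim (<⇒≱ s<r (≤-trans a (≤-reflexive src≡)))
    ...   | enters = ls , here refl , refl , ≤-refl , r+ls<e , local
      where
      r+ls<e : r + length ls < e
      r+ls<e = ≤-trans (≤-trans (≤-reflexive (cong suc (+-comm r (length ls)))) (m≤n+m _ (regions os))) (≤-reflexive (trans (regions-∷ ls os r) eq))
      local : ∀ {d′} → d′ ∈ options s e r (ls ∷ os) → r ≤ src d′ → src d′ ≤ r + length ls → d′ ∈ (r + length ls , (0 , e)) ∷ chain r ls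
      local h a b with ∈-++⁻ (block s e r ls) h
      ... | inj₁ h₁ with inBlock r ls h₁
      ...   | enters       = ⊥-elim (<⇒≱ s<r a)
      ...   | inside h₂ _ _ = h₂
      local h a b | inj₂ h₁ with inOptions (suc (length ls) + r) os (trans (regions-∷ ls os r) eq) h₁
      ...   | enters _ _ = ⊥-elim (<⇒≱ s<r a)
      ...   | inside c _ = ⊥-elim (<⇒≱ c (≤-trans b (≤-reflexive (+-comm r _))))
    find {s} {e} r (ls ∷ os) s<r eq {d} h src≡ | inj₂ h′ with find (suc (length ls) + r) os (≤-trans s<r (m≤n+m r _)) (trans (regions-∷ ls os r) eq) h′ src≡
    ... | ls′ , ls′∈ , l0 , r≤ , lt , local = ls′ , there ls′∈ , l0 , ≤-trans (m≤n+m r _) r≤ , lt , local′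
      where
      local′ : ∀ {d′} → d′ ∈ options s e r (ls ∷ os) → dst d ≤ src d′ → src d′ ≤ dst d + length ls′ → d′ ∈ (dst d + length ls′ , (0 , e)) ∷ chain (dst d) ls′
      local′ h a b with ∈-++⁻ (block s e r ls) h
      ... | inj₂ h₁ = local h₁ a b
      ... | inj₁ h₁ with inBlock r ls h₁
      ...   | enters       = ⊥-elim (<⇒≱ (≤-trans s<r (≤-trans (m≤n+m r _) r≤)) a)
      ...   | inside _ _ c = ⊥-elim (<⇒≱ (≤-trans (s≤s c) (≤-trans (≤-reflexive (cong suc (+-comm r _))) r≤)) a)
  followChoice (g ∷ gs) _ ((s , (_ , r)) ∷ es) only eq (d∈ ∷ walk) | inj₁ h | ls , ls∈ , refl , r≥ , lt , local
    with followChain r ls es only₁ (≤-trans lt (≤-trans (m≤n+m _ (nodes gs)) (≤-reflexive (trans (nodes-∷ g gs s) (sym eq))))) walk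
    where
    only₁ : ∀ {d} → d ∈ E → r ≤ src d → src d ≤ r + length ls → d ∈ (r + length ls , (0 , suc (regions g + s))) ∷ chain r ls
    only₁ d∈ a b with ∈-++⁻ (options s (suc (regions g + s)) (suc s) g) (only d∈ (<⇒≤ (≤-trans r≥ a)))
    ... | inj₁ h₁ = local h₁ a b
    ... | inj₂ h₁ = ⊥-elim (<⇒≱ (≤-trans (s≤s b) lt) (proj₁ (inGraph (suc (regions g) + s) gs h₁)))
  ... | es′ , walk′ , eq₁ with followChoice gs (suc (regions g + s)) es′ only₂ (trans eq (sym (nodes-∷ g gs s))) walk′
    where
    only₂ : ∀ {d} → d ∈ E → suc (regions g + s) ≤ src d → d ∈ graphFrom (suc (regions g + s)) gs
    only₂ d∈ a with ∈-++⁻ (options s (suc (regions g + s)) (suc s) g) (only d∈ (≤-trans (m≤n+m s _) a))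
    ... | inj₂ h₁ = h₁
    ... | inj₁ h₁ with inOptions (suc s) g (+-suc (regions g) s) h₁
    ...   | enters _ _ = ⊥-elim (<⇒≱ (m<n+m s (s≤s z≤n)) a)
    ...   | inside _ b = ⊥-elim (<⇒≱ b a)
  ...   | os , ch , eq₂ = ls ∷ os , ls∈ ∷ ch , trans eq₁ (cong (ls ++_) eq₂)

  walkChain : ∀ {e} r ls es → (∀ {d} → d ∈ (r + length ls , (0 , e)) ∷ chain r ls → d ∈ E) → Walk E v e es →
    ∃[ es′ ] Walk E v r es′ × labels es′ ≡ ls ++ labels es
  walkChain {e} r [] es sub walk = (r , (0 , e)) ∷ es , sub (here (cong (_, (0 , e)) (sym (+-identityʳ r)))) ∷ walk , refl
  walkChain {e} r (ℓ ∷ ls) es sub walk with walkChain (suc r) ls es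
    (λ { (here refl) → sub (here (cong (_, (0 , e)) (sym (+-suc r _)))) ; (there h) → sub (there (there h)) }) walk
  ... | es′ , walk′ , eq = (r , (suc ℓ , suc r)) ∷ es′ , sub (there (here refl)) ∷ walk′ , cong (ℓ ∷_) eq

  walkChoice : ∀ gs s os → (∀ {d} → d ∈ graphFrom s gs → d ∈ E) → nodes gs + s ≡ v → Choice gs os →
    ∃[ es ] Walk E v s es × labels es ≡ concat os
  walkChoice [] s [] sub refl [] = [] , stop , refl
  walkChoice (g ∷ gs) s (ls ∷ os) sub eq (ls∈ ∷ ch) with walkChoice gs (suc (regions g + s)) os
    (λ h → sub (∈-++⁺ʳ (options s (suc (regions g + s)) (suc s) g) h)) (trans (nodes-∷ g gs s) eq) ch
  ... | es , walk , e₁ with locate (suc s) g ls∈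
    where
    locate : ∀ {s e ls} r os → ls ∈ os → ∃[ r′ ] (∀ {d} → d ∈ block s e r′ ls → d ∈ options s e r os)
    locate r (ls ∷ os) (here refl) = r , ∈-++⁺ˡ
    locate {s} {e} r (ls ∷ os) (there h) with locate (suc (length ls) + r) os h
    ... | r′ , sub = r′ , λ h′ → ∈-++⁺ʳ (block s e r ls) (sub h′)
  ...   | r , sub′ with walkChain r ls es (λ h → sub (∈-++⁺ˡ (sub′ (there h)))) walk
  ...     | es′ , walk′ , e₂ = (s , (0 , r)) ∷ es′ , sub (∈-++⁺ˡ (sub′ (here refl))) ∷ walk′ , trans e₂ (cong (ls ++_) e₁)

-- Satisfiability as a choice of pairwise compatible literal occurrences

module _ {X : Set} where

  CNF : Set
  CNF = List (List (Bool × X))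

  Satisfies : (X → Bool) → CNF → Set
  Satisfies α = All (Any (λ l → α (proj₂ l) ≡ proj₁ l))

  Occurrence : Set
  Occurrence = ℕ × (Bool × X)

  enumerate : ℕ → List (Bool × X) → List Occurrence
  enumerate = scan (λ i l → [ (i , l) ]) (λ _ → 1)

  enumerateAll : ℕ → CNF → List (List Occurrence)
  enumerateAll = scan (λ i C → [ enumerate i C ]) length

  enumerate-++ : ∀ s C C′ → enumerate s (C ++ C′) ≡ enumerate s C ++ enumerate (length C + s) C′
  enumerate-++ s []      C′ = refl
  enumerate-++ s (l ∷ C) C′ = cong ((s , l) ∷_) (trans (enumerate-++ (suc s) C C′)
    (cong (λ k → enumerate (suc s) C ++ enumerate k C′) (+-suc (length C) s)))

  concat-enumerateAll : ∀ s φ → concat (enumerateAll s φ) ≡ enumerate s (concat φ)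
  concat-enumerateAll s []      = refl
  concat-enumerateAll s (C ∷ φ) = trans (cong (enumerate s C ++_) (concat-enumerateAll (length C + s) φ)) (sym (enumerate-++ s C (concat φ)))

  enumerate-at : ∀ s C {p} → p ∈ enumerate s C → s ≤ proj₁ p × proj₁ p < length C + s × proj₂ p ∈ C
  enumerate-at s (l ∷ C) (here refl) = ≤-refl , m<n+m s (s≤s z≤n) , here refl
  enumerate-at s (l ∷ C) (there h) with enumerate-at (suc s) C h
  ... | a , b , c = <⇒≤ a , ≤-trans b (≤-reflexive (+-suc (length C) s)) , there c

  enumerate-∋ : ∀ s C {l} → l ∈ C → ∃[ i ] (i , l) ∈ enumerate s C
  enumerate-∋ s (l ∷ C) (here refl) = s , here refl
  enumerate-∋ s (l ∷ C) (there h) with enumerate-∋ (suc s) C h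
  ... | i , h′ = i , there h′

  enumerate-functional : ∀ s C {i l l′} → (i , l) ∈ enumerate s C → (i , l′) ∈ enumerate s C → l ≡ l′
  enumerate-functional s (_ ∷ C) (here refl) (here refl) = refl
  enumerate-functional s (_ ∷ C) (here refl) (there q)   = ⊥-elim (<⇒≱ (proj₁ (enumerate-at (suc s) C q)) ≤-refl)
  enumerate-functional s (_ ∷ C) (there p)   (here refl) = ⊥-elim (<⇒≱ (proj₁ (enumerate-at (suc s) C p)) ≤-refl)
  enumerate-functional s (_ ∷ C) (there p)   (there q)   = enumerate-functional (suc s) C p q

  module Conflicts (eq : X → X → Bool) (eq-sound : ∀ x y → eq x y ≡ true → x ≡ y) (eq-refl : ∀ x → eq x x ≡ true) (φ : CNF) where

    occurrences : List Occurrence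
    occurrences = enumerate 0 (concat φ)

    O : ℕ
    O = length (concat φ)

    conflict : Bool × X → Bool × X → Bool
    conflict (b , x) (c , y) = eqBool c (not b) ∧ eq x y

    -- The label encodes the ordered pair of a positive and a negative occurrence in base `O`.
    -- Putting the positive one first gives both ends of a conflict the same label.
    pairLabel : Occurrence → Occurrence → ℕ
    pairLabel (o , (b , _)) (o′ , _) = if b then o * O + o′ else o′ * O + o

    labelsWith : Occurrence → Occurrence → List ℕ
    labelsWith p q = if conflict (proj₂ p) (proj₂ q) then [ pairLabel p q ] else []

    labelsOf : Occurrence → List ℕ
    labelsOf p = concatMap (labelsWith p) occurrences

    choices : List (List (List ℕ))
    choices = map (map labelsOf) (enumerateAll 0 φ)

    labelsWith-∈ : ∀ {p q ℓ} → ℓ ∈ labelsWith p q → conflict (proj₂ p) (proj₂ q) ≡ true × ℓ ≡ pairLabel p q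
    labelsWith-∈ {p} {q} h with conflict (proj₂ p) (proj₂ q)
    labelsWith-∈ (here refl) | true = refl , refl

    conflict-sound : ∀ b x c y → conflict (b , x) (c , y) ≡ true → c ≡ not b × x ≡ y
    conflict-sound b x c y e with eqBool c (not b) in e₁ | eq x y in e₂
    ... | true | true = eqBool-sound c (not b) e₁ , eq-sound x y e₂

    conflict-complete : ∀ b x → conflict (b , x) (not b , x) ≡ true
    conflict-complete b x rewrite eqBool-refl (not b) | eq-refl x = refl

    ∈-concatMap⁻ : ∀ {A B : Set} (f : A → List B) xs {y} → y ∈ concatMap f xs → ∃[ x ] x ∈ xs × y ∈ f x
    ∈-concatMap⁻ f (x ∷ xs) h with ∈-++⁻ (f x) h
    ... | inj₁ h′ = x , here refl , h′
    ... | inj₂ h′ with ∈-concatMap⁻ f xs h′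
    ...   | x′ , a , b = x′ , there a , b

    ∈-concatMap⁺ : ∀ {A B : Set} (f : A → List B) {xs x y} → x ∈ xs → y ∈ f x → y ∈ concatMap f xs
    ∈-concatMap⁺ f (here refl) h = ∈-++⁺ˡ h
    ∈-concatMap⁺ f {x ∷ xs} (there p) h = ∈-++⁺ʳ (f x) (∈-concatMap⁺ f p h)

    labelsOf-∈ : ∀ {o b x ℓ} → ℓ ∈ labelsOf (o , (b , x)) →
      ∃[ o′ ] (o′ , (not b , x)) ∈ occurrences × ℓ ≡ (if b then o * O + o′ else o′ * O + o)
    labelsOf-∈ {o} {b} {x} h with ∈-concatMap⁻ (labelsWith (o , (b , x))) occurrences h
    ... | (o′ , (c , y)) , q∈ , h′ with labelsWith-∈ {o , (b , x)} {o′ , (c , y)} h′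
    ...   | e , refl with conflict-sound b x c y e
    ...     | refl , refl = o′ , q∈ , refl

    <O : ∀ {o l} → (o , l) ∈ occurrences → o < O
    <O h = subst (_ <_) (+-identityʳ O) (proj₁ (proj₂ (enumerate-at 0 (concat φ) h)))

    O-unique : ∀ {a b c d l m} → (b , l) ∈ occurrences → (d , m) ∈ occurrences → a * O + b ≡ c * O + d → a ≡ c × b ≡ d
    O-unique {a} {b} {c} {d} hb hd e = remainder-unique O a c (<O hb) (<O hd)
      (trans (cong (_+ b) (*-comm O a)) (trans e (cong (_+ d) (*-comm c O))))

    labels<L : ∀ {p ℓ} → p ∈ occurrences → ℓ ∈ labelsOf p → ℓ < O * O
    labels<L {o , (b , x)} p∈ h with labelsOf-∈ {o} {b} {x} h
    ... | o′ , q∈ , refl = small b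
      where
      pair : ∀ {i j} → i < O → j < O → i * O + j < O * O
      pair {i} {j} hi hj = ≤-trans (+-monoʳ-< (i * O) hj) (≤-trans (≤-reflexive (+-comm (i * O) O)) (*-monoˡ-≤ O hi))
      small : ∀ b → (if b then o * O + o′ else o′ * O + o) < O * O
      small true  = pair (<O p∈) (<O q∈)
      small false = pair (<O q∈) (<O p∈)

    unique-labelsOf : ∀ {p} → p ∈ occurrences → Unique (labelsOf p)
    unique-labelsOf {o , (b , x)} p∈ = go 0 (concat φ) id
      where
      go : ∀ s C → (∀ {q} → q ∈ enumerate s C → q ∈ occurrences) → Unique (concatMap (labelsWith (o , (b , x))) (enumerate s C))
      go s []      sub = []
      go s (l ∷ C) sub = Uniqueₚ.++⁺ (single (conflict (b , x) l)) (go (suc s) C (sub ∘ there)) (λ { (h , h′) → apart h h′ })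
        where
        single : ∀ t {ℓ} → Unique (if t then [ ℓ ] else [])
        single true  = [] ∷ []
        single false = []
        apart : ∀ {ℓ} → ℓ ∈ labelsWith (o , (b , x)) (s , l) → ℓ ∈ concatMap (labelsWith (o , (b , x))) (enumerate (suc s) C) → ⊥
        apart h h′ with ∈-concatMap⁻ (labelsWith (o , (b , x))) (enumerate (suc s) C) h′
        ... | (o′ , l′) , q∈ , h″ = <⇒≢ (proj₁ (enumerate-at (suc s) C q∈))
          (inj b (trans (sym (proj₂ (labelsWith-∈ {o , (b , x)} {s , l} h))) (proj₂ (labelsWith-∈ {o , (b , x)} {o′ , l′} h″))))
          where
          inj : ∀ b → (if b then o * O + s else s * O + o) ≡ (if b then o * O + o′ else o′ * O + o) → s ≡ o′
          inj true  e = proj₂ (O-unique {o} {s} {o} {o′} (sub (here refl)) (sub (there q∈)) e)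
          inj false e = proj₁ (O-unique {s} {o} {o′} {o} p∈ p∈ e)

    Picks : CNF → ℕ → List Occurrence → Set
    Picks ψ s = Choice (enumerateAll s ψ)

    picks-occur : ∀ s ψ ps → Picks ψ s ps → ∀ {p} → p ∈ ps → p ∈ enumerate s (concat ψ)
    picks-occur s (C ∷ ψ) (p ∷ ps) (h ∷ ch) (here refl) = subst (p ∈_) (sym (enumerate-++ s C (concat ψ))) (∈-++⁺ˡ h)
    picks-occur s (C ∷ ψ) (p ∷ ps) (h ∷ ch) (there q) = subst (_ ∈_) (sym (enumerate-++ s C (concat ψ)))
      (∈-++⁺ʳ (enumerate s C) (picks-occur (length C + s) ψ ps ch q))

    -- One true literal is picked in each clause. A common label of two picks decodes to a pair
    -- containing both: with equal signs they would be the same occurrence, with opposite signs they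
    -- would be a literal and its negation, both true.
    satisfying-choice : ∀ α → Satisfies α φ → ∃[ os ] Choice choices os × Unique (concat os)
    satisfying-choice α sat with pick 0 φ sat
      where
      pickClause : ∀ s C → Any (λ l → α (proj₂ l) ≡ proj₁ l) C → ∃[ p ] p ∈ enumerate s C × α (proj₂ (proj₂ p)) ≡ proj₁ (proj₂ p)
      pickClause s (l ∷ C) (here e)  = (s , l) , here refl , e
      pickClause s (l ∷ C) (there h) with pickClause (suc s) C h
      ... | p , p∈ , e = p , there p∈ , e
      pick : ∀ s ψ → Satisfies α ψ → ∃[ ps ] Picks ψ s ps × All (λ p → α (proj₂ (proj₂ p)) ≡ proj₁ (proj₂ p)) ps
      pick s []      []        = [] , [] , []
      pick s (C ∷ ψ) (h ∷ sat) with pickClause s C h | pick (length C + s) ψ sat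
      ... | p , p∈ , e | ps , ch , es = p ∷ ps , p∈ ∷ ch , e ∷ es
    ... | ps , ch , true-ps = map labelsOf ps , mapChoice ch , distinct 0 φ ps ch id true-ps
      where
      mapChoice : ∀ {gs ps} → Choice gs ps → Choice (map (map labelsOf) gs) (map labelsOf ps)
      mapChoice []       = []
      mapChoice (h ∷ ch) = ∈-map⁺ labelsOf h ∷ mapChoice ch
      compatible : ∀ {o b x o′ b′ x′ ℓ} → (o , (b , x)) ∈ occurrences → (o′ , (b′ , x′)) ∈ occurrences → α x ≡ b → α x′ ≡ b′ → o ≢ o′ →
        ℓ ∈ labelsOf (o , (b , x)) → ℓ ∈ labelsOf (o′ , (b′ , x′)) → ⊥
      compatible {o} {b} {x} {o′} {b′} {x′} p∈ q∈ e e′ o≢ h h′ with labelsOf-∈ {o} {b} {x} h | labelsOf-∈ {o′} {b′} {x′} h′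
      ... | k , k∈ , refl | k′ , k′∈ , eq₁ = go b b′ e e′ p∈ q∈ k∈ k′∈ eq₁
        where
        go : ∀ b b′ → α x ≡ b → α x′ ≡ b′ → (o , (b , x)) ∈ occurrences → (o′ , (b′ , x′)) ∈ occurrences →
          (k , (not b , x)) ∈ occurrences → (k′ , (not b′ , x′)) ∈ occurrences →
          (if b then o * O + k else k * O + o) ≡ (if b′ then o′ * O + k′ else k′ * O + o′) → ⊥
        go true  true  _ _ p∈ q∈ k∈ k′∈ e = o≢ (proj₁ (O-unique {o} {k} {o′} {k′} k∈ k′∈ e))
        go false false _ _ p∈ q∈ k∈ k′∈ e = o≢ (proj₂ (O-unique {k} {o} {k′} {o′} p∈ q∈ e))
        go true  false a a′ p∈ q∈ k∈ k′∈ e with O-unique {o} {k} {k′} {o′} k∈ q∈ e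
        ... | refl , refl with enumerate-functional 0 (concat φ) p∈ k′∈
        ...   | refl with trans (sym a) a′
        ...     | ()
        go false true  a a′ p∈ q∈ k∈ k′∈ e with O-unique {k} {o} {o′} {k′} p∈ k′∈ e
        ... | refl , refl with enumerate-functional 0 (concat φ) q∈ k∈
        ...   | refl with trans (sym a) a′
        ...     | ()
      distinct : ∀ s ψ ps → Picks ψ s ps → (∀ {p} → p ∈ enumerate s (concat ψ) → p ∈ occurrences) →
        All (λ p → α (proj₂ (proj₂ p)) ≡ proj₁ (proj₂ p)) ps → Unique (concat (map labelsOf ps))
      distinct s []      []       []       sub []       = []
      distinct s (C ∷ ψ) (p ∷ ps) (h ∷ ch) sub (e ∷ es) =
        Uniqueₚ.++⁺ (unique-labelsOf p∈) (distinct (length C + s) ψ ps ch (sub ∘ later) es)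
          (λ { (a , b) → let q , q∈ , b′ = ∈-concatMap⁻ labelsOf ps b in
            compatible p∈ (sub (later (picks-occur _ ψ ps ch q∈))) e (All.lookup es q∈)
              (λ o≡ → <⇒≢ (<-≤-trans (proj₁ (proj₂ (enumerate-at s C h))) (proj₁ (enumerate-at _ (concat ψ) (picks-occur _ ψ ps ch q∈)))) o≡)
              a b′ })
        where
        later : ∀ {q} → q ∈ enumerate (length C + s) (concat ψ) → q ∈ enumerate s (C ++ concat ψ)
        later h = subst (_ ∈_) (sym (enumerate-++ s C (concat ψ))) (∈-++⁺ʳ (enumerate s C) h)
        p∈ : p ∈ occurrences
        p∈ = sub (subst (p ∈_) (sym (enumerate-++ s C (concat ψ))) (∈-++⁺ˡ h))

    -- A variable is made true iff a positive occurrence of it was picked. A negative pick could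
    -- then only fail next to a positive pick of the same variable, and both would carry the label
    -- of their pair.
    choice-satisfying : ∀ os → Choice choices os → Unique (concat os) → ∃[ α ] Satisfies α φ
    choice-satisfying os ch uniq with unmap (enumerateAll 0 φ) os ch
      where
      unmap : ∀ gs os → Choice (map (map labelsOf) gs) os → ∃[ ps ] Choice gs ps × os ≡ map labelsOf ps
      unmap []       []       []       = [] , [] , refl
      unmap (g ∷ gs) (o ∷ os) (h ∷ ch) with ∈-map⁻ labelsOf h | unmap gs os ch
      ... | p , p∈ , refl | ps , ch′ , refl = p ∷ ps , p∈ ∷ ch′ , refl
    ... | ps , ch′ , refl = α , sat 0 φ ps ch′ (All.tabulate (λ {p} → true-pick p))
      where
      positive : X → Occurrence → Bool
      positive x (_ , (b , y)) = b ∧ eq x y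
      α : X → Bool
      α x = any (positive x) ps
      any-true : ∀ (f : Occurrence → Bool) qs → any f qs ≡ true → ∃[ q ] q ∈ qs × f q ≡ true
      any-true f (q ∷ qs) e with f q in e₁
      ... | true = q , here refl , e₁
      ... | false with any-true f qs e
      ...   | q′ , a , b = q′ , there a , b
      any-∋ : ∀ (f : Occurrence → Bool) {qs q} → q ∈ qs → f q ≡ true → any f qs ≡ true
      any-∋ f (here refl) e rewrite e = refl
      any-∋ f {q′ ∷ qs} (there h) e with f q′
      ... | true  = refl
      ... | false = any-∋ f h e
      clash : ∀ {qs p q ℓ} → Unique (concat (map labelsOf qs)) → p ∈ qs → q ∈ qs → p ≢ q → ℓ ∈ labelsOf p → ℓ ∈ labelsOf q → ⊥
      clash u (here refl) (here refl) n _ _ = n refl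
      clash {q′ ∷ qs} u (here refl) (there q) n a b = disjoint-++ (labelsOf q′) u a (∈-concatMap⁺ labelsOf q b)
        where
        disjoint-++ : ∀ (xs : List ℕ) {ys ℓ} → Unique (xs ++ ys) → ℓ ∈ xs → ℓ ∈ ys → ⊥
        disjoint-++ (x ∷ xs) (u ∷ us) (here refl) b = All.lookup u (∈-++⁺ʳ xs b) refl
        disjoint-++ (x ∷ xs) (u ∷ us) (there a)   b = disjoint-++ xs us a b
      clash u (there p) (here refl) n a b = clash u (here refl) (there p) (n ∘ sym) b a
      clash {q′ ∷ qs} u (there p) (there q) n a b = clash (drop-++ (labelsOf q′) u) p q n a b
        where
        drop-++ : ∀ (xs : List ℕ) {ys} → Unique (xs ++ ys) → Unique ys
        drop-++ []       u        = u
        drop-++ (x ∷ xs) (_ ∷ us) = drop-++ xs us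
      label-∈ : ∀ o b x o′ → (o′ , (not b , x)) ∈ occurrences → (if b then o * O + o′ else o′ * O + o) ∈ labelsOf (o , (b , x))
      label-∈ o b x o′ h = ∈-concatMap⁺ (labelsWith (o , (b , x))) h (subst (λ t → _ ∈ (if t then [ _ ] else [])) (sym (conflict-complete b x)) (here refl))
      true-pick : ∀ p → p ∈ ps → α (proj₂ (proj₂ p)) ≡ proj₁ (proj₂ p)
      true-pick (o , (true , x))  p∈ = any-∋ (positive x) p∈ (eq-refl x)
      true-pick (o , (false , x)) p∈ with α x in e
      ... | false = refl
      ... | true with any-true (positive x) ps e
      ...   | (o′ , (true , y)) , q∈ , e′ with eq-sound x y e′
      ...     | refl = ⊥-elim (clash {ps} uniq p∈ q∈ (λ ()) (label-∈ o false x o′ (picks-occur 0 φ ps ch′ q∈)) (label-∈ o′ true x o (picks-occur 0 φ ps ch′ p∈)))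
      sat : ∀ s ψ ps → Picks ψ s ps → All (λ p → α (proj₂ (proj₂ p)) ≡ proj₁ (proj₂ p)) ps → Satisfies α ψ
      sat s []      []       []       []       = []
      sat s (C ∷ ψ) (p ∷ ps) (h ∷ ch) (e ∷ es) = toAny (proj₂ (proj₂ (enumerate-at s C h))) e ∷ sat (length C + s) ψ ps ch es
        where
        toAny : ∀ {l C} → l ∈ C → α (proj₂ l) ≡ proj₁ l → Any (λ l → α (proj₂ l) ≡ proj₁ l) C
        toAny h e = Any.map (λ { refl → e }) h

    choices<L : All (All (All (_< O * O))) choices
    choices<L = go 0 φ id
      where
      row : ∀ ps → (∀ {p} → p ∈ ps → p ∈ occurrences) → All (All (_< O * O)) (map labelsOf ps)
      row []       sub = []
      row (p ∷ ps) sub = All.tabulate (labels<L (sub (here refl))) ∷ row ps (sub ∘ there)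
      go : ∀ s ψ → (∀ {p} → p ∈ enumerate s (concat ψ) → p ∈ occurrences) → All (All (All (_< O * O))) (map (map labelsOf) (enumerateAll s ψ))
      go s []      sub = []
      go s (C ∷ ψ) sub = row (enumerate s C) (λ h → sub (subst (_ ∈_) (sym (enumerate-++ s C (concat ψ))) (∈-++⁺ˡ h))) ∷
        go (length C + s) ψ (λ h → sub (subst (_ ∈_) (sym (enumerate-++ s C (concat ψ))) (∈-++⁺ʳ (enumerate s C) h)))

-- The computation of a Turing machine as a formula: the head stays at position 0
-- of the right half tape and the tape contents move.

nth : ∀ {aux} → List (Symbol aux) → ℕ → Symbol aux
nth []       i       = blank
nth (s ∷ ss) zero    = s
nth (s ∷ ss) (suc i) = nth ss i

leftCell rightCell : ∀ {aux} → Tape aux → ℕ → Symbol aux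
leftCell  (tape ls h rs) i = nth ls i
rightCell (tape ls h rs) i = nth (h ∷ rs) i

moveIndex : Move → ℕ
moveIndex left  = 0
moveIndex stay  = 1
moveIndex right = 2

symbolIndex-injective : ∀ {aux} (s t : Symbol aux) → symbolIndex s ≡ symbolIndex t → s ≡ t
symbolIndex-injective s t e = trans (sym (symbol-fin s)) (trans (cong fin→Symbol (Finₚ.toℕ-injective
  (trans (symbolIndex-toℕ s) (trans e (sym (symbolIndex-toℕ t)))))) (symbol-fin t))

moveIndex-injective : ∀ m n → moveIndex m ≡ moveIndex n → m ≡ n
moveIndex-injective left  left  e = refl
moveIndex-injective stay  stay  e = refl
moveIndex-injective right right e = refl

allSymbols : ∀ aux → List (Symbol aux)
allSymbols aux = map fin→Symbol (allFin (3 + aux))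

∈-allSymbols : ∀ {aux} (s : Symbol aux) → s ∈ allSymbols aux
∈-allSymbols s = subst (_∈ _) (symbol-fin s) (∈-map⁺ fin→Symbol (∈-allFin (symbol→Fin s)))

allVectors : ∀ aux n → List (Vec (Symbol aux) n)
allVectors aux zero    = [ [] ]
allVectors aux (suc n) = concatMap (λ s → map (s ∷_) (allVectors aux n)) (allSymbols aux)

∈-concatMap : ∀ {A B : Set} (f : A → List B) {xs x y} → x ∈ xs → y ∈ f x → y ∈ concatMap f xs
∈-concatMap f (here refl) h = ∈-++⁺ˡ h
∈-concatMap f {x ∷ xs} (there p) h = ∈-++⁺ʳ (f x) (∈-concatMap f p h)

All-concatMap : ∀ {A B : Set} {P : B → Set} (f : A → List B) xs → (∀ {x} → x ∈ xs → All P (f x)) → All P (concatMap f xs)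
All-concatMap f []       h = []
All-concatMap f (x ∷ xs) h = Allₚ.++⁺ (h (here refl)) (All-concatMap f xs (h ∘ there))

All-map : ∀ {A B : Set} {P : B → Set} (f : A → B) xs → (∀ {x} → x ∈ xs → P (f x)) → All P (map f xs)
All-map f xs h = Allₚ.map⁺ (All.tabulate h)

All-concatMap⁻ : ∀ {A B : Set} {P : B → Set} (f : A → List B) xs → All P (concatMap f xs) → ∀ {x} → x ∈ xs → All P (f x)
All-concatMap⁻ f (x ∷ xs) h (here refl) = Allₚ.++⁻ˡ (f x) h
All-concatMap⁻ f (x ∷ xs) h (there p)   = All-concatMap⁻ f xs (Allₚ.++⁻ʳ (f x) h) p

∈-allVectors : ∀ {aux n} (v : Vec (Symbol aux) n) → v ∈ allVectors aux n
∈-allVectors []      = here refl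
∈-allVectors {aux} {suc n} (s ∷ v) = ∈-concatMap (λ s → map (s ∷_) (allVectors aux n)) (∈-allSymbols s) (∈-map⁺ (s ∷_) (∈-allVectors v))

∈-range : ∀ s n {i} → s ≤ i → i < s + n → i ∈ range s n
∈-range s zero    h h′ = ⊥-elim (<⇒≱ h′ (≤-trans (≤-reflexive (+-identityʳ s)) h))
∈-range s (suc n) h h′ with m≤n⇒m<n∨m≡n h
... | inj₂ refl = here refl
... | inj₁ s<i  = there (∈-range (suc s) n s<i (≤-trans h′ (≤-reflexive (+-suc s n))))

range-∈ : ∀ s n {i} → i ∈ range s n → s ≤ i × i < s + n
range-∈ s (suc n) (here refl) = ≤-refl , ≤-trans (s≤s (m≤m+n s n)) (≤-reflexive (sym (+-suc s n)))
range-∈ s (suc n) (there h) with range-∈ (suc s) n h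
... | a , b = <⇒≤ a , ≤-trans b (≤-reflexive (sym (+-suc s n)))

module Tableau (M : TM) where
  open TM M
  open Interpreter M

  K : ℕ
  K = suc workTapes

  -- The variables `ac` state what is written on one tape and how its head moves. They decouple the
  -- tapes: only the clauses for transitions refer to all heads at once, while the clauses that
  -- update cells deal with a single tape.
  data Var : Set where
    stq    : Fin states → ℕ → Var
    ac    : Fin K → Symbol aux → Move → ℕ → Var
    lf rt : Fin K → Symbol aux → ℕ → ℕ → Var

  varIndex : Var → List ℕ
  varIndex (stq q t)     = 0 ∷ Fin.toℕ q ∷ t ∷ []
  varIndex (ac k s m t) = 1 ∷ Fin.toℕ k ∷ symbolIndex s ∷ moveIndex m ∷ t ∷ []
  varIndex (lf k s t i) = 2 ∷ Fin.toℕ k ∷ symbolIndex s ∷ t ∷ i ∷ []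
  varIndex (rt k s t i) = 3 ∷ Fin.toℕ k ∷ symbolIndex s ∷ t ∷ i ∷ []

  private
    ix : ℕ → List ℕ → ℕ
    ix = λ i xs → lookupOr 0 xs i

  varIndex-injective : ∀ x y → varIndex x ≡ varIndex y → x ≡ y
  varIndex-injective (stq q t) (stq q′ t′) e = cong₂ stq (Finₚ.toℕ-injective (cong (ix 1) e)) (cong (ix 2) e)
  varIndex-injective (ac k s m t) (ac k′ s′ m′ t′) e with Finₚ.toℕ-injective {i = k} {k′} (cong (ix 1) e) | symbolIndex-injective s s′ (cong (ix 2) e) | moveIndex-injective m m′ (cong (ix 3) e) | cong (ix 4) e
  ... | refl | refl | refl | refl = refl
  varIndex-injective (lf k s t i) (lf k′ s′ t′ i′) e with Finₚ.toℕ-injective {i = k} {k′} (cong (ix 1) e) | symbolIndex-injective s s′ (cong (ix 2) e) | cong (ix 3) e | cong (ix 4) e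
  ... | refl | refl | refl | refl = refl
  varIndex-injective (rt k s t i) (rt k′ s′ t′ i′) e with Finₚ.toℕ-injective {i = k} {k′} (cong (ix 1) e) | symbolIndex-injective s s′ (cong (ix 2) e) | cong (ix 3) e | cong (ix 4) e
  ... | refl | refl | refl | refl = refl

  eqVar : Var → Var → Bool
  eqVar x y = eqList eqNat (varIndex x) (varIndex y)

  eqVar-sound : ∀ x y → eqVar x y ≡ true → x ≡ y
  eqVar-sound x y e = varIndex-injective x y (eqList-sound eqNat-sound (varIndex x) (varIndex y) e)

  eqVar-refl : ∀ x → eqVar x x ≡ true
  eqVar-refl x = eqList-refl eqNat-refl (varIndex x)

  -- Where the machine halts, it writes back what it reads and stays. All runs can then be followed
  -- up to one fixed time.
  δᵗ : Fin states → Vec (Symbol aux) K → Fin states × Vec (Symbol aux × Move) K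
  δᵗ q v with δ q v
  ... | nothing = q , Vec.map (_, stay) v
  ... | just r  = r

  stepᵗ-δᵗ : ∀ q ts → let v = Vec.map Tape.head ts in
    stepᵗ (config q ts) ≡ config (proj₁ (δᵗ q v)) (Vec.zipWith act ts (proj₂ (δᵗ q v)))
  stepᵗ-δᵗ q ts with δ q (Vec.map Tape.head ts)
  ... | nothing = cong (config q) (sym (act-keep ts))
  ... | just _  = refl

  Clause : Set
  Clause = List (Bool × Var)

  implication : List Var → Var → Clause
  implication ps c = map (false ,_) ps ++ [ (true , c) ]

  reads : Vec (Symbol aux) K → ℕ → List Var
  reads v t = map (λ k → rt k (lookup v k) t 0) (allFin K)

  transition : Fin states → Vec (Symbol aux) K → ℕ → List Clause
  transition q v t =
    implication (stq q t ∷ reads v t) (stq (proj₁ (δᵗ q v)) (suc t)) ∷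
    map (λ k → implication (stq q t ∷ reads v t) (ac k (proj₁ (lookup (proj₂ (δᵗ q v)) k)) (proj₂ (lookup (proj₂ (δᵗ q v)) k)) t)) (allFin K)

  -- Cells are indexed by their distance from the head, so a move shifts both halves of the tape. On
  -- a move to the left, the nearest left cell comes under the head and the written symbol becomes
  -- right cell 1; a move to the right mirrors this.
  update : Fin K → Symbol aux → Symbol aux → Move → ℕ → ℕ → List Clause
  update k a s stay t i =
    implication (ac k s stay t ∷ lf k a t i ∷ []) (lf k a (suc t) i) ∷
    implication (ac k s stay t ∷ rt k a t (suc i) ∷ []) (rt k a (suc t) (suc i)) ∷
    implication (ac k s stay t ∷ []) (rt k s (suc t) 0) ∷ []
  update k a s left t i =
    implication (ac k s left t ∷ lf k a t (suc i) ∷ []) (lf k a (suc t) i) ∷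
    implication (ac k s left t ∷ lf k a t 0 ∷ []) (rt k a (suc t) 0) ∷
    implication (ac k s left t ∷ []) (rt k s (suc t) 1) ∷
    implication (ac k s left t ∷ rt k a t (suc i) ∷ []) (rt k a (suc t) (suc (suc i))) ∷ []
  update k a s right t i =
    implication (ac k s right t ∷ []) (lf k s (suc t) 0) ∷
    implication (ac k s right t ∷ lf k a t i ∷ []) (lf k a (suc t) (suc i)) ∷
    implication (ac k s right t ∷ rt k a t (suc i) ∷ []) (rt k a (suc t) i) ∷ []

  moves : List Move
  moves = left ∷ stay ∷ right ∷ []

  updatesₛ : Fin K → Symbol aux → Symbol aux → ℕ → ℕ → List Clause
  updatesₛ k a s t i = concatMap (λ m → update k a s m t i) moves

  updatesₐ : Fin K → Symbol aux → ℕ → ℕ → List Clause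
  updatesₐ k a t i = concatMap (λ s → updatesₛ k a s t i) (allSymbols aux)

  updatesₖ : Fin K → ℕ → ℕ → List Clause
  updatesₖ k t i = concatMap (λ a → updatesₐ k a t i) (allSymbols aux)

  updates : ℕ → ℕ → List Clause
  updates t i = concatMap (λ k → updatesₖ k t i) (allFin K)

  transitions : ℕ → List Clause
  transitions t = concatMap (λ q → concatMap (λ v → transition q v t) (allVectors aux K)) (allFin states)

  unit₁ : Var → Clause
  unit₁ x = [ (true , x) ]

  blanks : ℕ → List Clause
  blanks i = map (λ k → unit₁ (lf k blank 0 i)) (allFin K) ++ map (λ k → unit₁ (rt (suc k) blank 0 i)) (allFin workTapes)

  -- The three-way choice is the only source of freedom in the formula. The implication makes the
  -- guessed cells a string of bits followed by blanks, as in the input of a shorter certificate.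
  guess : ℕ → List Clause
  guess i = ((true , rt zero (bit false) 0 i) ∷ (true , rt zero (bit true) 0 i) ∷ (true , rt zero blank 0 i) ∷ []) ∷
            implication [ rt zero blank 0 i ] (rt zero blank 0 (suc i)) ∷ []

  -- The output is `[ true ]` iff cell 0 holds `true` and cell 1 holds no bit. Over all symbols,
  -- every other content of cell 0 and both bits in cell 1 are excluded.
  rejecting : Symbol aux → ℕ → List Clause
  rejecting (bit true) t  = [ [ (false , rt zero (bit true) t 1) ] ]
  rejecting (bit false) t = [ (false , rt zero (bit false) t 0) ] ∷ [ (false , rt zero (bit false) t 1) ] ∷ []
  rejecting s t           = [ [ (false , rt zero s t 0) ] ]

  -- The width `2 + t` is chosen because the acceptance test looks at cells 0 and 1 at time `t`, and
  -- each step may bring in information from one cell farther away.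
  initialBlanks : ℕ → List Clause
  initialBlanks t = concatMap blanks (range 0 (2 + t))

  prefixFrom : ℕ → List Bool → List Clause
  prefixFrom = scan (λ i b → [ unit₁ (rt zero (bit b) 0 i) ]) (λ _ → 1)

  guesses : List Bool → ℕ → List Clause
  guesses pre p = concatMap guess (range (length pre) p)

  beyond : List Bool → ℕ → ℕ → List Clause
  beyond pre p t = map (λ i → unit₁ (rt zero blank 0 i)) (range (length pre + p) (2 + t))

  allTransitions : ℕ → List Clause
  allTransitions t = concatMap transitions (range 0 t)

  updatesAt : ℕ → ℕ → List Clause
  updatesAt t τ = concatMap (updates τ) (range 0 (2 + t))

  allUpdates : ℕ → List Clause
  allUpdates t = concatMap (updatesAt t) (range 0 t)

  rejections : ℕ → List Clause
  rejections t = concatMap (λ s → rejecting s t) (allSymbols aux)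

  -- pre is the known part of the input; at most p guessed bits follow it.
  formula : List Bool → ℕ → ℕ → List Clause
  formula pre p t = unit₁ (stq start 0) ∷ initialBlanks t ++ prefixFrom 0 pre ++ guesses pre p ++ beyond pre p t ++
    allTransitions t ++ allUpdates t ++ rejections t

  at : Config M → ℕ → Config M
  at c zero    = c
  at c (suc t) = stepᵗ (at c t)

  at-runᵗ : ∀ t c → runᵗ t c ≡ at c t
  at-runᵗ zero    c = refl
  at-runᵗ (suc t) c = trans (at-runᵗ t (stepᵗ c)) (shift t c)
    where
    shift : ∀ t c → at (stepᵗ c) t ≡ stepᵗ (at c t)
    shift zero    c = refl
    shift (suc t) c = cong stepᵗ (shift t c)

  tapeOf : Config M → Fin K → Tape aux
  tapeOf c k = lookup (Config.tapes c) k

  decided : Config M → Fin states × Vec (Symbol aux × Move) K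
  decided c = δᵗ (Config.state c) (Vec.map Tape.head (Config.tapes c))

  state-step : ∀ c → Config.state (stepᵗ c) ≡ proj₁ (decided c)
  state-step (config q ts) = cong Config.state (stepᵗ-δᵗ q ts)

  tape-step : ∀ c k → tapeOf (stepᵗ c) k ≡ act (tapeOf c k) (lookup (proj₂ (decided c)) k)
  tape-step (config q ts) k = trans (cong (λ d → lookup (Config.tapes d) k) (stepᵗ-δᵗ q ts)) (lookup-zipWith act k ts _)

  head-cell : ∀ (t : Tape aux) → Tape.head t ≡ rightCell t 0
  head-cell (tape _ _ _) = refl

  cells-stay : ∀ (t : Tape aux) s i → leftCell (act t (s , stay)) i ≡ leftCell t i ×
    rightCell (act t (s , stay)) 0 ≡ s × rightCell (act t (s , stay)) (suc i) ≡ rightCell t (suc i)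
  cells-stay (tape _ _ _) s i = refl , refl , refl

  cells-left : ∀ (t : Tape aux) s i → leftCell (act t (s , left)) i ≡ leftCell t (suc i) ×
    rightCell (act t (s , left)) 0 ≡ leftCell t 0 × rightCell (act t (s , left)) 1 ≡ s ×
    rightCell (act t (s , left)) (suc (suc i)) ≡ rightCell t (suc i)
  cells-left (tape []      _ _) s i = refl , refl , refl , refl
  cells-left (tape (_ ∷ _) _ _) s i = refl , refl , refl , refl

  cells-right : ∀ (t : Tape aux) s i → leftCell (act t (s , right)) 0 ≡ s ×
    leftCell (act t (s , right)) (suc i) ≡ leftCell t i × rightCell (act t (s , right)) i ≡ rightCell t (suc i)
  cells-right (tape _ _ [])      s zero    = refl , refl , refl
  cells-right (tape _ _ [])      s (suc i) = refl , refl , refl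
  cells-right (tape _ _ (_ ∷ _)) s zero    = refl , refl , refl
  cells-right (tape _ _ (_ ∷ _)) s (suc i) = refl , refl , refl

  cell-input : ∀ z i → rightCell (inputTape {aux} z) i ≡ nth (map bit z) i
  cell-input []      zero    = refl
  cell-input []      (suc i) = refl
  cell-input (b ∷ z) zero    = refl
  cell-input (b ∷ z) (suc i) = refl

  output-cells : ∀ (t : Tape aux) → outputOf t ≡ [ true ] → rightCell t 0 ≡ bit true × (∀ b → rightCell t 1 ≢ bit b)
  output-cells (tape _ (bit true) [])            refl = refl , λ _ ()
  output-cells (tape _ (bit true) (blank ∷ _))   refl = refl , λ _ ()
  output-cells (tape _ (bit true) (other _ ∷ _)) refl = refl , λ _ ()

  cells-output : ∀ (t : Tape aux) → rightCell t 0 ≡ bit true → (∀ b → rightCell t 1 ≢ bit b) → outputOf t ≡ [ true ]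
  cells-output (tape _ (bit true) [])            refl h = refl
  cells-output (tape _ (bit true) (blank ∷ _))   refl h = refl
  cells-output (tape _ (bit true) (bit b ∷ _))   refl h = ⊥-elim (h b refl)
  cells-output (tape _ (bit true) (other _ ∷ _)) refl h = refl

  output-tape : ∀ c → output M c ≡ outputOf (tapeOf c zero)
  output-tape (config _ (_ ∷ _)) = refl

  nth-++ : ∀ v u i → length v ≤ i → nth {aux} (map bit (v ++ u)) i ≡ nth (map bit u) (i ∸ length v)
  nth-++ []      u i       h       = refl
  nth-++ (b ∷ v) u (suc i) (s≤s h) = nth-++ v u i h

  blank-left : ∀ z k i → leftCell (tapeOf (initial M z) k) i ≡ blank
  blank-left []      zero    i = refl
  blank-left (_ ∷ _) zero    i = refl
  blank-left z       (suc k) i = cong (λ t → leftCell t i) (lookup-replicate k blankTape)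

  blank-right : ∀ z k i → rightCell (tapeOf (initial M z) (suc k)) i ≡ blank
  blank-right z k i = trans (cong (λ t → rightCell t i) (lookup-replicate k blankTape)) (blank-tape i)
    where
    blank-tape : ∀ i → rightCell {aux} blankTape i ≡ blank
    blank-tape zero    = refl
    blank-tape (suc i) = refl

  -- An accepting run satisfies the formula

  module Completeness (pre u : List Bool) (p t : ℕ) (u≤p : length u ≤ p)
    (accepts : output M (at (initial M (pre ++ u)) t) ≡ [ true ]) where

    c : ℕ → Config M
    c = at (initial M (pre ++ u))

    Holds : Var → Set
    Holds (stq q τ)     = Config.state (c τ) ≡ q
    Holds (ac k s m τ) = lookup (proj₂ (decided (c τ))) k ≡ (s , m)
    Holds (lf k s τ i) = leftCell (tapeOf (c τ) k) i ≡ s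
    Holds (rt k s τ i) = rightCell (tapeOf (c τ) k) i ≡ s

    _≟ˢ_ : (s s′ : Symbol aux) → Dec (s ≡ s′)
    s ≟ˢ s′ with symbolIndex s Data.Nat.≟ symbolIndex s′
    ... | yes e = yes (symbolIndex-injective s s′ e)
    ... | no ¬e = no (¬e ∘ cong symbolIndex)

    holds? : ∀ x → Dec (Holds x)
    holds? (stq q τ) = Config.state (c τ) Finₚ.≟ q
    holds? (ac k s m τ) with lookup (proj₂ (decided (c τ))) k
    ... | s′ , m′ with s′ ≟ˢ s | moveIndex m′ Data.Nat.≟ moveIndex m
    ...   | yes refl | yes e = yes (cong (s ,_) (moveIndex-injective m′ m e))
    ...   | no ¬e    | _     = no (¬e ∘ cong proj₁)
    ...   | _        | no ¬e = no (¬e ∘ cong (moveIndex ∘ proj₂))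
    holds? (lf k s τ i) = leftCell (tapeOf (c τ) k) i ≟ˢ s
    holds? (rt k s τ i) = rightCell (tapeOf (c τ) k) i ≟ˢ s

    opaque
      α : Var → Bool
      α x = ⌊ holds? x ⌋

      α-true : ∀ x → Holds x → α x ≡ true
      α-true x h with holds? x
      ... | yes _ = refl
      ... | no ¬h = ⊥-elim (¬h h)

      α-false : ∀ x → ¬ Holds x → α x ≡ false
      α-false x ¬h with holds? x
      ... | yes h = ⊥-elim (¬h h)
      ... | no _  = refl

    Sat : Clause → Set
    Sat = Any (λ l → α (proj₂ l) ≡ proj₁ l)

    sat-unit : ∀ x → Holds x → Sat (unit₁ x)
    sat-unit x h = here (α-true x h)

    sat-implication : ∀ ps x → (All Holds ps → Holds x) → Sat (implication ps x)
    sat-implication []       x h = here (α-true x (h []))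
    sat-implication (y ∷ ps) x h = go (holds? y)
      where
      go : Dec (Holds y) → Sat (implication (y ∷ ps) x)
      go (yes hy) = there (sat-implication ps x (λ hs → h (hy ∷ hs)))
      go (no ¬hy) = here (α-false y ¬hy)

    heads-agree : ∀ {n} (ts : Vec (Tape aux) n) v → (∀ k → rightCell (lookup ts k) 0 ≡ lookup v k) → Vec.map Tape.head ts ≡ v
    heads-agree []       []      h = refl
    heads-agree (t ∷ ts) (s ∷ v) h = cong₂ _∷_ (trans (head-cell t) (h zero)) (heads-agree ts v (h ∘ suc))

    premises : ∀ q v τ → All Holds (stq q τ ∷ reads v τ) → decided (c τ) ≡ δᵗ q v
    premises q v τ (refl ∷ hs) = cong (δᵗ q) (heads-agree (Config.tapes (c τ)) v (λ k → All.lookup (Allₚ.map⁻ hs) (∈-allFin k)))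

    sat-transition : ∀ q v τ → All Sat (transition q v τ)
    sat-transition q v τ =
      sat-implication (stq q τ ∷ reads v τ) (stq (proj₁ (δᵗ q v)) (suc τ))
        (λ hs → trans (state-step (c τ)) (cong proj₁ (premises q v τ hs))) ∷
      Allₚ.map⁺ (All.tabulate (λ {k} _ → sat-implication (stq q τ ∷ reads v τ)
        (ac k (proj₁ (lookup (proj₂ (δᵗ q v)) k)) (proj₂ (lookup (proj₂ (δᵗ q v)) k)) τ)
        (λ hs → cong (λ d → lookup (proj₂ d) k) (premises q v τ hs))))

    moved : ∀ k s m τ → Holds (ac k s m τ) → tapeOf (c (suc τ)) k ≡ act (tapeOf (c τ) k) (s , m)
    moved k s m τ h = trans (tape-step (c τ) k) (cong (act (tapeOf (c τ) k)) h)

    sat-update : ∀ k a s m τ i → All Sat (update k a s m τ i)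
    sat-update k a s stay τ i =
      let l , r₀ , r = cells-stay (tapeOf (c τ) k) s i in
      sat-implication (ac k s stay τ ∷ lf k a τ i ∷ []) (lf k a (suc τ) i)
        (λ { (h ∷ h′ ∷ []) → trans (cong (λ t → leftCell t i) (moved k s stay τ h)) (trans l h′) }) ∷
      sat-implication (ac k s stay τ ∷ rt k a τ (suc i) ∷ []) (rt k a (suc τ) (suc i))
        (λ { (h ∷ h′ ∷ []) → trans (cong (λ t → rightCell t (suc i)) (moved k s stay τ h)) (trans r h′) }) ∷
      sat-implication (ac k s stay τ ∷ []) (rt k s (suc τ) 0)
        (λ { (h ∷ []) → trans (cong (λ t → rightCell t 0) (moved k s stay τ h)) r₀ }) ∷ []
    sat-update k a s left τ i =
      let l , r₀ , r₁ , r = cells-left (tapeOf (c τ) k) s i in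
      sat-implication (ac k s left τ ∷ lf k a τ (suc i) ∷ []) (lf k a (suc τ) i)
        (λ { (h ∷ h′ ∷ []) → trans (cong (λ t → leftCell t i) (moved k s left τ h)) (trans l h′) }) ∷
      sat-implication (ac k s left τ ∷ lf k a τ 0 ∷ []) (rt k a (suc τ) 0)
        (λ { (h ∷ h′ ∷ []) → trans (cong (λ t → rightCell t 0) (moved k s left τ h)) (trans r₀ h′) }) ∷
      sat-implication (ac k s left τ ∷ []) (rt k s (suc τ) 1)
        (λ { (h ∷ []) → trans (cong (λ t → rightCell t 1) (moved k s left τ h)) r₁ }) ∷
      sat-implication (ac k s left τ ∷ rt k a τ (suc i) ∷ []) (rt k a (suc τ) (suc (suc i)))
        (λ { (h ∷ h′ ∷ []) → trans (cong (λ t → rightCell t (suc (suc i))) (moved k s left τ h)) (trans r h′) }) ∷ []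
    sat-update k a s right τ i =
      let l₀ , l , r = cells-right (tapeOf (c τ) k) s i in
      sat-implication (ac k s right τ ∷ []) (lf k s (suc τ) 0)
        (λ { (h ∷ []) → trans (cong (λ t → leftCell t 0) (moved k s right τ h)) l₀ }) ∷
      sat-implication (ac k s right τ ∷ lf k a τ i ∷ []) (lf k a (suc τ) (suc i))
        (λ { (h ∷ h′ ∷ []) → trans (cong (λ t → leftCell t (suc i)) (moved k s right τ h)) (trans l h′) }) ∷
      sat-implication (ac k s right τ ∷ rt k a τ (suc i) ∷ []) (rt k a (suc τ) i)
        (λ { (h ∷ h′ ∷ []) → trans (cong (λ t → rightCell t i) (moved k s right τ h)) (trans r h′) }) ∷ []

    nth-bits : ∀ z i → (∃[ b ] nth {aux} (map bit z) i ≡ bit b) ⊎ nth {aux} (map bit z) i ≡ blank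
    nth-bits []      i       = inj₂ refl
    nth-bits (b ∷ z) zero    = inj₁ (b , refl)
    nth-bits (b ∷ z) (suc i) = nth-bits z i

    nth-blank : ∀ z i → nth {aux} (map bit z) i ≡ blank → nth {aux} (map bit z) (suc i) ≡ blank
    nth-blank []      i       e = refl
    nth-blank (b ∷ z) (suc i) e = nth-blank z i e

    nth-end : ∀ z i → length z ≤ i → nth {aux} (map bit z) i ≡ blank
    nth-end []      i       h       = refl
    nth-end (b ∷ z) (suc i) (s≤s h) = nth-end z i h

    cell₀ : ∀ i → rightCell (tapeOf (c 0) zero) i ≡ nth (map bit (pre ++ u)) i
    cell₀ = cell-input (pre ++ u)

    sat-guess : ∀ i → All Sat (guess i)
    sat-guess i = three (nth-bits (pre ++ u) i) ∷ sat-implication [ rt zero blank 0 i ] (rt zero blank 0 (suc i)) (λ { (h ∷ []) → trans (cell₀ (suc i)) (nth-blank (pre ++ u) i (trans (sym (cell₀ i)) h)) }) ∷ []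
      where
      three : (∃[ b ] nth {aux} (map bit (pre ++ u)) i ≡ bit b) ⊎ nth {aux} (map bit (pre ++ u)) i ≡ blank →
        Sat ((true , rt zero (bit false) 0 i) ∷ (true , rt zero (bit true) 0 i) ∷ (true , rt zero blank 0 i) ∷ [])
      three (inj₁ (false , e)) = here (α-true (rt zero (bit false) 0 i) (trans (cell₀ i) e))
      three (inj₁ (true , e))  = there (here (α-true (rt zero (bit true) 0 i) (trans (cell₀ i) e)))
      three (inj₂ e)           = there (there (here (α-true (rt zero blank 0 i) (trans (cell₀ i) e))))

    sat-prefix : ∀ s v → (∀ i → rightCell (tapeOf (c 0) zero) (s + i) ≡ nth (map bit (v ++ u)) i) →
      All Sat (prefixFrom s v)
    sat-prefix s []      h = []
    sat-prefix s (b ∷ v) h = sat-unit (rt zero (bit b) 0 s) (trans (cong (rightCell (tapeOf (c 0) zero)) (sym (+-identityʳ s))) (h 0)) ∷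
      sat-prefix (suc s) v (λ i → trans (cong (rightCell (tapeOf (c 0) zero)) (sym (+-suc s i))) (h (suc i)))

    sat-rejecting : ∀ s → All Sat (rejecting s t)
    sat-rejecting s = go s (output-cells (tapeOf (c t) zero) (trans (sym (output-tape (c t))) accepts))
      where
      other₀ : ∀ s → s ≢ bit true → rightCell (tapeOf (c t) zero) 0 ≡ bit true → Sat [ (false , rt zero s t 0) ]
      other₀ s ≢ e = here (α-false (rt zero s t 0) (λ h → ≢ (trans (sym h) e)))
      go : ∀ s → rightCell (tapeOf (c t) zero) 0 ≡ bit true × (∀ b → rightCell (tapeOf (c t) zero) 1 ≢ bit b) → All Sat (rejecting s t)
      go (bit true)  (e₀ , e₁) = here (α-false (rt zero (bit true) t 1) (e₁ true)) ∷ []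
      go (bit false) (e₀ , e₁) = other₀ (bit false) (λ ()) e₀ ∷ here (α-false (rt zero (bit false) t 1) (e₁ false)) ∷ []
      go blank       (e₀ , e₁) = other₀ blank (λ ()) e₀ ∷ []
      go (other i)   (e₀ , e₁) = other₀ (other i) (λ ()) e₀ ∷ []

    satisfies : Satisfies α (formula pre p t)
    satisfies = sat-unit (stq start 0) refl ∷
      Allₚ.++⁺ (All-concatMap blanks (range 0 (2 + t)) (λ {i} _ → Allₚ.++⁺
        (All-map (λ k → unit₁ (lf k blank 0 i)) (allFin K) (λ {k} _ → sat-unit (lf k blank 0 i) (blank-left (pre ++ u) k i)))
        (All-map (λ k → unit₁ (rt (suc k) blank 0 i)) (allFin workTapes) (λ {k} _ → sat-unit (rt (suc k) blank 0 i) (blank-right (pre ++ u) k i)))))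
      (Allₚ.++⁺ (sat-prefix 0 pre cell₀)
      (Allₚ.++⁺ (All-concatMap guess (range (length pre) p) (λ {i} _ → sat-guess i))
      (Allₚ.++⁺ (Allₚ.map⁺ (All.tabulate (λ {i} h → sat-unit (rt zero blank 0 i) (trans (cell₀ i) (nth-end (pre ++ u) i
          (≤-trans (≤-reflexive (length-++ pre)) (≤-trans (+-monoʳ-≤ (length pre) u≤p) (proj₁ (range-∈ (length pre + p) (2 + t) h)))))))))
      (Allₚ.++⁺ (All-concatMap transitions (range 0 t) (λ {τ} _ →
        All-concatMap (λ q → concatMap (λ v → transition q v τ) (allVectors aux K)) (allFin states) (λ {q} _ →
          All-concatMap (λ v → transition q v τ) (allVectors aux K) (λ {v} _ → sat-transition q v τ))))
      (Allₚ.++⁺ (All-concatMap (updatesAt t) (range 0 t) (λ {τ} _ →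
        All-concatMap (updates τ) (range 0 (2 + t)) (λ {i} _ →
          All-concatMap (λ k → updatesₖ k τ i) (allFin K) (λ {k} _ → All-concatMap (λ a → updatesₐ k a τ i) (allSymbols aux) (λ {a} _ →
            All-concatMap (λ s → updatesₛ k a s τ i) (allSymbols aux) (λ {s} _ →
              All-concatMap (λ m → update k a s m τ i) moves (λ {m} _ → sat-update k a s m τ i)))))))
      (All-concatMap (λ s → rejecting s t) (allSymbols aux) (λ {s} _ → sat-rejecting s)))))))

  -- A satisfying assignment yields an accepted certificate

  module Soundness (pre : List Bool) (p t : ℕ) (α : Var → Bool) (sat : Satisfies α (formula pre p t)) where

    Sat : Clause → Set
    Sat = Any (λ l → α (proj₂ l) ≡ proj₁ l)

    True : Var → Set
    True x = α x ≡ true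

    m W : ℕ
    m = length pre
    W = 2 + t

    unit-true : ∀ {x} → Sat (unit₁ x) → True x
    unit-true (here e) = e

    modus-ponens : ∀ ps x → Sat (implication ps x) → All True ps → True x
    modus-ponens []       x (here e)  []       = e
    modus-ponens (y ∷ ps) x (here e)  (h ∷ hs) with trans (sym h) e
    ... | ()
    modus-ponens (y ∷ ps) x (there s) (h ∷ hs) = modus-ponens ps x s hs

    after₁ : All Sat (initialBlanks t ++ prefixFrom 0 pre ++ guesses pre p ++ beyond pre p t ++ allTransitions t ++ allUpdates t ++ rejections t)
    after₁ = All.tail sat
    after₂ : All Sat (prefixFrom 0 pre ++ guesses pre p ++ beyond pre p t ++ allTransitions t ++ allUpdates t ++ rejections t)
    after₂ = Allₚ.++⁻ʳ (initialBlanks t) after₁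
    after₃ : All Sat (guesses pre p ++ beyond pre p t ++ allTransitions t ++ allUpdates t ++ rejections t)
    after₃ = Allₚ.++⁻ʳ (prefixFrom 0 pre) after₂
    after₄ : All Sat (beyond pre p t ++ allTransitions t ++ allUpdates t ++ rejections t)
    after₄ = Allₚ.++⁻ʳ (guesses pre p) after₃
    after₅ : All Sat (allTransitions t ++ allUpdates t ++ rejections t)
    after₅ = Allₚ.++⁻ʳ (beyond pre p t) after₄
    after₆ : All Sat (allUpdates t ++ rejections t)
    after₆ = Allₚ.++⁻ʳ (allTransitions t) after₅

    blanks-true : ∀ i → i < W → All Sat (blanks i)
    blanks-true i h = All-concatMap⁻ blanks (range 0 W) (Allₚ.++⁻ˡ (initialBlanks t) after₁) (∈-range 0 W z≤n h)

    left-true : ∀ k i → i < W → True (lf k blank 0 i)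
    left-true k i h = unit-true (All.lookup (Allₚ.map⁻ (Allₚ.++⁻ˡ (map (λ k → unit₁ (lf k blank 0 i)) (allFin K)) (blanks-true i h))) (∈-allFin k))

    right-true : ∀ k i → i < W → True (rt (suc k) blank 0 i)
    right-true k i h = unit-true (All.lookup (Allₚ.map⁻ (Allₚ.++⁻ʳ (map (λ k → unit₁ (lf k blank 0 i)) (allFin K)) (blanks-true i h))) (∈-allFin k))

    prefix-true : ∀ s v → All Sat (prefixFrom s v) →
      ∀ u j → j < length v → True (rt zero (nth (map bit (v ++ u)) j) 0 (s + j))
    prefix-true s (b ∷ v) (h ∷ hs) u zero    _       = trans (cong (λ z → α (rt zero (bit b) 0 z)) (+-identityʳ s)) (unit-true h)
    prefix-true s (b ∷ v) (h ∷ hs) u (suc j) (s≤s l) = trans (cong (λ z → α (rt zero (nth (map bit (v ++ u)) j) 0 z)) (+-suc s j)) (prefix-true (suc s) v hs u j l)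

    guess-true : ∀ i → m ≤ i → i < m + p → All Sat (guess i)
    guess-true i h h′ = All-concatMap⁻ guess (range m p) (Allₚ.++⁻ˡ (guesses pre p) after₃) (∈-range m p h h′)

    beyond-true : ∀ i → m + p ≤ i → i < m + p + W → True (rt zero blank 0 i)
    beyond-true i h h′ = unit-true (All.lookup (Allₚ.map⁻ (Allₚ.++⁻ˡ (beyond pre p t) after₄)) (∈-range (m + p) W h h′))

    blank-onwards : ∀ i → m ≤ i → True (rt zero blank 0 i) → ∀ j → i + j < m + p + W → True (rt zero blank 0 (i + j))
    blank-onwards i h e zero    _ = trans (cong (λ z → α (rt zero blank 0 z)) (+-identityʳ i)) e
    blank-onwards i h e (suc j) l = go (i + j <? m + p)
      where
      go : Dec (i + j < m + p) → True (rt zero blank 0 (i + suc j))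
      go (yes l′) = trans (cong (λ z → α (rt zero blank 0 z)) (+-suc i j))
        (modus-ponens [ rt zero blank 0 (i + j) ] (rt zero blank 0 (suc (i + j)))
          (All.head (All.tail (guess-true (i + j) (≤-trans h (m≤m+n i j)) l′)))
          (blank-onwards i h e j (≤-trans (s≤s (≤-trans (n≤1+n _) (≤-reflexive (sym (+-suc i j))))) l) ∷ []))
      go (no ¬l′) = beyond-true (i + suc j) (≤-trans (≮⇒≥ ¬l′) (≤-trans (n≤1+n _) (≤-reflexive (sym (+-suc i j))))) l

    Reads : ℕ → List Bool → Set
    Reads i u = ∀ j → i + j < m + p + W → True (rt zero (nth (map bit u) j) 0 (i + j))

    -- The certificate is read off cell by cell, following the literal that the satisfied clause
    -- provides; others may be true as well. The first blank ends it, and by `blank-onwards` all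
    -- later cells are then blank.
    guessed : ∀ r i → i + r ≡ m + p → m ≤ i → ∃[ u ] length u ≤ r × Reads i u
    guessed zero    i e h = [] , z≤n , λ j l → beyond-true (i + j) (≤-trans (≤-reflexive (trans (sym e) (+-identityʳ i))) (m≤m+n i j)) l
    guessed (suc r) i e h = choose (All.head (guess-true i h (≤-trans (s≤s (m≤m+n i r)) (≤-reflexive (trans (sym (+-suc i r)) e)))))
                                   (guessed r (suc i) (trans (sym (+-suc i r)) e) (≤-trans h (n≤1+n i)))
      where
      extend : ∀ b → True (rt zero (bit b) 0 i) → (∃[ u ] length u ≤ r × Reads (suc i) u) → ∃[ u ] length u ≤ suc r × Reads i u
      extend b e (u , l , reads) = b ∷ u , s≤s l , λ
        { zero    _  → trans (cong (λ z → α (rt zero (bit b) 0 z)) (+-identityʳ i)) e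
        ; (suc j) l′ → trans (cong (λ z → α (rt zero (nth (map bit u) j) 0 z)) (+-suc i j)) (reads j (subst (_< m + p + W) (+-suc i j) l′)) }
      choose : Sat ((true , rt zero (bit false) 0 i) ∷ (true , rt zero (bit true) 0 i) ∷ (true , rt zero blank 0 i) ∷ []) →
        (∃[ u ] length u ≤ r × Reads (suc i) u) → ∃[ u ] length u ≤ suc r × Reads i u
      choose (here e)                 ih = extend false e ih
      choose (there (here e))         ih = extend true e ih
      choose (there (there (here e))) ih = [] , z≤n , λ j l → blank-onwards i h e j l

    certificate : ∃[ u ] length u ≤ p × Reads m u
    certificate = guessed p m refl ≤-refl

    u : List Bool
    u = proj₁ certificate

    c : ℕ → Config M
    c = at (initial M (pre ++ u))

    input-true : ∀ i → i < W → True (rt zero (nth (map bit (pre ++ u)) i) 0 i)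
    input-true i h = go (i <? m)
      where
      go : Dec (i < m) → True (rt zero (nth (map bit (pre ++ u)) i) 0 i)
      go (yes l) = prefix-true 0 pre (Allₚ.++⁻ˡ (prefixFrom 0 pre) after₂) u i l
      go (no ¬l) = subst₂ (λ a z → True (rt zero a 0 z)) (sym (nth-++ pre u i (≮⇒≥ ¬l))) (m+[n∸m]≡n (≮⇒≥ ¬l))
        (proj₂ (proj₂ certificate) (i ∸ m) (subst (_< m + p + W) (sym (m+[n∸m]≡n (≮⇒≥ ¬l))) (≤-trans h (m≤n+m W (m + p)))))

    -- The variables that describe the actual run are true, in a window that loses one cell per
    -- step, because a move may depend on the next cell outside.
    record Tracks (τ : ℕ) : Set where
      field
        state : True (stq (Config.state (c τ)) τ)
        lefts : ∀ k i → i + τ < W → True (lf k (leftCell (tapeOf (c τ) k) i) τ i)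
        rights : ∀ k i → i + τ < W → True (rt k (rightCell (tapeOf (c τ) k) i) τ i)
    open Tracks

    tracks-zero : Tracks 0
    tracks-zero = record
      { state  = unit-true (All.head sat)
      ; lefts  = λ k i h → subst (λ a → True (lf k a 0 i)) (sym (blank-left (pre ++ u) k i)) (left-true k i (subst (_< W) (+-identityʳ i) h))
      ; rights = λ
        { zero    i h → subst (λ a → True (rt zero a 0 i)) (sym (cell-input (pre ++ u) i)) (input-true i (subst (_< W) (+-identityʳ i) h))
        ; (suc k) i h → subst (λ a → True (rt (suc k) a 0 i)) (sym (blank-right (pre ++ u) k i)) (right-true k i (subst (_< W) (+-identityʳ i) h)) } }

    update-true : ∀ τ → τ < t → ∀ i → i < W → ∀ k a s m → All Sat (update k a s m τ i)
    update-true τ h i h′ k a s m = All-concatMap⁻ (λ m → update k a s m τ i) moves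
      (All-concatMap⁻ (λ s → updatesₛ k a s τ i) (allSymbols aux) (All-concatMap⁻ (λ a → updatesₐ k a τ i) (allSymbols aux)
        (All-concatMap⁻ (λ k → updatesₖ k τ i) (allFin K)
        (All-concatMap⁻ (updates τ) (range 0 W) (All-concatMap⁻ (updatesAt t) (range 0 t)
          (Allₚ.++⁻ˡ (allUpdates t) after₆)
          (∈-range 0 t z≤n h)) (∈-range 0 W z≤n h′)) (∈-allFin k)) (∈-allSymbols a)) (∈-allSymbols s)) (∈-moves m)
      where
      ∈-moves : ∀ m → m ∈ moves
      ∈-moves left  = here refl
      ∈-moves stay  = there (here refl)
      ∈-moves right = there (there (here refl))

    tracks-suc : ∀ τ → τ < t → Tracks τ → Tracks (suc τ)
    tracks-suc τ τ<t T = record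
      { state  = subst (λ q → True (stq q (suc τ))) (sym (state-step (c τ))) (modus-ponens _ (stq (proj₁ (decided (c τ))) (suc τ)) (All.head clauses) premises)
      ; lefts  = λ k i h → subst (λ tp → True (lf k (leftCell tp i) (suc τ) i)) (sym (tape-step (c τ) k))
          (proj₁ (cells k (proj₁ (action k)) (proj₂ (action k)) (acts k)) i h)
      ; rights = λ k i h → subst (λ tp → True (rt k (rightCell tp i) (suc τ) i)) (sym (tape-step (c τ) k))
          (proj₂ (cells k (proj₁ (action k)) (proj₂ (action k)) (acts k)) i h) }
      where
      q : Fin states
      q = Config.state (c τ)
      v : Vec (Symbol aux) K
      v = Vec.map Tape.head (Config.tapes (c τ))
      action : Fin K → Symbol aux × Move
      action k = lookup (proj₂ (decided (c τ))) k
      clauses : All Sat (transition q v τ)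
      clauses = All-concatMap⁻ (λ v → transition q v τ) (allVectors aux K)
        (All-concatMap⁻ (λ q → concatMap (λ v → transition q v τ) (allVectors aux K)) (allFin states)
          (All-concatMap⁻ transitions (range 0 t) (Allₚ.++⁻ˡ (allTransitions t) after₅) (∈-range 0 t z≤n τ<t))
          (∈-allFin q)) (∈-allVectors v)
      premises : All True (stq q τ ∷ reads v τ)
      premises = state T ∷ All-map (λ k → rt k (lookup v k) τ 0) (allFin K) (λ {k} _ →
        subst (λ a → True (rt k a τ 0)) (sym (trans (lookup-map k Tape.head (Config.tapes (c τ))) (head-cell (tapeOf (c τ) k))))
          (rights T k 0 (≤-trans τ<t (≤-trans (n≤1+n t) (n≤1+n (suc t))))))
      acts : ∀ k → True (ac k (proj₁ (action k)) (proj₂ (action k)) τ)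
      acts k = modus-ponens (stq q τ ∷ reads v τ) (ac k (proj₁ (action k)) (proj₂ (action k)) τ) (All.lookup (Allₚ.map⁻ (All.tail clauses)) (∈-allFin k)) premises
      shorter : ∀ {i} → i + suc τ < W → i + τ < W
      shorter {i} h = ≤-trans (s≤s (≤-trans (n≤1+n _) (≤-reflexive (sym (+-suc i τ))))) h
      within : ∀ {i j} → i + j < W → i < W
      within {i} {j} h = ≤-trans (s≤s (m≤m+n i j)) h
      0+ : τ < W
      0+ = ≤-trans τ<t (≤-trans (n≤1+n t) (n≤1+n (suc t)))
      cells : ∀ k s m → True (ac k s m τ) → let tp = act (tapeOf (c τ) k) (s , m) in
        (∀ i → i + suc τ < W → True (lf k (leftCell tp i) (suc τ) i)) × (∀ i → i + suc τ < W → True (rt k (rightCell tp i) (suc τ) i))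
      cells k s stay e = L , R
        where
        tp = tapeOf (c τ) k
        L : ∀ i → i + suc τ < W → True (lf k (leftCell (act tp (s , stay)) i) (suc τ) i)
        L i h = subst (λ a → True (lf k a (suc τ) i)) (sym (proj₁ (cells-stay tp s i)))
          (modus-ponens (ac k s stay τ ∷ lf k (leftCell tp i) τ i ∷ []) (lf k (leftCell tp i) (suc τ) i)
            (All.head (update-true τ τ<t i (within h) k (leftCell tp i) s stay)) (e ∷ lefts T k i (shorter h) ∷ []))
        R : ∀ i → i + suc τ < W → True (rt k (rightCell (act tp (s , stay)) i) (suc τ) i)
        R zero    h = subst (λ a → True (rt k a (suc τ) 0)) (sym (proj₁ (proj₂ (cells-stay tp s 0))))
          -- The arguments `blank` and 0 are arbitrary: this clause mentions neither a further
          -- symbol nor a cell index.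
          (modus-ponens (ac k s stay τ ∷ []) (rt k s (suc τ) 0) (All.head (All.tail (All.tail (update-true τ τ<t 0 (s≤s z≤n) k blank s stay)))) (e ∷ []))
        R (suc i) h = subst (λ a → True (rt k a (suc τ) (suc i))) (sym (proj₂ (proj₂ (cells-stay tp s i))))
          (modus-ponens (ac k s stay τ ∷ rt k (rightCell tp (suc i)) τ (suc i) ∷ []) (rt k (rightCell tp (suc i)) (suc τ) (suc i))
            (All.head (All.tail (update-true τ τ<t i (<⇒≤ (within {suc i} h)) k (rightCell tp (suc i)) s stay))) (e ∷ rights T k (suc i) (shorter {suc i} h) ∷ []))
      cells k s left e = L , R
        where
        tp = tapeOf (c τ) k
        L : ∀ i → i + suc τ < W → True (lf k (leftCell (act tp (s , left)) i) (suc τ) i)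
        L i h = subst (λ a → True (lf k a (suc τ) i)) (sym (proj₁ (cells-left tp s i)))
          (modus-ponens (ac k s left τ ∷ lf k (leftCell tp (suc i)) τ (suc i) ∷ []) (lf k (leftCell tp (suc i)) (suc τ) i)
            (All.head (update-true τ τ<t i (within h) k (leftCell tp (suc i)) s left)) (e ∷ lefts T k (suc i) (subst (_< W) (+-suc i τ) h) ∷ []))
        R : ∀ i → i + suc τ < W → True (rt k (rightCell (act tp (s , left)) i) (suc τ) i)
        R zero    h = subst (λ a → True (rt k a (suc τ) 0)) (sym (proj₁ (proj₂ (cells-left tp s 0))))
          (modus-ponens (ac k s left τ ∷ lf k (leftCell tp 0) τ 0 ∷ []) (rt k (leftCell tp 0) (suc τ) 0)
            (All.head (All.tail (update-true τ τ<t 0 (s≤s z≤n) k (leftCell tp 0) s left))) (e ∷ lefts T k 0 0+ ∷ []))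
        R (suc zero) h = subst (λ a → True (rt k a (suc τ) 1)) (sym (proj₁ (proj₂ (proj₂ (cells-left tp s 0)))))
          (modus-ponens (ac k s left τ ∷ []) (rt k s (suc τ) 1) (All.head (All.tail (All.tail (update-true τ τ<t 0 (s≤s z≤n) k blank s left)))) (e ∷ []))
        R (suc (suc i)) h = subst (λ a → True (rt k a (suc τ) (suc (suc i)))) (sym (proj₂ (proj₂ (proj₂ (cells-left tp s i)))))
          (modus-ponens (ac k s left τ ∷ rt k (rightCell tp (suc i)) τ (suc i) ∷ []) (rt k (rightCell tp (suc i)) (suc τ) (suc (suc i)))
            (All.head (All.tail (All.tail (All.tail (update-true τ τ<t i (<⇒≤ (<⇒≤ (within {suc (suc i)} h))) k (rightCell tp (suc i)) s left)))))
            (e ∷ rights T k (suc i) (<⇒≤ (shorter {suc (suc i)} h)) ∷ []))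
      cells k s right e = L , R
        where
        tp = tapeOf (c τ) k
        L : ∀ i → i + suc τ < W → True (lf k (leftCell (act tp (s , right)) i) (suc τ) i)
        L zero    h = subst (λ a → True (lf k a (suc τ) 0)) (sym (proj₁ (cells-right tp s 0)))
          (modus-ponens (ac k s right τ ∷ []) (lf k s (suc τ) 0) (All.head (update-true τ τ<t 0 (s≤s z≤n) k blank s right)) (e ∷ []))
        L (suc i) h = subst (λ a → True (lf k a (suc τ) (suc i))) (sym (proj₁ (proj₂ (cells-right tp s i))))
          (modus-ponens (ac k s right τ ∷ lf k (leftCell tp i) τ i ∷ []) (lf k (leftCell tp i) (suc τ) (suc i))
            (All.head (All.tail (update-true τ τ<t i (<⇒≤ (within {suc i} h)) k (leftCell tp i) s right))) (e ∷ lefts T k i (<⇒≤ (shorter {suc i} h)) ∷ []))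
        R : ∀ i → i + suc τ < W → True (rt k (rightCell (act tp (s , right)) i) (suc τ) i)
        R i h = subst (λ a → True (rt k a (suc τ) i)) (sym (proj₂ (proj₂ (cells-right tp s i))))
          (modus-ponens (ac k s right τ ∷ rt k (rightCell tp (suc i)) τ (suc i) ∷ []) (rt k (rightCell tp (suc i)) (suc τ) i)
            (All.head (All.tail (All.tail (update-true τ τ<t i (within h) k (rightCell tp (suc i)) s right)))) (e ∷ rights T k (suc i) (subst (_< W) (+-suc i τ) h) ∷ []))

    tracks : ∀ τ → τ ≤ t → Tracks τ
    tracks zero    h = tracks-zero
    tracks (suc τ) h = tracks-suc τ h (tracks τ (<⇒≤ h))

    rejecting-true : ∀ s → All Sat (rejecting s t)
    rejecting-true s = All-concatMap⁻ (λ s → rejecting s t) (allSymbols aux) (Allₚ.++⁻ʳ (allUpdates t) after₆) (∈-allSymbols s)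

    unit-false : ∀ {x} → Sat [ (false , x) ] → ¬ True x
    unit-false (here e) e′ with trans (sym e) e′
    ... | ()

    -- Cells 0 and 1 are still inside the tracked window at time `t`, and the final clauses leave
    -- them only contents of an accepting output.
    accepts : output M (c t) ≡ [ true ]
    accepts = trans (output-tape (c t)) (cells-output (tapeOf (c t) zero) (first _ (rights (tracks t ≤-refl) zero 0 (n≤1+n (suc t))))
      (λ b e → second b (subst (λ a → True (rt zero a t 1)) e (rights (tracks t ≤-refl) zero 1 ≤-refl))))
      where
      first : ∀ s → True (rt zero s t 0) → s ≡ bit true
      first (bit true)  e = refl
      first (bit false) e = ⊥-elim (unit-false (All.head (rejecting-true (bit false))) e)
      first blank       e = ⊥-elim (unit-false (All.head (rejecting-true blank)) e)
      first (other i)   e = ⊥-elim (unit-false (All.head (rejecting-true (other i))) e)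
      second : ∀ b → ¬ True (rt zero (bit b) t 1)
      second true  = unit-false (All.head (rejecting-true (bit true)))
      second false = unit-false (All.head (All.tail (rejecting-true (bit false))))

-- The formula is computable

module _ {A Γ Y : Set} {{_ : Enc Γ}} {{_ : Enc Y}} where

  -- The list depends on the machine alone and is unrolled into the program, so its items may be of
  -- a type without codes.
  constConcatMapC : (xs : List A) {f : A → Γ → List Y} → (∀ a → Comp (f a)) → Comp (λ γ → concatMap (λ a → f a γ) xs)
  constConcatMapC []       cf = constC []
  constConcatMapC (x ∷ xs) cf = appendC (cf x) (constConcatMapC xs cf)

  constMapC : (xs : List A) {f : A → Γ → Y} → (∀ a → Comp (f a)) → Comp (λ γ → map (λ a → f a γ) xs)
  constMapC []       cf = constC []
  constMapC (x ∷ xs) cf = consC (cf x) (constMapC xs cf)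

module FormulaC (M : TM) where
  open TM M
  open Tableau M

  instance
    Enc-Var : Enc Var
    Enc-Var = record { enc = λ x → enc (varIndex x) }

  eqVarC : Comp {Var × Var} (λ p → eqVar (proj₁ p) (proj₂ p))
  eqVarC = eqListC eqNatC (coeC varIndex (λ _ → refl) ∙ fstC) (coeC varIndex (λ _ → refl) ∙ sndC)

  module _ {Γ : Set} {{_ : Enc Γ}} where

    stC : ∀ q {t : Γ → ℕ} → Comp t → Comp (λ γ → stq q (t γ))
    stC q ct = recodeC (λ _ → refl) (consC (constC 0) (consC (constC (Fin.toℕ q)) (singleC ct)))

    acC : ∀ k s m {t : Γ → ℕ} → Comp t → Comp (λ γ → ac k s m (t γ))
    acC k s m ct = recodeC (λ _ → refl) (consC (constC 1) (consC (constC (Fin.toℕ k)) (consC (constC (symbolIndex s)) (consC (constC (moveIndex m)) (singleC ct)))))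

    lfC : ∀ k s {t i : Γ → ℕ} → Comp t → Comp i → Comp (λ γ → lf k s (t γ) (i γ))
    lfC k s ct ci = recodeC (λ _ → refl) (consC (constC 2) (consC (constC (Fin.toℕ k)) (consC (constC (symbolIndex s)) (consC ct (singleC ci)))))

    rtC : ∀ k s {t i : Γ → ℕ} → Comp t → Comp i → Comp (λ γ → rt k s (t γ) (i γ))
    rtC k s ct ci = recodeC (λ _ → refl) (consC (constC 3) (consC (constC (Fin.toℕ k)) (consC (constC (symbolIndex s)) (consC ct (singleC ci)))))

    literalC : ∀ (b : Bool) {x : Γ → Var} → Comp x → Comp (λ γ → b , x γ)
    literalC b cx = constC b ,C cx

    unit₁C : {x : Γ → Var} → Comp x → Comp (λ γ → unit₁ (x γ))
    unit₁C cx = singleC (literalC true cx)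

  module _ {Γ : Set} {{_ : Enc Γ}} where

    implicationC : {ps : Γ → List Var} {x : Γ → Var} → Comp ps → Comp x → Comp (λ γ → implication (ps γ) (x γ))
    implicationC cps cx = appendC (mapC (literalC false sndC) cps) (singleC (literalC true cx))

  transitionC : ∀ q v → Comp (transition q v)
  transitionC q v = consC (implicationC ps (stC (proj₁ (δᵗ q v)) (sucC idC)))
    (constMapC (allFin K) (λ k → implicationC ps (acC k (proj₁ (lookup (proj₂ (δᵗ q v)) k)) (proj₂ (lookup (proj₂ (δᵗ q v)) k)) idC)))
    where
    ps : Comp (λ t → stq q t ∷ reads v t)
    ps = consC (stC q idC) (constMapC (allFin K) (λ k → rtC k (lookup v k) idC (constC 0)))

  updateC : ∀ k a s m → Comp {ℕ × ℕ} (λ p → update k a s m (proj₁ p) (proj₂ p))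
  updateC k a s stay =
    consC (implicationC (consC (acC k s stay fstC) (singleC (lfC k a fstC sndC))) (lfC k a (sucC fstC) sndC))
    (consC (implicationC (consC (acC k s stay fstC) (singleC (rtC k a fstC (sucC sndC)))) (rtC k a (sucC fstC) (sucC sndC)))
    (singleC (implicationC (singleC (acC k s stay fstC)) (rtC k s (sucC fstC) (constC 0)))))
  updateC k a s left =
    consC (implicationC (consC (acC k s left fstC) (singleC (lfC k a fstC (sucC sndC)))) (lfC k a (sucC fstC) sndC))
    (consC (implicationC (consC (acC k s left fstC) (singleC (lfC k a fstC (constC 0)))) (rtC k a (sucC fstC) (constC 0)))
    (consC (implicationC (singleC (acC k s left fstC)) (rtC k s (sucC fstC) (constC 1)))
    (singleC (implicationC (consC (acC k s left fstC) (singleC (rtC k a fstC (sucC sndC)))) (rtC k a (sucC fstC) (sucC (sucC sndC)))))))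
  updateC k a s right =
    consC (implicationC (singleC (acC k s right fstC)) (lfC k s (sucC fstC) (constC 0)))
    (consC (implicationC (consC (acC k s right fstC) (singleC (lfC k a fstC sndC))) (lfC k a (sucC fstC) (sucC sndC)))
    (singleC (implicationC (consC (acC k s right fstC) (singleC (rtC k a fstC (sucC sndC)))) (rtC k a (sucC fstC) sndC))))

  updatesC : Comp {ℕ × ℕ} (λ p → updates (proj₁ p) (proj₂ p))
  updatesC = constConcatMapC (allFin K) (λ k → constConcatMapC (allSymbols aux) (λ a → constConcatMapC (allSymbols aux) (λ s →
    constConcatMapC moves (λ m → updateC k a s m))))

  transitionsC : Comp transitions
  transitionsC = constConcatMapC (allFin states) (λ q → constConcatMapC (allVectors aux K) (transitionC q))

  blanksC : Comp blanks
  blanksC = appendC (constMapC (allFin K) (λ k → unit₁C (lfC k blank (constC 0) idC)))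
                    (constMapC (allFin workTapes) (λ k → unit₁C (rtC (suc k) blank (constC 0) idC)))

  guessC : Comp guess
  guessC = consC (consC (literalC true (rtC zero (bit false) (constC 0) idC)) (consC (literalC true (rtC zero (bit true) (constC 0) idC))
      (singleC (literalC true (rtC zero blank (constC 0) idC)))))
    (singleC (implicationC (singleC (rtC zero blank (constC 0) idC)) (rtC zero blank (constC 0) (sucC idC))))

  rejectingC : ∀ s → Comp (rejecting s)
  rejectingC (bit true)  = singleC (singleC (literalC false (rtC zero (bit true) idC (constC 1))))
  rejectingC (bit false) = consC (singleC (literalC false (rtC zero (bit false) idC (constC 0))))
    (singleC (singleC (literalC false (rtC zero (bit false) idC (constC 1)))))
  rejectingC blank       = singleC (singleC (literalC false (rtC zero blank idC (constC 0))))
  rejectingC (other i)   = singleC (singleC (literalC false (rtC zero (other i) idC (constC 0))))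

  formulaC : Comp {List Bool × (ℕ × ℕ)} (λ p → formula (proj₁ p) (proj₁ (proj₂ p)) (proj₂ (proj₂ p)))
  formulaC =
    consC (unit₁C (stC start (constC 0)))
    (appendC (concatMapC (blanksC ∙ sndC) (rangeC (constC 0) width))
    (appendC (scanC (singleC (unit₁C (extC (λ { ((_ , i) , true) → refl ; ((_ , i) , false) → refl })
        (ifC sndC (rtC zero (bit true) (constC 0) (sfC)) (rtC zero (bit false) (constC 0) (sfC)))))) (constC 1) fstC (constC 0))
    (appendC (concatMapC (guessC ∙ sndC) (rangeC (lengthC fstC) (fsC)))
    (appendC (mapC (unit₁C (rtC zero blank (constC 0) sndC)) (rangeC (plusC (lengthC fstC) (fsC)) width))
    (appendC (concatMapC (transitionsC ∙ sndC) (rangeC (constC 0) (ssC)))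
    (appendC (concatMapC (concatMapC (updatesC ∙ (sfC ,C sndC)) (rangeC (constC 0) (width ∙ fstC))) (rangeC (constC 0) (ssC)))
    (constConcatMapC (allSymbols aux) (λ s → rejectingC s ∙ ssC))))))))
    where
    width : Comp {List Bool × (ℕ × ℕ)} (λ p → 2 + proj₂ (proj₂ p))
    width = sucC (sucC (ssC))

-- The scheduling instance is computable

module ConflictsC {X : Set} {{_ : Enc X}} (eq : X → X → Bool) (eq-sound : ∀ x y → eq x y ≡ true → x ≡ y) (eq-refl : ∀ x → eq x x ≡ true)
  (eqC : Comp {X × X} (λ p → eq (proj₁ p) (proj₂ p))) where

  module Cf = Conflicts eq eq-sound eq-refl

  concatC : {Γ Y : Set} {{_ : Enc Γ}} {{_ : Enc Y}} {f : Γ → List (List Y)} → Comp f → Comp (λ γ → concat (f γ))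
  concatC {f = f} cf = extC (λ γ → cong concat (sym (map-id (f γ)))) (concatMapC {f = λ _ x → x} sndC cf)

  enumerateC : Comp {ℕ × List (Bool × X)} (λ p → enumerate (proj₁ p) (proj₂ p))
  enumerateC = scanC (singleC (sfC ,C sndC)) (constC 1) sndC fstC

  enumerateAllC : {Γ : Set} {{_ : Enc Γ}} {φ : Γ → CNF {X}} → Comp φ → Comp (λ γ → enumerateAll 0 (φ γ))
  enumerateAllC cφ = scanC (singleC (enumerateC ∙ (sfC ,C sndC))) (lengthC sndC) cφ (constC 0)

  OC : {Γ : Set} {{_ : Enc Γ}} {φ : Γ → CNF {X}} → Comp φ → Comp (λ γ → Cf.O (φ γ))
  OC cφ = lengthC (concatC cφ)

  private
    Env : Set
    Env = (CNF {X} × Occurrence {X}) × Occurrence {X}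
    signC : Comp {Env} (λ p → proj₁ (proj₂ (proj₂ (proj₁ p))))
    signC = fsC ∙ sfC
    sign′C : Comp {Env} (λ p → proj₁ (proj₂ (proj₂ p)))
    sign′C = fstC ∙ ssC
    indexC : Comp {Env} (λ p → proj₁ (proj₂ (proj₁ p)))
    indexC = fstC ∙ sfC
    index′C : Comp {Env} (λ p → proj₁ (proj₂ p))
    index′C = fsC
    ordC : Comp {Env} (λ p → Cf.O (proj₁ (proj₁ p)))
    ordC = OC (ffC)
    atomC : Comp {Env} (λ p → proj₂ (proj₂ (proj₂ (proj₁ p))))
    atomC = ssC ∙ sfC
    atom′C : Comp {Env} (λ p → proj₂ (proj₂ (proj₂ p)))
    atom′C = sndC ∙ ssC

  labelsOfC : Comp {CNF {X} × Occurrence {X}} (λ p → Cf.labelsOf (proj₁ p) (proj₂ p))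
  labelsOfC = concatMapC {f = λ p → Cf.labelsWith (proj₁ p) (proj₂ p)}
    (ifC (andC (eqBoolC ∙ (sign′C ,C notC signC)) (eqC ∙ (atomC ,C atom′C)))
      (singleC (ifC signC (plusC (timesC indexC ordC) index′C) (plusC (timesC index′C ordC) indexC)))
      (constC []))
    (enumerateC ∙ (constC 0 ,C concatC fstC))

  choicesC : {Γ : Set} {{_ : Enc Γ}} {φ : Γ → CNF {X}} → Comp φ → Comp (λ γ → Cf.choices (φ γ))
  choicesC cφ = mapC {f = λ φ → map (Cf.labelsOf φ)} (mapC {f = λ p → Cf.labelsOf (proj₁ p)} (labelsOfC ∙ (ffC ,C sndC)) sndC) (enumerateAllC idC) ∙ cφ

chainC : Comp {ℕ × List ℕ} (λ p → chain (proj₁ p) (proj₂ p))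
chainC = scanC (singleC (sfC ,C (sucC sndC ,C sucC (sfC)))) (constC 1) sndC fstC

regionsC : Comp regions
regionsC = lengthC (concatMapC (consC (constC 0) sndC) idC)

nodesC : Comp nodes
nodesC = lengthC (concatMapC (consC (constC 0) (concatMapC (consC (constC 0) sndC) sndC)) idC)

optionsC : Comp {(ℕ × ℕ) × (ℕ × List (List ℕ))} (λ p → options (proj₁ (proj₁ p)) (proj₂ (proj₁ p)) (proj₁ (proj₂ p)) (proj₂ (proj₂ p)))
optionsC = scanC {o = λ p → block (proj₁ (proj₁ p)) (proj₂ (proj₁ p))}
  (consC (ffC ∙ ffC ,C (constC 0 ,C sfC))
    (consC (plusC (sfC) (lengthC sndC) ,C (constC 0 ,C sfC ∙ ffC))
      (chainC ∙ (sfC ,C sndC))))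
  (sucC (lengthC sndC)) (ssC) (fsC)

graphC : Comp (graphFrom 0)
graphC = scanC (optionsC ∙ ((sfC ,C sucC (plusC (regionsC ∙ sndC) (sfC))) ,C (sucC (sfC) ,C sndC)))
  (sucC (regionsC ∙ sndC)) idC (constC 0)

instance
  Enc-Job : Enc Job
  Enc-Job = record { enc = λ j → enc (processing j , (arrival j , deadline j)) }

encodeJobC : Comp encodeJob
encodeJobC = appendC (encodeℕC ∙ fstC) (appendC (encodeℕC ∙ fsC) (encodeℕC ∙ ssC)) ∙
  coeC (λ j → processing j , (arrival j , deadline j)) (λ _ → refl)

module GadgetC {Γ : Set} {{_ : Enc Γ}} {V L huge : Γ → ℕ} (cV : Comp V) (cL : Comp L) (ch : Comp huge) where

  modulusC : Comp (λ γ → Scale.modulus (V γ) (L γ))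
  modulusC = extC (λ γ → Scale.modulus-def (V γ) (L γ)) (plusC (timesC (constC 2) cV) (constC 2))

  halfUnitC : Comp (λ γ → Scale.halfUnit (V γ) (L γ))
  halfUnitC = extC (λ γ → Scale.halfUnit-def (V γ) (L γ)) (timesC modulusC (sucC cL))

  unitC : Comp (λ γ → Scale.unit (V γ) (L γ))
  unitC = extC (λ γ → Scale.unit-def (V γ) (L γ)) (timesC (constC 2) halfUnitC)

  horizonC : Comp (λ γ → Scale.horizon (V γ) (L γ))
  horizonC = timesC cV unitC

  jobC : {p a d : Γ → ℕ} → Comp p → Comp a → Comp d → Comp (λ γ → record { processing = p γ ; arrival = a γ ; deadline = d γ })
  jobC cp ca cd = recodeC (λ _ → refl) (cp ,C (ca ,C cd))

  bigC : Comp (λ γ → Gadget.jobOf (V γ) (L γ) (huge γ) big)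
  bigC = jobC ch (constC 0) (plusC (monusC horizonC (constC 1)) ch)

  wideLengthC : {ℓ : Γ → ℕ} → Comp ℓ → Comp (λ γ → Scale.wideLength (V γ) (L γ) (ℓ γ))
  wideLengthC cℓ = plusC halfUnitC (sucC (timesC modulusC cℓ))

  wideC : {ℓ : Γ → ℕ} → Comp ℓ → Comp (λ γ → Gadget.jobOf (V γ) (L γ) (huge γ) (wide (ℓ γ)))
  wideC cℓ = jobC (wideLengthC cℓ) (constC 0) (plusC (timesC (monusC cV (constC 1)) unitC) (wideLengthC cℓ))

module EdgeC {Γ : Set} {{_ : Enc Γ}} {V L huge : Γ → ℕ} (cV : Comp V) (cL : Comp L) (ch : Comp huge) {e : Γ → Edge} (ce : Comp e) where

  open GadgetC cV cL ch
  open GadgetC {Γ = ℕ × Γ} (cV ∙ sndC) (cL ∙ sndC) (ch ∙ sndC) using () renaming (wideLengthC to wideLengthC′)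

  offsetC : Comp (λ γ → Scale.offset (V γ) (L γ) (lab (e γ)))
  offsetC = extC (λ γ → lem γ (lab (e γ))) (caseNatC {g = λ ℓ γ → Scale.wideLength (V γ) (L γ) ℓ} (fsC ∙ ce) (constC 0) (wideLengthC′ fstC))
    where
    lem : ∀ γ l → Scale.offset (V γ) (L γ) l ≡ natCase l 0 (λ ℓ → Scale.wideLength (V γ) (L γ) ℓ)
    lem γ zero    = refl
    lem γ (suc l) = refl

  startC : Comp (λ γ → Gadget.startOf (V γ) (L γ) (huge γ) (e γ))
  startC = plusC (timesC (fstC ∙ ce) unitC) offsetC

  edgeC : Comp (λ γ → Gadget.jobOf (V γ) (L γ) (huge γ) (edge (e γ)))
  edgeC = jobC (monusC end startC) startC end
    where
    end : Comp (λ γ → dst (e γ) * Scale.unit (V γ) (L γ))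
    end = timesC (ssC ∙ ce) unitC

-- From formulas to schedules

module _ {A : Set} where

  lookup-fromList : ∀ (xs : List A) i → lookup (Vec.fromList xs) i ∈ xs
  lookup-fromList (x ∷ xs) zero    = here refl
  lookup-fromList (x ∷ xs) (suc i) = there (lookup-fromList xs i)

  indexOf : ∀ {xs : List A} {x} → x ∈ xs → ∃[ i ] lookup (Vec.fromList xs) i ≡ x
  indexOf (here refl) = zero , refl
  indexOf (there h) with indexOf h
  ... | i , e = suc i , e

  lookup-fromList-injective : ∀ {xs : List A} → Unique xs → ∀ i j → lookup (Vec.fromList xs) i ≡ lookup (Vec.fromList xs) j → i ≡ j
  lookup-fromList-injective {x ∷ xs} (u ∷ us) zero    zero    e = refl
  lookup-fromList-injective {x ∷ xs} (u ∷ us) zero    (suc j) e = ⊥-elim (All.lookup u (lookup-fromList xs j) e)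
  lookup-fromList-injective {x ∷ xs} (u ∷ us) (suc i) zero    e = ⊥-elim (All.lookup u (lookup-fromList xs i) (sym e))
  lookup-fromList-injective {x ∷ xs} (u ∷ us) (suc i) (suc j) e = cong suc (lookup-fromList-injective us i j e)

unique-range : ∀ s n → Unique (range s n)
unique-range s zero    = []
unique-range s (suc n) = All.tabulate (λ h e → <⇒≢ (proj₁ (range-∈ (suc s) n h)) e) ∷ unique-range (suc s) n

length-range : ∀ s n → length (range s n) ≡ n
length-range s zero    = refl
length-range s (suc n) = cong suc (length-range (suc s) n)

-- The variable stands for the number of jobs.
numberBound : ℕ → PExp
numberBound gap = horizonBound :+ (con gap :* (var :* horizonBound) :+ (con 1 :+ horizonBound))
  where
  horizonBound : PExp
  horizonBound = var :* (con 2 :* ((con 2 :* var :+ con 2) :* (con 1 :+ var)))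

opaque
  numberPoly : ℕ → Poly
  numberPoly gap = toPoly (numberBound gap)

  eval-numberPoly : ∀ gap n → eval (numberPoly gap) n ≡ ⟦ numberBound gap ⟧ n
  eval-numberPoly gap = eval-toPoly (numberBound gap)

module Scheduling {X : Set} (eq : X → X → Bool) (eq-sound : ∀ x y → eq x y ≡ true → x ≡ y) (eq-refl : ∀ x → eq x x ≡ true)
  (φ : CNF {X}) (gap : ℕ) where

  open Conflicts eq eq-sound eq-refl φ

  V L : ℕ
  V = nodes choices
  -- The summand `V` makes the number of jobs at least `V`. The horizon is thereby bounded by a
  -- polynomial in the number of jobs.
  L = V + O * O

  E : List Edge
  E = graphFrom 0 choices

  tags : List Tag
  tags = big ∷ map wide (range 0 L) ++ map edge E

  span : ℕ
  span = V * Scale.unit V L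

  opaque
    budget huge : ℕ
    budget = length tags * span
    -- The first summand puts the huge job beyond `gap` times the cost of any walk; `gap` is 1 for
    -- completeness and otherwise a natural number that stands in for the approximation factor. The
    -- second makes the huge job outlast the horizon.
    huge   = gap * budget + suc span

    budget-def : budget ≡ length tags * span
    budget-def = refl

    huge-def : huge ≡ gap * budget + suc span
    huge-def = refl

  open Gadget V L huge using (jobOf; startOf)
  open Scale V L using (unit; wideLength; wideLength<unit)

  inst : Instance (length tags)
  inst = Vec.map jobOf (Vec.fromList tags)

  toList-inst : Vec.toList inst ≡ map jobOf tags
  toList-inst = trans (toList-map jobOf (Vec.fromList tags)) (cong (map jobOf) (toList∘fromList tags))

  jobs : List Job
  jobs = jobOf big ∷ map (λ ℓ → jobOf (wide ℓ)) (range 0 L) ++ map (λ e → jobOf (edge e)) E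

  toList-jobs : Vec.toList inst ≡ jobs
  toList-jobs = trans toList-inst (cong (jobOf big ∷_) (trans (map-++ jobOf (map wide (range 0 L)) (map edge E))
    (cong₂ _++_ (sym (map-∘ (range 0 L))) (sym (map-∘ E)))))

  tag-cases : ∀ {t} → t ∈ tags → t ≡ big ⊎ (∃[ ℓ ] ℓ < L × t ≡ wide ℓ) ⊎ (∃[ e ] e ∈ E × t ≡ edge e)
  tag-cases (here e) = inj₁ e
  tag-cases (there h) with ∈-++⁻ (map wide (range 0 L)) h
  ... | inj₁ h′ = let ℓ , ℓ∈ , e = ∈-map⁻ wide h′ in inj₂ (inj₁ (ℓ , proj₂ (range-∈ 0 L ℓ∈) , e))
  ... | inj₂ h′ = let d , d∈ , e = ∈-map⁻ edge h′ in inj₂ (inj₂ (d , d∈ , e))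

  unique-tags : Unique tags
  unique-tags = All.tabulate big∉ ∷ Uniqueₚ.++⁺ (Uniqueₚ.map⁺ (λ { refl → refl }) (unique-range 0 L)) (Uniqueₚ.map⁺ (λ { refl → refl }) (unique-graph 0 choices))
    (λ { (h , h′) → apart h h′ })
    where
    apart : ∀ {t} → t ∈ map wide (range 0 L) → t ∈ map edge E → ⊥
    apart h h′ with ∈-map⁻ wide h | ∈-map⁻ edge h′
    ... | _ , _ , refl | _ , _ , ()
    big∉ : ∀ {t} → t ∈ map wide (range 0 L) ++ map edge E → big ≢ t
    big∉ h refl with ∈-++⁻ (map wide (range 0 L)) h
    ... | inj₁ h′ with ∈-map⁻ wide h′
    ...   | _ , _ , ()
    big∉ h refl | inj₂ h′ with ∈-map⁻ edge h′
    ...   | _ , _ , ()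

  edges-ok : ∀ {e} → e ∈ E → src e < dst e × dst e ≤ V × lab e ≤ L
  edges-ok h with graph-ok (O * O) 0 choices choices<L h
  ... | a , b , c = a , ≤-trans b (≤-reflexive (+-identityʳ V)) , ≤-trans c (m≤n+m (O * O) V)

  module _ (1≤V : 1 ≤ V) where

    private
      module G = Gadget V L huge
      tags-ok : ∀ i → lookup (Vec.fromList tags) i ≡ big ⊎ (∃[ ℓ ] ℓ < L × lookup (Vec.fromList tags) i ≡ wide ℓ) ⊎
        (∃[ e ] e ∈ E × lookup (Vec.fromList tags) i ≡ edge e)
      tags-ok i = tag-cases (lookup-fromList tags i)
      wide∈ : ∀ {ℓ} → ℓ < L → ∃[ i ] lookup (Vec.fromList tags) i ≡ wide ℓ
      wide∈ h = indexOf {xs = tags} (there (∈-++⁺ˡ (∈-map⁺ wide (∈-range 0 L z≤n h))))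
      edge∈ : ∀ {e} → e ∈ E → ∃[ i ] lookup (Vec.fromList tags) i ≡ edge e
      edge∈ h = indexOf {xs = tags} (there (∈-++⁺ʳ (map wide (range 0 L)) (∈-map⁺ edge h)))
      injective = lookup-fromList-injective unique-tags
      span<huge : span < huge
      span<huge = ≤-trans (m≤n+m (suc span) (gap * budget)) (≤-reflexive (sym huge-def))

    satisfiable⇒cheap : ∀ {α} → Satisfies α φ → ∃[ σ ] Feasible inst σ × (∀ obj → value obj inst σ ≤ budget)
    satisfiable⇒cheap {α} sat = choose (satisfying-choice α sat)
      where
      schedule : ∀ {os} → Unique (concat os) → (∃[ es ] Walk E V 0 es × labels es ≡ concat os) →
        ∃[ σ ] Feasible inst σ × (∀ obj → value obj inst σ ≤ budget)
      schedule uniq (es , walk , e) = σ , feasible , λ obj → ≤-trans (cheap obj) (≤-reflexive (sym budget-def))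
        where
        open G.Build edges-ok 1≤V span<huge (Vec.fromList tags) zero refl tags-ok injective wide∈ edge∈ walk (subst Unique (sym e) uniq)
      choose : (∃[ os ] Choice choices os × Unique (concat os)) → ∃[ σ ] Feasible inst σ × (∀ obj → value obj inst σ ≤ budget)
      choose (os , ch , uniq) = schedule {os} uniq (walkChoice choices 0 os id (+-identityʳ V) ch)

    lazy⇒satisfiable : ∀ σ → Feasible inst σ → lookup σ zero ≡ nothing → ∃[ α ] Satisfies α φ
    lazy⇒satisfiable σ F lazy = assign (G.Extract.extract edges-ok 1≤V span<huge (Vec.fromList tags) zero refl tags-ok injective wide∈ edge∈ σ F lazy)
      where
      assign′ : ∀ {es} → Unique (labels es) → (∃[ os ] Choice choices os × labels es ≡ concat os) → ∃[ α ] Satisfies α φ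
      assign′ uniq (os , ch , e) = choice-satisfying os ch (subst Unique e uniq)
      assign : (∃[ es ] Walk E V 0 es × Unique (labels es)) → ∃[ α ] Satisfies α φ
      assign (es , walk , uniq) = assign′ {es} uniq (followChoice choices 0 es (λ d∈ _ → d∈) (sym (+-identityʳ V)) walk)

    cheap⇒lazy : ∀ obj σ → value obj inst σ ≤ gap * budget → lookup σ zero ≡ nothing
    cheap⇒lazy obj σ h = G.lazy⇐cheap edges-ok 1≤V span<huge (Vec.fromList tags) zero refl tags-ok injective wide∈ edge∈ obj σ
      (<-≤-trans (≤-<-trans h (m<m+n (gap * budget) (s≤s z≤n))) (≤-reflexive (sym huge-def)))

    some-feasible : ∃[ σ ] Feasible inst σ
    some-feasible = _ , G.feasible-onlyBig edges-ok 1≤V span<huge (Vec.fromList tags) zero refl tags-ok injective wide∈ edge∈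

    span≤ : ∀ {m} → L ≤ m → span ≤ m * (2 * ((2 * m + 2) * suc m))
    span≤ {m} h = *-mono-≤ V≤ (≤-trans (≤-reflexive unit≡) (*-monoʳ-≤ 2 (*-mono-≤ (+-monoˡ-≤ 2 (*-monoʳ-≤ 2 V≤)) (s≤s h))))
      where
      unit≡ : unit ≡ 2 * ((2 * V + 2) * suc L)
      unit≡ = trans (Scale.unit-def V L) (cong (2 *_) (trans (Scale.halfUnit-def V L) (cong (_* suc L) (Scale.modulus-def V L))))
      V≤ : V ≤ m
      V≤ = ≤-trans (m≤m+n V (O * O)) h

    L≤jobs : L ≤ length tags
    L≤jobs = ≤-trans (≤-reflexive (sym (trans (length-map wide (range 0 L)) (length-range 0 L))))
      (≤-trans (m≤m+n _ (length (map edge E))) (≤-trans (≤-reflexive (sym (length-++ (map wide (range 0 L))))) (n≤1+n _)))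

    numbers≤ : ∀ m → length tags ≤ m → 1 ≤ gap → All (_≤ ⟦ numberBound gap ⟧ m) (budget ∷ concatMap jobNumbers (Vec.toList inst))
    numbers≤ m h g = ≤-trans (≤-trans (m≤m+n budget 0) (*-monoˡ-≤ budget g)) (≤-trans (m≤n+m (gap * budget) span)
        (≤-trans (+-monoʳ-≤ span (≤-trans (m≤m+n (gap * budget) (suc span)) (≤-reflexive (sym huge-def)))) all≤)) ∷
      subst (λ js → All (_≤ ⟦ numberBound gap ⟧ m) (concatMap jobNumbers js)) (sym toList-inst)
        (All-concatMap jobNumbers (map jobOf tags) (λ h → let t , t∈ , e = ∈-map⁻ jobOf h in subst (λ j → All (_≤ ⟦ numberBound gap ⟧ m) (jobNumbers j)) (sym e) (job≤ (tag-cases t∈))))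
      where
      s≤ : span ≤ m * (2 * ((2 * m + 2) * suc m))
      s≤ = span≤ (≤-trans L≤jobs h)
      all≤ : span + huge ≤ ⟦ numberBound gap ⟧ m
      all≤ = +-mono-≤ s≤ (≤-trans (≤-reflexive huge-def) (+-mono-≤ (*-monoʳ-≤ gap (≤-trans (≤-reflexive budget-def) (*-mono-≤ h s≤))) (s≤s s≤)))
      span≤all : ∀ {k} → k ≤ span → k ≤ ⟦ numberBound gap ⟧ m
      span≤all k≤ = ≤-trans k≤ (≤-trans (m≤m+n span huge) all≤)
      unit≤span : unit ≤ span
      unit≤span = ≤-trans (≤-reflexive (sym (*-identityˡ unit))) (*-monoˡ-≤ unit 1≤V)
      job≤ : ∀ {t} → t ≡ big ⊎ (∃[ ℓ ] ℓ < L × t ≡ wide ℓ) ⊎ (∃[ e ] e ∈ E × t ≡ edge e) → All (_≤ ⟦ numberBound gap ⟧ m) (jobNumbers (jobOf t))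
      job≤ (inj₁ refl) = ≤-trans (m≤n+m huge span) all≤ ∷ z≤n ∷ ≤-trans (+-monoˡ-≤ huge (m∸n≤m span 1)) all≤ ∷ []
      job≤ (inj₂ (inj₁ (ℓ , ℓ<L , refl))) = span≤all (≤-trans wℓ≤ unit≤span) ∷ z≤n ∷
        span≤all (≤-trans (+-monoʳ-≤ ((V ∸ 1) * unit) wℓ≤) (≤-reflexive (trans (+-comm _ unit) (cong (_* unit) (m+[n∸m]≡n 1≤V))))) ∷ []
        where
        wℓ≤ : wideLength ℓ ≤ unit
        wℓ≤ = <⇒≤ (wideLength<unit ℓ<L)
      job≤ (inj₂ (inj₂ (e , e∈ , refl))) = span≤all (≤-trans (m∸n≤m _ (startOf e)) end≤) ∷ span≤all (≤-trans (<⇒≤ start<) end≤) ∷ span≤all end≤ ∷ []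
        where
        end≤ : dst e * unit ≤ span
        end≤ = *-monoˡ-≤ unit (proj₁ (proj₂ (edges-ok e∈)))
        start< : startOf e < dst e * unit
        start< = G.start<end edges-ok 1≤V span<huge (Vec.fromList tags) zero refl tags-ok injective wide∈ edge∈ e∈

    small : ∀ m → length tags ≤ m → 1 ≤ gap → All (_≤ eval (numberPoly gap) m) (budget ∷ concatMap jobNumbers (Vec.toList inst))
    small m h g = subst (λ k → All (_≤ k) (budget ∷ concatMap jobNumbers (Vec.toList inst))) (sym (eval-numberPoly gap m)) (numbers≤ m h g)

length≤encodeList : ∀ {A : Set} (e : A → List Bool) xs → length xs ≤ length (encodeList e xs)
length≤encodeList e []       = z≤n
length≤encodeList e (x ∷ xs) = s≤s (≤-trans (length≤encodeList e xs) (≤-trans (m≤n+m _ (length (e x))) (≤-reflexive (sym (length-++ (e x))))))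

eval-mono : ∀ p {m n} → m ≤ n → eval p m ≤ eval p n
eval-mono p {m} {n} h = subst₂ _≤_ (⟦fromPoly⟧ p m) (⟦fromPoly⟧ p n) (⟦⟧-mono (fromPoly p) h)

-- The reduction from an arbitrary language in NP

module Reduction {verify : List Bool → List Bool} (verifyₚ : PolyTime verify) (pc : Poly) (gap : ℕ) where

  M : TM
  M = proj₁ verifyₚ

  pM : Poly
  pM = proj₁ (proj₂ verifyₚ)

  open Interpreter M
  open Tableau M
  open FormulaC M

  prefix : List Bool → List Bool
  prefix = encodeList [_]

  -- One clock serves all certificates: it is the time for the longest admissible input, and after
  -- halting the simulated machine does not change any more.
  certBound clock : List Bool → ℕ
  certBound w = eval pc (length w)
  clock w = eval pM (length (prefix w) + certBound w)

  opaque
    formulaOf : List Bool → List Clause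
    formulaOf w = formula (prefix w) (certBound w) (clock w)

  module S (w : List Bool) = Scheduling eqVar eqVar-sound eqVar-refl (formulaOf w) gap

  Accepted : List Bool → Set
  Accepted w = ∃[ u ] length u ≤ eval pc (length w) × verify (encodePair w u) ≡ [ true ]

  clock-output : ∀ w u → length u ≤ certBound w → output M (at (initial M (prefix w ++ u)) (clock w)) ≡ verify (encodePair w u)
  clock-output w u h with proj₂ (proj₂ verifyₚ) (prefix w ++ u)
  ... | n , c , n≤ , r , e = trans (cong (output M) (trans (sym (at-runᵗ (clock w) _)) (runᵗ-halts r (clock w)
    (≤-trans n≤ (eval-mono pM (≤-trans (≤-reflexive (length-++ (prefix w))) (+-monoʳ-≤ (length (prefix w)) h))))))) e

  opaque
    unfolding formulaOf

    accepted⇒satisfiable : ∀ w → Accepted w → ∃[ α ] Satisfies α (formulaOf w)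
    accepted⇒satisfiable w (u , h , e) = _ , Completeness.satisfies (prefix w) u (certBound w) (clock w) h (trans (clock-output w u h) e)

    satisfiable⇒accepted : ∀ w → (∃[ α ] Satisfies α (formulaOf w)) → Accepted w
    satisfiable⇒accepted w (α , sat) = u , proj₁ (proj₂ certificate) , trans (sym (clock-output w u (proj₁ (proj₂ certificate)))) accepts
      where
      open Soundness (prefix w) (certBound w) (clock w) α sat

    -- The clause for the start state is always present, so there is at least one group and its
    -- entry is a node.
    1≤V : ∀ w → 1 ≤ S.V w
    1≤V w = s≤s z≤n

    formulaOfC : Comp formulaOf
    formulaOfC = formulaC ∙ (prefixC ,C (certBoundC ,C clockC))
      where
      prefixC : Comp prefix
      prefixC = encodeListC (singleC idC) idC
      certBoundC : Comp certBound
      certBoundC = evalC pc (lengthC idC)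
      clockC : Comp clock
      clockC = evalC pM {λ w → length (prefix w) + certBound w} (plusC (lengthC prefixC) certBoundC)

  private
    module CC = ConflictsC eqVar eqVar-sound eqVar-refl eqVarC

    cV : Comp S.V
    cV = nodesC ∙ CC.choicesC formulaOfC

    cL : Comp S.L
    cL = plusC cV (timesC (CC.OC formulaOfC) (CC.OC formulaOfC))

    cE : Comp S.E
    cE = graphC ∙ CC.choicesC formulaOfC

    cspan : Comp S.span
    cspan = GadgetC.horizonC cV cL (constC 0)

  budgetC : Comp S.budget
  budgetC = extC S.budget-def (timesC (extC length-tags (sucC (plusC (lengthC (rangeC (constC 0) cL)) (lengthC cE)))) cspan)
    where
    length-tags : ∀ w → length (S.tags w) ≡ suc (length (range 0 (S.L w)) + length (S.E w))
    length-tags w = cong suc (trans (length-++ (map wide (range 0 (S.L w)))) (cong₂ _+_ (length-map wide (range 0 (S.L w))) (length-map edge (S.E w))))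

  private
    chuge : Comp S.huge
    chuge = extC S.huge-def (plusC (timesC (constC gap) budgetC) (sucC cspan))

    cjobs : Comp (λ w → Vec.toList (S.inst w))
    cjobs = extC S.toList-jobs (consC (GadgetC.bigC cV cL chuge)
      (appendC (mapC (GadgetC.wideC (cV ∙ fstC) (cL ∙ fstC) (chuge ∙ fstC) sndC) (rangeC (constC 0) cL))
        (mapC (EdgeC.edgeC (cV ∙ fstC) (cL ∙ fstC) (chuge ∙ fstC) sndC) cE)))

  instanceC : Comp (λ w → encodeInstance (S.inst w))
  instanceC = encodeListC encodeJobC cjobs

  inputOf : List Bool → Σ ℕ Instance × ℕ
  inputOf w = (_ , S.inst w) , S.budget w

  inputC : ∀ obj → Comp (λ w → DecisionProblem.encode (LBP obj) (inputOf w))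
  inputC obj = appendC instanceC (encodeℕC ∙ budgetC)

-- Splitting an encoded pair; the second component is the postfix code of a tree

-- Postfix rather than prefix, because then a single pass from left to right with a stack of
-- finished subtrees decodes the tree, and such a pass is a left fold.
postfix : D → List Bool
postfix leaf       = [ false ]
postfix (node l r) = postfix l ++ postfix r ++ [ true ]

length-postfix : ∀ d → length (postfix d) ≡ sizeᵈ d
length-postfix leaf = refl
length-postfix (node l r) = trans (length-++ (postfix l)) (trans (cong (length (postfix l) +_) (length-++ (postfix r)))
  (trans (cong₂ (λ a b → a + (b + 1)) (length-postfix l) (length-postfix r)) (lem (sizeᵈ l) (sizeᵈ r))))
  where
  lem : ∀ a b → a + (b + 1) ≡ suc (a + b)
  lem = solve-∀

reduce : List D → List D
reduce ds = listCase ds [] (λ r ds → listCase ds [] (λ l ds → node l r ∷ ds))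

shiftReduce : List D → Bool → List D
shiftReduce ds b = if b then reduce ds else leaf ∷ ds

shiftReduce-postfix : ∀ d ds → foldl shiftReduce ds (postfix d) ≡ d ∷ ds
shiftReduce-postfix leaf       ds = refl
shiftReduce-postfix (node l r) ds
  rewrite foldl-++ shiftReduce ds (postfix l) (postfix r ++ [ true ]) | shiftReduce-postfix l ds
        | foldl-++ shiftReduce (l ∷ ds) (postfix r) [ true ] | shiftReduce-postfix r (l ∷ ds) = refl

-- (in the second component?, expecting a bit of the first component?), …
SplitState : Set
SplitState = (Bool × Bool) × (List Bool × List D)

splitStep : SplitState → Bool → SplitState
splitStep ((second , payload) , (w , ds)) b =
  if second then (true , false) , (w , shiftReduce ds b)
  else if payload then (false , false) , (b ∷ w , ds)
  else if b then (false , true) , (w , ds)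
  else (true , false) , (w , ds)

-- Malformed strings are also split somehow. This is harmless, since the check re-encodes what it
-- obtains and compares it with the input.
splitPair : List Bool → List Bool × D
splitPair z = reverse (proj₁ (proj₂ s)) , listCase (proj₂ (proj₂ s)) leaf (λ d _ → d)
  where
  s : SplitState
  s = foldl splitStep ((false , false) , ([] , [])) z

splitStep-second : ∀ z w ds → foldl splitStep ((true , false) , (w , ds)) z ≡ ((true , false) , (w , foldl shiftReduce ds z))
splitStep-second []      w ds = refl
splitStep-second (b ∷ z) w ds = splitStep-second z w (shiftReduce ds b)

splitStep-first : ∀ w v z → foldl splitStep ((false , false) , (v , [])) (encodeList [_] w ++ z) ≡ ((true , false) , (reverse w ++ v , foldl shiftReduce [] z))
splitStep-first []      v z = splitStep-second z v []
splitStep-first (b ∷ w) v z = trans (splitStep-first w (b ∷ v) z)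
  (cong (λ q → (true , false) , (q , foldl shiftReduce [] z)) (trans (sym (++-assoc (reverse w) [ b ] v)) (cong (_++ v) (sym (unfold-reverse b w)))))

splitPair-fst : ∀ w u → proj₁ (splitPair (encodePair w u)) ≡ w
splitPair-fst w u rewrite splitStep-first w [] u | ++-identityʳ (reverse w) = reverse-involutive w

splitPair-snd : ∀ w d → proj₂ (splitPair (encodePair w (postfix d))) ≡ d
splitPair-snd w d rewrite splitStep-first w [] (postfix d) | shiftReduce-postfix d [] = refl

splitStepC : Comp {SplitState × Bool} (λ p → splitStep (proj₁ p) (proj₂ p))
splitStepC = ifC (fstC ∙ ffC)
    (constC (true , false) ,C (fstC ∙ sfC ,C ifC sndC (reduceC ∙ sndC ∙ sfC) (consC (constC leaf) (sndC ∙ sfC))))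
  (ifC (sndC ∙ ffC)
    (constC (false , false) ,C (consC sndC (fstC ∙ sfC) ,C sndC ∙ sfC))
    (ifC sndC (constC (false , true) ,C sfC) (constC (true , false) ,C sfC)))
  where
  reduceC : Comp reduce
  reduceC = caseListC {g = λ r ds _ → listCase ds [] (λ l ds → node l r ∷ ds)} idC (constC [])
    (caseListC {g = λ l ds p → node l (proj₁ (proj₁ p)) ∷ ds} sfC (constC [])
      (consC (recodeC (λ _ → refl) (ffC ,C fstC ∙ fsC)) sfC))

splitPairC : Comp splitPair
splitPairC = (reverseC fsC ,C caseListC {g = λ d _ _ → d} ssC (constC leaf) ffC) ∙
  foldAddC {h = λ _ → splitStep} (splitStepC ∙ (sfC ,C sndC)) idC (constC ((false , false) , ([] , []))) (con 4) (λ _ → grow)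
  where
  size-reduce : ∀ ds → ⟪ reduce ds ⟫ ≤ ⟪ ds ⟫
  size-reduce []           = ≤-refl
  size-reduce (r ∷ [])     = s≤s z≤n
  size-reduce (r ∷ l ∷ ds) = ≤-reflexive (lem (sizeᵈ r) (sizeᵈ l) ⟪ ds ⟫)
    where
    lem : ∀ x y z → 2 + (y + x + z) ≡ 1 + (x + (1 + (y + z)))
    lem = solve-∀
  size-shiftReduce : ∀ ds b → ⟪ shiftReduce ds b ⟫ ≤ 2 + ⟪ ds ⟫
  size-shiftReduce ds true  = ≤-trans (size-reduce ds) (m≤n+m _ 2)
  size-shiftReduce ds false = ≤-refl
  lower : ∀ (a b : Bool) {w d : ℕ} → suc (suc (1 + 1) + suc (w + d)) ≤ suc (suc (⟪ a ⟫ + ⟪ b ⟫) + suc (w + d))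
  lower a b = s≤s (+-monoˡ-≤ _ (s≤s (+-mono-≤ (1≤⟪ a ⟫) (1≤⟪ b ⟫))))
  grow : ∀ s b → ⟪ splitStep s b ⟫ ≤ ⟪ s ⟫ + 4
  grow ((true , y) , (w , ds)) b = ≤-trans (s≤s (+-monoʳ-≤ 5 (s≤s (+-monoʳ-≤ ⟪ w ⟫ (size-shiftReduce ds b)))))
    (≤-trans (≤-reflexive (lem ⟪ w ⟫ ⟪ ds ⟫)) (+-monoˡ-≤ 4 (lower true y {⟪ w ⟫} {⟪ ds ⟫})))
    where
    lem : ∀ w d → suc (5 + suc (w + (2 + d))) ≡ suc (suc (1 + 1) + suc (w + d)) + 4
    lem = solve-∀
  grow ((false , true) , (w , ds)) b = ≤-trans (s≤s (+-monoʳ-≤ 3 (s≤s (+-monoˡ-≤ ⟪ ds ⟫ (s≤s (+-monoˡ-≤ ⟪ w ⟫ (size-bool b)))))))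
    (≤-trans (≤-reflexive (lem ⟪ w ⟫ ⟪ ds ⟫)) (+-monoˡ-≤ 4 (lower false true {⟪ w ⟫} {⟪ ds ⟫})))
    where
    lem : ∀ w d → suc (3 + suc (suc (3 + w) + d)) ≡ suc (suc (1 + 1) + suc (w + d)) + 4
    lem = solve-∀
  grow ((false , false) , (w , ds)) b = ≤-trans (flags b) (+-monoˡ-≤ 4 (lower false false {⟪ w ⟫} {⟪ ds ⟫}))
    where
    lem : ∀ w d → suc (5 + suc (w + d)) + 2 ≡ suc (suc (1 + 1) + suc (w + d)) + 4
    lem = solve-∀
    flags : ∀ b → ⟪ splitStep ((false , false) , (w , ds)) b ⟫ ≤ suc (suc (1 + 1) + suc (⟪ w ⟫ + ⟪ ds ⟫)) + 4
    flags true  = ≤-trans (m≤m+n _ 2) (≤-reflexive (lem ⟪ w ⟫ ⟪ ds ⟫))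
    flags false = ≤-trans (m≤m+n _ 2) (≤-reflexive (lem ⟪ w ⟫ ⟪ ds ⟫))

-- Certificates: the jobs with their start times, and the bound

Entry Certificate : Set
Entry       = (ℕᵇ × (ℕᵇ × ℕᵇ)) × (Bool × ℕᵇ)
Certificate = List Entry × ℕᵇ

leftᵈ rightᵈ : D → D
leftᵈ leaf        = leaf
leftᵈ (node l r)  = l
rightᵈ leaf       = leaf
rightᵈ (node l r) = r

isNode : D → Bool
isNode leaf       = false
isNode (node _ _) = true

spine : D → List D
spine leaf       = []
spine (node l r) = l ∷ spine r

toBin : D → ℕᵇ
toBin d = undigits (map isNode (spine d))

toEntry : D → Entry
toEntry d = (toBin (leftᵈ (leftᵈ d)) , (toBin (leftᵈ (rightᵈ (leftᵈ d))) , toBin (rightᵈ (rightᵈ (leftᵈ d))))) ,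
            (isNode (leftᵈ (rightᵈ d)) , toBin (rightᵈ (rightᵈ d)))

-- Every tree is read as some certificate, malformed parts by default values; the check needs no
-- separate test of well-formedness.
toCertificate : D → Certificate
toCertificate d = map toEntry (spine (leftᵈ d)) , toBin (rightᵈ d)

toBin-enc : ∀ x → toBin (enc x) ≡ x
toBin-enc x = trans (cong undigits (lem x)) (undigits-digits x)
  where
  lem : ∀ x → map isNode (spine (enc x)) ≡ digits x
  lem ℕᵇ.zero     = refl
  lem ℕᵇ.2[1+ x ] = cong (true ∷_) (lem x)
  lem ℕᵇ.1+[2 x ] = cong (false ∷_) (lem x)

toEntry-enc : ∀ e → toEntry (enc e) ≡ e
toEntry-enc ((p , (a , d)) , (b , s)) =
  cong₂ _,_ (cong₂ _,_ (toBin-enc p) (cong₂ _,_ (toBin-enc a) (toBin-enc d))) (cong₂ _,_ (isNode-enc b) (toBin-enc s))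
  where
  isNode-enc : ∀ b → isNode (enc b) ≡ b
  isNode-enc true  = refl
  isNode-enc false = refl

toCertificate-enc : ∀ c → toCertificate (enc c) ≡ c
toCertificate-enc (es , b) = cong₂ _,_ (lem es) (toBin-enc b)
  where
  lem : ∀ es → map toEntry (spine (enc es)) ≡ es
  lem []       = refl
  lem (e ∷ es) = cong₂ _∷_ (toEntry-enc e) (lem es)

spineC : Comp spine
spineC = coeC spine lem
  where
  lem : ∀ d → enc (spine d) ≡ d
  lem leaf       = refl
  lem (node l r) = cong (node l) (lem r)

module _ {Γ : Set} {{_ : Enc Γ}} {f : Γ → D} (cf : Comp f) where

  leftᵈC : Comp (λ γ → leftᵈ (f γ))
  leftᵈC = extC (λ γ → lem (f γ)) (caseListC {g = λ d _ _ → d} (spineC ∙ cf) (constC leaf) (ffC))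
    where
    lem : ∀ d → leftᵈ d ≡ listCase (spine d) leaf (λ d _ → d)
    lem leaf       = refl
    lem (node l r) = refl

  rightᵈC : Comp (λ γ → rightᵈ (f γ))
  rightᵈC = recodeC (λ γ → lem (f γ)) (caseListC {g = λ _ ds _ → ds} (spineC ∙ cf) (constC []) (sfC))
    where
    enc-spine : ∀ d → enc (spine d) ≡ d
    enc-spine leaf       = refl
    enc-spine (node l r) = cong (node l) (enc-spine r)
    lem : ∀ d → enc (rightᵈ d) ≡ enc (listCase (spine d) [] (λ _ ds → ds))
    lem leaf       = refl
    lem (node l r) = sym (enc-spine r)

  isNodeC : Comp (λ γ → isNode (f γ))
  isNodeC = extC (λ γ → lem (f γ)) (caseListC {g = λ _ _ _ → true} (spineC ∙ cf) (constC false) (constC true))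
    where
    lem : ∀ d → isNode d ≡ listCase (spine d) false (λ _ _ → true)
    lem leaf       = refl
    lem (node l r) = refl

toBinC : {Γ : Set} {{_ : Enc Γ}} {f : Γ → D} → Comp f → Comp (λ γ → toBin (f γ))
toBinC cf = undigitsC ∙ mapC (isNodeC sndC) (spineC ∙ cf)

toCertificateC : Comp toCertificate
toCertificateC = mapC {f = λ _ → toEntry} (entryC ∙ sndC) (spineC ∙ leftᵈC idC) ,C toBinC (rightᵈC idC)
  where
  entryC : Comp toEntry
  entryC = (toBinC (leftᵈC (leftᵈC idC)) ,C (toBinC (leftᵈC (rightᵈC (leftᵈC idC))) ,C toBinC (rightᵈC (rightᵈC (leftᵈC idC))))) ,C
           (isNodeC (leftᵈC (rightᵈC idC)) ,C toBinC (rightᵈC (rightᵈC idC)))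

-- Checking a certificate

module _ (e : Entry) where

  procᵉ arrᵉ deadᵉ startᵉ endᵉ : ℕᵇ
  procᵉ  = proj₁ (proj₁ e)
  arrᵉ   = proj₁ (proj₂ (proj₁ e))
  deadᵉ  = proj₂ (proj₂ (proj₁ e))
  startᵉ = proj₂ (proj₂ e)
  endᵉ   = startᵉ ℕᵇ.+ procᵉ

  executed : Bool
  executed = proj₁ (proj₂ e)

  covers executable : ℕᵇ → Bool
  covers x     = executed ∧ ((startᵉ ≤ᵇⁿ x) ∧ not (endᵉ ≤ᵇⁿ x))
  executable x = not (executed ∧ not (x ≤ᵇⁿ startᵉ)) ∧ ((arrᵉ ≤ᵇⁿ x) ∧ (x ℕᵇ.+ procᵉ ≤ᵇⁿ deadᵉ))

  inWindowᵉ : Bool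
  inWindowᵉ = not executed ∨ ((arrᵉ ≤ᵇⁿ startᵉ) ∧ (endᵉ ≤ᵇⁿ deadᵉ))

  pointsᵉ : List ℕᵇ
  pointsᵉ = arrᵉ ∷ startᵉ ∷ endᵉ ∷ []

  jobᵉ : Job
  jobᵉ = record { processing = toℕ procᵉ ; arrival = toℕ arrᵉ ; deadline = toℕ deadᵉ }

  scheduleᵉ : Maybe ℕ
  scheduleᵉ = if executed then just (toℕ startᵉ) else nothing

hits : (Entry → Bool) → List Entry → List ⊤
hits p = concatMap (λ e → if p e then [ tt ] else [])

atMostOne : (Entry → Bool) → List Entry → Bool
atMostOne p es = listCase (hits p es) true (λ _ us → null us)

-- Coverage can only break at arrivals and completions, and two jobs that
-- overlap do so at one of their start times.
feasibleAt : List Entry → ℕᵇ → Bool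
feasibleAt es x = atMostOne (λ e → covers e x) es ∧ (any (λ e → covers e x) es ∨ all (λ e → not (executable e x)) es)

feasibleᵇ : List Entry → Bool
feasibleᵇ es = all inWindowᵉ es ∧ all (feasibleAt es) (concatMap pointsᵉ es)

total-work : List Entry → ℕᵇ
total-work = foldl (λ s e → s ℕᵇ.+ (if executed e then procᵉ e else ℕᵇ.zero)) ℕᵇ.zero

cheapᵇ : Objective → List Entry → ℕᵇ → Bool
cheapᵇ workingTime       es b = total-work es ≤ᵇⁿ b
cheapᵇ weightedCompleted es b = total-work es ≤ᵇⁿ b
cheapᵇ makespan          es b = all (λ e → not (executed e) ∨ (endᵉ e ≤ᵇⁿ b)) es

-- The Boolean check reflects feasibility

≤ᵇⁿ-reflects : ∀ x y → Reflects (toℕ x ≤ toℕ y) (x ≤ᵇⁿ y)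
≤ᵇⁿ-reflects x y with x ≤ᵇⁿ y in e
... | true  = ofʸ (≤ᵇⁿ-sound x y e)
... | false = ofⁿ λ h → true≢false (trans (sym (≤ᵇⁿ-complete x y h)) e)
  where
  true≢false : true ≡ false → ⊥
  true≢false ()

true-reflects : ∀ b → Reflects (b ≡ true) b
true-reflects true  = ofʸ refl
true-reflects false = ofⁿ λ ()

mapᵣ : ∀ {A B : Set} {b} → (A → B) → (B → A) → Reflects A b → Reflects B b
mapᵣ f g (ofʸ a)  = ofʸ (f a)
mapᵣ f g (ofⁿ ¬a) = ofⁿ (¬a ∘ g)

sound : ∀ {A : Set} {b} → Reflects A b → b ≡ true → A
sound (ofʸ a) refl = a

complete : ∀ {A : Set} {b} → Reflects A b → A → b ≡ true
complete (ofʸ _)  a = refl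
complete (ofⁿ ¬a) a = ⊥-elim (¬a a)

module _ {X : Set} {P : X → Set} {p : X → Bool} (r : ∀ x → Reflects (P x) (p x)) where

  all-reflects : ∀ {n} (v : Vec X n) → Reflects (∀ i → P (lookup v i)) (all p (Vec.toList v))
  all-reflects []      = ofʸ λ ()
  all-reflects (x ∷ v) = mapᵣ (λ { (a , b) zero → a ; (a , b) (suc i) → b i }) (λ h → h zero , h ∘ suc) (r x ×-reflects all-reflects v)

  any-reflects : ∀ {n} (v : Vec X n) → Reflects (∃[ i ] P (lookup v i)) (any p (Vec.toList v))
  any-reflects []      = ofⁿ λ { (() , _) }
  any-reflects (x ∷ v) = mapᵣ (λ { (inj₁ a) → zero , a ; (inj₂ (i , a)) → suc i , a })
    (λ { (zero , a) → inj₁ a ; (suc i , a) → inj₂ (i , a) }) (r x ⊎-reflects any-reflects v)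

  all-∈-reflects : ∀ xs → Reflects (∀ x → x ∈ xs → P x) (all p xs)
  all-∈-reflects []       = ofʸ λ _ ()
  all-∈-reflects (x ∷ xs) = mapᵣ (λ { (a , b) _ (here refl) → a ; (a , b) y (there h) → b y h }) (λ h → h x (here refl) , λ y → h y ∘ there)
    (r x ×-reflects all-∈-reflects xs)

module _ {P : Entry → Set} {p : Entry → Bool} (r : ∀ x → Reflects (P x) (p x)) where

  hits-reflects : ∀ {n} (v : Vec Entry n) → Reflects (∀ i → ¬ P (lookup v i)) (null (hits p (Vec.toList v)))
  hits-reflects []      = ofʸ λ ()
  hits-reflects (x ∷ v) with p x | r x
  ... | true  | ofʸ a  = ofⁿ λ h → h zero a
  ... | false | ofⁿ ¬a = mapᵣ (λ { h zero → ¬a ; h (suc i) → h i }) (λ h → h ∘ suc) (hits-reflects v)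

  atMostOne-reflects : ∀ {n} (v : Vec Entry n) → Reflects (∀ i j → P (lookup v i) → P (lookup v j) → i ≡ j) (atMostOne p (Vec.toList v))
  atMostOne-reflects []      = ofʸ λ ()
  atMostOne-reflects (x ∷ v) with p x | r x
  ... | true  | ofʸ a  = mapᵣ (λ { h zero zero _ _ → refl ; h zero (suc j) _ b → ⊥-elim (h j b)
                                 ; h (suc i) zero b _ → ⊥-elim (h i b) ; h (suc i) (suc j) b _ → ⊥-elim (h i b) })
                              (λ h i b → case-zero (h zero (suc i) a b)) (hits-reflects v)
    where
    case-zero : ∀ {n} {i : Fin n} → zero ≡ Fin.suc i → ⊥
    case-zero ()
  ... | false | ofⁿ ¬a = mapᵣ (λ { h zero _ b _ → ⊥-elim (¬a b) ; h (suc i) zero _ b → ⊥-elim (¬a b)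
                                 ; h (suc i) (suc j) b c → cong suc (h i j b c) })
                              (λ h i j b c → suc-inj (h (suc i) (suc j) b c)) (atMostOne-reflects v)
    where
    suc-inj : ∀ {n} {i j : Fin n} → Fin.suc i ≡ suc j → i ≡ j
    suc-inj refl = refl

module _ (e : Entry) (τ : ℕ) where

  Covers Executableᵉ : Set
  Covers = executed e ≡ true × toℕ (startᵉ e) ≤ τ × ¬ toℕ (startᵉ e) + toℕ (procᵉ e) ≤ τ
  Executableᵉ = ¬ (executed e ≡ true × ¬ τ ≤ toℕ (startᵉ e)) × toℕ (arrᵉ e) ≤ τ × τ + toℕ (procᵉ e) ≤ toℕ (deadᵉ e)

+-≤ᵇⁿ-reflects : ∀ x y z → Reflects (toℕ x + toℕ y ≤ toℕ z) (x ℕᵇ.+ y ≤ᵇⁿ z)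
+-≤ᵇⁿ-reflects x y z = subst (λ k → Reflects (k ≤ toℕ z) (x ℕᵇ.+ y ≤ᵇⁿ z)) (toℕ-homo-+ x y) (≤ᵇⁿ-reflects (x ℕᵇ.+ y) z)

covers-reflects : ∀ x e → Reflects (Covers e (toℕ x)) (covers e x)
covers-reflects x e = true-reflects (executed e) ×-reflects (≤ᵇⁿ-reflects (startᵉ e) x ×-reflects ¬-reflects (+-≤ᵇⁿ-reflects (startᵉ e) (procᵉ e) x))

executable-reflects : ∀ x e → Reflects (Executableᵉ e (toℕ x)) (executable e x)
executable-reflects x e = ¬-reflects (true-reflects (executed e) ×-reflects ¬-reflects (≤ᵇⁿ-reflects x (startᵉ e))) ×-reflects
  (≤ᵇⁿ-reflects (arrᵉ e) x ×-reflects +-≤ᵇⁿ-reflects x (procᵉ e) (deadᵉ e))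

inWindowᵉ-reflects : ∀ e → Reflects (executed e ≡ true → toℕ (arrᵉ e) ≤ toℕ (startᵉ e) × toℕ (startᵉ e) + toℕ (procᵉ e) ≤ toℕ (deadᵉ e)) (inWindowᵉ e)
inWindowᵉ-reflects e = true-reflects (executed e) →-reflects (≤ᵇⁿ-reflects (arrᵉ e) (startᵉ e) ×-reflects +-≤ᵇⁿ-reflects (startᵉ e) (procᵉ e) (deadᵉ e))

module _ {n : ℕ} (v : Vec Entry n) where

  Iᵛ : Instance n
  Iᵛ = Vec.map jobᵉ v

  σᵛ : Schedule n
  σᵛ = Vec.map scheduleᵉ v

  scheduled : ∀ i {s} → lookup σᵛ i ≡ just s → executed (lookup v i) ≡ true × s ≡ toℕ (startᵉ (lookup v i))
  scheduled i e with trans (sym (lookup-map i scheduleᵉ v)) e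
  ... | e′ with executed (lookup v i)
  scheduled i e | refl | true = refl , refl

  schedule-of : ∀ i → executed (lookup v i) ≡ true → lookup σᵛ i ≡ just (toℕ (startᵉ (lookup v i)))
  schedule-of i e = trans (lookup-map i scheduleᵉ v) (cong (λ b → if b then just (toℕ (startᵉ (lookup v i))) else nothing) e)

  job-of : ∀ i → lookup Iᵛ i ≡ jobᵉ (lookup v i)
  job-of i = lookup-map i jobᵉ v

  covers⇒processed : ∀ i τ → Covers (lookup v i) τ → ProcessedAt Iᵛ σᵛ i τ
  covers⇒processed i τ (ex , s≤ , ¬e) = _ , schedule-of i ex , s≤ , subst (λ j → τ < toℕ (startᵉ (lookup v i)) + processing j) (sym (job-of i)) (≰⇒> ¬e)

  processed⇒covers : ∀ i τ → ProcessedAt Iᵛ σᵛ i τ → Covers (lookup v i) τ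
  processed⇒covers i τ (s , e , s≤ , τ<) with scheduled i e
  ... | ex , refl = ex , s≤ , <⇒≱ (subst (λ j → τ < toℕ (startᵉ (lookup v i)) + processing j) (job-of i) τ<)

  executable⇒ : ∀ i τ → Executable Iᵛ σᵛ i τ → Executableᵉ (lookup v i) τ
  executable⇒ i τ (¬s , w) with window⁻ _ τ (subst (λ j → InWindow j τ) (job-of i) w)
  ... | a , b = (λ { (ex , ¬h) → ¬s (_ , schedule-of i ex , ≰⇒> ¬h) }) , a , b

  ⇒executable : ∀ i τ → Executableᵉ (lookup v i) τ → Executable Iᵛ σᵛ i τ
  ⇒executable i τ (¬s , a , b) = (λ { (s , e , s<) → let ex , s≡ = scheduled i e in ¬s (ex , λ h → <⇒≱ s< (≤-trans h (≤-reflexive (sym s≡)))) }) ,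
    subst (λ j → InWindow j τ) (sym (job-of i)) (window⁺ _ τ a b)

  FeasibleAt : ℕ → Set
  FeasibleAt τ = (∀ i j → Covers (lookup v i) τ → Covers (lookup v j) τ → i ≡ j) ×
    ((∃[ i ] Covers (lookup v i) τ) ⊎ (∀ i → ¬ Executableᵉ (lookup v i) τ))

  feasibleAt-reflects : ∀ x → Reflects (FeasibleAt (toℕ x)) (feasibleAt (Vec.toList v) x)
  feasibleAt-reflects x = atMostOne-reflects (covers-reflects x) v ×-reflects
    (any-reflects (covers-reflects x) v ⊎-reflects all-reflects (λ e → ¬-reflects (executable-reflects x e)) v)

  point : ∀ i {x} → x ∈ pointsᵉ (lookup v i) → x ∈ concatMap pointsᵉ (Vec.toList v)
  point i h = ∈-concatMap pointsᵉ (∈-toList v i) h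
    where
    ∈-toList : ∀ {n} (v : Vec Entry n) i → lookup v i ∈ Vec.toList v
    ∈-toList (x ∷ v) zero    = here refl
    ∈-toList (x ∷ v) (suc i) = there (∈-toList v i)

  feasible⇒checked : Feasible Iᵛ σᵛ → feasibleᵇ (Vec.toList v) ≡ true
  feasible⇒checked F = complete (all-reflects inWindowᵉ-reflects v ×-reflects all-∈-reflects feasibleAt-reflects (concatMap pointsᵉ (Vec.toList v)))
    ( (λ i ex → window⁻ (jobᵉ (lookup v i)) (toℕ (startᵉ (lookup v i)))
        (subst (λ j → InWindow j (toℕ (startᵉ (lookup v i)))) (job-of i) (inWindow i _ (schedule-of i ex))))
    , λ x _ → (λ i j a b → disjoint i j (toℕ x) (covers⇒processed i _ a) (covers⇒processed j _ b)) , decide x)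
    where
    open Feasible F
    decide : ∀ x → (∃[ i ] Covers (lookup v i) (toℕ x)) ⊎ (∀ i → ¬ Executableᵉ (lookup v i) (toℕ x))
    decide x with any (λ e → covers e x) (Vec.toList v) | any-reflects (covers-reflects x) v
    ... | true  | ofʸ a  = inj₁ a
    ... | false | ofⁿ ¬a = inj₂ λ i h → busy (toℕ x) (λ j p → ¬a (j , processed⇒covers j _ p)) i (⇒executable i _ h)

  checked⇒feasible : feasibleᵇ (Vec.toList v) ≡ true → Feasible Iᵛ σᵛ
  checked⇒feasible h = record
    { inWindow = λ i s e → let ex , s≡ = scheduled i e ; a , b = proj₁ ok i ex in
        subst₂ InWindow (sym (job-of i)) (sym s≡) (window⁺ (jobᵉ (lookup v i)) _ a b)
    ; disjoint = λ i j τ p q → sharing i j τ (processed⇒covers i τ p) (processed⇒covers j τ q)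
    ; busy     = λ τ idle i ex → let j , c = covered τ i (executable⇒ i τ ex) in idle j (covers⇒processed j τ c) }
    where
    ok : (∀ i → executed (lookup v i) ≡ true → toℕ (arrᵉ (lookup v i)) ≤ toℕ (startᵉ (lookup v i)) ×
           toℕ (startᵉ (lookup v i)) + toℕ (procᵉ (lookup v i)) ≤ toℕ (deadᵉ (lookup v i))) ×
         (∀ x → x ∈ concatMap pointsᵉ (Vec.toList v) → FeasibleAt (toℕ x))
    ok = sound (all-reflects inWindowᵉ-reflects v ×-reflects all-∈-reflects feasibleAt-reflects (concatMap pointsᵉ (Vec.toList v))) h
    -- If two jobs overlap, then both are being processed at the later of their starts, which is one
    -- of the checked points.
    sharing : ∀ i j τ → Covers (lookup v i) τ → Covers (lookup v j) τ → i ≡ j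
    sharing i j τ (ex , s≤ , ¬e) (ex′ , s′≤ , ¬e′) with toℕ (startᵉ (lookup v i)) ≤? toℕ (startᵉ (lookup v j))
    ... | yes l = proj₁ (proj₂ ok _ (point j (there (here refl)))) i j (ex , l , λ q → ¬e (≤-trans q s′≤)) (ex′ , ≤-refl , λ q → ¬e′ (≤-trans q s′≤))
    ... | no ¬l = proj₁ (proj₂ ok _ (point i (there (here refl)))) i j (ex , ≤-refl , λ q → ¬e (≤-trans q s≤)) (ex′ , <⇒≤ (≰⇒> ¬l) , λ q → ¬e′ (≤-trans q s≤))
    coveredAt : ∀ τ i {x} → toℕ x ≡ τ → x ∈ concatMap pointsᵉ (Vec.toList v) → Executableᵉ (lookup v i) τ → ∃[ j ] Covers (lookup v j) τ
    coveredAt τ i refl p ex with proj₂ (proj₂ ok _ p)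
    ... | inj₁ c = c
    ... | inj₂ n = ⊥-elim (n i ex)
    -- A job executable at `suc τ` either arrives at that time, a checked point, or is executable at
    -- `τ` already. In the latter case some job covers `τ`; it covers `suc τ` too unless it ends
    -- exactly there, which is again a checked point.
    covered : ∀ τ i → Executableᵉ (lookup v i) τ → ∃[ j ] Covers (lookup v j) τ
    covered zero i ex@(_ , a , _) = coveredAt 0 i (n≤0⇒n≡0 a) (point i (here refl)) ex
    covered (suc τ) i ex@(¬s , a , b) with m≤n⇒m<n∨m≡n a
    ... | inj₂ e = coveredAt (suc τ) i e (point i (here refl)) ex
    ... | inj₁ (s≤s a′) with covered τ i ((λ { (x , ¬h) → ¬s (x , λ h → ¬h (≤-trans (n≤1+n τ) h)) }) , a′ , ≤-trans (n≤1+n _) b)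
    ...   | j , x , s≤ , ¬e with toℕ (startᵉ (lookup v j)) + toℕ (procᵉ (lookup v j)) ≤? suc τ
    ...     | no ¬e′ = j , x , ≤-trans s≤ (n≤1+n τ) , ¬e′
    ...     | yes e′ = coveredAt (suc τ) i (trans (toℕ-homo-+ (startᵉ (lookup v j)) (procᵉ (lookup v j))) (≤-antisym e′ (≰⇒> ¬e)))
                         (point j (there (there (here refl)))) ex

work : Entry → ℕᵇ
work e = if executed e then procᵉ e else ℕᵇ.zero

toℕ-total-work : ∀ {n} (v : Vec Entry n) s →
  toℕ (foldl (λ s e → s ℕᵇ.+ work e) s (Vec.toList v)) ≡ toℕ s + Vec.sum (perExecuted (λ j _ → processing j) (Iᵛ v) (σᵛ v))
toℕ-total-work []      s = sym (+-identityʳ (toℕ s))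
toℕ-total-work (e ∷ v) s = trans (toℕ-total-work v (s ℕᵇ.+ work e)) (trans (cong (_+ rest′) (toℕ-homo-+ s (work e)))
  (trans (+-assoc (toℕ s) (toℕ (work e)) rest′) (cong (toℕ s +_) (first (executed e) refl))))
  where
  rest′ : ℕ
  rest′ = Vec.sum (perExecuted (λ j _ → processing j) (Iᵛ v) (σᵛ v))
  first : ∀ b → executed e ≡ b → toℕ (work e) + rest′ ≡ Vec.sum (perExecuted (λ j _ → processing j) (Iᵛ (e ∷ v)) (σᵛ (e ∷ v)))
  first true  eq rewrite eq = refl
  first false eq rewrite eq = refl

cheap-reflects : ∀ obj {n} (v : Vec Entry n) b → Reflects (value obj (Iᵛ v) (σᵛ v) ≤ toℕ b) (cheapᵇ obj (Vec.toList v) b)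
cheap-reflects workingTime v b = subst (λ k → Reflects (k ≤ toℕ b) (total-work (Vec.toList v) ≤ᵇⁿ b)) (toℕ-total-work v ℕᵇ.zero) (≤ᵇⁿ-reflects (total-work (Vec.toList v)) b)
cheap-reflects weightedCompleted v b = subst (λ k → Reflects (k ≤ toℕ b) (total-work (Vec.toList v) ≤ᵇⁿ b)) (toℕ-total-work v ℕᵇ.zero) (≤ᵇⁿ-reflects (total-work (Vec.toList v)) b)
cheap-reflects makespan v b = mapᵣ
  (λ h → max-bound (perExecuted (λ j s → s + processing j) (Iᵛ v) (σᵛ v)) (toℕ b) (perExecuted≤ (Iᵛ v) (σᵛ v) (λ j s → s + processing j) (toℕ b) (λ i s e →
    let ex , s≡ = scheduled v i e in subst₂ (λ j t → t + processing j ≤ toℕ b) (sym (job-of v i)) (sym s≡) (h i ex))))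
  (λ h i ex → ≤-trans (≤-reflexive (trans (cong (λ j → toℕ (startᵉ (lookup v i)) + processing j) (sym (job-of v i)))
      (perExecuted≡ (Iᵛ v) (σᵛ v) (λ j s → s + processing j) i (toℕ (startᵉ (lookup v i))) (schedule-of v i ex))))
    (≤-trans (lookup≤max (perExecuted (λ j s → s + processing j) (Iᵛ v) (σᵛ v)) i) h))
  (all-reflects (λ e → true-reflects (executed e) →-reflects +-≤ᵇⁿ-reflects (startᵉ e) (procᵉ e) b) v)

numbersᵇ : ℕᵇ → Certificate → Bool
numbersᵇ l (es , b) = (b ≤ᵇⁿ l) ∧ all (λ e → (procᵉ e ≤ᵇⁿ l) ∧ ((arrᵉ e ≤ᵇⁿ l) ∧ (deadᵉ e ≤ᵇⁿ l))) es

numbers-reflects : ∀ l {n} (v : Vec Entry n) b →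
  Reflects (All (_≤ toℕ l) (toℕ b ∷ concatMap jobNumbers (Vec.toList (Iᵛ v)))) (numbersᵇ l (Vec.toList v , b))
numbers-reflects l v b = mapᵣ (λ { (a , as) → a ∷ as }) (λ { (a ∷ as) → a , as }) (≤ᵇⁿ-reflects b l ×-reflects jobs v)
  where
  jobs : ∀ {n} (v : Vec Entry n) → Reflects (All (_≤ toℕ l) (concatMap jobNumbers (Vec.toList (Iᵛ v))))
    (all (λ e → (procᵉ e ≤ᵇⁿ l) ∧ ((arrᵉ e ≤ᵇⁿ l) ∧ (deadᵉ e ≤ᵇⁿ l))) (Vec.toList v))
  jobs []      = ofʸ []
  jobs (e ∷ v) = mapᵣ (λ { ((p , (a , d)) , r) → p ∷ a ∷ d ∷ r }) (λ { (p ∷ a ∷ d ∷ r) → (p , (a , d)) , r })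
    ((≤ᵇⁿ-reflects (procᵉ e) l ×-reflects (≤ᵇⁿ-reflects (arrᵉ e) l ×-reflects ≤ᵇⁿ-reflects (deadᵉ e) l)) ×-reflects jobs v)

encodeEntry : Entry → List Bool
encodeEntry e = encodeBin (procᵉ e) ++ encodeBin (arrᵉ e) ++ encodeBin (deadᵉ e)

encodeCertificate : Certificate → List Bool
encodeCertificate (es , b) = encodeList encodeEntry es ++ encodeBin b

encodeBin≡ : ∀ x → encodeBin x ≡ encodeℕ (toℕ x)
encodeBin≡ x = cong encodeBin (sym (fromℕ-toℕ x))

encodeCertificate≡ : ∀ {n} (v : Vec Entry n) b → encodeCertificate (Vec.toList v , b) ≡ encodeInstance (Iᵛ v) ++ encodeℕ (toℕ b)
encodeCertificate≡ v b = cong₂ _++_ (entries v) (encodeBin≡ b)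
  where
  entries : ∀ {n} (v : Vec Entry n) → encodeList encodeEntry (Vec.toList v) ≡ encodeInstance (Iᵛ v)
  entries []      = refl
  entries (e ∷ v) = cong (true ∷_) (cong₂ _++_ (cong₂ _++_ (encodeBin≡ (procᵉ e)) (cong₂ _++_ (encodeBin≡ (arrᵉ e)) (encodeBin≡ (deadᵉ e)))) (entries v))

-- The check is computable

module _ {Γ : Set} {{_ : Enc Γ}} {e : Γ → Entry} (ce : Comp e) where

  procC : Comp (λ γ → procᵉ (e γ))
  procC = ffC ∙ ce
  arrC : Comp (λ γ → arrᵉ (e γ))
  arrC = fstC ∙ sfC ∙ ce
  deadC : Comp (λ γ → deadᵉ (e γ))
  deadC = sndC ∙ sfC ∙ ce
  executedC : Comp (λ γ → executed (e γ))
  executedC = fsC ∙ ce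
  startᵉC : Comp (λ γ → startᵉ (e γ))
  startᵉC = ssC ∙ ce
  endC : Comp (λ γ → endᵉ (e γ))
  endC = addC startᵉC procC

  coversC : {x : Γ → ℕᵇ} → Comp x → Comp (λ γ → covers (e γ) (x γ))
  coversC cx = andC executedC (andC (leC startᵉC cx) (notC (leC endC cx)))

  executableC : {x : Γ → ℕᵇ} → Comp x → Comp (λ γ → executable (e γ) (x γ))
  executableC cx = andC (notC (andC executedC (notC (leC cx startᵉC)))) (andC (leC arrC cx) (leC (addC cx procC) deadC))

feasibleAtC : Comp {List Entry × ℕᵇ} (λ p → feasibleAt (proj₁ p) (proj₂ p))
feasibleAtC = andC (caseListC {g = λ _ us _ → null us} hitsC (constC true) (nullC ∙ sfC))
  (orC (anyC {p = λ p e → covers e (proj₂ p)} covC fstC)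
    (allC {p = λ p e → not (executable e (proj₂ p))} (notC (executableC sndC sfC)) fstC))
  where
  covC : Comp {(List Entry × ℕᵇ) × Entry} (λ q → covers (proj₂ q) (proj₂ (proj₁ q)))
  covC = coversC sndC sfC
  hitsC : Comp {List Entry × ℕᵇ} (λ p → hits (λ e → covers e (proj₂ p)) (proj₁ p))
  hitsC = concatMapC {f = λ p e → if covers e (proj₂ p) then [ tt ] else []} (ifC covC (constC [ tt ]) (constC [])) fstC
  nullC : Comp {List ⊤} null
  nullC = caseListC {g = λ _ _ _ → false} idC (constC true) (constC false)

feasibleC : Comp feasibleᵇ
feasibleC = andC (allC {p = λ _ → inWindowᵉ} (windowC ∙ sndC) idC)
  (allC {p = feasibleAt} feasibleAtC (concatMapC {f = λ _ → pointsᵉ} (pointsC ∙ sndC) idC))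
  where
  windowC : Comp inWindowᵉ
  windowC = orC (notC (executedC idC)) (andC (leC (arrC idC) (startᵉC idC)) (leC (endC idC) (deadC idC)))
  pointsC : Comp pointsᵉ
  pointsC = consC (arrC idC) (consC (startᵉC idC) (singleC (endC idC)))

length-digits : ∀ x → length (digits x) ≤ ⟪ x ⟫
length-digits x = ≤-trans (length≤size (digits x)) (≤-reflexive (cong sizeᵈ (enc-digits x)))

size-digits : ∀ x → ⟪ x ⟫ ≤ 4 * length (digits x) + 1
size-digits x = ≤-trans (≤-reflexive (cong sizeᵈ (sym (enc-digits x)))) (size-bits (digits x))

length-sum : ∀ x y → length (digits (x ℕᵇ.+ y)) ≤ suc (length (digits x) + length (digits y))
length-sum x y = ≤-trans (≤-reflexive (cong length (trans (cong digits x+y) (digits-undigits (addBits (digits x) (digits y))))))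
  (≤-trans (length-adder (true ∷ digits x ++ digits y) (digits x) (digits y) 0) (≤-reflexive (cong suc (length-++ (digits x)))))
  where
  x+y : x ℕᵇ.+ y ≡ undigits (addBits (digits x) (digits y))
  x+y = toℕ-injective (trans (toℕ-homo-+ x y) (sym (trans (val-addBits (digits x) (digits y))
    (cong₂ (λ a b → toℕ a + toℕ b) (undigits-digits x) (undigits-digits y)))))
  length-emit : ∀ s → length (emit s) ≤ 1
  length-emit 0 = z≤n
  length-emit 1 = ≤-refl
  length-emit 2 = ≤-refl
  length-emit 3 = ≤-refl
  length-emit 4 = ≤-refl
  length-emit 5 = ≤-refl
  length-emit 6 = ≤-refl
  length-emit (suc (suc (suc (suc (suc (suc (suc _))))))) = z≤n
  length-adder : ∀ f xs ys c → length (adder f xs ys c) ≤ length f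
  length-adder []      xs ys c = z≤n
  length-adder (_ ∷ f) xs ys c = ≤-trans (≤-reflexive (length-++ (emit (lowest xs + lowest ys + c))))
    (+-mono-≤ (length-emit (lowest xs + lowest ys + c)) (length-adder f (rest xs) (rest ys) (carry (lowest xs + lowest ys + c))))

-- The codes of the digits 1 and 2 differ in size, so the running sum is bounded through its number
-- of digits: an addition adds at most those of the summand and one more.
total-workC : Comp total-work
total-workC = foldC {h = λ _ s e → s ℕᵇ.+ work e} (addC (sfC) (ifC (executedC sndC) (procC sndC) (constC ℕᵇ.zero))) idC (constC ℕᵇ.zero)
  (con 4 :* var :+ con 1) bound
  where
  length-work : ∀ e → length (digits (work e)) ≤ ⟪ e ⟫
  length-work ((p , ad) , (false , s)) = z≤n
  length-work ((p , ad) , (true , s))  = ≤-trans (length-digits p) (≤-trans (m≤m+n ⟪ p ⟫ ⟪ ad ⟫) (≤-trans (n≤1+n _) (≤-trans (m≤m+n _ _) (n≤1+n _))))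
  go : ∀ es s → length (digits (foldl (λ s e → s ℕᵇ.+ work e) s es)) ≤ length (digits s) + ⟪ es ⟫
  go []       s = m≤m+n _ _
  go (e ∷ es) s = ≤-trans (go es (s ℕᵇ.+ work e)) (≤-trans (+-monoˡ-≤ ⟪ es ⟫ (≤-trans (length-sum s (work e)) (s≤s (+-monoʳ-≤ (length (digits s)) (length-work e)))))
    (≤-reflexive (lem (length (digits s)) ⟪ e ⟫ ⟪ es ⟫)))
    where
    lem : ∀ s x y → 1 + (s + x) + y ≡ s + (1 + (x + y))
    lem = solve-∀
  bound : ∀ (γ : List Entry) s es → ⟪ foldl (λ s e → s ℕᵇ.+ work e) s es ⟫ ≤ 4 * (⟪ es ⟫ + ⟪ s ⟫ + ⟪ γ ⟫) + 1
  bound γ s es = ≤-trans (size-digits _) (+-monoˡ-≤ 1 (*-monoʳ-≤ 4 (≤-trans (go es s) (≤-trans (+-monoˡ-≤ ⟪ es ⟫ (length-digits s))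
    (≤-trans (≤-reflexive (+-comm ⟪ s ⟫ ⟪ es ⟫)) (m≤m+n _ ⟪ γ ⟫))))))

cheapC : ∀ obj → Comp {Certificate} (λ c → cheapᵇ obj (proj₁ c) (proj₂ c))
cheapC workingTime       = leC (total-workC ∙ fstC) sndC
cheapC weightedCompleted = leC (total-workC ∙ fstC) sndC
cheapC makespan          = allC {p = λ c e → not (executed e) ∨ (endᵉ e ≤ᵇⁿ proj₂ c)} (orC (notC (executedC sndC)) (leC (endC sndC) (sfC))) fstC

numbersC : Comp {ℕᵇ × Certificate} (λ p → numbersᵇ (proj₁ p) (proj₂ p))
numbersC = andC (leC (ssC) fstC)
  (allC {p = λ q e → (procᵉ e ≤ᵇⁿ proj₁ q) ∧ ((arrᵉ e ≤ᵇⁿ proj₁ q) ∧ (deadᵉ e ≤ᵇⁿ proj₁ q))}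
    (andC (leC (procC sndC) (ffC)) (andC (leC (arrC sndC) (ffC)) (leC (deadC sndC) (ffC)))) (fsC))

encodeCertificateC : Comp encodeCertificate
encodeCertificateC = appendC (encodeListC (appendC (encodeBinC ∙ procC idC) (appendC (encodeBinC ∙ arrC idC) (encodeBinC ∙ deadC idC))) fstC) (encodeBinC ∙ sndC)

-- Membership in NP

module Membership (obj : Objective) (extra : List Bool × Certificate → Bool) (extraC : Comp extra)
  (Extra : Σ ℕ Instance × ℕ → Set)
  (extra-reflects : ∀ {n} (v : Vec Entry n) b →
    Reflects (Extra ((n , Iᵛ v) , toℕ b)) (extra (DecisionProblem.encode (LBP obj) ((n , Iᵛ v) , toℕ b) , (Vec.toList v , b)))) where

  open DecisionProblem (LBP obj)

  -- The certificate repeats the whole instance, and the check compares its encoding with the input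
  -- word. Encoded instances therefore never have to be parsed.
  check : List Bool × Certificate → Bool
  check (w , c) = eqList eqBool (encodeCertificate c) w ∧ (feasibleᵇ (proj₁ c) ∧ (cheapᵇ obj (proj₁ c) (proj₂ c) ∧ extra (w , c)))

  verify : List Bool → List Bool
  verify z = [ check (proj₁ (splitPair z) , toCertificate (proj₂ (splitPair z))) ]

  verifyC : Comp verify
  verifyC = singleC (andC (eqListC eqBoolC (encodeCertificateC ∙ sndC) fstC) (andC (feasibleC ∙ fsC) (andC (cheapC obj ∙ sndC) extraC)) ∙
    (fstC ,C toCertificateC ∙ sndC) ∙ splitPairC)

  ∧-true : ∀ {a b} → a ∧ b ≡ true → a ≡ true × b ≡ true
  ∧-true {true} {true} e = refl , refl

  check-sound : ∀ w c → check (w , c) ≡ true → ∃[ x ] w ≡ encode x × Extra x × Yes x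
  check-sound w (es , b) h with ∧-true {eqList eqBool (encodeCertificate (es , b)) w} h
  ... | e₁ , h₁ with ∧-true {feasibleᵇ es} h₁
  ...   | e₂ , h₂ with ∧-true {cheapᵇ obj es b} h₂
  ...     | e₃ , e₄ = x , w≡ , sound (extra-reflects v b) (subst₂ (λ w es → extra (w , (es , b)) ≡ true) w≡ (sym es≡) e₄) ,
                      σᵛ v , checked⇒feasible v (trans (cong feasibleᵇ es≡) e₂) , sound (cheap-reflects obj v b) (trans (cong (λ es → cheapᵇ obj es b) es≡) e₃)
    where
    v : Vec Entry (length es)
    v = Vec.fromList es
    es≡ : Vec.toList v ≡ es
    es≡ = toList∘fromList es
    x : Σ ℕ Instance × ℕ
    x = (_ , Iᵛ v) , toℕ b
    w≡ : w ≡ encode x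
    w≡ = trans (sym (eqList-sound eqBool-sound (encodeCertificate (es , b)) w e₁)) (trans (cong (λ es → encodeCertificate (es , b)) (sym es≡)) (encodeCertificate≡ v b))

  entryOf : Job → Maybe ℕ → Entry
  entryOf j m = (fromℕ (processing j) , (fromℕ (arrival j) , fromℕ (deadline j))) , starting m
    where
    starting : Maybe ℕ → Bool × ℕᵇ
    starting nothing  = false , ℕᵇ.zero
    starting (just s) = true , fromℕ s

  entries : ∀ {n} → Instance n → Schedule n → Vec Entry n
  entries = Vec.zipWith entryOf

  Iᵛ-entries : ∀ {n} (I : Instance n) σ → Iᵛ (entries I σ) ≡ I
  Iᵛ-entries []      []      = refl
  Iᵛ-entries (j ∷ I) (m ∷ σ) = cong₂ _∷_ job≡ (Iᵛ-entries I σ)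
    where
    job≡ : jobᵉ (entryOf j m) ≡ j
    job≡ = lem (toℕ-fromℕ (processing j)) (toℕ-fromℕ (arrival j)) (toℕ-fromℕ (deadline j))
      where
      lem : ∀ {p a d} → p ≡ processing j → a ≡ arrival j → d ≡ deadline j → record { processing = p ; arrival = a ; deadline = d } ≡ j
      lem refl refl refl = refl

  σᵛ-entries : ∀ {n} (I : Instance n) σ → σᵛ (entries I σ) ≡ σ
  σᵛ-entries []      []            = refl
  σᵛ-entries (j ∷ I) (nothing ∷ σ) = cong (nothing ∷_) (σᵛ-entries I σ)
  σᵛ-entries (j ∷ I) (just s ∷ σ)  = cong₂ _∷_ (cong just (toℕ-fromℕ s)) (σᵛ-entries I σ)

  check-complete : ∀ {n} (I : Instance n) B → Extra ((n , I) , B) → ∀ σ → Feasible I σ → value obj I σ ≤ B →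
    check (encode ((n , I) , B) , (Vec.toList (entries I σ) , fromℕ B)) ≡ true
  check-complete {n} I B ex σ F h = ∧-intro (trans (cong (λ w → eqList eqBool w (encode ((n , I) , B))) enc≡) (eqList-refl eqBool-refl (encode ((n , I) , B))))
    (∧-intro (feasible⇒checked v (subst₂ Feasible (sym I≡) (sym σ≡) F))
      (∧-intro (complete (cheap-reflects obj v (fromℕ B)) (subst₂ _≤_ (cong₂ (value obj) (sym I≡) (sym σ≡)) (sym (toℕ-fromℕ B)) h))
        (trans (cong (λ y → extra (y , (Vec.toList v , fromℕ B))) (cong (λ y → encode y) (sym x≡))) (complete (extra-reflects v (fromℕ B)) (subst Extra (sym x≡) ex)))))
    where
    v : Vec Entry n
    v = entries I σ
    I≡ = Iᵛ-entries I σ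
    σ≡ = σᵛ-entries I σ
    x≡ : ((n , Iᵛ v) , toℕ (fromℕ B)) ≡ ((n , I) , B)
    x≡ = cong₂ (λ J b → (n , J) , b) I≡ (toℕ-fromℕ B)
    enc≡ : encodeCertificate (Vec.toList v , fromℕ B) ≡ encode ((n , I) , B)
    enc≡ = trans (encodeCertificate≡ v (fromℕ B)) (cong encode x≡)
    ∧-intro : ∀ {a b} → a ≡ true → b ≡ true → a ∧ b ≡ true
    ∧-intro refl refl = refl

  -- Numerals of `k` digits are exactly those of the numbers from one block, and the blocks are
  -- ordered by `k`. Applied to a start time and a deadline, this bounds the certificate by the
  -- encoded instance.
  val-length : ∀ xs ys → val xs ≤ val ys → length xs ≤ length ys
  val-length []           ys           h = z≤n
  val-length (true ∷ xs)  []           ()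
  val-length (false ∷ xs) []           ()
  val-length (x ∷ xs) (y ∷ ys) h = s≤s (val-length xs ys (half-≤ (val xs) (val ys) (+-cancelˡ-≤ 1 _ _ (≤-trans (low x) (≤-trans h (high y))))))
    where
    low : ∀ x → 1 + 2 * val xs ≤ val (x ∷ xs)
    low true  = ≤-trans (n≤1+n _) (≤-reflexive (sym (*-distribˡ-+ 2 1 (val xs))))
    low false = ≤-refl
    high : ∀ y → val (y ∷ ys) ≤ 1 + (2 * val ys + 1)
    high true  = ≤-reflexive (lem (val ys))
      where
      lem : ∀ z → 2 * suc z ≡ 1 + (2 * z + 1)
      lem = solve-∀
    high false = s≤s (m≤m+n _ 1)

  length-encodeBin : ∀ x → length (encodeBin x) ≡ 2 * length (digits x) + 1
  length-encodeBin x = go (digits x)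
    where
    go : ∀ w → length (encodeList [_] w) ≡ 2 * length w + 1
    go []      = refl
    go (b ∷ w) = trans (cong (2 +_) (go w)) (lem (length w))
      where
      lem : ∀ x → 2 + (2 * x + 1) ≡ 2 * suc x + 1
      lem = solve-∀

  size-entry : ∀ j m → (∀ s → m ≡ just s → s ≤ deadline j) → ⟪ entryOf j m ⟫ ≤ 8 * length (encodeJob j)
  size-entry j m h = ≤-trans (s≤s (+-mono-≤ (s≤s (+-mono-≤ (size-digits p) (s≤s (+-mono-≤ (size-digits a) (size-digits d))))) (start m h)))
    (≤-trans (m≤m+n _ (13 + 12 * length (digits p) + 12 * length (digits a) + 8 * length (digits d))) (≤-reflexive (trans (lem (length (digits p)) (length (digits a)) (length (digits d)))
      (cong (8 *_) (sym (trans (length-++ (encodeBin p)) (trans (cong (length (encodeBin p) +_) (length-++ (encodeBin a)))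
        (cong₂ _+_ (length-encodeBin p) (cong₂ _+_ (length-encodeBin a) (length-encodeBin d))))))))))
    where
    p a d : ℕᵇ
    p = fromℕ (processing j)
    a = fromℕ (arrival j)
    d = fromℕ (deadline j)
    start : ∀ m → (∀ s → m ≡ just s → s ≤ deadline j) → ⟪ proj₂ (entryOf j m) ⟫ ≤ 5 + 4 * length (digits d)
    start nothing  h = ≤-trans (m≤m+n 3 2) (m≤m+n 5 _)
    start (just s) h = ≤-trans (+-monoʳ-≤ 4 (size-digits (fromℕ s))) (≤-trans (≤-reflexive (lem′ (length (digits (fromℕ s))))) (+-monoʳ-≤ 5 (*-monoʳ-≤ 4
      (val-length (digits (fromℕ s)) (digits d) (subst₂ _≤_ (sym (trans (cong toℕ (undigits-digits (fromℕ s))) (toℕ-fromℕ s)))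
        (sym (trans (cong toℕ (undigits-digits d)) (toℕ-fromℕ (deadline j)))) (h s refl))))))
      where
      lem′ : ∀ x → 4 + (4 * x + 1) ≡ 5 + 4 * x
      lem′ = solve-∀
    lem : ∀ p a d → suc (suc (4 * p + 1 + suc (4 * a + 1 + (4 * d + 1))) + (5 + 4 * d)) + (13 + 12 * p + 12 * a + 8 * d) ≡
      8 * (2 * p + 1 + (2 * a + 1 + (2 * d + 1)))
    lem = solve-∀

  -- A digit takes two bits in the instance and at most four symbols in a tree. The factor 8 leaves
  -- room for the start time, whose numeral is no longer than that of the deadline, and for the
  -- structure of pairs and lists.
  certificateBound : PExp
  certificateBound = con 1 :+ con 8 :* var

  size-certificate : ∀ {n} (I : Instance n) B σ → Feasible I σ →
    ⟪ (Vec.toList (entries I σ) , fromℕ B) ⟫ ≤ ⟦ certificateBound ⟧ (length (encode ((n , I) , B)))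
  size-certificate I B σ F = s≤s (≤-trans (+-mono-≤ (jobs I σ started) (≤-trans (size-digits (fromℕ B)) bound≤))
    (≤-reflexive (trans (sym (*-distribˡ-+ 8 (length (encodeInstance I)) _)) (cong (8 *_) (sym (length-++ (encodeInstance I)))))))
    where
    started : ∀ i s → lookup σ i ≡ just s → s ≤ deadline (lookup I i)
    started i s e = ≤-trans (m≤m+n s (processing (lookup I i))) (proj₂ (window⁻ (lookup I i) s (Feasible.inWindow F i s e)))
    bound≤ : 4 * length (digits (fromℕ B)) + 1 ≤ 8 * length (encodeℕ B)
    bound≤ = ≤-trans (m≤m+n _ (12 * length (digits (fromℕ B)) + 7)) (≤-reflexive (trans (lem (length (digits (fromℕ B)))) (cong (8 *_) (sym (length-encodeBin (fromℕ B))))))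
      where
      lem : ∀ x → 4 * x + 1 + (12 * x + 7) ≡ 8 * (2 * x + 1)
      lem = solve-∀
    jobs : ∀ {n} (I : Instance n) σ → (∀ i s → lookup σ i ≡ just s → s ≤ deadline (lookup I i)) →
      ⟪ Vec.toList (entries I σ) ⟫ ≤ 8 * length (encodeInstance I)
    jobs []      []      h = m≤m+n 1 7
    jobs (j ∷ I) (m ∷ σ) h = ≤-trans (s≤s (+-mono-≤ (size-entry j m (h zero)) (jobs I σ (h ∘ suc))))
      (≤-trans (s≤s (m≤n+m _ 7)) (≤-reflexive (trans (lem (length (encodeJob j)) (length (encodeInstance I))) (cong (λ k → 8 * suc k) (sym (length-++ (encodeJob j)))))))
      where
      lem : ∀ x y → 8 + (8 * x + 8 * y) ≡ 8 * (1 + (x + y))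
      lem = solve-∀

  member : ∀ {L : Language} → (∀ w → L w ⇔ (∃[ x ] w ≡ encode x × Extra x × Yes x)) → InNP L
  member {L} L⇔ = verify , toPoly certificateBound , comp⇒polyTime verifyC , λ w → mk⇔ (to w) (from w)
    where
    to : ∀ w → L w → ∃[ u ] length u ≤ eval (toPoly certificateBound) (length w) × verify (encodePair w u) ≡ [ true ]
    to w l with Equivalence.to (L⇔ w) l
    ... | ((n , I) , B) , refl , ex , σ , F , h = postfix (enc c) ,
        subst₂ _≤_ (sym (length-postfix (enc c))) (sym (eval-toPoly certificateBound (length w))) (size-certificate I B σ F) ,
        cong [_] (trans (cong₂ (λ a b → check (a , toCertificate b)) (splitPair-fst w (postfix (enc c))) (splitPair-snd w (enc c)))
          (trans (cong (λ c → check (w , c)) (toCertificate-enc c)) (check-complete I B ex σ F h)))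
      where
      c : Certificate
      c = Vec.toList (entries I σ) , fromℕ B
    from : ∀ w → (∃[ u ] length u ≤ eval (toPoly certificateBound) (length w) × verify (encodePair w u) ≡ [ true ]) → L w
    from w (u , _ , e) = Equivalence.from (L⇔ w) (check-sound w (toCertificate (proj₂ (splitPair (encodePair w u))))
      (trans (cong (λ a → check (a , toCertificate (proj₂ (splitPair (encodePair w u))))) (sym (splitPair-fst w u))) (head-true e)))
      where
      head-true : ∀ {b} → [ b ] ≡ [ true ] → b ≡ true
      head-true refl = refl

-- Encodings are injective

-- Stronger than injectivity: the end of the code can be recognised whatever follows, which is what
-- passes through concatenations.
SelfDelimiting : ∀ {A : Set} → (A → List Bool) → Set
SelfDelimiting e = ∀ x y {u v} → e x ++ u ≡ e y ++ v → x ≡ y × u ≡ v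

encodeList-selfDelimiting : ∀ {A : Set} {e : A → List Bool} → SelfDelimiting e → SelfDelimiting (encodeList e)
encodeList-selfDelimiting d []       []       q = refl , proj₂ (∷-injective q)
encodeList-selfDelimiting {e = e} d (x ∷ xs) (y ∷ ys) {u} {v} q with d x y
  (trans (sym (++-assoc (e x) (encodeList e xs) u)) (trans (proj₂ (∷-injective q)) (++-assoc (e y) (encodeList e ys) v)))
... | refl , q′ with encodeList-selfDelimiting d xs ys q′
...   | refl , q″ = refl , q″

encodeℕ-selfDelimiting : SelfDelimiting encodeℕ
encodeℕ-selfDelimiting m n q with encodeList-selfDelimiting (λ { x y q → ∷-injective q }) (digits (fromℕ m)) (digits (fromℕ n)) q
... | d≡ , q′ = fromℕ-injective (trans (sym (undigits-digits (fromℕ m))) (trans (cong undigits d≡) (undigits-digits (fromℕ n)))) , q′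

encodeJob-selfDelimiting : SelfDelimiting encodeJob
encodeJob-selfDelimiting j k {u} {v} q with encodeℕ-selfDelimiting (processing j) (processing k) {encodeℕ (arrival j) ++ encodeℕ (deadline j) ++ u} {encodeℕ (arrival k) ++ encodeℕ (deadline k) ++ v}
  (trans (sym (assoc₃ (encodeℕ (processing j)) (encodeℕ (arrival j)) (encodeℕ (deadline j)) u))
    (trans q (assoc₃ (encodeℕ (processing k)) (encodeℕ (arrival k)) (encodeℕ (deadline k)) v)))
  where
  assoc₃ : ∀ (a b c w : List Bool) → (a ++ b ++ c) ++ w ≡ a ++ (b ++ (c ++ w))
  assoc₃ a b c w = trans (++-assoc a (b ++ c) w) (cong (a ++_) (++-assoc b c w))
... | p≡ , q₁ with encodeℕ-selfDelimiting (arrival j) (arrival k) {encodeℕ (deadline j) ++ u} {encodeℕ (deadline k) ++ v} q₁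
...   | a≡ , q₂ with encodeℕ-selfDelimiting (deadline j) (deadline k) {u} {v} q₂
...     | d≡ , q₃ = job≡ p≡ a≡ d≡ , q₃
  where
  job≡ : ∀ {j k} → processing j ≡ processing k → arrival j ≡ arrival k → deadline j ≡ deadline k → j ≡ k
  job≡ refl refl refl = refl

-- Membership in the language only provides some yes-instance with the given encoding; injectivity
-- identifies it with the instance that the reduction has constructed.
encode-injective : ∀ obj x y → DecisionProblem.encode (LBP obj) x ≡ DecisionProblem.encode (LBP obj) y → x ≡ y
encode-injective obj ((m , I) , B) ((n , J) , C) q with encodeList-selfDelimiting encodeJob-selfDelimiting (toList I) (toList J) q
... | I≡J , q′ = cong₂ _,_ (toList-injective I J I≡J) (proj₁ (encodeℕ-selfDelimiting B C (cong (_++ []) q′)))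
  where
  toList-injective : ∀ {m n} (I : Instance m) (J : Instance n) → toList I ≡ toList J → (m , I) ≡ (n , J)
  toList-injective []      []      e = refl
  toList-injective (i ∷ I) (j ∷ J) e with ∷-injective e
  ... | refl , e′ with toList-injective I J e′
  ...   | refl = refl

-- NP-completeness

lbp∈NP : ∀ obj → InNP (language (LBP obj))
lbp∈NP obj = Membership.member obj (λ _ → true) (constC true) (λ _ → ⊤) (λ _ _ → ofʸ tt)
  (λ w → mk⇔ (λ { (x , e , y) → x , e , tt , y }) (λ { (x , e , _ , y) → x , e , y }))

restricted∈NP : ∀ p obj → InNP (language (restrict p (LBP obj)))
restricted∈NP p obj = Membership.member obj (λ q → numbersᵇ (fromℕ (eval p (length (proj₁ q)))) (proj₂ q))
  (numbersC ∙ (fromℕC (evalC p (lengthC fstC)) ,C sndC))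
  (λ x → All (_≤ eval p (length (DecisionProblem.encode (LBP obj) x))) (DecisionProblem.numbers (LBP obj) x))
  (λ v b → let l = eval p (length (encodeInstance (Iᵛ v) ++ encodeℕ (toℕ b))) in
    subst (λ k → Reflects (All (_≤ k) (toℕ b ∷ List.concatMap jobNumbers (toList (Iᵛ v)))) (numbersᵇ (fromℕ l) (toList v , b)))
      (toℕ-fromℕ l) (numbers-reflects (fromℕ l) v b))
  (λ w → mk⇔ id id)

restricted-yes : ∀ p obj x →
  All (_≤ eval p (length (DecisionProblem.encode (LBP obj) x))) (DecisionProblem.numbers (LBP obj) x) → DecisionProblem.Yes (LBP obj) x →
  language (restrict p (LBP obj)) (DecisionProblem.encode (LBP obj) x)
restricted-yes p obj x small y = x , refl , small , y

module _ (obj : Objective) {L : Language} (np : InNP L) where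

  open Reduction (proj₁ (proj₂ (proj₂ np))) (proj₁ (proj₂ np)) 1
  open DecisionProblem (LBP obj) using (encode; Yes)

  L⇔ : ∀ w → L w ⇔ Accepted w
  L⇔ = proj₂ (proj₂ (proj₂ np))

  yes⇒ : ∀ w → L w → Yes (inputOf w)
  yes⇒ w l =
    let σ , F , cheap = S.satisfiable⇒cheap w (1≤V w) (proj₂ (accepted⇒satisfiable w (Equivalence.to (L⇔ w) l)))
    in σ , F , cheap obj

  ⇒yes : ∀ w → Yes (inputOf w) → L w
  ⇒yes w (σ , F , h) = Equivalence.from (L⇔ w) (satisfiable⇒accepted w (S.lazy⇒satisfiable w (1≤V w) σ F
    (S.cheap⇒lazy w (1≤V w) obj σ (≤-trans h (≤-reflexive (sym (+-identityʳ (S.budget w))))))))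

  reduceTo : L ≤ₚ language (LBP obj)
  reduceTo = _ , comp⇒polyTime (inputC obj) , λ w → mk⇔ (λ l → inputOf w , refl , yes⇒ w l)
    (λ { (x , e , y) → ⇒yes w (subst Yes (sym (encode-injective obj (inputOf w) x e)) y) })

  -- The same reduction works, because every number is bounded by a polynomial in the number of
  -- jobs, and each job contributes at least one bit to the encoding.
  reduceToRestricted : L ≤ₚ language (restrict (numberPoly 1) (LBP obj))
  reduceToRestricted = (λ w → encode (inputOf w)) , comp⇒polyTime (inputC obj) , λ w → mk⇔
    (λ l → restricted-yes (numberPoly 1) obj (inputOf w) (S.small w (1≤V w) (length (encode (inputOf w))) (jobs≤ w) ≤-refl) (yes⇒ w l))
    (λ { (x , e , _ , y) → ⇒yes w (subst Yes (sym (encode-injective obj (inputOf w) x e)) y) })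
    where
    jobs≤ : ∀ w → length (S.tags w) ≤ length (encode (inputOf w))
    jobs≤ w = ≤-trans (≤-reflexive (trans (sym (length-map _ (S.tags w))) (cong length (sym (S.toList-inst w)))))
      (≤-trans (length≤encodeList encodeJob (toList (S.inst w)))
        (≤-trans (m≤m+n _ (length (encodeℕ (S.budget w)))) (≤-reflexive (sym (length-++ (encodeInstance (S.inst w)))))))

-- Approximation

-- Any rational upper bound of `ρ` may be rounded up to its numerator, since the denominator is at
-- least 1.
natural-factor : ∀ ρ → ∃[ K ] ∀ v o → WithinFactor ρ v o → v ≤ K * o
natural-factor ρ with ℝ.upperInhabited ρ
... | q@(mkℚ n d _) , up = ℤ.∣ n ∣ , λ v o w → bound v o (w q up)
  where
  bound : ∀ v o → (ℤ.+ v) ℚ./ 1 ℚ.≤ q ℚ.* ((ℤ.+ o) ℚ./ 1) → v ≤ ℤ.∣ n ∣ * o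
  bound v o h = ≤-trans (m≤m*n v (suc d * 1) {{m*n≢0 (suc d) 1}}) (ℤₚ.drop‿+≤+ (ℤₚ.≤-trans le upper))
    where
    hᵘ : mkℚᵘ (ℤ.+ v) 0 ℚᵘ.≤ mkℚᵘ n d ℚᵘ.* mkℚᵘ (ℤ.+ o) 0
    hᵘ = ℚᵘₚ.≤-respˡ-≃ (toℚᵘ-fromℚᵘ (mkℚᵘ (ℤ.+ v) 0)) (ℚᵘₚ.≤-respʳ-≃
      (ℚᵘₚ.≃-trans (toℚᵘ-homo-* q ((ℤ.+ o) ℚ./ 1)) (ℚᵘₚ.*-congˡ {toℚᵘ q} (toℚᵘ-fromℚᵘ (mkℚᵘ (ℤ.+ o) 0)))) (toℚᵘ-mono-≤ h))
    le : ℤ.+ (v * (suc d * 1)) ℤ.≤ n ℤ.* (ℤ.+ o)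
    le with hᵘ
    ... | ℚᵘ.*≤* p = ℤₚ.≤-trans (ℤₚ.≤-reflexive (ℤₚ.pos-* v (suc d * 1))) (ℤₚ.≤-trans p (ℤₚ.≤-reflexive (ℤₚ.*-identityʳ (n ℤ.* (ℤ.+ o)))))
    below : ∀ i → i ℤ.≤ ℤ.+ ℤ.∣ i ∣
    below (ℤ.+ _)    = ℤₚ.≤-refl
    below (ℤ.-[1+ _ ]) = ℤ.-≤+
    upper : n ℤ.* (ℤ.+ o) ℤ.≤ ℤ.+ (ℤ.∣ n ∣ * o)
    upper = ℤₚ.≤-trans (ℤₚ.*-monoʳ-≤-nonNeg (ℤ.+ o) (below n)) (ℤₚ.≤-reflexive (sym (ℤₚ.pos-* ℤ.∣ n ∣ o)))

-- Descent on the value: a schedule that is not optimal is beaten by a cheaper one. Finding that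
-- schedule is not constructive here, hence the double negation; it is removed later because the
-- conclusions drawn from an optimum are decidable.
¬¬optimum : ∀ obj {n} (I : Instance n) k σ → Feasible I σ → value obj I σ ≤ k → ¬ ¬ (∃[ opt ] IsOptimum obj I opt)
¬¬optimum obj I k σ F h none = none (value obj I σ , (σ , F , refl) , least k h)
  where
  least : ∀ k → value obj I σ ≤ k → ∀ σ′ → Feasible I σ′ → value obj I σ ≤ value obj I σ′
  least k h σ′ F′ with value obj I σ ≤? value obj I σ′
  ... | yes le = le
  least zero    h σ′ F′ | no ¬le = ⊥-elim (¬le (≤-trans h z≤n))
  least (suc k) h σ′ F′ | no ¬le = ⊥-elim (¬¬optimum obj I k σ′ F′ (≤-pred (≤-trans (≰⇒> ¬le) h)) none)

-- Exhaustive search through the certificates. It makes acceptance decidable, which permits removing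
-- a double negation; its running time does not matter.
bounded? : ∀ {P : List Bool → Set} → (∀ u → Dec (P u)) → ∀ n → Dec (∃[ u ] length u ≤ n × P u)
bounded? P? n with P? []
... | yes p = yes ([] , z≤n , p)
bounded? P? zero    | no ¬p = no λ { ([] , _ , p) → ¬p p }
bounded? P? (suc n) | no ¬p with bounded? (P? ∘ (true ∷_)) n | bounded? (P? ∘ (false ∷_)) n
... | yes (u , h , p) | _ = yes (true ∷ u , s≤s h , p)
... | _ | yes (u , h , p) = yes (false ∷ u , s≤s h , p)
... | no ¬t | no ¬f = no λ { ([] , _ , p) → ¬p p ; (true ∷ u , s≤s h , p) → ¬t (u , h , p) ; (false ∷ u , s≤s h , p) → ¬f (u , h , p) }

_≟ᵇˢ_ : (u v : List Bool) → Dec (u ≡ v)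
_≟ᵇˢ_ = Listₚ.≡-dec Boolₚ._≟_

-- The second bit of an encoded schedule tells whether the first job is executed.
skipsFirst : List Bool → List Bool
skipsFirst z = listCase z [] (λ _ z → listCase z [] (λ b _ → [ not b ]))

skipsFirstC : Comp skipsFirst
skipsFirstC = caseListC {g = λ _ z _ → listCase z [] (λ b _ → [ not b ])} idC (constC [])
  (caseListC {g = λ b _ _ → [ not b ]} (sfC) (constC []) (singleC (notC (ffC))))

skipsFirst-true : ∀ {n} (σ : Schedule (suc n)) → skipsFirst (encodeSchedule σ) ≡ [ true ] ⇔ lookup σ zero ≡ nothing
skipsFirst-true (nothing ∷ σ) = mk⇔ (λ _ → refl) (λ _ → refl)
skipsFirst-true (just s ∷ σ)  = mk⇔ (λ ()) (λ ())

-- The verifier decides the word by itself, and the polynomial `[]`, which is constantly 0, leaves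
-- only the empty certificate.
P⊆NP : ∀ {L} → InP L → InNP L
P⊆NP (f , fₚ , L⇔) = (λ z → f (proj₁ (splitPair z))) , [] , comp⇒polyTime (polyTime⇒comp fₚ ∙ fstC ∙ splitPairC) , λ w → mk⇔
  (λ l → [] , z≤n , trans (cong f (splitPair-fst w [])) (Equivalence.to (L⇔ w) l))
  (λ { (u , _ , e) → Equivalence.from (L⇔ w) (trans (cong f (sym (splitPair-fst w u))) e) })

-- The decision procedure looks whether the approximate schedule leaves out the huge job. For an
-- accepted word the optimum is at most the budget, so an approximation within the factor cannot
-- afford that job; conversely, a feasible schedule without it yields a certificate.
approximable⇒NP⊆P : ∀ obj ρ → PolyTimeApproximable obj ρ → ∀ {L} → InNP L → InP L
approximable⇒NP⊆P obj ρ (g , gₚ , approx) {L} (verify , pc , verifyₚ , L⇔) =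
  decide , comp⇒polyTime (skipsFirstC ∙ polyTime⇒comp gₚ ∙ instanceC) , λ w → mk⇔ (to w) (from w)
  where
  K : ℕ
  K = proj₁ (natural-factor ρ)
  open Reduction verifyₚ pc K
  decide : List Bool → List Bool
  decide w = skipsFirst (g (encodeInstance (S.inst w)))
  accepted? : ∀ w → Dec (Accepted w)
  accepted? w = bounded? (λ u → verify (encodePair w u) ≟ᵇˢ [ true ]) (eval pc (length w))
  to : ∀ w → L w → decide w ≡ [ true ]
  to w l =
    let σ , F , cheap = S.satisfiable⇒cheap w (1≤V w) (proj₂ (accepted⇒satisfiable w (Equivalence.to (L⇔ w) l)))
    in decidable-stable (decide w ≟ᵇˢ [ true ]) λ ¬d → ¬¬optimum obj (S.inst w) _ σ F (cheap obj) λ { (opt , isOpt) →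
    let σ′ , e , F′ , near = approx (S.inst w) opt isOpt in
    ¬d (trans (cong skipsFirst e) (Equivalence.from (skipsFirst-true σ′) (S.cheap⇒lazy w (1≤V w) obj σ′
      (≤-trans (proj₂ (natural-factor ρ) _ opt near) (*-monoʳ-≤ K (≤-trans (proj₂ isOpt σ F) (cheap obj))))))) }
  from : ∀ w → decide w ≡ [ true ] → L w
  from w d = Equivalence.from (L⇔ w) (decidable-stable (accepted? w) λ ¬a →
    let σ , F = S.some-feasible w (1≤V w) in ¬¬optimum obj (S.inst w) _ σ F ≤-refl λ { (opt , isOpt) →
      let σ′ , e , F′ , _ = approx (S.inst w) opt isOpt in
      ¬a (satisfiable⇒accepted w (S.lazy⇒satisfiable w (1≤V w) σ′ F′
        (Equivalence.to (skipsFirst-true σ′) (trans (sym (cong skipsFirst e)) d)))) })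

theorem2 : (obj : Objective) → StronglyNPComplete (LBP obj) × ((ρ : ℝ) → AtLeastOne ρ → ¬ P≡NP → ¬ PolyTimeApproximable obj ρ)
theorem2 obj =
  ( (lbp∈NP obj , λ _ np → reduceTo obj np)
  , numberPoly 1 , (restricted∈NP (numberPoly 1) obj , λ _ np → reduceToRestricted obj np)) ,
  λ ρ _ ¬P≡NP approx → ¬P≡NP (λ L → mk⇔ P⊆NP (approximable⇒NP⊆P obj ρ approx))
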